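{- For each positive integer $n$ let $f_{\max}(n)$ denote the number of maximal sum-free subsets of $[n]=\{1,\dots,n\}$. There are at most $2^{(1/4+o(1))n}$ maximal sum-free sets in $[n]$; that is, $$f_{\max}(n)=2^{(1/4+o(1))n}\quad\text{as } n\to\infty,$$ i.e. $\lim_{n\to\infty}\frac{1}{n}\log_2 f_{\max}(n)=\frac14$.
   Context: A set $S$ of integers is sum-free if $x+y\notin S$ for all $x,y\in S$ (where $x=y$ is allowed). A sum-free subset of $[n]$ is maximal if it is not properly contained in another sum-free subset of $[n]$. -}

module Defs where

open import Data.Nat as ℕ using (ℕ; zero; suc; NonZero; z≤n; s≤s)
import Data.Nat.Properties as ℕₚ
open import Data.Nat.Solver using (module +-*-Solver)
open import Data.Integer as ℤ using (ℤ; +_; -[1+_])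
import Data.Integer.Properties as ℤₚ
open import Data.Rational.Unnormalised as ℚ using (ℚᵘ; mkℚᵘ; 0ℚᵘ; _≃_; *<*)
import Data.Rational.Unnormalised.Properties as ℚₚ
open import Data.Bool using (true; false)
open import Data.Empty using (⊥; ⊥-elim)
open import Data.Unit using (⊤; tt)
open import Data.Fin using (Fin; toℕ)
import Data.Fin.Properties as Finₚ
open import Data.Fin.Subset using (Subset; inside; outside; _⊂_)
import Data.Fin.Subset as Subset
open import Data.Fin.Subset.Properties using (_∈?_; _⊂?_; anySubset?; ∉⊥)
open import Data.Fin.Subset.Induction using (⊃-wellFounded)
open import Data.List using (List; []; _∷_; _++_; map; filter; length)
open import Data.List.Membership.Propositional using () renaming (_∈_ to _∈ˡ_)
open import Data.List.Membership.Propositional.Properties using (∈-map⁺; ∈-++⁺ˡ; ∈-++⁺ʳ; ∈-filter⁺)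
open import Data.List.Relation.Unary.Any using (here; there)
open import Data.Product using (∃; ∃-syntax; _×_; _,_; proj₁; proj₂)
open import Data.Sum using (_⊎_; inj₁; inj₂)
open import Data.Vec using ([]; _∷_)
open import Induction.WellFounded using (Acc; acc)
open import Level using (0ℓ)
open import Relation.Binary.PropositionalEquality
open import Relation.Nullary using (¬_; Dec; yes; no)
open import Relation.Nullary.Decidable using (map′; ¬?; _×-dec_; _→-dec_)
open import Relation.Unary using (Pred; _∈_; _∉_)

SumFree : Pred ℤ 0ℓ → Set
SumFree S = ∀ x y → x ∈ S → y ∈ S → (x ℤ.+ y) ∉ S

-- A `Subset n` is read as a subset of [n] = {1,…,n}: the index i : Fin n
-- stands for the integer 1 + toℕ i.
val : ∀ {n} → Fin n → ℤ
val i = + suc (toℕ i)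

⟦_⟧ : ∀ {n} → Subset n → Pred ℤ 0ℓ
⟦ S ⟧ z = ∃[ i ] i Subset.∈ S × z ≡ val i

MaximalSumFree : ∀ {n} → Subset n → Set
MaximalSumFree {n} S =
  SumFree ⟦ S ⟧ × ((T : Subset n) → SumFree ⟦ T ⟧ → ¬ (S ⊂ T))

∈⟦⟧? : ∀ {n} (S : Subset n) z → Dec (z ∈ ⟦ S ⟧)
∈⟦⟧? S z = Finₚ.any? λ i → (i ∈? S) ×-dec (z ℤ.≟ val i)

sumFree? : ∀ {n} (S : Subset n) → Dec (SumFree ⟦ S ⟧)
sumFree? S = map′
  (λ h → λ { _ _ (i , i∈S , refl) (j , j∈S , refl) → h i j i∈S j∈S })
  (λ h i j i∈S j∈S → h (val i) (val j) (i , i∈S , refl) (j , j∈S , refl))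
  (Finₚ.all? λ i → Finₚ.all? λ j →
    (i ∈? S) →-dec ((j ∈? S) →-dec ¬? (∈⟦⟧? S (val i ℤ.+ val j))))

extendable? : ∀ {n} (S : Subset n) → Dec (∃[ T ] SumFree ⟦ T ⟧ × S ⊂ T)
extendable? S = anySubset? λ T → sumFree? T ×-dec (S ⊂? T)

maximalSumFree? : ∀ {n} (S : Subset n) → Dec (MaximalSumFree S)
maximalSumFree? S = sumFree? S ×-dec map′
  (λ h T sf S⊂T → h (T , sf , S⊂T))
  (λ { h (T , sf , S⊂T) → h T sf S⊂T })
  (¬? (extendable? S))

allSubsets : ∀ n → List (Subset n)
allSubsets zero    = [] ∷ []
allSubsets (suc n) = map (outside ∷_) (allSubsets n) ++ map (inside ∷_) (allSubsets n)

fmax : ℕ → ℕ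
fmax n = length (filter maximalSumFree? (allSubsets n))

∈-allSubsets : ∀ {n} (S : Subset n) → S ∈ˡ allSubsets n
∈-allSubsets []          = here refl
∈-allSubsets (false ∷ S) = ∈-++⁺ˡ (∈-map⁺ _ (∈-allSubsets S))
∈-allSubsets (true ∷ S)  = ∈-++⁺ʳ _ (∈-map⁺ _ (∈-allSubsets S))

∃-maximal : ∀ n → ∃[ S ] MaximalSumFree {n} S
∃-maximal n = grow Subset.⊥ (λ { _ _ (_ , i∈⊥ , _) → ⊥-elim (∉⊥ i∈⊥) }) (⊃-wellFounded _)
  where
  grow : (S : Subset n) → SumFree ⟦ S ⟧ → Acc Subset._⊃_ S → ∃[ T ] MaximalSumFree T
  grow S sf (acc rec) with extendable? S
  ... | yes (T , sfT , S⊂T) = grow T sfT (rec S⊂T)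
  ... | no ¬ext = S , sf , λ T sfT S⊂T → ¬ext (T , sfT , S⊂T)

fmax≢0 : ∀ n → NonZero (fmax n)
fmax≢0 n = nonEmpty (∈-filter⁺ maximalSumFree? (∈-allSubsets _) (proj₂ (∃-maximal n)))
  where
  nonEmpty : ∀ {S : Subset n} {xs} → S ∈ˡ xs → NonZero (length xs)
  nonEmpty (here _)  = _
  nonEmpty (there _) = _

-- Dedekind reals: `lower x q` reads q < x and `upper x q` reads x < q.
record ℝ : Set₁ where
  field
    lower upper     : Pred ℚᵘ 0ℓ
    lower-inhabited : ∃[ q ] lower q
    upper-inhabited : ∃[ q ] upper q
    lower-closed    : ∀ {q r} → q ℚ.< r → lower r → lower q
    upper-closed    : ∀ {q r} → q ℚ.< r → upper q → upper r
    lower-rounded   : ∀ {q} → lower q → ∃[ r ] q ℚ.< r × lower r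
    upper-rounded   : ∀ {r} → upper r → ∃[ q ] q ℚ.< r × upper q
    disjoint        : ∀ {q} → lower q → ¬ upper q
    located         : ∀ {q r} → q ℚ.< r → lower q ⊎ upper r

  lower-resp : ∀ {q r} → q ≃ r → lower q → lower r
  lower-resp q≃r lq with lower-rounded lq
  ... | s , q<s , ls = lower-closed (ℚₚ.<-respˡ-≃ q≃r q<s) ls

  upper-resp : ∀ {q r} → q ≃ r → upper q → upper r
  upper-resp q≃r uq with upper-rounded uq
  ... | s , s<q , us = upper-closed (ℚₚ.<-respʳ-≃ q≃r s<q) us

open ℝ public using (lower; upper)

infixl 7 _÷ℕ_

-- q < x / n is defined as q n < x, and x / n < q as x < q n.
_÷ℕ_ : ℝ → (n : ℕ) .{{_ : NonZero n}} → ℝ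
x ÷ℕ n@(suc _) = record
  { lower           = λ q → X.lower (q ℚ.* c)
  ; upper           = λ q → X.upper (q ℚ.* c)
  ; lower-inhabited = let q , l = X.lower-inhabited in q ℚ.* 1/c , X.lower-resp (ℚₚ.≃-sym (cancel q)) l
  ; upper-inhabited = let q , u = X.upper-inhabited in q ℚ.* 1/c , X.upper-resp (ℚₚ.≃-sym (cancel q)) u
  ; lower-closed    = λ q<r → X.lower-closed (ℚₚ.*-monoˡ-<-pos c q<r)
  ; upper-closed    = λ q<r → X.upper-closed (ℚₚ.*-monoˡ-<-pos c q<r)
  ; lower-rounded   = λ l → let r , qc<r , lr = X.lower-rounded l in
      r ℚ.* 1/c
    , ℚₚ.*-cancelʳ-<-nonNeg c (ℚₚ.<-respʳ-≃ (ℚₚ.≃-sym (cancel r)) qc<r)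
    , X.lower-resp (ℚₚ.≃-sym (cancel r)) lr
  ; upper-rounded   = λ u → let r , r<qc , ur = X.upper-rounded u in
      r ℚ.* 1/c
    , ℚₚ.*-cancelʳ-<-nonNeg c (ℚₚ.<-respˡ-≃ (ℚₚ.≃-sym (cancel r)) r<qc)
    , X.upper-resp (ℚₚ.≃-sym (cancel r)) ur
  ; disjoint        = X.disjoint
  ; located         = λ q<r → X.located (ℚₚ.*-monoˡ-<-pos c q<r)
  }
  where
  module X = ℝ x
  c 1/c : ℚᵘ
  c   = + n ℚ./ 1
  1/c = ℚ.1/ c
  cancel : ∀ q → q ℚ.* 1/c ℚ.* c ≃ q
  cancel q = ℚₚ.≃-trans (ℚₚ.*-assoc q 1/c c)
    (ℚₚ.≃-trans (ℚₚ.*-congˡ {q} (ℚₚ.*-inverseˡ c)) (ℚₚ.*-identityʳ q))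

private
  frac< : ∀ {a b d e} → mkℚᵘ (+ a) d ℚ.< mkℚᵘ (+ b) e → a ℕ.* suc e ℕ.< b ℕ.* suc d
  frac< {a} {b} {d} {e} (*<* h) = ℤₚ.drop‿+<+
    (subst₂ ℤ._<_ (sym (ℤₚ.pos-* a (suc e))) (sym (ℤₚ.pos-* b (suc d))) h)

  <frac : ∀ {a b d e} → a ℕ.* suc e ℕ.< b ℕ.* suc d → mkℚᵘ (+ a) d ℚ.< mkℚᵘ (+ b) e
  <frac {a} {b} {d} {e} h = *<*
    (subst₂ ℤ._<_ (ℤₚ.pos-* a (suc e)) (ℤₚ.pos-* b (suc d)) (ℤ.+<+ h))

  pos≮neg : ∀ {a b d e} → ¬ (mkℚᵘ (+ a) d ℚ.< mkℚᵘ -[1+ b ] e)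
  pos≮neg {a} {b} {d} {e} (*<* h) with () ← subst (ℤ._< _) (sym (ℤₚ.pos-* a (suc e))) h

  ^-swap : ∀ m a b → (m ℕ.^ a) ℕ.^ b ≡ (m ℕ.^ b) ℕ.^ a
  ^-swap m a b = trans (ℕₚ.^-*-assoc m a b)
    (trans (cong (m ℕ.^_) (ℕₚ.*-comm a b)) (sym (ℕₚ.^-*-assoc m b a)))

  ^-cancelˡ-< : ∀ {x y} k → x ℕ.^ k ℕ.< y ℕ.^ k → x ℕ.< y
  ^-cancelˡ-< k h = ℕₚ.≰⇒> λ y≤x → ℕₚ.<⇒≱ h (ℕₚ.^-monoˡ-≤ k y≤x)

  n<2^n : ∀ n → n ℕ.< 2 ℕ.^ n
  n<2^n zero    = s≤s z≤n
  n<2^n (suc n) = ℕₚ.≤-trans (ℕₚ.+-mono-≤ (ℕₚ.m^n>0 2 n) (n<2^n n))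
    (ℕₚ.+-monoʳ-≤ (2 ℕ.^ n) (ℕₚ.≤-reflexive (sym (ℕₚ.+-identityʳ _))))

  bernoulli : ∀ x k → x ℕ.^ suc k ℕ.+ suc k ℕ.* x ℕ.^ k ℕ.≤ suc x ℕ.^ suc k
  bernoulli x zero    = ℕₚ.≤-reflexive
    (solve 1 (λ x → x :* con 1 :+ con 1 := (con 1 :+ x) :* con 1) refl x)
    where open +-*-Solver
  bernoulli x (suc k) = begin
    x ℕ.* (x ℕ.* p) ℕ.+ suc (suc k) ℕ.* (x ℕ.* p)
      ≤⟨ ℕₚ.m≤m+n _ (suc k ℕ.* p) ⟩
    x ℕ.* (x ℕ.* p) ℕ.+ suc (suc k) ℕ.* (x ℕ.* p) ℕ.+ suc k ℕ.* p
      ≡⟨ solve 3 (λ x p k → x :* (x :* p) :+ (con 2 :+ k) :* (x :* p) :+ (con 1 :+ k) :* p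
                    := (con 1 :+ x) :* (x :* p :+ (con 1 :+ k) :* p)) refl x p k ⟩
    suc x ℕ.* (x ℕ.* p ℕ.+ suc k ℕ.* p)
      ≤⟨ ℕₚ.*-monoʳ-≤ (suc x) (bernoulli x k) ⟩
    suc x ℕ.* suc x ℕ.^ suc k ∎
    where
    open +-*-Solver
    open ℕₚ.≤-Reasoning
    p = x ℕ.^ k

  gap : ∀ {x y} .{{_ : NonZero x}} → x ℕ.< y → 2 ℕ.* x ℕ.^ suc x ℕ.< y ℕ.^ suc x
  gap {x} {y} x<y = begin-strict
    2 ℕ.* (x ℕ.* p)            <⟨ ℕₚ.m<m+n _ (ℕₚ.m^n>0 x x) ⟩
    2 ℕ.* (x ℕ.* p) ℕ.+ p      ≡⟨ solve 2 (λ x p → con 2 :* (x :* p) :+ p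
                                     := x :* p :+ (con 1 :+ x) :* p) refl x p ⟩
    x ℕ.* p ℕ.+ suc x ℕ.* p    ≤⟨ bernoulli x x ⟩
    suc x ℕ.^ suc x            ≤⟨ ℕₚ.^-monoˡ-≤ (suc x) x<y ⟩
    y ℕ.^ suc x                ∎
    where
    open +-*-Solver
    open ℕₚ.≤-Reasoning
    p = x ℕ.^ x

module Log₂ (m : ℕ) .{{_ : NonZero m}} where

  -- a / b < log₂ m  iff  2 ^ a < m ^ b  (b > 0), and dually; since m ≥ 1,
  -- log₂ m ≥ 0 exceeds every negative rational.
  Lower Upper : Pred ℚᵘ 0ℓ
  Lower (mkℚᵘ (+ a)    d) = 2 ℕ.^ a ℕ.< m ℕ.^ suc d
  Lower (mkℚᵘ -[1+ _ ] _) = ⊤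
  Upper (mkℚᵘ (+ a)    d) = m ℕ.^ suc d ℕ.< 2 ℕ.^ a
  Upper (mkℚᵘ -[1+ _ ] _) = ⊥

  private
    chain : ∀ a b D E → a ℕ.* E ℕ.< b ℕ.* D → (2 ℕ.^ a) ℕ.^ E ℕ.< (2 ℕ.^ b) ℕ.^ D
    chain a b D E h = subst₂ ℕ._<_ (sym (ℕₚ.^-*-assoc 2 a E)) (sym (ℕₚ.^-*-assoc 2 b D))
      (ℕₚ.^-monoʳ-< 2 (s≤s (s≤s z≤n)) h)

    closedˡ : ∀ {q r} → q ℚ.< r → Lower r → Lower q
    closedˡ {mkℚᵘ -[1+ _ ] _} _ _ = tt
    closedˡ {mkℚᵘ (+ a) d} {mkℚᵘ -[1+ _ ] e} q<r _ = ⊥-elim (pos≮neg q<r)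
    closedˡ {mkℚᵘ (+ a) d} {mkℚᵘ (+ b) e} q<r l = ^-cancelˡ-< (suc e)
      (ℕₚ.<-trans (chain a b (suc d) (suc e) (frac< q<r))
        (subst ((2 ℕ.^ b) ℕ.^ suc d ℕ.<_) (^-swap m (suc e) (suc d)) (ℕₚ.^-monoˡ-< (suc d) l)))

    closedʳ : ∀ {q r} → q ℚ.< r → Upper q → Upper r
    closedʳ {mkℚᵘ (+ a) d} {mkℚᵘ -[1+ _ ] e} q<r _ = pos≮neg q<r
    closedʳ {mkℚᵘ (+ a) d} {mkℚᵘ (+ b) e} q<r u = ^-cancelˡ-< (suc d)
      (ℕₚ.<-trans (subst (ℕ._< (2 ℕ.^ a) ℕ.^ suc e) (^-swap m (suc d) (suc e)) (ℕₚ.^-monoˡ-< (suc e) u))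
        (chain a b (suc d) (suc e) (frac< q<r)))

    roundedˡ : ∀ {q} → Lower q → ∃[ r ] q ℚ.< r × Lower r
    roundedˡ {mkℚᵘ -[1+ a ] d} _ = mkℚᵘ -[1+ a ] (suc d) , *<* (ℤ.-<- (ℕ.s<s⁻¹ lt)) , tt
      where
      lt : suc a ℕ.* suc d ℕ.< suc a ℕ.* suc (suc d)
      lt = ℕₚ.*-monoʳ-< (suc a) (ℕₚ.n<1+n (suc d))
    roundedˡ {mkℚᵘ (+ a) d} l =
      mkℚᵘ (+ suc (a ℕ.* K)) (ℕ.pred (suc d ℕ.* K)) , <frac lt , pow
      where
      instance
        nz : NonZero (2 ℕ.^ a)
        nz = ℕₚ.m^n≢0 2 a
      K = suc (2 ℕ.^ a)
      lt : a ℕ.* (suc d ℕ.* K) ℕ.< suc (a ℕ.* K) ℕ.* suc d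
      lt = subst (ℕ._< suc (a ℕ.* K) ℕ.* suc d)
        (solve 3 (λ a d k → a :* k :* d := a :* (d :* k)) refl a (suc d) K)
        (ℕₚ.*-monoˡ-< (suc d) (ℕₚ.n<1+n (a ℕ.* K)))
        where open +-*-Solver
      pow : 2 ℕ.^ suc (a ℕ.* K) ℕ.< m ℕ.^ (suc d ℕ.* K)
      pow = subst₂ ℕ._<_ (cong (2 ℕ.*_) (ℕₚ.^-*-assoc 2 a K)) (ℕₚ.^-*-assoc m (suc d) K) (gap {2 ℕ.^ a} l)

    roundedʳ : ∀ {r} → Upper r → ∃[ q ] q ℚ.< r × Upper q
    roundedʳ {mkℚᵘ (+ zero) d} u = ⊥-elim (ℕₚ.<⇒≱ u (ℕₚ.m^n>0 m (suc d)))
    roundedʳ {mkℚᵘ (+ suc a) d} u =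
      mkℚᵘ (+ ℕ.pred (suc a ℕ.* K)) (ℕ.pred (suc d ℕ.* K)) , <frac lt , pow
      where
      instance
        nz : NonZero (m ℕ.^ suc d)
        nz = ℕₚ.m^n≢0 m (suc d)
      K = suc (m ℕ.^ suc d)
      lt : ℕ.pred (suc a ℕ.* K) ℕ.* suc d ℕ.< suc a ℕ.* (suc d ℕ.* K)
      lt = subst (ℕ.pred (suc a ℕ.* K) ℕ.* suc d ℕ.<_)
        (solve 3 (λ a d k → a :* k :* d := a :* (d :* k)) refl (suc a) (suc d) K)
        (ℕₚ.*-monoˡ-< (suc d) (ℕₚ.n<1+n (ℕ.pred (suc a ℕ.* K))))
        where open +-*-Solver
      pow : m ℕ.^ (suc d ℕ.* K) ℕ.< 2 ℕ.^ ℕ.pred (suc a ℕ.* K)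
      pow = ℕₚ.*-cancelˡ-< 2 _ _
        (subst₂ ℕ._<_ (cong (2 ℕ.*_) (ℕₚ.^-*-assoc m (suc d) K)) (ℕₚ.^-*-assoc 2 (suc a) K) (gap {m ℕ.^ suc d} u))

    loc : ∀ {q r} → q ℚ.< r → Lower q ⊎ Upper r
    loc {mkℚᵘ -[1+ _ ] _} _ = inj₁ tt
    loc {mkℚᵘ (+ a) d} {mkℚᵘ -[1+ _ ] e} q<r = ⊥-elim (pos≮neg q<r)
    loc {mkℚᵘ (+ a) d} {mkℚᵘ (+ b) e} q<r with 2 ℕ.^ a ℕ.<? m ℕ.^ suc d
    ... | yes l = inj₁ l
    ... | no ¬l = inj₂ (^-cancelˡ-< (suc d)
      (ℕₚ.≤-<-trans (subst (ℕ._≤ (2 ℕ.^ a) ℕ.^ suc e) (^-swap m (suc d) (suc e))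
          (ℕₚ.^-monoˡ-≤ (suc e) (ℕₚ.≮⇒≥ ¬l)))
        (chain a b (suc d) (suc e) (frac< q<r))))

    disj : ∀ {q} → Lower q → ¬ Upper q
    disj {mkℚᵘ (+ _) _} l u = ℕₚ.<-asym l u
    disj {mkℚᵘ -[1+ _ ] _} _ ()

  log₂ : ℝ
  log₂ = record
    { lower           = Lower
    ; upper           = Upper
    ; lower-inhabited = mkℚᵘ -[1+ 0 ] 0 , tt
    ; upper-inhabited = mkℚᵘ (+ m) 0 , subst (ℕ._< 2 ℕ.^ m) (sym (ℕₚ.*-identityʳ m)) (n<2^n m)
    ; lower-closed    = closedˡ
    ; upper-closed    = closedʳ
    ; lower-rounded   = roundedˡ
    ; upper-rounded   = roundedʳ
    ; disjoint        = disj
    ; located         = loc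
    }

open Log₂ public using (log₂)

infix 4 _⟶_

_⟶_ : ((n : ℕ) .{{_ : NonZero n}} → ℝ) → ℚᵘ → Set
a ⟶ l = ∀ ε → 0ℚᵘ ℚ.< ε →
  ∃[ N ] ∀ n .{{_ : NonZero n}} → N ℕ.≤ n →
    lower (a n) (l ℚ.- ε) × upper (a n) (l ℚ.+ ε)

-- Lower bound: from every pair {x, 4j − x} of odd numbers choose one element and add 4j; any maximal
-- sum-free superset determines the choices, so there are at least 2^⌊n/4⌋ maximal sum-free sets.
--
-- Upper bound: containers give 2^(o(n)) sets F with o(n²) Schur triples such that every sum-free set lies
-- in one of them, and the removal lemma (triangle removal for the graph x ~ y iff y − x ∈ F, from
-- Szemerédi's regularity lemma) splits F = B ∪ C with B sum-free and |C| = o(n).  Once S ∩ C is fixed, a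
-- maximal sum-free S ⊆ F meets B in a maximal independent set of the link graph of S ∩ C.
-- If |B| ≤ 15n/32, Moon–Moser gives 3^(|B|/3) ≤ 2^(n/4).  Otherwise B reduced modulo max B − min B has
-- fewer than 3|B|/2 differences, so these form a subgroup of index at most 2; hence B consists of odd
-- numbers or |B| ≤ min B.  When |B| ≤ min B, also fix S ∩ B ∩ [1,n/2]; the rest of the link graph is
-- triangle-free, and Hujter–Tuza gives 2^(n/4) in total.  When B is odd, the link graph is triangle-free up
-- to O(1) vertices if S has boundedly many even elements, and otherwise a second round of containers
-- brings the set below density 15/32.
module Submission where

open import Defs
open import Data.Nat renaming (_/_ to _div_)
open import Data.Nat.Properties
open import Data.Bool using (Bool; true; false; if_then_else_; _∧_; _∨_; not; T)
open import Data.Bool.Properties using (∧-comm; ∨-comm)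
open import Data.Empty using (⊥; ⊥-elim)
open import Data.List using (List; []; _∷_; _++_; length; map; filter)
open import Data.List.Properties using (length-map; length-++)
open import Data.List.Membership.Propositional using (_∈_)
open import Data.List.Membership.Propositional.Properties using (∈-map⁺; ∈-++⁺ˡ; ∈-++⁺ʳ; ∈-filter⁺; ∈-filter⁻; ∈-++⁻; ∈-map⁻)
open import Data.List.Relation.Unary.Any using (here; there)
open import Data.Product using (∃; ∃-syntax; _×_; _,_; proj₁; proj₂)
open import Data.Sum using (_⊎_; inj₁; inj₂)
open import Data.Maybe using (Maybe; just; nothing)
open import Relation.Binary.PropositionalEquality
open import Relation.Nullary using (¬_; Dec; yes; no)
open import Data.Nat.Divisibility using (m≤n⇒m!∣n!; ∣-trans; m∣m*n)
open import Relation.Binary.Definitions using (tri<; tri≈; tri>)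
open import Data.Nat.DivMod using (m/n*n≡m; m%n<n; [m+n]%n≡m%n; m<n⇒m%n≡m; %-distribˡ-+; m≡m%n+[m/n]*n; m*n/n≡m; /-monoˡ-≤; m/n*n≤m)
open import Data.Nat.Tactic.RingSolver using (solve-∀)

-- The threshold 15/32 is squeezed from two sides. Moon-Moser yields at most 2^(n/4) as long as
-- |B|/n stays below 3/(4 log₂ 3) = 0.473..., and the difference argument for larger sum-free sets
-- works once |B|/n exceeds 4/9; the fraction 15/32 lies in between and turns the first condition
-- into 3⁵ < 2⁸. Odd sets need separate treatment: at density 1/2 Moon-Moser gives only 2^(0.264 n),
-- while sums of odd vertices can close triangles in the link graph. Only even elements of S create
-- edges between odd vertices, which is why the argument splits by their number.
--
-- No real number occurs before the last step. The accuracy is a natural number s, and every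
-- estimate compares integer powers: a family of L containers is measured by L qᴺ ≤ (q+1)ᴺ,
-- densities are multiplied by common denominators, and the final bounds read 2^(s n) < f^(4(s+1))
-- and f^(4s) < 2^((s+14) n). Sets are Boolean predicates on ℕ, and families of sets are counted by
-- lists of representatives up to agreement on an initial segment.

ι : Bool → ℕ
ι true = 1
ι false = 0

-- Coefficientwise comparison of polynomials over ℕ

infixl 6 _⊞_
infixl 7 _⊠_

data Expr : Set where
  con : ℕ → Expr
  var : ℕ → Expr
  _⊞_ _⊠_ : Expr → Expr → Expr

Env : Set
Env = List ℕ

_‼_ : Env → ℕ → ℕ
[] ‼ _ = 0
(x ∷ ρ) ‼ zero = x
(x ∷ ρ) ‼ suc i = ρ ‼ i

⟪_⟫ : Expr → Env → ℕ
⟪ con c ⟫ ρ = c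
⟪ var i ⟫ ρ = ρ ‼ i
⟪ a ⊞ b ⟫ ρ = ⟪ a ⟫ ρ + ⟪ b ⟫ ρ
⟪ a ⊠ b ⟫ ρ = ⟪ a ⟫ ρ * ⟪ b ⟫ ρ

Mono Poly : Set
Mono = List ℕ
Poly = List (ℕ × Mono)

evalM : Mono → Env → ℕ
evalM [] ρ = 1
evalM (i ∷ m) ρ = ρ ‼ i * evalM m ρ

evalP : Poly → Env → ℕ
evalP [] ρ = 0
evalP ((c , m) ∷ p) ρ = c * evalM m ρ + evalP p ρ

eqM : (m m' : Mono) → Maybe (m ≡ m')
eqM [] [] = just refl
eqM [] (_ ∷ _) = nothing
eqM (_ ∷ _) [] = nothing
eqM (i ∷ m) (j ∷ m') with i ≟ j | eqM m m'
... | yes refl | just refl = just refl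
... | _ | _ = nothing

insM : ℕ → Mono → Mono
insM i [] = i ∷ []
insM i (j ∷ m) = if i ≤ᵇ j then i ∷ j ∷ m else j ∷ insM i m

insM-ok : ∀ i m ρ → evalM (insM i m) ρ ≡ ρ ‼ i * evalM m ρ
insM-ok i [] ρ = refl
insM-ok i (j ∷ m) ρ with i ≤ᵇ j
... | true = refl
... | false rewrite insM-ok i m ρ | sym (*-assoc (ρ ‼ j) (ρ ‼ i) (evalM m ρ))
  | *-comm (ρ ‼ j) (ρ ‼ i) = *-assoc (ρ ‼ i) (ρ ‼ j) (evalM m ρ)

mulM : Mono → Mono → Mono
mulM [] m' = m'
mulM (i ∷ m) m' = insM i (mulM m m')

mulM-ok : ∀ m m' ρ → evalM (mulM m m') ρ ≡ evalM m ρ * evalM m' ρ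
mulM-ok [] m' ρ = sym (+-identityʳ _)
mulM-ok (i ∷ m) m' ρ rewrite insM-ok i (mulM m m') ρ | mulM-ok m m' ρ =
  sym (*-assoc (ρ ‼ i) _ _)

addT : ℕ → Mono → Poly → Poly
addT c m [] = (c , m) ∷ []
addT c m ((d , m') ∷ p) with eqM m m'
... | just _ = (c + d , m') ∷ p
... | nothing = (d , m') ∷ addT c m p

addT-ok : ∀ c m p ρ → evalP (addT c m p) ρ ≡ c * evalM m ρ + evalP p ρ
addT-ok c m [] ρ = refl
addT-ok c m ((d , m') ∷ p) ρ with eqM m m'
... | just refl rewrite *-distribʳ-+ (evalM m ρ) c d = +-assoc (c * evalM m ρ) _ _
... | nothing rewrite addT-ok c m p ρ | sym (+-assoc (d * evalM m' ρ) (c * evalM m ρ) (evalP p ρ))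
  | +-comm (d * evalM m' ρ) (c * evalM m ρ) = +-assoc (c * evalM m ρ) _ _

addP : Poly → Poly → Poly
addP [] q = q
addP ((c , m) ∷ p) q = addT c m (addP p q)

addP-ok : ∀ p q ρ → evalP (addP p q) ρ ≡ evalP p ρ + evalP q ρ
addP-ok [] q ρ = refl
addP-ok ((c , m) ∷ p) q ρ rewrite addT-ok c m (addP p q) ρ | addP-ok p q ρ =
  sym (+-assoc (c * evalM m ρ) _ _)

mulT : ℕ → Mono → Poly → Poly
mulT c m [] = []
mulT c m ((d , m') ∷ p) = addT (c * d) (mulM m m') (mulT c m p)

mulT-ok : ∀ c m p ρ → evalP (mulT c m p) ρ ≡ c * evalM m ρ * evalP p ρ
mulT-ok c m [] ρ = sym (*-zeroʳ (c * evalM m ρ))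
mulT-ok c m ((d , m') ∷ p) ρ rewrite addT-ok (c * d) (mulM m m') (mulT c m p) ρ
  | mulT-ok c m p ρ | mulM-ok m m' ρ
  | *-distribˡ-+ (c * evalM m ρ) (d * evalM m' ρ) (evalP p ρ)
  = cong (_+ c * evalM m ρ * evalP p ρ) ([m*n]*[o*p]≡[m*o]*[n*p] c d (evalM m ρ) (evalM m' ρ))

mulP : Poly → Poly → Poly
mulP [] q = []
mulP ((c , m) ∷ p) q = addP (mulT c m q) (mulP p q)

mulP-ok : ∀ p q ρ → evalP (mulP p q) ρ ≡ evalP p ρ * evalP q ρ
mulP-ok [] q ρ = refl
mulP-ok ((c , m) ∷ p) q ρ rewrite addP-ok (mulT c m q) (mulP p q) ρ | mulT-ok c m q ρ
  | mulP-ok p q ρ = sym (*-distribʳ-+ (evalP q ρ) (c * evalM m ρ) (evalP p ρ))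

norm : Expr → Poly
norm (con c) = (c , []) ∷ []
norm (var i) = (1 , i ∷ []) ∷ []
norm (a ⊞ b) = addP (norm a) (norm b)
norm (a ⊠ b) = mulP (norm a) (norm b)

norm-ok : ∀ e ρ → evalP (norm e) ρ ≡ ⟪ e ⟫ ρ
norm-ok (con c) ρ = trans (+-identityʳ _) (*-identityʳ c)
norm-ok (var i) ρ = trans (+-identityʳ _) (trans (+-identityʳ _) (*-identityʳ _))
norm-ok (a ⊞ b) ρ = trans (addP-ok (norm a) (norm b) ρ) (cong₂ _+_ (norm-ok a ρ) (norm-ok b ρ))
norm-ok (a ⊠ b) ρ = trans (mulP-ok (norm a) (norm b) ρ) (cong₂ _*_ (norm-ok a ρ) (norm-ok b ρ))

leT : ℕ → Mono → Poly → Bool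
leT c m [] = c ≤ᵇ 0
leT c m ((d , m') ∷ p) with eqM m m'
... | just _ = c ≤ᵇ d
... | nothing = leT c m p

dropT : ℕ → Mono → Poly → Poly
dropT c m [] = []
dropT c m ((d , m') ∷ p) with eqM m m'
... | just _ = (d ∸ c , m') ∷ p
... | nothing = (d , m') ∷ dropT c m p

T⇒ : ∀ {a b} → (a ≤ᵇ b) ≡ true → a ≤ b
T⇒ {a} {b} h = ≤ᵇ⇒≤ a b (subst (λ b → T b) (sym h) _)

leT-ok : ∀ c m p ρ → leT c m p ≡ true → c * evalM m ρ + evalP (dropT c m p) ρ ≡ evalP p ρ
leT-ok c m [] ρ h with T⇒ {c} h
... | z≤n = refl
leT-ok c m ((d , m') ∷ p) ρ h with eqM m m'
... | just refl = trans (sym (+-assoc (c * evalM m ρ) _ _))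
  (cong (_+ evalP p ρ) (trans (sym (*-distribʳ-+ (evalM m ρ) c (d ∸ c))) (cong (_* evalM m ρ) (m+[n∸m]≡n (T⇒ {c} {d} h)))))
... | nothing rewrite sym (leT-ok c m p ρ h) | sym (+-assoc (c * evalM m ρ) (d * evalM m' ρ) (evalP (dropT c m p) ρ))
  | +-comm (c * evalM m ρ) (d * evalM m' ρ) = +-assoc (d * evalM m' ρ) _ _

-- Each term of `p` is charged to the term of `q` with the same monomial, which `dropT` then
-- diminishes. `norm` merges equal monomials, so the first match carries the whole coefficient. On
-- concrete expressions the test computes, and later arithmetic steps are certified by `refl`.
leP : Poly → Poly → Bool
leP [] q = true
leP ((c , m) ∷ p) q = leT c m q ∧ leP p (dropT c m q)

leP-ok : ∀ p q ρ → leP p q ≡ true → evalP p ρ ≤ evalP q ρ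
leP-ok [] q ρ h = z≤n
leP-ok ((c , m) ∷ p) q ρ h with leT c m q in eq
... | true = ≤-trans (+-monoʳ-≤ (c * evalM m ρ) (leP-ok p (dropT c m q) ρ h)) (≤-reflexive (leT-ok c m q ρ eq))

expr-≤ : ∀ e f ρ → leP (norm e) (norm f) ≡ true → ⟪ e ⟫ ρ ≤ ⟪ f ⟫ ρ
expr-≤ e f ρ h = subst₂ _≤_ (norm-ok e ρ) (norm-ok f ρ) (leP-ok (norm e) (norm f) ρ h)

expr-≡ : ∀ e f ρ → leP (norm e) (norm f) ∧ leP (norm f) (norm e) ≡ true → ⟪ e ⟫ ρ ≡ ⟪ f ⟫ ρ
expr-≡ e f ρ h with leP (norm e) (norm f) in eq₁ | leP (norm f) (norm e) in eq₂
... | true | true = ≤-antisym (expr-≤ e f ρ eq₁) (expr-≤ f e ρ eq₂)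

-- From A ≤ B derive L ≤ R whenever L + B is dominated by R + A coefficientwise.
lin-sound : ∀ l r a b ρ → leP (norm (l ⊞ b)) (norm (r ⊞ a)) ≡ true → ⟪ a ⟫ ρ ≤ ⟪ b ⟫ ρ → ⟪ l ⟫ ρ ≤ ⟪ r ⟫ ρ
lin-sound l r a b ρ c h = +-cancelʳ-≤ (⟪ b ⟫ ρ) _ _
  (≤-trans (expr-≤ (l ⊞ b) (r ⊞ a) ρ c) (+-monoʳ-≤ (⟪ r ⟫ ρ) h))

infixr 5 _&_
infixr 6 _·_

_&_ : ∀ {a b c d} → a ≤ b → c ≤ d → a + c ≤ b + d
_&_ = +-mono-≤

_·_ : ∀ {a b} c → a ≤ b → c * a ≤ c * b
c · h = *-monoʳ-≤ c h

1≰0 : ∀ {a} {A : Set a} → 1 ≤ 0 → A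
1≰0 ()

-- Finite sums and decidable subsets of ℕ

Pr : Set
Pr = ℕ → Bool

true≢false : ∀ {a} {A : Set a} {b : Bool} → b ≡ true → b ≡ false → A
true≢false refl ()

bool? : (b : Bool) → (b ≡ true) ⊎ (b ≡ false)
bool? true = inj₁ refl
bool? false = inj₂ refl

¬true : ∀ {b : Bool} → ¬ (b ≡ true) → b ≡ false
¬true {true} h = ⊥-elim (h refl)
¬true {false} h = refl

∧-split : ∀ {a b} → a ∧ b ≡ true → (a ≡ true) × (b ≡ true)
∧-split {true} {true} refl = refl , refl

∧-join : ∀ {a b} → a ≡ true → b ≡ true → a ∧ b ≡ true
∧-join refl refl = refl

∨-split : ∀ {a b} → a ∨ b ≡ true → (a ≡ true) ⊎ (b ≡ true)
∨-split {true} h = inj₁ refl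
∨-split {false} h = inj₂ h

∨-left : ∀ {a b} → a ≡ true → a ∨ b ≡ true
∨-left refl = refl

∨-right : ∀ {a b} → b ≡ true → a ∨ b ≡ true
∨-right {true} h = refl
∨-right {false} h = h

∨-false : ∀ {a b} → a ∨ b ≡ false → (a ≡ false) × (b ≡ false)
∨-false {false} {false} refl = refl , refl

not-true : ∀ {b} → not b ≡ true → b ≡ false
not-true {false} refl = refl

not-false : ∀ {b} → b ≡ false → not b ≡ true
not-false refl = refl

≤ᵇ-true : ∀ {a b} → (a ≤ᵇ b) ≡ true → a ≤ b
≤ᵇ-true {a} {b} h = ≤ᵇ⇒≤ a b (subst T (sym h) _)

true-≤ᵇ : ∀ {a b} → a ≤ b → (a ≤ᵇ b) ≡ true
true-≤ᵇ {a} {b} h with a ≤ᵇ b | ≤⇒≤ᵇ h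
... | true | _ = refl

≤ᵇ-false : ∀ {a b} → (a ≤ᵇ b) ≡ false → b < a
≤ᵇ-false h = ≰⇒> λ le → true≢false (true-≤ᵇ le) h

false-≤ᵇ : ∀ {a b} → b < a → (a ≤ᵇ b) ≡ false
false-≤ᵇ h = ¬true λ e → <⇒≱ h (≤ᵇ-true e)

≡ᵇ-true : ∀ {a b} → (a ≡ᵇ b) ≡ true → a ≡ b
≡ᵇ-true {a} {b} h = ≡ᵇ⇒≡ a b (subst T (sym h) _)

≡ᵇ-refl : ∀ a → (a ≡ᵇ a) ≡ true
≡ᵇ-refl zero = refl
≡ᵇ-refl (suc a) = ≡ᵇ-refl a

≢ᵇ-false : ∀ {a b} → a ≢ b → (a ≡ᵇ b) ≡ false
≢ᵇ-false h = ¬true λ e → h (≡ᵇ-true e)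

ι≤1 : ∀ b → ι b ≤ 1
ι≤1 true = s≤s z≤n
ι≤1 false = z≤n

ι-∧ : ∀ a b → ι (a ∧ b) ≡ ι a * ι b
ι-∧ true b = sym (+-identityʳ _)
ι-∧ false b = refl

ι-not : ∀ b → ι b + ι (not b) ≡ 1
ι-not true = refl
ι-not false = refl

ι-mono : ∀ {a b} → (a ≡ true → b ≡ true) → ι a ≤ ι b
ι-mono {true} h rewrite h refl = ≤-refl
ι-mono {false} h = z≤n

ι-pos : ∀ {b} → 0 < ι b → b ≡ true
ι-pos {true} _ = refl

ι-true : ∀ {b} → b ≡ true → ι b ≡ 1
ι-true refl = refl

ι-false : ∀ {b} → b ≡ false → ι b ≡ 0
ι-false refl = refl

∑ : ℕ → (ℕ → ℕ) → ℕ
∑ zero f = 0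
∑ (suc n) f = ∑ n f + f n

∑-cong : ∀ n {f g} → (∀ x → x < n → f x ≡ g x) → ∑ n f ≡ ∑ n g
∑-cong zero h = refl
∑-cong (suc n) h = cong₂ _+_ (∑-cong n λ x l → h x (m<n⇒m<1+n l)) (h n ≤-refl)

∑-mono : ∀ n {f g} → (∀ x → x < n → f x ≤ g x) → ∑ n f ≤ ∑ n g
∑-mono zero h = z≤n
∑-mono (suc n) h = +-mono-≤ (∑-mono n λ x l → h x (m<n⇒m<1+n l)) (h n ≤-refl)

∑-+ : ∀ n f g → ∑ n (λ x → f x + g x) ≡ ∑ n f + ∑ n g
∑-+ zero f g = refl
∑-+ (suc n) f g = trans (cong (_+ (f n + g n)) (∑-+ n f g)) (r (∑ n f) (∑ n g) (f n) (g n))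
  where
  r : ∀ a b c d → a + b + (c + d) ≡ a + c + (b + d)
  r = solve-∀

∑-*ˡ : ∀ n c f → ∑ n (λ x → c * f x) ≡ c * ∑ n f
∑-*ˡ zero c f = sym (*-zeroʳ c)
∑-*ˡ (suc n) c f = trans (cong (_+ c * f n) (∑-*ˡ n c f)) (sym (*-distribˡ-+ c (∑ n f) (f n)))

∑-*ʳ : ∀ n c f → ∑ n (λ x → f x * c) ≡ ∑ n f * c
∑-*ʳ n c f = trans (∑-cong n λ x _ → *-comm (f x) c) (trans (∑-*ˡ n c f) (*-comm c _))

∑-const : ∀ n c → ∑ n (λ _ → c) ≡ n * c
∑-const zero c = refl
∑-const (suc n) c = trans (cong (_+ c) (∑-const n c)) (+-comm (n * c) c)

∑-zero : ∀ n → ∑ n (λ _ → 0) ≡ 0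
∑-zero n = trans (∑-const n 0) (*-zeroʳ n)

∑-swap : ∀ m n (f : ℕ → ℕ → ℕ) → ∑ m (λ x → ∑ n (λ y → f x y)) ≡ ∑ n (λ y → ∑ m (λ x → f x y))
∑-swap zero n f = sym (∑-zero n)
∑-swap (suc m) n f = trans (cong (_+ ∑ n (f m)) (∑-swap m n f)) (sym (∑-+ n (λ y → ∑ m (λ x → f x y)) (f m)))

∑-term : ∀ n f {x} → x < n → f x ≤ ∑ n f
∑-term (suc n) f {x} l with x ≟ n
... | yes refl = m≤n+m (f n) (∑ n f)
... | no ne = ≤-trans (∑-term n f (≤∧≢⇒< (s≤s⁻¹ l) ne)) (m≤m+n _ _)

∑-pigeon : ∀ n {f g} → ∑ n f < ∑ n g → ∃[ x ] x < n × f x < g x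
∑-pigeon (suc n) {f} {g} h with f n <? g n
... | yes l = n , ≤-refl , l
... | no nl with ∑-pigeon n {f} {g} (+-cancelʳ-< (g n) _ _ (≤-<-trans (+-monoʳ-≤ (∑ n f) (≮⇒≥ nl)) h))
... | x , l , q = x , m<n⇒m<1+n l , q

∑-split : ∀ a b f → ∑ (a + b) f ≡ ∑ a f + ∑ b (λ x → f (a + x))
∑-split a zero f rewrite +-identityʳ a = sym (+-identityʳ _)
∑-split a (suc b) f rewrite +-suc a b | ∑-split a b f = +-assoc (∑ a f) _ _

∑-len : ∀ {a b} f → a ≤ b → ∑ a f ≤ ∑ b f
∑-len {a} {b} f h = subst (λ b → ∑ a f ≤ ∑ b f) (m+[n∸m]≡n h)
  (≤-trans (m≤m+n _ _) (≤-reflexive (sym (∑-split a (b ∸ a) f))))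

∑-head : ∀ n f → ∑ (suc n) f ≡ f 0 + ∑ n (λ x → f (suc x))
∑-head n f = ∑-split 1 n f

∑-rev : ∀ n f → ∑ n (λ x → f (n ∸ suc x)) ≡ ∑ n f
∑-rev zero f = refl
∑-rev (suc n) f = trans (∑-head n _) (trans (cong (f n +_) (∑-rev n f)) (+-comm (f n) _))

∑-tail0 : ∀ {a b} f → a ≤ b → (∀ x → a ≤ x → f x ≡ 0) → ∑ b f ≡ ∑ a f
∑-tail0 {a} {b} f h z = trans (cong (λ b → ∑ b f) (sym (m+[n∸m]≡n h)))
  (trans (∑-split a (b ∸ a) f) (trans (cong (∑ a f +_) (trans (∑-cong (b ∸ a) λ x _ → z (a + x) (m≤m+n a x)) (∑-zero (b ∸ a)))) (+-identityʳ _)))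

∑-shift : ∀ a n f → ∑ n (λ x → f (a + x)) ≤ ∑ (a + n) f
∑-shift a n f = ≤-trans (m≤n+m _ _) (≤-reflexive (sym (∑-split a n f)))

-- Truncated subtraction sends every x ≤ a to 0; the vanishing of `f 0` keeps these repeated terms
-- from being counted.
∑-monus : ∀ m a f → f 0 ≡ 0 → ∑ m (λ x → f (x ∸ a)) ≤ ∑ m f
∑-monus m a f z with ≤-total a m
... | inj₁ a≤m = begin
  ∑ m g ≡⟨ cong (λ m → ∑ m g) (sym (m+[n∸m]≡n a≤m)) ⟩
  ∑ (a + (m ∸ a)) g ≡⟨ ∑-split a (m ∸ a) g ⟩
  ∑ a g + ∑ (m ∸ a) (λ x → f (a + x ∸ a)) ≡⟨ cong₂ _+_ (trans (∑-cong a λ x l → trans (cong f (m≤n⇒m∸n≡0 (<⇒≤ l))) z) (∑-zero a)) (∑-cong (m ∸ a) λ x _ → cong f (m+n∸m≡n a x)) ⟩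
  ∑ (m ∸ a) f ≤⟨ ∑-len f (m∸n≤m m a) ⟩
  ∑ m f ∎
  where
  open ≤-Reasoning
  g = λ x → f (x ∸ a)
... | inj₂ m≤a = ≤-trans (≤-reflexive (trans (∑-cong m λ x l → trans (cong f (m≤n⇒m∸n≡0 (≤-trans (<⇒≤ l) m≤a))) z) (∑-zero m))) z≤n

δ : ℕ → ℕ → ℕ
δ i j = ι (i ≡ᵇ j)

δ-refl : ∀ i → δ i i ≡ 1
δ-refl i = ι-true (≡ᵇ-refl i)

δ-≢ : ∀ {i j} → i ≢ j → δ i j ≡ 0
δ-≢ h = ι-false (≢ᵇ-false h)

δ-cases : ∀ i j → (i ≡ j) ⊎ (δ i j ≡ 0)
δ-cases i j with i ≟ j
... | yes e = inj₁ e
... | no ne = inj₂ (δ-≢ ne)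

∑-δ-out : ∀ n j (F : ℕ → ℕ) → n ≤ j → ∑ n (λ i → δ j i * F i) ≡ 0
∑-δ-out n j F h = trans (∑-cong n λ i l → cong (_* F i) (δ-≢ {j} {i} λ { refl → <⇒≱ l h })) (∑-zero n)

∑-δ : ∀ n j (F : ℕ → ℕ) → j < n → ∑ n (λ i → δ j i * F i) ≡ F j
∑-δ (suc n) j F h with j ≟ n
... | yes refl = cong₂ _+_ (∑-δ-out n n F ≤-refl) (trans (cong (_* F n) (δ-refl n)) (+-identityʳ _))
... | no ne = trans (cong₂ _+_ (∑-δ n j F (≤∧≢⇒< (s≤s⁻¹ h) ne)) (cong (_* F n) (δ-≢ ne))) (+-identityʳ _)

# : ℕ → Pr → ℕ
# n p = ∑ n (λ x → ι (p x))

#-cong : ∀ n {p q : Pr} → (∀ x → x < n → p x ≡ q x) → # n p ≡ # n q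
#-cong n h = ∑-cong n λ x l → cong ι (h x l)

#-mono : ∀ n {p q : Pr} → (∀ x → x < n → p x ≡ true → q x ≡ true) → # n p ≤ # n q
#-mono n h = ∑-mono n λ x l → ι-mono (h x l)

#-split : ∀ n (p q : Pr) → # n p ≡ # n (λ x → p x ∧ q x) + # n (λ x → p x ∧ not (q x))
#-split n p q = trans (∑-cong n λ x _ → e (p x) (q x)) (∑-+ n _ _)
  where
  e : ∀ a b → ι a ≡ ι (a ∧ b) + ι (a ∧ not b)
  e true true = refl
  e true false = refl
  e false b = refl

#≤ : ∀ n p → # n p ≤ n
#≤ n p = ≤-trans (∑-mono n λ x _ → ι≤1 (p x)) (≤-reflexive (trans (∑-const n 1) (*-identityʳ n)))

#-pos : ∀ n p → 0 < # n p → ∃[ x ] x < n × p x ≡ true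
#-pos n p h with ∑-pigeon n {λ _ → 0} {λ x → ι (p x)} (subst (_< # n p) (sym (∑-zero n)) h)
... | x , l , q = x , l , ι-pos q

#-has : ∀ n p {x} → x < n → p x ≡ true → 0 < # n p
#-has n p {x} l e = ≤-trans (≤-reflexive (sym (ι-true e))) (∑-term n (λ x → ι (p x)) l)

#-empty : ∀ n p → (∀ x → x < n → p x ≡ false) → # n p ≡ 0
#-empty n p h = trans (∑-cong n λ x l → ι-false (h x l)) (∑-zero n)

#-zero : ∀ n p → # n p ≡ 0 → ∀ x → x < n → p x ≡ false
#-zero n p h x l = ¬true λ e → <⇒≢ (#-has n p l e) (sym h)

any<? : ∀ n (p : Pr) → (∃[ x ] x < n × p x ≡ true) ⊎ (∀ x → x < n → p x ≡ false)
any<? n p with # n p in e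
... | zero = inj₂ (#-zero n p e)
... | suc k = inj₁ (#-pos n p (subst (0 <_) (sym e) (s≤s z≤n)))

#-single : ∀ n v → v < n → # n (v ≡ᵇ_) ≡ 1
#-single n v l = trans (∑-cong n λ x _ → sym (*-identityʳ (δ v x))) (∑-δ n v (λ _ → 1) l)

#-single≤ : ∀ n v → # n (v ≡ᵇ_) ≤ 1
#-single≤ n v with v <? n
... | yes l = ≤-reflexive (#-single n v l)
... | no nl = ≤-trans (≤-reflexive (#-empty n _ λ x l → ≢ᵇ-false {v} {x} λ { refl → nl l })) z≤n

-- `φ` reads its argument only below `m`. This makes exhaustive search over predicates finite, which
-- later decides whether a pair of cells has a witness of irregularity.
Resp : ℕ → (Pr → Bool) → Set
Resp m φ = ∀ p q → (∀ x → x < m → p x ≡ q x) → φ p ≡ φ q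

set : ℕ → Bool → Pr → Pr
set v b p x = if v ≡ᵇ x then b else p x

set-= : ∀ v b p → set v b p v ≡ b
set-= v b p rewrite ≡ᵇ-refl v = refl

set-≢ : ∀ v b p {x} → v ≢ x → set v b p x ≡ p x
set-≢ v b p {x} ne rewrite ≢ᵇ-false ne = refl

set-resp : ∀ m φ b → Resp (suc m) φ → Resp m (λ p → φ (set m b p))
set-resp m φ b r p q h = r _ _ λ x l → g x l (m ≟ x)
  where
  g : ∀ x → x < suc m → Dec (m ≡ x) → set m b p x ≡ set m b q x
  g x l (yes refl) = trans (set-= m b p) (sym (set-= m b q))
  g x l (no ne) = trans (set-≢ m b p ne) (trans (h x (≤∧≢⇒< (s≤s⁻¹ l) λ e → ne (sym e))) (sym (set-≢ m b q ne)))

findPr : ∀ m φ → Resp m φ → (∃[ p ] φ p ≡ true) ⊎ (∀ p → φ p ≡ false)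
findPr zero φ r with bool? (φ (λ _ → false))
... | inj₁ e = inj₁ (_ , e)
... | inj₂ e = inj₂ λ p → trans (r p _ λ x ()) e
findPr (suc m) φ r with findPr m _ (set-resp m φ true r) | findPr m _ (set-resp m φ false r)
... | inj₁ (p , e) | _ = inj₁ (_ , e)
... | inj₂ _ | inj₁ (p , e) = inj₁ (_ , e)
... | inj₂ f₁ | inj₂ f₀ = inj₂ λ p → trans (r p _ λ x l → g p x (m ≟ x)) (h p (p m) refl)
  where
  g : ∀ p x → Dec (m ≡ x) → p x ≡ set m (p m) p x
  g p x (yes refl) = sym (set-= m (p m) p)
  g p x (no ne) = sym (set-≢ m (p m) p ne)
  h : ∀ p b → p m ≡ b → φ (set m (p m) p) ≡ false
  h p true e rewrite e = f₁ p
  h p false e rewrite e = f₀ p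

-- Szemerédi regularity and triangle removal

dist-sq : ∀ a b → ∣ a - b ∣ * ∣ a - b ∣ + 2 * (a * b) ≡ a * a + b * b
dist-sq a b with ≤-total a b
... | inj₁ h with m≤n⇒∃[o]m+o≡n h
...   | d , refl rewrite ∣m-m+n∣≡n a d = expr-≡ (var 0 ⊠ var 0 ⊞ (var 1 ⊠ (var 1 ⊞ var 0) ⊞ (var 1 ⊠ (var 1 ⊞ var 0) ⊞ con 0))) (var 1 ⊠ var 1 ⊞ (var 1 ⊞ var 0) ⊠ (var 1 ⊞ var 0)) (d ∷ a ∷ []) refl
dist-sq a b | inj₂ h with m≤n⇒∃[o]m+o≡n h
...   | d , refl rewrite ∣-∣-comm (b + d) b | ∣m-m+n∣≡n b d = expr-≡ (var 0 ⊠ var 0 ⊞ ((var 1 ⊞ var 0) ⊠ var 1 ⊞ ((var 1 ⊞ var 0) ⊠ var 1 ⊞ con 0))) ((var 1 ⊞ var 0) ⊠ (var 1 ⊞ var 0) ⊞ var 1 ⊠ var 1) (d ∷ b ∷ []) refl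

dist-≤ : ∀ a b → a ≤ ∣ a - b ∣ + b
dist-≤ a b = ≤-trans (m≤n+m∸n a b) (≤-trans (+-monoʳ-≤ b (m∸n≤∣m-n∣ a b)) (≤-reflexive (+-comm b _)))

amgm : ∀ a b → 2 * (a * b) ≤ a * a + b * b
amgm a b = ≤-trans (m≤n+m _ (∣ a - b ∣ * ∣ a - b ∣)) (≤-reflexive (dist-sq a b))

-- A partition is a colouring `c` of ℕ with colours below `k`; its cells are the colour classes,
-- possibly empty. A refinement determines the coarser colour, and a measurable set is a union of
-- cells.
Bounded : (ℕ → ℕ) → ℕ → Set
Bounded c k = ∀ x → c x < k

Refines : (ℕ → ℕ) → (ℕ → ℕ) → Set
Refines c' c = ∃ λ (r : ℕ → ℕ) → ∀ x → c x ≡ r (c' x)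

Measurable : Pr → (ℕ → ℕ) → Set
Measurable p c = ∃ λ (q : Pr) → ∀ x → p x ≡ q (c x)

-- Densities are scaled by D = (m!)² to stay in ℕ: class sizes divide m!.
module Energy (m : ℕ) (f : ℕ → ℕ → ℕ) (f≤1 : ∀ x y → f x y ≤ 1) where

  ∑∑ : (ℕ → ℕ → ℕ) → ℕ
  ∑∑ u = ∑ m λ x → ∑ m λ y → u x y

  ∑∑-cong : ∀ {u v} → (∀ x y → u x y ≡ v x y) → ∑∑ u ≡ ∑∑ v
  ∑∑-cong h = ∑-cong m λ x _ → ∑-cong m λ y _ → h x y

  ∑∑-mono : ∀ {u v} → (∀ x y → x < m → y < m → u x y ≤ v x y) → ∑∑ u ≤ ∑∑ v
  ∑∑-mono h = ∑-mono m λ x l → ∑-mono m λ y l' → h x y l l'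

  ∑∑-+ : ∀ u v → ∑∑ (λ x y → u x y + v x y) ≡ ∑∑ u + ∑∑ v
  ∑∑-+ u v = trans (∑-cong m λ x _ → ∑-+ m (u x) (v x)) (∑-+ m _ _)

  ∑∑-* : ∀ k u → ∑∑ (λ x y → k * u x y) ≡ k * ∑∑ u
  ∑∑-* k u = trans (∑-cong m λ x _ → ∑-*ˡ m k (u x)) (∑-*ˡ m k _)

  cell : (ℕ → ℕ) → ℕ → ℕ → (ℕ → ℕ → ℕ) → ℕ
  cell c i j u = ∑∑ λ x y → δ (c x) i * (δ (c y) j * u x y)

  cell-mono : ∀ c i j {u v} → (∀ x y → c x ≡ i → c y ≡ j → u x y ≤ v x y) → cell c i j u ≤ cell c i j v
  cell-mono c i j {u} {v} h = ∑∑-mono λ x y _ _ → g x y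
    where
    g : ∀ x y → δ (c x) i * (δ (c y) j * u x y) ≤ δ (c x) i * (δ (c y) j * v x y)
    g x y with δ-cases (c x) i | δ-cases (c y) j
    ... | inj₁ e | inj₁ e' = *-monoʳ-≤ (δ (c x) i) (*-monoʳ-≤ (δ (c y) j) (h x y e e'))
    ... | inj₂ z | _ rewrite z = z≤n
    ... | inj₁ _ | inj₂ z rewrite z = ≤-refl

  cell-cong : ∀ c i j {u v} → (∀ x y → c x ≡ i → c y ≡ j → u x y ≡ v x y) → cell c i j u ≡ cell c i j v
  cell-cong c i j h = ≤-antisym (cell-mono c i j λ x y e e' → ≤-reflexive (h x y e e'))
    (cell-mono c i j λ x y e e' → ≤-reflexive (sym (h x y e e')))

  cell-+ : ∀ c i j u v → cell c i j (λ x y → u x y + v x y) ≡ cell c i j u + cell c i j v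
  cell-+ c i j u v = trans (∑∑-cong λ x y → g (δ (c x) i) (δ (c y) j) (u x y) (v x y)) (∑∑-+ _ _)
    where
    g : ∀ a b s t → a * (b * (s + t)) ≡ a * (b * s) + a * (b * t)
    g = solve-∀

  cell-* : ∀ c i j k u → cell c i j (λ x y → k * u x y) ≡ k * cell c i j u
  cell-* c i j k u = trans (∑∑-cong λ x y → g (δ (c x) i) (δ (c y) j) (u x y)) (∑∑-* k _)
    where
    g : ∀ a b s → a * (b * (k * s)) ≡ k * (a * (b * s))
    g a b s = expr-≡ (var 0 ⊠ (var 1 ⊠ (var 2 ⊠ var 3))) (var 2 ⊠ (var 0 ⊠ (var 1 ⊠ var 3))) (a ∷ b ∷ k ∷ s ∷ []) refl

  cell-prod : ∀ c i j (a b : ℕ → ℕ) → cell c i j (λ x y → a x * b y)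
    ≡ (∑ m λ x → δ (c x) i * a x) * (∑ m λ y → δ (c y) j * b y)
  cell-prod c i j a b = trans (∑-cong m λ x _ → trans (∑-cong m λ y _ → g (δ (c x) i) (δ (c y) j) (a x) (b y))
      (∑-*ˡ m (δ (c x) i * a x) _)) (∑-*ʳ m _ _)
    where
    g : ∀ a b s t → a * (b * (s * t)) ≡ a * s * (b * t)
    g = solve-∀

  cells : ∀ {c k} → Bounded c k → ∀ u → ∑∑ u ≡ ∑ k λ i → ∑ k λ j → cell c i j u
  cells {c} {k} bd u = begin
    ∑∑ u ≡⟨ ∑∑-cong (λ x y → sym (pt x y)) ⟩
    (∑ m λ x → ∑ m λ y → ∑ k λ i → ∑ k λ j → t x y i j) ≡⟨ ∑-cong m (λ x _ → ∑-swap m k _) ⟩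
    (∑ m λ x → ∑ k λ i → ∑ m λ y → ∑ k λ j → t x y i j) ≡⟨ ∑-swap m k _ ⟩
    (∑ k λ i → ∑ m λ x → ∑ m λ y → ∑ k λ j → t x y i j) ≡⟨ ∑-cong k (λ i _ → ∑-cong m λ x _ → ∑-swap m k _) ⟩
    (∑ k λ i → ∑ m λ x → ∑ k λ j → ∑ m λ y → t x y i j) ≡⟨ ∑-cong k (λ i _ → ∑-swap m k _) ⟩
    (∑ k λ i → ∑ k λ j → ∑ m λ x → ∑ m λ y → t x y i j) ∎
    where
    open ≡-Reasoning
    t : ℕ → ℕ → ℕ → ℕ → ℕ
    t x y i j = δ (c x) i * (δ (c y) j * u x y)
    pt : ∀ x y → (∑ k λ i → ∑ k λ j → t x y i j) ≡ u x y
    pt x y = trans (∑-cong k λ i _ → trans (∑-*ˡ k (δ (c x) i) _) (cong (δ (c x) i *_) (∑-δ k (c y) (λ _ → u x y) (bd y))))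
      (∑-δ k (c x) (λ _ → u x y) (bd x))

  size : (ℕ → ℕ) → ℕ → ℕ
  size c i = ∑ m λ x → δ (c x) i

  size≤ : ∀ c i → size c i ≤ m
  size≤ c i = #≤ m λ x → c x ≡ᵇ i

  size-pos : ∀ c {x} → x < m → 0 < size c (c x)
  size-pos c {x} l = ≤-trans (≤-reflexive (sym (δ-refl (c x)))) (∑-term m (λ y → δ (c y) (c x)) l)

  cell-1 : ∀ c i j → cell c i j (λ _ _ → 1) ≡ size c i * size c j
  cell-1 c i j = trans (cell-prod c i j (λ _ → 1) (λ _ → 1))
    (cong₂ _*_ (∑-cong m λ x _ → *-identityʳ _) (∑-cong m λ x _ → *-identityʳ _))

  edges : (ℕ → ℕ) → ℕ → ℕ → ℕ
  edges c i j = cell c i j f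

  edges≤ : ∀ c i j → edges c i j ≤ size c i * size c j
  edges≤ c i j = ≤-trans (cell-mono c i j λ x y _ _ → f≤1 x y) (≤-reflexive (cell-1 c i j))

  M D : ℕ
  M = m !
  D = M * M

  w : ℕ → ℕ
  w zero = 0
  w (suc n) = M div suc n

  w-eq : ∀ n → 0 < n → n ≤ m → w n * n ≡ M
  w-eq (suc n) _ h = m/n*n≡m (∣-trans (m∣m*n (n !)) (m≤n⇒m!∣n! h))

  G : (ℕ → ℕ) → ℕ → ℕ → ℕ
  G c i j = edges c i j * (w (size c i) * w (size c j))

  G-eq : ∀ c i j → G c i j * (size c i * size c j) ≡ D * edges c i j
  G-eq c i j with size c i in ei | size c j in ej | edges≤ c i j
  ... | zero | b | h rewrite n≤0⇒n≡0 h = sym (*-zeroʳ D)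
  ... | suc a | zero | h rewrite *-zeroʳ a | n≤0⇒n≡0 h = sym (*-zeroʳ D)
  ... | suc a | suc b | h = trans (g (edges c i j) (w (suc a)) (w (suc b)) (suc a) (suc b))
    (cong₂ (λ s t → s * t * edges c i j)
      (w-eq (suc a) (s≤s z≤n) (subst (_≤ m) ei (size≤ c i)))
      (w-eq (suc b) (s≤s z≤n) (subst (_≤ m) ej (size≤ c j))))
    where
    g : ∀ e u v a b → e * (u * v) * (a * b) ≡ u * a * (v * b) * e
    g = solve-∀

  -- The conditional expectation of `D * f` on the product of the partition with itself: on each
  -- pair of cells it is constant, equal to `D` times the edge density.
  γ : (ℕ → ℕ) → ℕ → ℕ → ℕ
  γ c x y = G c (c x) (c y)

  cell-γ : ∀ c i j → cell c i j (γ c) ≡ D * edges c i j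
  cell-γ c i j = trans (cell-cong c i j {v = λ _ _ → G c i j * 1} λ { x y refl refl → sym (*-identityʳ _) })
    (trans (cell-* c i j (G c i j) _) (trans (cong (G c i j *_) (cell-1 c i j)) (G-eq c i j)))

  -- On every pair of cells `γ c` and `D * f` have the same sum, so they pair equally with any
  -- weight that is constant on pairs of cells.
  project : ∀ {c k} → Bounded c k → ∀ (H : ℕ → ℕ → ℕ) →
    ∑∑ (λ x y → H (c x) (c y) * γ c x y) ≡ D * ∑∑ (λ x y → H (c x) (c y) * f x y)
  project {c} {k} bd H = begin
    ∑∑ (λ x y → H (c x) (c y) * γ c x y) ≡⟨ cells bd _ ⟩
    (∑ k λ i → ∑ k λ j → cell c i j (λ x y → H (c x) (c y) * γ c x y)) ≡⟨ ∑-cong k (λ i _ → ∑-cong k λ j _ → p i j) ⟩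
    (∑ k λ i → ∑ k λ j → D * cell c i j (λ x y → H (c x) (c y) * f x y)) ≡⟨ ∑-cong k (λ i _ → ∑-*ˡ k D _) ⟩
    (∑ k λ i → D * ∑ k λ j → cell c i j (λ x y → H (c x) (c y) * f x y)) ≡⟨ ∑-*ˡ k D _ ⟩
    D * (∑ k λ i → ∑ k λ j → cell c i j (λ x y → H (c x) (c y) * f x y)) ≡⟨ cong (D *_) (sym (cells bd _)) ⟩
    D * ∑∑ (λ x y → H (c x) (c y) * f x y) ∎
    where
    open ≡-Reasoning
    pull : ∀ i j u → cell c i j (λ x y → H (c x) (c y) * u x y) ≡ H i j * cell c i j u
    pull i j u = trans (cell-cong c i j λ { x y refl refl → refl }) (cell-* c i j (H i j) u)
    p : ∀ i j → cell c i j (λ x y → H (c x) (c y) * γ c x y) ≡ D * cell c i j (λ x y → H (c x) (c y) * f x y)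
    p i j = trans (pull i j (γ c)) (trans (cong (H i j *_) (cell-γ c i j))
      (trans (g (H i j) D (edges c i j)) (cong (D *_) (sym (pull i j f)))))
      where
      g : ∀ a b c → a * (b * c) ≡ b * (a * c)
      g = solve-∀

  energy : (ℕ → ℕ) → ℕ
  energy c = ∑∑ λ x y → γ c x y * γ c x y

  γ≤D : ∀ c x y → x < m → y < m → γ c x y ≤ D
  γ≤D c x y lx ly = *-cancelʳ-≤ (γ c x y) D (size c (c x) * size c (c y)) {{>-nonZero (*-mono-≤ (size-pos c lx) (size-pos c ly))}}
    (≤-trans (≤-reflexive (G-eq c (c x) (c y))) (*-monoʳ-≤ D (edges≤ c (c x) (c y))))

  energy≤ : ∀ c → energy c ≤ m * m * (D * D)
  energy≤ c = ≤-trans (∑∑-mono λ x y lx ly → *-mono-≤ (γ≤D c x y lx ly) (γ≤D c x y lx ly))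
    (≤-reflexive (trans (∑-cong m λ x _ → ∑-const m (D * D)) (trans (∑-const m _) (sym (*-assoc m m _)))))

  diff² : (ℕ → ℕ) → (ℕ → ℕ) → ℕ → ℕ → ℕ
  diff² c c' x y = ∣ γ c x y - γ c' x y ∣ * ∣ γ c x y - γ c' x y ∣

  -- `γ c` is constant on the cells of both partitions. Applying `project` for `c'` and then
  -- backwards for `c` turns the cross term into `energy c`, so the change of density is orthogonal
  -- to `γ c`.
  pythagoras : ∀ {c c' k k'} → Bounded c k → Bounded c' k' → Refines c' c →
    energy c' ≡ energy c + ∑∑ (diff² c c')
  pythagoras {c} {c'} {k} {k'} bd bd' (r , ref) = fin
    where
    cross : ∑∑ (λ x y → γ c x y * γ c' x y) ≡ energy c
    cross = trans (∑∑-cong λ x y → cong (_* γ c' x y) (cong₂ (G c) (ref x) (ref y)))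
      (trans (project bd' (λ i j → G c (r i) (r j)))
      (trans (cong (D *_) (∑∑-cong λ x y → cong (_* f x y) (sym (cong₂ (G c) (ref x) (ref y)))))
        (sym (project bd (G c)))))
    tot : ∑∑ (diff² c c') + 2 * ∑∑ (λ x y → γ c x y * γ c' x y) ≡ energy c + energy c'
    tot = trans (cong (∑∑ (diff² c c') +_) (sym (∑∑-* 2 _))) (trans (sym (∑∑-+ _ _))
      (trans (∑∑-cong λ x y → dist-sq (γ c x y) (γ c' x y)) (∑∑-+ _ _)))
    fin : energy c' ≡ energy c + ∑∑ (diff² c c')
    fin = +-cancelˡ-≡ (energy c) _ _ (trans (sym tot) (trans (cong (λ e → ∑∑ (diff² c c') + 2 * e) cross) (g (∑∑ (diff² c c')) (energy c))))
      where
      g : ∀ a e → a + 2 * e ≡ e + (e + a)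
      g = solve-∀

  part : (ℕ → ℕ) → ℕ → Pr → ℕ
  part c i U = ∑ m λ x → δ (c x) i * ι (U x)

  part≤ : ∀ c i U → part c i U ≤ size c i
  part≤ c i U = ∑-mono m λ x _ → ≤-trans (*-monoʳ-≤ (δ (c x) i) (ι≤1 (U x))) (≤-reflexive (*-identityʳ _))

  edgesIn : (ℕ → ℕ) → ℕ → ℕ → Pr → Pr → ℕ
  edgesIn c i j U W = cell c i j λ x y → ι (U x) * ι (W y) * f x y

  -- The pair of cells has density at least 2/t, the rectangle U × W less than 1/t. Hence |γ c - γ
  -- c'| averages at least D/t over U × W, which fills at least 1/t² of the pair; Cauchy-Schwarz
  -- gives the gain D²/t⁴ per vertex pair.
  gain : ∀ {c c' k'} → Bounded c' k' → Refines c' c → ∀ t i j U W → Measurable U c' → Measurable W c' →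
    size c i ≤ t * part c i U → size c j ≤ t * part c j W →
    t * edgesIn c i j U W < part c i U * part c j W →
    2 * (size c i * size c j) ≤ t * edges c i j →
    D * D * (size c i * size c j) ≤ t * t * (t * t) * cell c i j (diff² c c')
  gain {c} {c'} {k'} bd' (r , ref) t i j U W (qU , mU) (qW , mW) hU hW sp de = final
    where
    a = part c i U
    b = part c j W
    s = size c i
    s' = size c j
    χ : ℕ → ℕ → ℕ
    χ x y = ι (U x) * ι (W y)
    h : ℕ → ℕ → ℕ
    h x y = ∣ γ c x y - γ c' x y ∣
    X = cell c i j (λ x y → χ x y * h x y)
    Y = cell c i j (λ x y → χ x y * γ c' x y)
    Z = cell c i j (λ x y → χ x y * (h x y * h x y))
    ab : cell c i j χ ≡ a * b
    ab = cell-prod c i j (λ x → ι (U x)) (λ y → ι (W y))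
    Y-eq : Y ≡ D * edgesIn c i j U W
    Y-eq = trans (∑∑-cong λ x y → conv x y (γ c' x y)) (trans (project bd' H) (cong (D *_) (∑∑-cong λ x y → sym (conv x y (f x y)))))
      where
      H : ℕ → ℕ → ℕ
      H k l = δ (r k) i * (δ (r l) j * (ι (qU k) * ι (qW l)))
      conv : ∀ x y u → δ (c x) i * (δ (c y) j * (χ x y * u)) ≡ H (c' x) (c' y) * u
      conv x y u rewrite ref x | ref y | mU x | mW y =
        gg (δ (r (c' x)) i) (δ (r (c' y)) j) (ι (qU (c' x)) * ι (qW (c' y))) u
        where
        gg : ∀ a b c d → a * (b * (c * d)) ≡ a * (b * c) * d
        gg = solve-∀
    sp′ : t * edgesIn c i j U W ≤ a * b
    sp′ = <⇒≤ sp
    pos : 0 < a * b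
    pos = ≤-<-trans z≤n sp
    pos' : 0 < s * s'
    pos' = <-≤-trans pos (*-mono-≤ (part≤ c i U) (part≤ c j W))
    dense : 2 * D ≤ t * G c i j
    dense = *-cancelʳ-≤ (2 * D) (t * G c i j) (s * s') {{>-nonZero pos'}}
      (≤-trans (≤-reflexive (g₁ D (s * s'))) (≤-trans (*-monoʳ-≤ D de) (≤-reflexive (trans (g₂ D t (edges c i j))
        (trans (cong (t *_) (sym (G-eq c i j))) (sym (*-assoc t _ _)))))))
      where
      g₁ : ∀ d n → 2 * d * n ≡ d * (2 * n)
      g₁ = solve-∀
      g₂ : ∀ d t e → d * (t * e) ≡ t * (d * e)
      g₂ = solve-∀
    lower₁ : G c i j * (a * b) ≤ X + Y
    lower₁ = ≤-trans (≤-reflexive (trans (cong (G c i j *_) (sym ab)) (sym (cell-* c i j (G c i j) χ))))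
      (≤-trans (cell-mono c i j λ { x y refl refl → ≤-trans (≤-reflexive (*-comm (G c i j) (χ x y)))
          (≤-trans (*-monoʳ-≤ (χ x y) (dist-≤ (γ c x y) (γ c' x y))) (≤-reflexive (*-distribˡ-+ (χ x y) _ _))) })
        (≤-reflexive (cell-+ c i j _ _)))
    lower₂ : D * (a * b) ≤ t * X
    lower₂ = lin-sound (var 0 ⊠ (var 1 ⊠ var 2)) (var 3 ⊠ var 4) (var 1 ⊠ var 2 ⊠ (con 2 ⊠ var 0) ⊞ (var 3 ⊠ (var 5 ⊠ (var 1 ⊠ var 2)) ⊞ (var 3 ⊠ var 6 ⊞ var 0 ⊠ (var 3 ⊠ var 7)))) (var 1 ⊠ var 2 ⊠ (var 3 ⊠ var 5) ⊞ (var 3 ⊠ (var 4 ⊞ var 6) ⊞ (var 3 ⊠ (var 0 ⊠ var 7) ⊞ var 0 ⊠ (var 1 ⊠ var 2)))) (D ∷ a ∷ b ∷ t ∷ X ∷ G c i j ∷ Y ∷ edgesIn c i j U W ∷ []) refl (a * b · dense & t · lower₁ & t · ≤-reflexive Y-eq & D · sp′)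
    -- Cauchy-Schwarz in pointwise form: 2 (t h) D ≤ (t h)² + D², weighted by the indicator `χ` of U
    -- × W.
    cs : 2 * (D * (t * X)) ≤ t * t * Z + D * D * (a * b)
    cs = begin
      2 * (D * (t * X)) ≡⟨ gg D t X ⟩
      2 * D * t * X ≡⟨ cell-* c i j (2 * D * t) _ ⟨
      cell c i j (λ x y → 2 * D * t * (χ x y * h x y)) ≤⟨ cell-mono c i j (λ x y _ _ → pt (χ x y) (h x y)) ⟩
      cell c i j (λ x y → t * t * (χ x y * (h x y * h x y)) + D * D * χ x y) ≡⟨ cell-+ c i j _ _ ⟩
      cell c i j (λ x y → t * t * (χ x y * (h x y * h x y))) + cell c i j (λ x y → D * D * χ x y)
        ≡⟨ cong₂ _+_ (cell-* c i j (t * t) _) (trans (cell-* c i j (D * D) χ) (cong (D * D *_) ab)) ⟩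
      t * t * Z + D * D * (a * b) ∎
      where
      open ≤-Reasoning
      gg : ∀ D t X → 2 * (D * (t * X)) ≡ 2 * D * t * X
      gg = solve-∀
      pt : ∀ χ h → 2 * D * t * (χ * h) ≤ t * t * (χ * (h * h)) + D * D * χ
      pt χ h = lin-sound (con 2 ⊠ var 0 ⊠ var 1 ⊠ (var 2 ⊠ var 3)) (var 1 ⊠ var 1 ⊠ (var 2 ⊠ (var 3 ⊠ var 3)) ⊞ var 0 ⊠ var 0 ⊠ var 2) (var 2 ⊠ (con 2 ⊠ (var 1 ⊠ var 3 ⊠ var 0))) (var 2 ⊠ (var 1 ⊠ var 3 ⊠ (var 1 ⊠ var 3) ⊞ var 0 ⊠ var 0)) (D ∷ t ∷ χ ∷ h ∷ []) refl (χ · amgm (t * h) D)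
    Z≤ : Z ≤ cell c i j (diff² c c')
    Z≤ = cell-mono c i j λ x y _ _ → ≤-trans (*-monoˡ-≤ (diff² c c' x y) (*-mono-≤ (ι≤1 (U x)) (ι≤1 (W y)))) (≤-reflexive (*-identityˡ _))
    hUW : s * s' ≤ t * a * (t * b)
    hUW = *-mono-≤ hU hW
    final : D * D * (s * s') ≤ t * t * (t * t) * cell c i j (diff² c c')
    final = lin-sound (var 0 ⊠ var 0 ⊠ (var 1 ⊠ var 2)) (var 3 ⊠ var 3 ⊠ (var 3 ⊠ var 3) ⊠ var 4) (var 0 ⊠ var 0 ⊠ (var 1 ⊠ var 2) ⊞ var 3 ⊠ var 3 ⊠ (con 2 ⊠ var 0 ⊠ (var 0 ⊠ (var 5 ⊠ var 6)) ⊞ (con 2 ⊠ (var 0 ⊠ (var 3 ⊠ var 7)) ⊞ var 3 ⊠ var 3 ⊠ var 8))) (var 0 ⊠ var 0 ⊠ (var 3 ⊠ var 5 ⊠ (var 3 ⊠ var 6)) ⊞ var 3 ⊠ var 3 ⊠ (con 2 ⊠ var 0 ⊠ (var 3 ⊠ var 7) ⊞ (var 3 ⊠ var 3 ⊠ var 8 ⊞ var 0 ⊠ var 0 ⊠ (var 5 ⊠ var 6) ⊞ var 3 ⊠ var 3 ⊠ var 4))) (D ∷ s ∷ s' ∷ t ∷ cell c i j (diff² c c') ∷ a ∷ b ∷ X ∷ Z ∷ []) refl (D * D · hUW & (t * t) · (2 * D · lower₂ & cs & t * t · Z≤))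

refines-trans : ∀ {c c' c''} → Refines c'' c' → Refines c' c → Refines c'' c
refines-trans (r , e) (r' , e') = (λ i → r' (r i)) , λ x → trans (e' x) (cong r' (e x))

refines-refl : ∀ {c} → Refines c c
refines-refl = (λ i → i) , λ x → refl

measurable-refine : ∀ {p c c'} → Measurable p c → Refines c' c → Measurable p c'
measurable-refine (q , e) (r , e') = (λ i → q (r i)) , λ x → trans (e x) (cong q (e' x))

Refinement : (ℕ → ℕ) → ℕ → (Pr → Set) → Set
Refinement c k P = ∃[ c' ] Bounded c' k × Refines c' c × (∀ p → P p → Measurable p c')

refine₁ : ∀ {c k} p → Bounded c k → Refinement c (k * 2) (_≡ p)
refine₁ {c} {k} p bd = c' , bd' , (r , ref) , λ { _ refl → q , meas }
  where
  c' : ℕ → ℕ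
  c' x = if p x then c x else k + c x
  q : Pr
  q i = suc i ≤ᵇ k
  r : ℕ → ℕ
  r i = if q i then i else i ∸ k
  lo : ∀ x → (suc (c x) ≤ᵇ k) ≡ true
  lo x = true-≤ᵇ (bd x)
  hi : ∀ x → (suc (k + c x) ≤ᵇ k) ≡ false
  hi x = false-≤ᵇ (s≤s (m≤m+n k (c x)))
  ub₁ : ∀ {i} → i < k → i < k * 2
  ub₁ {i} h = lin-sound (con 1 ⊞ var 0) (var 1 ⊠ con 2) (con 1 ⊞ var 0) (var 1) (i ∷ k ∷ []) refl h
  ub₂ : ∀ {i} → i < k → k + i < k * 2
  ub₂ {i} h = lin-sound (con 1 ⊞ (var 0 ⊞ var 1)) (var 0 ⊠ con 2) (con 1 ⊞ var 1) (var 0) (k ∷ i ∷ []) refl h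
  bd' : Bounded c' (k * 2)
  bd' x with p x
  ... | true = ub₁ (bd x)
  ... | false = ub₂ (bd x)
  ref : ∀ x → c x ≡ r (c' x)
  ref x with p x
  ... | true rewrite lo x = refl
  ... | false rewrite hi x = sym (m+n∸m≡n k (c x))
  meas : ∀ x → p x ≡ q (c' x)
  meas x with p x
  ... | true = sym (lo x)
  ... | false = sym (hi x)

refineMany : ∀ n (P : ℕ → Pr) {c k} → Bounded c k → Refinement c (k * 2 ^ n) (λ p → ∃[ i ] i < n × p ≡ P i)
refineMany zero P {c} {k} bd = c , (λ x → subst (c x <_) (sym (*-identityʳ k)) (bd x)) , refines-refl , λ { _ (_ , () , _) }
refineMany (suc n) P {c} {k} bd with refineMany n P bd
... | c₁ , bd₁ , ref₁ , meas₁ with refine₁ (P n) bd₁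
... | c₂ , bd₂ , ref₂ , meas₂ = c₂ , (λ x → ≤-trans (bd₂ x) (≤-reflexive (g k (2 ^ n)))) , refines-trans ref₂ ref₁ , meas
  where
  g : ∀ k e → k * e * 2 ≡ k * (2 * e)
  g = solve-∀
  meas : ∀ p → ∃[ i ] i < suc n × p ≡ P i → Measurable p c₂
  meas p (i , l , e) with i ≟ n
  ... | yes refl = meas₂ p e
  ... | no ne = measurable-refine (meas₁ p (i , ≤∧≢⇒< (s≤s⁻¹ l) ne , e)) ref₂

refineMany₂ : ∀ a b (P : ℕ → ℕ → Pr) {c k} → Bounded c k →
  Refinement c (k * 2 ^ (a * b)) (λ p → ∃[ i ] ∃[ j ] i < a × j < b × p ≡ P i j)
refineMany₂ zero b P {c} {k} bd = c , (λ x → subst (c x <_) (sym (*-identityʳ k)) (bd x)) , refines-refl , λ { _ (_ , _ , () , _) }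
refineMany₂ (suc a) b P {c} {k} bd with refineMany₂ a b P bd
... | c₁ , bd₁ , ref₁ , meas₁ with refineMany b (P a) bd₁
... | c₂ , bd₂ , ref₂ , meas₂ = c₂ , (λ x → ≤-trans (bd₂ x) (≤-reflexive g)) , refines-trans ref₂ ref₁ , meas
  where
  g : k * 2 ^ (a * b) * 2 ^ b ≡ k * 2 ^ (b + a * b)
  g = trans (*-assoc k _ _) (cong (k *_) (trans (sym (^-distribˡ-+-* 2 (a * b) b)) (cong (2 ^_) (+-comm (a * b) b))))
  meas : ∀ p → ∃[ i ] ∃[ j ] i < suc a × j < b × p ≡ P i j → Measurable p c₂
  meas p (i , j , l , l' , e) with i ≟ a
  ... | yes refl = meas₂ p (j , l' , e)
  ... | no ne = measurable-refine (meas₁ p (i , j , ≤∧≢⇒< (s≤s⁻¹ l) ne , l' , e)) ref₂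

-- At most k² pairs of cells each supply two witnesses; refining by all the sets U and then by all
-- the sets W doubles the number of colours k² times in each round.
next : ℕ → ℕ
next k = k * 2 ^ (k * k) * 2 ^ (k * k)

k≤next : ∀ k → k ≤ next k
k≤next k = ≤-trans (m≤m*n k (2 ^ (k * k)) {{m^n≢0 2 (k * k)}}) (m≤m*n (k * 2 ^ (k * k)) (2 ^ (k * k)) {{m^n≢0 2 (k * k)}})

tower : ℕ → ℕ → ℕ
tower zero k = k
tower (suc s) k = tower s (next k)

k≤tower : ∀ s k → k ≤ tower s k
k≤tower zero k = ≤-refl
k≤tower (suc s) k = ≤-trans (k≤next k) (k≤tower s (next k))

module Regularity (m : ℕ) (g : ℕ → ℕ → Bool) (t : ℕ) where

  f : ℕ → ℕ → ℕ
  f x y = ι (g x y)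

  open Energy m f (λ x y → ι≤1 (g x y))

  -- A one-sided form of regularity. Finding triangles only takes a lower bound 1/t for the density
  -- between large subsets, so an upper deviation never has to be excluded.
  Good : (ℕ → ℕ) → ℕ → ℕ → Set
  Good c i j = ∀ U W → size c i ≤ t * part c i U → size c j ≤ t * part c j W →
    part c i U * part c j W ≤ t * edgesIn c i j U W

  BadDense : (ℕ → ℕ) → ℕ → ℕ → Pr → Pr → Set
  BadDense c i j U W = size c i ≤ t * part c i U × size c j ≤ t * part c j W ×
    t * edgesIn c i j U W < part c i U * part c j W × 2 * (size c i * size c j) ≤ t * edges c i j

  Sparse : (ℕ → ℕ) → ℕ → ℕ → Set
  Sparse c i j = t * edges c i j ≤ 2 * (size c i * size c j)

  part-cong : ∀ c i {U U'} → (∀ x → x < m → U x ≡ U' x) → part c i U ≡ part c i U'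
  part-cong c i h = ∑-cong m λ x l → cong (λ b → δ (c x) i * ι b) (h x l)

  edgesIn-cong : ∀ c i j {U U' W W'} → (∀ x → x < m → U x ≡ U' x) → (∀ x → x < m → W x ≡ W' x) →
    edgesIn c i j U W ≡ edgesIn c i j U' W'
  edgesIn-cong c i j h h' = ∑-cong m λ x l → ∑-cong m λ y l' →
    cong₂ (λ a b → δ (c x) i * (δ (c y) j * (ι a * ι b * f x y))) (h x l) (h' y l')

  isBad : (ℕ → ℕ) → ℕ → ℕ → Pr → Pr → Bool
  isBad c i j U W = (size c i ≤ᵇ t * part c i U) ∧ (size c j ≤ᵇ t * part c j W) ∧
    (suc (t * edgesIn c i j U W) ≤ᵇ part c i U * part c j W)

  isBad-cong : ∀ c i j {U U' W W'} → (∀ x → x < m → U x ≡ U' x) → (∀ x → x < m → W x ≡ W' x) →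
    isBad c i j U W ≡ isBad c i j U' W'
  isBad-cong c i j {U} {U'} {W} {W'} h h' rewrite part-cong c i {U} {U'} h | part-cong c j {W} {W'} h' | edgesIn-cong c i j {U} {U'} {W} {W'} h h' = refl

  -- One predicate on [0,2m) encodes the pair (U,W).
  search : ∀ c i j → (∃[ U ] ∃[ W ] isBad c i j U W ≡ true) ⊎ (∀ U W → isBad c i j U W ≡ false)
  search c i j with findPr (m + m) (λ p → isBad c i j p (λ x → p (m + x)))
    (λ p q h → isBad-cong c i j (λ x l → h x (≤-trans l (m≤m+n m m))) (λ x l → h (m + x) (+-monoʳ-< m l)))
  ... | inj₁ (p , e) = inj₁ (p , _ , e)
  ... | inj₂ h = inj₂ λ U W → trans (isBad-cong c i j
      (λ x l → sym (fst U W x l)) (λ x l → sym (snd U W x))) (h (pair U W))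
    where
    pair : Pr → Pr → Pr
    pair U W x = if suc x ≤ᵇ m then U x else W (x ∸ m)
    fst : ∀ U W x → x < m → pair U W x ≡ U x
    fst U W x l rewrite true-≤ᵇ l = refl
    snd : ∀ U W x → pair U W (m + x) ≡ W x
    snd U W x rewrite false-≤ᵇ {suc (m + x)} {m} (s≤s (m≤m+n m x)) | m+n∸m≡n m x = refl

  data Status (c : ℕ → ℕ) (i j : ℕ) : Set where
    bad    : ∀ U W → BadDense c i j U W → Status c i j
    sparse : Sparse c i j → Status c i j
    good   : Good c i j → Status c i j

  status : ∀ c i j → Status c i j
  status c i j with 2 * (size c i * size c j) ≤? t * edges c i j
  ... | no nd = sparse (<⇒≤ (≰⇒> nd))
  ... | yes de with search c i j
  ...   | inj₁ (U , W , e) = bad U W (≤ᵇ-true (proj₁ (∧-split e)) , ≤ᵇ-true (proj₁ (∧-split (proj₂ (∧-split {size c i ≤ᵇ t * part c i U} e)))) ,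
      ≤ᵇ-true (proj₂ (∧-split (proj₂ (∧-split {size c i ≤ᵇ t * part c i U} e)))) , de)
  ...   | inj₂ h = good λ U W hU hW → ≮⇒≥ λ lt → true≢false (∧-join (true-≤ᵇ hU) (∧-join (true-≤ᵇ hW) (true-≤ᵇ lt))) (h U W)

  flag : ∀ {c i j} → Status c i j → ℕ
  flag (bad _ _ _) = 1
  flag _ = 0

  wit₁ wit₂ : ∀ {c i j} → Status c i j → Pr
  wit₁ (bad U _ _) = U
  wit₁ _ = λ _ → false
  wit₂ (bad _ W _) = W
  wit₂ _ = λ _ → false

  β : (ℕ → ℕ) → ℕ → ℕ → ℕ
  β c i j = flag (status c i j)

  irregular : (ℕ → ℕ) → ℕ → ℕ
  irregular c k = ∑ k λ i → ∑ k λ j → β c i j * (size c i * size c j)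

  t⁴ : ℕ
  t⁴ = t * t * (t * t)

  -- Refine by the witnesses of all bad pairs at once. By `gain` a bad pair raises the energy by its
  -- area times D²/t⁴, and the bad pairs have total area at least m²/t, so the rise is at least D²
  -- m²/t⁵.
  increment : ∀ {c k} → Bounded c k → m * m ≤ t * irregular c k →
    ∃[ c' ] Bounded c' (next k) × t * t⁴ * energy c + D * D * (m * m) ≤ t * t⁴ * energy c'
  increment {c} {k} bd irr
    with refineMany₂ k k (λ i j → wit₁ (status c i j)) bd
  ... | c₁ , bd₁ , ref₁ , meas₁
    with refineMany₂ k k (λ i j → wit₂ (status c i j)) bd₁
  ... | c₂ , bd₂ , ref₂ , meas₂ = c₂ , bd₂ , fin
    where
    ref : Refines c₂ c
    ref = refines-trans ref₂ ref₁
    Δ : ℕ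
    Δ = ∑∑ (diff² c c₂)
    each : ∀ i j → (st : Status c i j) → Measurable (wit₁ st) c₂ → Measurable (wit₂ st) c₂ →
      D * D * (flag st * (size c i * size c j)) ≤ t⁴ * cell c i j (diff² c c₂)
    each i j (bad U W (hU , hW , sp , de)) mU mW = ≤-trans (*-monoʳ-≤ (D * D) (≤-reflexive (+-identityʳ _)))
      (gain bd₂ ref t i j U W mU mW hU hW sp de)
    each i j (sparse _) _ _ = ≤-trans (≤-reflexive (*-zeroʳ (D * D))) z≤n
    each i j (good _) _ _ = ≤-trans (≤-reflexive (*-zeroʳ (D * D))) z≤n
    sum : D * D * irregular c k ≤ t⁴ * Δ
    sum = begin
      D * D * irregular c k ≡⟨ ∑-*ˡ k (D * D) _ ⟨
      (∑ k λ i → D * D * ∑ k λ j → β c i j * (size c i * size c j)) ≡⟨ ∑-cong k (λ i _ → sym (∑-*ˡ k (D * D) _)) ⟩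
      (∑ k λ i → ∑ k λ j → D * D * (β c i j * (size c i * size c j)))
        ≤⟨ ∑-mono k (λ i li → ∑-mono k λ j lj → each i j (status c i j)
             (measurable-refine (meas₁ _ (i , j , li , lj , refl)) ref₂) (meas₂ _ (i , j , li , lj , refl))) ⟩
      (∑ k λ i → ∑ k λ j → t⁴ * cell c i j (diff² c c₂)) ≡⟨ ∑-cong k (λ i _ → ∑-*ˡ k t⁴ _) ⟩
      (∑ k λ i → t⁴ * ∑ k λ j → cell c i j (diff² c c₂)) ≡⟨ ∑-*ˡ k t⁴ _ ⟩
      t⁴ * (∑ k λ i → ∑ k λ j → cell c i j (diff² c c₂)) ≡⟨ cong (t⁴ *_) (sym (cells bd _)) ⟩
      t⁴ * Δ ∎
      where open ≤-Reasoning
    pyth : energy c₂ ≡ energy c + Δ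
    pyth = pythagoras bd bd₂ ref
    fin : t * t⁴ * energy c + D * D * (m * m) ≤ t * t⁴ * energy c₂
    fin = ≤-trans (fin' t⁴ Δ (energy c) (irregular c k) (D * D) irr sum) (≤-reflexive (cong (t * t⁴ *_) (sym pyth)))
      where
      fin' : ∀ T Δ e I d → m * m ≤ t * I → d * I ≤ T * Δ → t * T * e + d * (m * m) ≤ t * T * (e + Δ)
      fin' T Δ e I d h₁ h₂ = lin-sound (var 0 ⊠ var 1 ⊠ var 2 ⊞ var 3 ⊠ (var 4 ⊠ var 4)) (var 0 ⊠ var 1 ⊠ (var 2 ⊞ var 5)) (var 3 ⊠ (var 4 ⊠ var 4) ⊞ var 0 ⊠ (var 3 ⊠ var 6)) (var 3 ⊠ (var 0 ⊠ var 6) ⊞ var 0 ⊠ (var 1 ⊠ var 5)) (t ∷ T ∷ e ∷ d ∷ m ∷ Δ ∷ I ∷ []) refl (d · h₁ & t · h₂)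

  -- The hypothesis is an energy budget: `s` further rises of D² m²/t⁵ would push the energy past
  -- its maximum m² D², so the refinement must stop within `s` rounds.
  regular : ∀ s c k → Bounded c k → t * t⁴ * (m * m * (D * D)) < t * t⁴ * energy c + s * (D * D * (m * m)) →
    ∃[ c' ] ∃[ k' ] Bounded c' k' × k' ≤ tower s k × t * irregular c' k' < m * m
  regular zero c k bd h = ⊥-elim (overflow (t * t⁴) (m * m * (D * D)) (energy c) h (energy≤ c))
    where
    overflow : ∀ T E e → T * E < T * e + 0 → e ≤ E → ⊥
    overflow T E e h q = 1≰0 (lin-sound (con 1) (con 0) (con 1 ⊞ var 0 ⊠ var 1 ⊞ var 0 ⊠ var 2) (var 0 ⊠ var 2 ⊞ con 0 ⊞ var 0 ⊠ var 1) (T ∷ E ∷ e ∷ []) refl (h & T · q))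
  regular (suc s) c k bd h with m * m ≤? t * irregular c k
  ... | no ni = c , k , bd , k≤tower (suc s) k , ≰⇒> ni
  ... | yes irr = go (increment bd irr)
    where
    advance : ∀ T X e e' d → T * X < T * e + suc s * d → T * e + d ≤ T * e' → T * X < T * e' + s * d
    advance T X e e' d h q = lin-sound (con 1 ⊞ var 0 ⊠ var 1) (var 0 ⊠ var 2 ⊞ var 3 ⊠ var 4) (con 1 ⊞ var 0 ⊠ var 1 ⊞ (var 0 ⊠ var 5 ⊞ var 4)) (var 0 ⊠ var 5 ⊞ (con 1 ⊞ var 3) ⊠ var 4 ⊞ var 0 ⊠ var 2) (T ∷ X ∷ e' ∷ s ∷ d ∷ e ∷ []) refl (h & q)
    go : (∃[ c' ] Bounded c' (next k) × t * t⁴ * energy c + D * D * (m * m) ≤ t * t⁴ * energy c') →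
      ∃[ c' ] ∃[ k' ] Bounded c' k' × k' ≤ tower (suc s) k × t * irregular c' k' < m * m
    go (c₁ , bd₁ , inc) = regular s c₁ (next k) bd₁
      (advance (t * t⁴) (m * m * (D * D)) (energy c) (energy c₁) (D * D * (m * m)) h inc)

  -- From energy at least 0, t⁵ + 1 rises exceed the maximum strictly, and the start is the trivial
  -- partition with one cell.
  K : ℕ
  K = tower (suc (t * t⁴)) 1

  szemeredi : 0 < m → ∃[ c ] ∃[ k ] Bounded c k × k ≤ K × t * irregular c k < m * m
  szemeredi m>0 = regular (suc (t * t⁴)) (λ _ → 0) 1 (λ _ → s≤s z≤n)
    (start (t * t⁴) (m * m) (D * D) (energy (λ _ → 0)) pos)
    where
    M>0 : 0 < M
    M>0 = n≢0⇒n>0 λ e → ≢-nonZero⁻¹ M {{m !≢0}} e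
    pos : 0 < D * D * (m * m)
    pos = *-mono-≤ (*-mono-≤ (*-mono-≤ M>0 M>0) (*-mono-≤ M>0 M>0)) (*-mono-≤ m>0 m>0)
    start : ∀ T a d e → 0 < d * a → T * (a * d) < T * e + suc T * (d * a)
    start T a d e h = lin-sound (con 1 ⊞ var 0 ⊠ (var 1 ⊠ var 2)) (var 0 ⊠ var 3 ⊞ (con 1 ⊞ var 0) ⊠ (var 2 ⊠ var 1)) (con 1 ⊞ con 0) (var 2 ⊠ var 1) (T ∷ a ∷ d ∷ e ∷ []) refl h

  -- Counting and removing triangles

  triangles : ℕ
  triangles = ∑ m λ x → ∑ m λ y → ∑ m λ z → f x y * f x z * f y z

  all : Pr
  all _ = true

  part-all : ∀ c i → part c i all ≡ size c i
  part-all c i = ∑-cong m λ x _ → *-identityʳ _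

  edgesIn-deg : ∀ c i j U → edgesIn c i j U all ≡ ∑ m λ x → δ (c x) i * ι (U x) * part c j (g x)
  edgesIn-deg c i j U = ∑-cong m λ x _ → trans (∑-cong m λ y _ → e (δ (c x) i) (δ (c y) j) (ι (U x)) (f x y)) (∑-*ˡ m (δ (c x) i * ι (U x)) _)
    where
    e : ∀ a b c d → a * (b * (c * 1 * d)) ≡ a * c * (b * d)
    e = solve-∀

  atypical : (ℕ → ℕ) → ℕ → Pr
  atypical c j x = suc (t * part c j (g x)) ≤ᵇ size c j

  -- Vertices with fewer than |j|/t neighbours in cell j span too few edges with all of cell j. If
  -- they filled a 1/t fraction of cell i, `Good` with W the whole cell would contradict this.
  few-atypical : ∀ c i j → 0 < t → 0 < size c i → Good c i j → t * part c i (atypical c j) ≤ size c i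
  few-atypical c i j t>0 si gd = ≮⇒≥ λ h → contra (<⇒≤ h)
    where
    U = atypical c j
    p = part c i U
    sj = size c j
    all-big : sj ≤ t * part c j all
    all-big = ≤-trans (m≤n*m sj t {{>-nonZero t>0}}) (≤-reflexive (cong (t *_) (sym (part-all c j))))
    up : t * edgesIn c i j U all + p ≤ p * sj
    up = begin
      t * edgesIn c i j U all + p ≡⟨ cong (λ e → t * e + p) (edgesIn-deg c i j U) ⟩
      t * (∑ m λ x → δ (c x) i * ι (U x) * part c j (g x)) + p ≡⟨ cong (_+ p) (∑-*ˡ m t _) ⟨
      (∑ m λ x → t * (δ (c x) i * ι (U x) * part c j (g x))) + p ≡⟨ ∑-+ m _ _ ⟨
      (∑ m λ x → t * (δ (c x) i * ι (U x) * part c j (g x)) + δ (c x) i * ι (U x)) ≤⟨ ∑-mono m (λ x _ → pt x) ⟩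
      (∑ m λ x → δ (c x) i * ι (U x) * sj) ≡⟨ ∑-*ʳ m sj _ ⟩
      p * sj ∎
      where
      open ≤-Reasoning
      pt : ∀ x → t * (δ (c x) i * ι (U x) * part c j (g x)) + δ (c x) i * ι (U x) ≤ δ (c x) i * ι (U x) * sj
      pt x = aux (U x) (δ (c x) i) (part c j (g x)) ≤ᵇ-true
        where
        aux : ∀ b d p → (b ≡ true → suc (t * p) ≤ sj) → t * (d * ι b * p) + d * ι b ≤ d * ι b * sj
        aux true d p h = lin-sound (var 0 ⊠ (var 1 ⊠ con 1 ⊠ var 2) ⊞ var 1 ⊠ con 1) (var 1 ⊠ con 1 ⊠ var 3) (var 1 ⊠ (con 1 ⊞ var 0 ⊠ var 2)) (var 1 ⊠ var 3) (t ∷ d ∷ p ∷ sj ∷ []) refl (d · h refl)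
        aux false d p h = expr-≤ (var 0 ⊠ (var 1 ⊠ con 0 ⊠ var 2) ⊞ var 1 ⊠ con 0) (var 1 ⊠ con 0 ⊠ var 3) (t ∷ d ∷ p ∷ sj ∷ []) refl
    contra : size c i ≤ t * p → ⊥
    contra h = 1≰0 (≤-trans si (≤-trans h (≤-reflexive (trans (cong (t *_) p≡0) (*-zeroʳ t)))))
      where
      sj≤ : sj ≤ part c j all
      sj≤ = ≤-reflexive (sym (part-all c j))
      low : p * part c j all ≤ t * edgesIn c i j U all
      low = gd U all h all-big
      squeeze : ∀ e p s a → t * e + p ≤ p * s → p * a ≤ t * e → s ≤ a → p ≤ 0
      squeeze e p s a h₁ h₂ h₃ = lin-sound (var 0) (con 0) (var 1 ⊠ var 2 ⊞ var 0 ⊞ (var 0 ⊠ var 3 ⊞ var 0 ⊠ var 4)) (var 0 ⊠ var 4 ⊞ (var 1 ⊠ var 2 ⊞ var 0 ⊠ var 3)) (p ∷ t ∷ e ∷ a ∷ s ∷ []) refl (h₁ & h₂ & p · h₃)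
      p≡0 : p ≡ 0
      p≡0 = n≤0⇒n≡0 (squeeze (edgesIn c i j U all) p sj (part c j all) up low sj≤)

  -- At most 2/t of cell i is atypical towards j or l, so with t ≥ 3 at least a 1/t fraction is
  -- typical towards both. The two neighbourhoods of a typical vertex are large, and goodness of the
  -- pair (j, l) puts at least |j||l|/t³ edges between them.
  counting : ∀ c i j l → 3 ≤ t → 0 < size c i → Good c i j → Good c i l → Good c j l →
    size c i * (size c j * size c l) ≤ t⁴ * triangles
  counting c i j l t≥3 si gij gil gjl = fin
    where
    si' = size c i
    n₂ = size c j * size c l
    p₂ = part c i (atypical c j)
    p₃ = part c i (atypical c l)
    E : ℕ → ℕ
    E x = edgesIn c j l (g x) (g x)
    pt : ∀ x → n₂ ≤ t * (t * t) * E x + (ι (atypical c j x) + ι (atypical c l x)) * n₂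
    pt x with atypical c j x in e₂ | atypical c l x in e₃
    ... | true | b = triv b
      where
      triv : ∀ b → n₂ ≤ t * (t * t) * E x + (ι true + ι b) * n₂
      triv b = expr-≤ (var 0) (var 1 ⊠ (var 1 ⊠ var 1) ⊠ var 2 ⊞ (con 1 ⊞ var 3) ⊠ var 0) (n₂ ∷ t ∷ E x ∷ ι b ∷ []) refl
    ... | false | true = triv
      where
      triv : n₂ ≤ t * (t * t) * E x + (ι false + ι true) * n₂
      triv = expr-≤ (var 0) (var 1 ⊠ (var 1 ⊠ var 1) ⊠ var 2 ⊞ (con 0 ⊞ con 1) ⊠ var 0) (n₂ ∷ t ∷ E x ∷ []) refl
    ... | false | false = typical (part c j (g x)) (part c l (g x)) (size c j) (size c l) (E x) d₂ d₃ (gjl (g x) (g x) d₂ d₃)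
      where
      d₂ : size c j ≤ t * part c j (g x)
      d₂ = s≤s⁻¹ (≤ᵇ-false e₂)
      d₃ : size c l ≤ t * part c l (g x)
      d₃ = s≤s⁻¹ (≤ᵇ-false e₃)
      typical : ∀ p q a b e → a ≤ t * p → b ≤ t * q → p * q ≤ t * e → a * b ≤ t * (t * t) * e + 0
      typical p q a b e h₁ h₂ h₃ = lin-sound (var 0 ⊠ var 1) (var 2 ⊠ (var 2 ⊠ var 2) ⊠ var 3 ⊞ con 0) (var 0 ⊠ var 1 ⊞ var 2 ⊠ var 2 ⊠ (var 4 ⊠ var 5)) (var 2 ⊠ var 4 ⊠ (var 2 ⊠ var 5) ⊞ var 2 ⊠ var 2 ⊠ (var 2 ⊠ var 3)) (a ∷ b ∷ t ∷ e ∷ p ∷ q ∷ []) refl (*-mono-≤ h₁ h₂ & t * t · h₃)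
    E≤ : (∑ m λ x → δ (c x) i * E x) ≤ triangles
    E≤ = ∑-mono m λ x _ → ≤-trans (≤-trans (*-monoˡ-≤ (E x) (ι≤1 (c x ≡ᵇ i))) (≤-reflexive (*-identityˡ (E x))))
      (∑-mono m λ y _ → ∑-mono m λ z _ → le (c y ≡ᵇ j) (c z ≡ᵇ l) (f x y * f x z * f y z))
      where
      le : ∀ a b u → ι a * (ι b * u) ≤ u
      le true true u = expr-≤ (con 1 ⊠ (con 1 ⊠ var 0)) (var 0) (u ∷ []) refl
      le true false u = z≤n
      le false b u = z≤n
    sum : si' * n₂ ≤ t * (t * t) * triangles + (p₂ + p₃) * n₂
    sum = begin
      si' * n₂ ≡⟨ ∑-*ʳ m n₂ _ ⟨
      (∑ m λ x → δ (c x) i * n₂) ≤⟨ ∑-mono m (λ x _ → *-monoʳ-≤ (δ (c x) i) (pt x)) ⟩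
      (∑ m λ x → δ (c x) i * (t * (t * t) * E x + (ι (atypical c j x) + ι (atypical c l x)) * n₂))
        ≡⟨ ∑-cong m (λ x _ → e (δ (c x) i) (t * (t * t)) (E x) (ι (atypical c j x)) (ι (atypical c l x)) n₂) ⟩
      (∑ m λ x → t * (t * t) * (δ (c x) i * E x) + (δ (c x) i * ι (atypical c j x) + δ (c x) i * ι (atypical c l x)) * n₂)
        ≡⟨ ∑-+ m _ _ ⟩
      (∑ m λ x → t * (t * t) * (δ (c x) i * E x)) + (∑ m λ x → (δ (c x) i * ι (atypical c j x) + δ (c x) i * ι (atypical c l x)) * n₂)
        ≡⟨ cong₂ _+_ (∑-*ˡ m (t * (t * t)) _) (trans (∑-*ʳ m n₂ _) (cong (_* n₂) (∑-+ m _ _))) ⟩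
      t * (t * t) * (∑ m λ x → δ (c x) i * E x) + (p₂ + p₃) * n₂ ≤⟨ +-monoˡ-≤ ((p₂ + p₃) * n₂) (*-monoʳ-≤ (t * (t * t)) E≤) ⟩
      t * (t * t) * triangles + (p₂ + p₃) * n₂ ∎
      where
      open ≤-Reasoning
      e : ∀ d T E a b n → d * (T * E + (a + b) * n) ≡ T * (d * E) + (d * a + d * b) * n
      e = solve-∀
    t>0 : 0 < t
    t>0 = ≤-trans (s≤s z≤n) t≥3
    q₂ : t * p₂ ≤ si'
    q₂ = few-atypical c i j t>0 si gij
    q₃ : t * p₃ ≤ si'
    q₃ = few-atypical c i l t>0 si gil
    fin : si' * n₂ ≤ t * t * (t * t) * triangles
    fin = lin-sound (var 0 ⊠ var 1) (var 2 ⊠ var 2 ⊠ (var 2 ⊠ var 2) ⊠ var 3) (var 2 ⊠ (var 0 ⊠ var 1) ⊞ (var 1 ⊠ (var 2 ⊠ var 4) ⊞ (var 1 ⊠ (var 2 ⊠ var 5) ⊞ var 0 ⊠ var 1 ⊠ con 3))) (var 2 ⊠ (var 2 ⊠ (var 2 ⊠ var 2) ⊠ var 3 ⊞ (var 4 ⊞ var 5) ⊠ var 1) ⊞ (var 1 ⊠ var 0 ⊞ (var 1 ⊠ var 0 ⊞ var 0 ⊠ var 1 ⊠ var 2))) (si' ∷ n₂ ∷ t ∷ triangles ∷ p₂ ∷ p₃ ∷ []) refl (t · sum & n₂ · q₂ & n₂ · q₃ & si' * n₂ · t≥3)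

  fibres : ∀ {c k} → Bounded c k → ∀ F → ∑ m (λ x → F (c x)) ≡ ∑ k λ i → size c i * F i
  fibres {c} {k} bd F = trans (∑-cong m λ x _ → sym (∑-δ k (c x) F (bd x)))
    (trans (∑-swap m k _) (∑-cong k λ i _ → ∑-*ʳ m (F i) _))

  -- Deleted are the pairs with an end in a cell smaller than m/(t k) and those in sparse or bad
  -- pairs of cells. In units of m²/t the deleted edges number at most 1 + 1 for the two ends, 2 for
  -- sparse and 1 for bad pairs, hence 5. A surviving triangle sits in three large, pairwise good
  -- cells, where `counting` applies.
  removal : 3 ≤ t → 0 < m → ∃ λ (R : ℕ → ℕ → Bool) →
    t * ∑∑ (λ x y → f x y * ι (R x y)) ≤ 5 * (m * m) ×
    (∀ x y z → x < m → y < m → z < m → R x y ≡ false → R x z ≡ false → R y z ≡ false →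
      m * m * m ≤ t⁴ * (t * t * t) * (K * K * K) * triangles)
  removal t≥3 m>0 with szemeredi m>0
  ... | c , k , bd , k≤K , irr = R , count , survive
    where
    small : Pr
    small i = suc (t * k * size c i) ≤ᵇ m
    sp bdn : ℕ → ℕ → Bool
    sp i j with status c i j
    ... | sparse _ = true
    ... | _ = false
    bdn i j with status c i j
    ... | bad _ _ _ = true
    ... | _ = false
    R : ℕ → ℕ → Bool
    R x y = (small (c x) ∨ small (c y)) ∨ (sp (c x) (c y) ∨ bdn (c x) (c y))
    goodR : ∀ i j → sp i j ≡ false → bdn i j ≡ false → Good c i j
    goodR i j h h' with status c i j
    ... | good gd = gd
    bigR : ∀ i → small i ≡ false → m ≤ t * k * size c i
    bigR i h = s≤s⁻¹ (≤ᵇ-false h)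
    k>0 : 0 < k
    k>0 = ≤-trans (s≤s z≤n) (bd 0)
    pos : ∀ i → small i ≡ false → 0 < size c i
    pos i h = n≢0⇒n>0 λ e → <⇒≱ m>0 (≤-trans (bigR i h) (≤-reflexive (trans (cong (t * k *_) e) (*-zeroʳ (t * k)))))
    survive : ∀ x y z → x < m → y < m → z < m → R x y ≡ false → R x z ≡ false → R y z ≡ false →
      m * m * m ≤ t⁴ * (t * t * t) * (K * K * K) * triangles
    survive x y z _ _ _ rxy rxz ryz = begin
      m * m * m ≤⟨ *-mono-≤ (*-mono-≤ (bigR i (proj₁ sxy)) (bigR j (proj₂ sxy))) (bigR l (proj₂ sxz)) ⟩
      t * k * size c i * (t * k * size c j) * (t * k * size c l) ≡⟨ e t k (size c i) (size c j) (size c l) ⟩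
      t * t * t * (k * k * k) * (size c i * (size c j * size c l)) ≤⟨ *-monoʳ-≤ (t * t * t * (k * k * k)) cnt ⟩
      t * t * t * (k * k * k) * (t⁴ * triangles) ≤⟨ *-monoˡ-≤ (t⁴ * triangles) (*-monoʳ-≤ (t * t * t) (*-mono-≤ (*-mono-≤ k≤K k≤K) k≤K)) ⟩
      t * t * t * (K * K * K) * (t⁴ * triangles) ≡⟨ e' (t * t * t) (K * K * K) t⁴ triangles ⟩
      t⁴ * (t * t * t) * (K * K * K) * triangles ∎
      where
      open ≤-Reasoning
      i = c x
      j = c y
      l = c z
      e : ∀ t k a b d → t * k * a * (t * k * b) * (t * k * d) ≡ t * t * t * (k * k * k) * (a * (b * d))
      e = solve-∀
      e' : ∀ a b c d → a * b * (c * d) ≡ c * a * b * d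
      e' = solve-∀
      sxy = ∨-false {small i} {small j} (proj₁ (∨-false rxy))
      sxz = ∨-false {small i} {small l} (proj₁ (∨-false rxz))
      gd : ∀ u v → R u v ≡ false → Good c (c u) (c v)
      gd u v r = goodR (c u) (c v) (proj₁ h) (proj₂ h)
        where h = ∨-false {sp (c u) (c v)} (proj₂ (∨-false {small (c u) ∨ small (c v)} r))
      cnt : size c i * (size c j * size c l) ≤ t⁴ * triangles
      cnt = counting c i j l t≥3 (pos i (proj₁ sxy)) (gd x y rxy) (gd x z rxz) (gd y z ryz)
    S₁ S₂ S₃ S₄ : ℕ
    S₁ = ∑∑ λ x y → ι (small (c x))
    S₂ = ∑∑ λ x y → ι (small (c y))
    S₃ = ∑∑ λ x y → ι (sp (c x) (c y)) * f x y
    S₄ = ∑∑ λ x y → ι (bdn (c x) (c y))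
    T₁ : ℕ
    T₁ = ∑ m λ x → ι (small (c x))
    S₁-eq : S₁ ≡ m * T₁
    S₁-eq = trans (∑-cong m λ x _ → ∑-const m _) (∑-*ˡ m m _)
    S₂-eq : S₂ ≡ m * T₁
    S₂-eq = ∑-const m T₁
    tT₁ : t * T₁ ≤ m
    tT₁ = *-cancelˡ-≤ k {{>-nonZero k>0}} (begin
      k * (t * T₁) ≡⟨ cong (λ s → k * (t * s)) (fibres bd (λ i → ι (small i))) ⟩
      k * (t * ∑ k (λ i → size c i * ι (small i))) ≡⟨ e k t _ ⟩
      t * k * ∑ k (λ i → size c i * ι (small i)) ≡⟨ ∑-*ˡ k (t * k) _ ⟨
      ∑ k (λ i → t * k * (size c i * ι (small i))) ≤⟨ ∑-mono k (λ i _ → pt i) ⟩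
      ∑ k (λ _ → m) ≡⟨ ∑-const k m ⟩
      k * m ∎)
      where
      open ≤-Reasoning
      e : ∀ k t s → k * (t * s) ≡ t * k * s
      e = solve-∀
      pt : ∀ i → t * k * (size c i * ι (small i)) ≤ m
      pt i = aux (small i) (size c i) ≤ᵇ-true
        where
        aux : ∀ b s → (b ≡ true → suc (t * k * s) ≤ m) → t * k * (s * ι b) ≤ m
        aux true s h = lin-sound (var 0 ⊠ var 1 ⊠ (var 2 ⊠ con 1)) (var 3) (con 1 ⊞ var 0 ⊠ var 1 ⊠ var 2) (var 3) (t ∷ k ∷ s ∷ m ∷ []) refl (h refl)
        aux false s h = expr-≤ (var 0 ⊠ var 1 ⊠ (var 2 ⊠ con 0)) (var 3) (t ∷ k ∷ s ∷ m ∷ []) refl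
    sizes : (∑ k λ i → ∑ k λ j → size c i * size c j) ≡ m * m
    sizes = trans (∑-cong k λ i _ → ∑-cong k λ j _ → sym (cell-1 c i j)) (trans (sym (cells bd (λ _ _ → 1)))
      (trans (∑-cong m λ _ _ → trans (∑-const m 1) (*-identityʳ m)) (∑-const m m)))
    tS₃ : t * S₃ ≤ 2 * (m * m)
    tS₃ = begin
      t * S₃ ≡⟨ ∑∑-* t _ ⟨
      ∑∑ (λ x y → t * (ι (sp (c x) (c y)) * f x y)) ≡⟨ cells bd _ ⟩
      (∑ k λ i → ∑ k λ j → cell c i j (λ x y → t * (ι (sp (c x) (c y)) * f x y))) ≤⟨ ∑-mono k (λ i _ → ∑-mono k λ j _ → pt i j) ⟩
      (∑ k λ i → ∑ k λ j → 2 * (size c i * size c j)) ≡⟨ trans (∑-cong k λ i _ → ∑-*ˡ k 2 _) (∑-*ˡ k 2 _) ⟩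
      2 * (∑ k λ i → ∑ k λ j → size c i * size c j) ≡⟨ cong (2 *_) sizes ⟩
      2 * (m * m) ∎
      where
      open ≤-Reasoning
      spSparse : ∀ i j → ι (sp i j) * (t * edges c i j) ≤ 2 * (size c i * size c j)
      spSparse i j with status c i j
      ... | sparse h = ≤-trans (≤-reflexive (*-identityˡ _)) h
      ... | good _ = z≤n
      ... | bad _ _ _ = z≤n
      pt : ∀ i j → cell c i j (λ x y → t * (ι (sp (c x) (c y)) * f x y)) ≤ 2 * (size c i * size c j)
      pt i j = ≤-trans (≤-reflexive (trans (cell-cong c i j {v = λ x y → ι (sp i j) * t * f x y} λ { x y refl refl → e t (ι (sp i j)) (f x y) })
          (trans (cell-* c i j (ι (sp i j) * t) f) (*-assoc (ι (sp i j)) t _)))) (spSparse i j)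
        where
        e : ∀ a b c → a * (b * c) ≡ b * a * c
        e = solve-∀
    S₄-eq : S₄ ≡ irregular c k
    S₄-eq = trans (cells bd _) (∑-cong k λ i _ → ∑-cong k λ j _ → trans (cell-cong c i j {v = λ x y → ι (bdn i j) * 1} λ { x y refl refl → sym (*-identityʳ _) })
      (trans (cell-* c i j (ι (bdn i j)) (λ _ _ → 1)) (cong₂ _*_ (fl i j) (cell-1 c i j))))
      where
      fl : ∀ i j → ι (bdn i j) ≡ β c i j
      fl i j with status c i j
      ... | bad _ _ _ = refl
      ... | sparse _ = refl
      ... | good _ = refl
    count : t * ∑∑ (λ x y → f x y * ι (R x y)) ≤ 5 * (m * m)
    count = ≤-trans (*-monoʳ-≤ t le) (tot T₁ S₁ S₂ S₃ S₄ (irregular c k) tT₁ tS₃ (<⇒≤ irr) S₁-eq S₂-eq S₄-eq)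
      where
      tot : ∀ T₁ S₁ S₂ S₃ S₄ I → t * T₁ ≤ m → t * S₃ ≤ 2 * (m * m) → t * I ≤ m * m →
        S₁ ≡ m * T₁ → S₂ ≡ m * T₁ → S₄ ≡ I → t * (S₁ + S₂ + (S₃ + S₄)) ≤ 5 * (m * m)
      tot T₁ _ _ S₃ _ I h₁ h₃ h₄ refl refl refl = lin-sound (var 0 ⊠ (var 1 ⊠ var 2 ⊞ var 1 ⊠ var 2 ⊞ (var 3 ⊞ var 4))) (con 5 ⊠ (var 1 ⊠ var 1)) (con 2 ⊠ var 1 ⊠ (var 0 ⊠ var 2) ⊞ (var 0 ⊠ var 3 ⊞ var 0 ⊠ var 4)) (con 2 ⊠ var 1 ⊠ var 1 ⊞ (con 2 ⊠ (var 1 ⊠ var 1) ⊞ var 1 ⊠ var 1)) (t ∷ m ∷ T₁ ∷ S₃ ∷ I ∷ []) refl (2 * m · h₁ & h₃ & h₄)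
      le : ∑∑ (λ x y → f x y * ι (R x y)) ≤ S₁ + S₂ + (S₃ + S₄)
      le = ≤-trans (∑∑-mono λ x y _ _ → pt (g x y) (small (c x)) (small (c y)) (sp (c x) (c y)) (bdn (c x) (c y)))
        (≤-reflexive (trans (∑∑-+ _ _) (cong₂ _+_ (∑∑-+ _ _) (∑∑-+ _ _))))
        where
        pt : ∀ a p q r s → ι a * ι ((p ∨ q) ∨ (r ∨ s)) ≤ ι p + ι q + (ι r * ι a + ι s)
        pt false p q r s = z≤n
        pt true true q r s = s≤s z≤n
        pt true false true r s = s≤s z≤n
        pt true false false true s = s≤s z≤n
        pt true false false false s = ≤-reflexive (+-identityʳ _)

-- Arithmetic removal

SF : Pr → Set
SF A = ∀ x y → A x ≡ true → A y ≡ true → A (x + y) ≡ false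

Within : ℕ → Pr → Set
Within n A = A 0 ≡ false × (∀ x → n < x → A x ≡ false)

within-≤ : ∀ {n A x} → Within n A → A x ≡ true → x ≤ n
within-≤ {n} {A} {x} w h = ≮⇒≥ λ l → true≢false h (proj₂ w x l)

within-pos : ∀ {n A x} → Within n A → A x ≡ true → 0 < x
within-pos {x = zero} w h = true≢false h (proj₁ w)
within-pos {x = suc x} w h = s≤s z≤n

_∖_ : Pr → Pr → Pr
(A ∖ C) x = A x ∧ not (C x)

schur : Pr → ℕ → ℕ → ℕ
schur A a b = ι (A a) * ι (A b) * ι (A (a + b))

τ : ℕ → Pr → ℕ
τ n A = ∑ (suc n) λ a → ∑ (suc n) λ b → schur A a b

∑-cut : ∀ N m u → ∑ N (λ y → ι (suc y ≤ᵇ m) * u y) ≤ ∑ m u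
∑-cut N m u with ≤-total N m
... | inj₁ h = ≤-trans (∑-mono N λ y _ → ≤-trans (*-monoˡ-≤ (u y) (ι≤1 (suc y ≤ᵇ m))) (≤-reflexive (*-identityˡ _))) (∑-len u h)
... | inj₂ h = ≤-trans (≤-reflexive (∑-tail0 _ h λ x l → cong (_* u x) (ι-false (false-≤ᵇ (s≤s l)))))
  (∑-mono m λ y _ → ≤-trans (*-monoˡ-≤ (u y) (ι≤1 (suc y ≤ᵇ m))) (≤-reflexive (*-identityˡ _)))

removalConst : ℕ → ℕ
removalConst t = t * t * (t * t) * (t * t * t) * (k * k * k)
  where k = tower (suc (t * (t * t * (t * t)))) 1

-- There are 2n vertices so that a triple a, b, a + b ≤ n has at least n translates x, x + a, x + a
-- + b. Since `A 0` is false, truncated subtraction produces only upward edges, and a triangle is a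
-- Schur triple of gaps together with its least vertex.
module ArithmeticRemoval (t : ℕ) (t≥3 : 3 ≤ t) (n : ℕ) (n>0 : 0 < n) (A : Pr) (wA : Within n A)
  (few : removalConst t * τ n A ≤ n * n) where

  m : ℕ
  m = n + n

  g : ℕ → ℕ → Bool
  g x y = A (y ∸ x)

  open Regularity m g t using (f; triangles; removal) public

  sn≤m : suc n ≤ m
  sn≤m = +-monoˡ-≤ n n>0

  schur-0ˡ : ∀ b → schur A 0 b ≡ 0
  schur-0ˡ b rewrite proj₁ wA = refl

  schur-0ʳ : ∀ a → schur A a 0 ≡ 0
  schur-0ʳ a rewrite proj₁ wA | *-zeroʳ (ι (A a)) = refl

  schur-big : ∀ a b → n < a → schur A a b ≡ 0
  schur-big a b l rewrite proj₂ wA a l = refl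

  schur-bigʳ : ∀ a b → n < b → schur A a b ≡ 0
  schur-bigʳ a b l rewrite proj₂ wA b l | *-zeroʳ (ι (A a)) = refl

  triangles≤ : triangles ≤ m * τ n A
  triangles≤ = ≤-trans (∑-mono m λ x _ → row x) (≤-reflexive (∑-const m _))
    where
    pt : ∀ x y z → f x y * f x z * f y z ≤ schur A (y ∸ x) (z ∸ y)
    pt x y z with A (y ∸ x) in e₁ | A (z ∸ y) in e₂
    ... | false | _ = z≤n
    ... | true | false = ≤-reflexive (*-zeroʳ (1 * f x z))
    ... | true | true = ≤-reflexive (trans (*-identityʳ (1 * f x z)) (cong (λ v → 1 * ι (A v)) eq))
      where
      x<y : x ≤ y
      x<y = <⇒≤ (m∸n≢0⇒n<m λ z → true≢false (subst (λ v → A v ≡ true) z e₁) (proj₁ wA))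
      y<z : y ≤ z
      y<z = <⇒≤ (m∸n≢0⇒n<m λ w → true≢false (subst (λ v → A v ≡ true) w e₂) (proj₁ wA))
      eq : z ∸ x ≡ (y ∸ x) + (z ∸ y)
      eq = trans (cong (_∸ x) (sym (m+[n∸m]≡n y<z))) (+-∸-comm (z ∸ y) x<y)
    row : ∀ x → (∑ m λ y → ∑ m λ z → f x y * f x z * f y z) ≤ τ n A
    row x = begin
      (∑ m λ y → ∑ m λ z → f x y * f x z * f y z) ≤⟨ ∑-mono m (λ y _ → ∑-mono m λ z _ → pt x y z) ⟩
      (∑ m λ y → ∑ m λ z → schur A (y ∸ x) (z ∸ y)) ≤⟨ ∑-mono m (λ y _ → ∑-monus m y (schur A (y ∸ x)) (schur-0ʳ (y ∸ x))) ⟩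
      (∑ m λ y → ∑ m (schur A (y ∸ x))) ≤⟨ ∑-monus m x (λ a → ∑ m (schur A a)) (trans (∑-cong m λ b _ → schur-0ˡ b) (∑-zero m)) ⟩
      (∑ m λ a → ∑ m (schur A a)) ≡⟨ ∑-tail0 _ sn≤m (λ a l → trans (∑-cong m λ b _ → schur-big a b l) (∑-zero m)) ⟩
      (∑ (suc n) λ a → ∑ m (schur A a)) ≡⟨ ∑-cong (suc n) (λ a _ → ∑-tail0 _ sn≤m λ b l → schur-bigʳ a b l) ⟩
      τ n A ∎
      where open ≤-Reasoning

  -- The left side is 8n³, while scarcity of Schur triples bounds the right side by 2n · n².
  no-survivor : ¬ (m * m * m ≤ removalConst t * triangles)
  no-survivor h = contra (removalConst t) (τ n A) triangles h triangles≤ few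
    where
    pos : 0 < n * n * n
    pos = *-mono-≤ (*-mono-≤ n>0 n>0) n>0
    contra : ∀ d τ T → (n + n) * (n + n) * (n + n) ≤ d * T → T ≤ (n + n) * τ → d * τ ≤ n * n → ⊥
    contra d τ T h₁ h₂ h₃ = 1≰0 (lin-sound (con 1) (con 0) ((var 0 ⊞ var 0) ⊠ (var 0 ⊞ var 0) ⊠ (var 0 ⊞ var 0) ⊞ (var 1 ⊠ var 2 ⊞ ((var 0 ⊞ var 0) ⊠ (var 1 ⊠ var 3) ⊞ (con 1 ⊞ con 0)))) (var 1 ⊠ var 2 ⊞ (var 1 ⊠ ((var 0 ⊞ var 0) ⊠ var 3) ⊞ ((var 0 ⊞ var 0) ⊠ (var 0 ⊠ var 0) ⊞ var 0 ⊠ var 0 ⊠ var 0))) (n ∷ d ∷ T ∷ τ ∷ []) refl (h₁ & d · h₂ & (n + n) · h₃ & pos))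

module Extraction (t : ℕ) (n : ℕ) (n>0 : 0 < n) (A : Pr) (wA : Within n A) (R : ℕ → ℕ → Bool)
  (R-few : t * (∑ (n + n) λ x → ∑ (n + n) λ y → ι (A (y ∸ x)) * ι (R x y)) ≤ 5 * ((n + n) * (n + n)))
  (R-hits : ∀ x y z → x < n + n → y < n + n → z < n + n → R x y ≡ false → R x z ≡ false → R y z ≡ false → ⊥) where

  m : ℕ
  m = n + n

  f : ℕ → ℕ → ℕ
  f x y = ι (A (y ∸ x))

  v : ℕ → ℕ → ℕ
  v a x = ι (suc (x + a) ≤ᵇ m) * ι (R x (x + a))

  r : ℕ → ℕ
  r a = ∑ m (v a)

  -- The discarded elements are those for which at least n/3 of the edges from x to x + a were
  -- deleted.
  C : Pr
  C a = A a ∧ (n ≤ᵇ 3 * r a)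

  total : (∑ (suc n) λ a → ι (A a) * r a) ≤ ∑ m λ x → ∑ m λ y → f x y * ι (R x y)
  total = begin
    (∑ (suc n) λ a → ι (A a) * r a) ≡⟨ ∑-cong (suc n) (λ a _ → sym (∑-*ˡ m (ι (A a)) (v a))) ⟩
    (∑ (suc n) λ a → ∑ m λ x → ι (A a) * v a x) ≡⟨ ∑-swap (suc n) m _ ⟩
    (∑ m λ x → ∑ (suc n) λ a → ι (A a) * v a x) ≤⟨ ∑-mono m (λ x _ → row x) ⟩
    (∑ m λ x → ∑ m λ y → f x y * ι (R x y)) ∎
    where
    open ≤-Reasoning
    row : ∀ x → (∑ (suc n) λ a → ι (A a) * v a x) ≤ ∑ m λ y → f x y * ι (R x y)
    row x = begin
      (∑ (suc n) λ a → ι (A a) * v a x) ≡⟨ ∑-cong (suc n) (λ a _ → trans (e (ι (A a)) (ι (suc (x + a) ≤ᵇ m)) (ι (R x (x + a))))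
          (cong (λ s → ι (suc (x + a) ≤ᵇ m) * (ι (A s) * ι (R x (x + a)))) (sym (m+n∸m≡n x a)))) ⟩
      (∑ (suc n) λ a → ι (suc (x + a) ≤ᵇ m) * (f x (x + a) * ι (R x (x + a)))) ≤⟨ ∑-shift x (suc n) (λ y → ι (suc y ≤ᵇ m) * (f x y * ι (R x y))) ⟩
      (∑ (x + suc n) λ y → ι (suc y ≤ᵇ m) * (f x y * ι (R x y))) ≤⟨ ∑-cut (x + suc n) m _ ⟩
      (∑ m λ y → f x y * ι (R x y)) ∎
      where
      e : ∀ a b c → a * (b * c) ≡ b * (a * c)
      e = solve-∀

  -- Each discarded element accounts for n/3 deleted edges out of at most 5 (2n)²/t = 20 n²/t,
  -- whence the constant 60.
  C-small : t * # (suc n) C ≤ 60 * n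
  C-small = *-cancelˡ-≤ n {{>-nonZero n>0}} (fin (# (suc n) C) _ _ le total R-few)
    where
    fin : ∀ c s q → n * c ≤ 3 * s → s ≤ q → t * q ≤ 5 * ((n + n) * (n + n)) → n * (t * c) ≤ n * (60 * n)
    fin c s q h₁ h₂ h₃ = lin-sound (var 0 ⊠ (var 1 ⊠ var 2)) (var 0 ⊠ (con 60 ⊠ var 0)) (var 1 ⊠ (var 0 ⊠ var 2) ⊞ (con 3 ⊠ var 1 ⊠ var 3 ⊞ con 3 ⊠ (var 1 ⊠ var 4))) (var 1 ⊠ (con 3 ⊠ var 3) ⊞ (con 3 ⊠ var 1 ⊠ var 4 ⊞ con 3 ⊠ (con 5 ⊠ ((var 0 ⊞ var 0) ⊠ (var 0 ⊞ var 0))))) (n ∷ t ∷ c ∷ s ∷ q ∷ []) refl (t · h₁ & 3 * t · h₂ & 3 · h₃)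
    pt : ∀ a → n * ι (C a) ≤ 3 * (ι (A a) * r a)
    pt a = ≤-trans (≤-reflexive (cong (n *_) (ι-∧ (A a) (n ≤ᵇ 3 * r a)))) (aux (A a) (n ≤ᵇ 3 * r a) (r a) ≤ᵇ-true)
      where
      aux : ∀ b b' r → (b' ≡ true → n ≤ 3 * r) → n * (ι b * ι b') ≤ 3 * (ι b * r)
      aux true true r h = lin-sound (var 0 ⊠ (con 1 ⊠ con 1)) (con 3 ⊠ (con 1 ⊠ var 1)) (var 0) (con 3 ⊠ var 1) (n ∷ r ∷ []) refl (h refl)
      aux true false r h = expr-≤ (var 0 ⊠ (con 1 ⊠ con 0)) (con 3 ⊠ (con 1 ⊠ var 1)) (n ∷ r ∷ []) refl
      aux false b' r h = expr-≤ (var 0 ⊠ (con 0 ⊠ var 1)) (con 3 ⊠ (con 0 ⊠ var 2)) (n ∷ ι b' ∷ r ∷ []) refl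
    le : n * # (suc n) C ≤ 3 * ∑ (suc n) (λ a → ι (A a) * r a)
    le = ≤-trans (≤-reflexive (sym (∑-*ˡ (suc n) n _))) (≤-trans (∑-mono (suc n) λ a _ → pt a) (≤-reflexive (∑-*ˡ (suc n) 3 _)))

  in-A : ∀ a → (A ∖ C) a ≡ true → A a ≡ true
  in-A a h = proj₁ (∧-split h)

  light : ∀ a → (A ∖ C) a ≡ true → 3 * r a < n
  light a h = ≰⇒> λ le → true≢false (∧-join (in-A a h) (true-≤ᵇ le)) (not-true (proj₂ (∧-split {A a} h)))

  -- Each of a, b, a + b loses fewer than n/3 translates, so one of the n starting points x < n
  -- keeps all three edges of its triangle, which `R-hits` forbids.
  sumFree : SF (A ∖ C)
  sumFree a b ha hb = ¬true λ hc → contra hc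
    where
    v-in : ∀ c x → x + c < m → ι (R x (x + c)) ≤ v c x
    v-in c x l = ≤-reflexive (sym (trans (cong (_* ι (R x (x + c))) (ι-true (true-≤ᵇ l))) (*-identityˡ _)))
    contra : (A ∖ C) (a + b) ≡ true → ⊥
    contra hc = 1≰0 (fin (r a) (r (a + b)) (r b) (light a ha) (light (a + b) hc) (light b hb) sum)
      where
      ab≤n : a + b ≤ n
      ab≤n = within-≤ wA (in-A (a + b) hc)
      a≤n : a ≤ n
      a≤n = ≤-trans (m≤m+n a b) ab≤n
      fin : ∀ p q s → 3 * p < n → 3 * q < n → 3 * s < n → n ≤ p + q + s → 1 ≤ 0
      fin p q s h₁ h₂ h₃ h = lin-sound (con 1) (con 0) (con 1 ⊞ con 3 ⊠ var 0 ⊞ (con 1 ⊞ con 3 ⊠ var 1 ⊞ (con 1 ⊞ con 3 ⊠ var 2 ⊞ con 3 ⊠ var 3))) (var 3 ⊞ (var 3 ⊞ (var 3 ⊞ con 3 ⊠ (var 0 ⊞ var 1 ⊞ var 2)))) (p ∷ q ∷ s ∷ n ∷ []) refl (h₁ & h₂ & h₃ & 3 · h)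
      each : ∀ x → x < n → 1 ≤ v a x + v (a + b) x + v b (a + x)
      each x l = ≤-trans (hit (R x (x + a)) (R x (x + (a + b))) (R (a + x) (a + x + b)) refl refl refl)
          (+-mono-≤ (+-mono-≤ (v-in a x la) (v-in (a + b) x lab)) (v-in b (a + x) (subst (_< m) (sym eq) lab)))
        where
        eq : a + x + b ≡ x + (a + b)
        eq = expr-≡ (var 0 ⊞ var 1 ⊞ var 2) (var 1 ⊞ (var 0 ⊞ var 2)) (a ∷ x ∷ b ∷ []) refl
        la : x + a < m
        la = +-mono-≤ l a≤n
        lab : x + (a + b) < m
        lab = +-mono-≤ l ab≤n
        hit : ∀ p q s → R x (x + a) ≡ p → R x (x + (a + b)) ≡ q → R (a + x) (a + x + b) ≡ s → 1 ≤ ι p + ι q + ι s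
        hit true q s _ _ _ = s≤s z≤n
        hit false true s _ _ _ = s≤s z≤n
        hit false false true _ _ _ = s≤s z≤n
        hit false false false e₁ e₂ e₃ = ⊥-elim (R-hits x (x + a) (x + (a + b)) (≤-trans (s≤s (m≤m+n x a)) la) la lab e₁ e₂
          (trans (cong₂ R (+-comm x a) (sym eq)) e₃))
      sum : n ≤ r a + r (a + b) + r b
      sum = begin
        n ≡⟨ trans (∑-const n 1) (*-identityʳ n) ⟨
        ∑ n (λ _ → 1) ≤⟨ ∑-mono n each ⟩
        ∑ n (λ x → v a x + v (a + b) x + v b (a + x)) ≡⟨ trans (∑-+ n _ _) (cong (_+ ∑ n (λ x → v b (a + x))) (∑-+ n _ _)) ⟩
        ∑ n (v a) + ∑ n (v (a + b)) + ∑ n (λ x → v b (a + x)) ≤⟨ +-mono-≤ (+-mono-≤ (∑-len (v a) (m≤m+n n n)) (∑-len (v (a + b)) (m≤m+n n n)))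
            (≤-trans (∑-shift a n (v b)) (∑-len (v b) (+-monoˡ-≤ n a≤n))) ⟩
        r a + r (a + b) + r b ∎
        where open ≤-Reasoning

arithmetic-removal : ∀ t → 3 ≤ t → ∀ n A → 0 < n → Within n A → removalConst t * τ n A ≤ n * n →
  ∃ λ (C : Pr) → (∀ x → C x ≡ true → A x ≡ true) × t * # (suc n) C ≤ 60 * n × SF (A ∖ C)
arithmetic-removal t t≥3 n A n>0 w few = go (AR.removal t≥3 (≤-trans (s≤s z≤n) AR.sn≤m))
  where
  module AR = ArithmeticRemoval t t≥3 n n>0 A w few
  go : (∃ λ (R : ℕ → ℕ → Bool) →
      t * (∑ (n + n) λ x → ∑ (n + n) λ y → ι (A (y ∸ x)) * ι (R x y)) ≤ 5 * ((n + n) * (n + n)) ×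
      (∀ x y z → x < n + n → y < n + n → z < n + n → R x y ≡ false → R x z ≡ false → R y z ≡ false →
        (n + n) * (n + n) * (n + n) ≤ removalConst t * AR.triangles)) →
    ∃ λ (C : Pr) → (∀ x → C x ≡ true → A x ≡ true) × t * # (suc n) C ≤ 60 * n × SF (A ∖ C)
  go (R , R-few , survive) = X.C , (λ x h → proj₁ (∧-split h)) , X.C-small , X.sumFree
    where module X = Extraction t n n>0 A w R R-few (λ x y z lx ly lz r₁ r₂ r₃ → AR.no-survivor (survive x y z lx ly lz r₁ r₂ r₃))

-- Counting maximal independent sets

_≈[_]_ : Pr → ℕ → Pr → Set
p ≈[ N ] q = ∀ x → x < N → p x ≡ q x

-- Says that `P` holds for at most `M` sets when only their part below `N` is distinguished; the
-- list form makes union bounds and branching recursions into list operations.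
Cover : ℕ → (Pr → Set) → ℕ → Set
Cover N P M = ∃ λ (L : List Pr) → length L ≤ M × (∀ p → P p → ∃ λ q → q ∈ L × p ≈[ N ] q)

cover-⊆ : ∀ {N P Q M M'} → (∀ p → Q p → P p) → M ≤ M' → Cover N P M → Cover N Q M'
cover-⊆ h le (L , l , c) = L , ≤-trans l le , λ p q → c p (h p q)

cover-none : ∀ {N P} → (∀ p → ¬ P p) → Cover N P 0
cover-none h = [] , z≤n , λ p x → ⊥-elim (h p x)

cover-one : ∀ {N P} q → (∀ p → P p → p ≈[ N ] q) → Cover N P 1
cover-one q h = q ∷ [] , ≤-refl , λ p x → q , here refl , h p x

cover-⊎ : ∀ {N P Q M M'} → Cover N P M → Cover N Q M' → Cover N (λ p → P p ⊎ Q p) (M + M')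
cover-⊎ {N} {P} {Q} (L , l , c) (L' , l' , c') = L ++ L' , ≤-trans (≤-reflexive (length-++ L)) (+-mono-≤ l l') , g
  where
  g : ∀ p → P p ⊎ Q p → ∃ λ q → q ∈ L ++ L' × p ≈[ N ] q
  g p (inj₁ x) with c p x
  ... | q , i , e = q , ∈-++⁺ˡ i , e
  g p (inj₂ x) with c' p x
  ... | q , i , e = q , ∈-++⁺ʳ L i , e

cover-map : ∀ {N P Q M} (h : Pr → Pr) → (∀ p q → p ≈[ N ] q → h p ≈[ N ] h q) →
  (∀ p → Q p → ∃ λ p' → P p' × p ≈[ N ] h p') → Cover N P M → Cover N Q M
cover-map {N} {P} {Q} h hr back (L , l , c) = map h L , ≤-trans (≤-reflexive (length-map h L)) l , g
  where
  g : ∀ p → Q p → ∃ λ q → q ∈ map h L × p ≈[ N ] q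
  g p x with back p x
  ... | p' , y , e with c p' y
  ... | q , i , e' = h q , ∈-map⁺ h i , λ v lv → trans (e v lv) (hr p' q e' v lv)

cover-⋃ : ∀ {N} k (Q : Pr) {P : ℕ → Pr → Set} {M} → (∀ u → u < k → Q u ≡ true → Cover N (P u) M) →
  Cover N (λ p → ∃[ u ] u < k × Q u ≡ true × P u p) (# k Q * M)
cover-⋃ zero Q h = cover-none λ { p (u , () , _) }
cover-⋃ {N} (suc k) Q {P} {M} h with bool? (Q k)
... | inj₁ e = cover-⊆ split (≤-reflexive (sym (trans (cong (λ b → (# k Q + ι b) * M) e) (*-distribʳ-+ M (# k Q) 1))))
    (cover-⊎ (cover-⋃ k Q λ u l → h u (m<n⇒m<1+n l)) (cover-⊆ (λ _ x → x) (≤-reflexive (sym (+-identityʳ M))) (h k ≤-refl e)))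
  where
  split : ∀ p → ∃[ u ] u < suc k × Q u ≡ true × P u p → (∃[ u ] u < k × Q u ≡ true × P u p) ⊎ P k p
  split p (u , l , q , x) with u ≟ k
  ... | yes refl = inj₂ x
  ... | no ne = inj₁ (u , ≤∧≢⇒< (s≤s⁻¹ l) ne , q , x)
... | inj₂ e = cover-⊆ shrink (*-monoˡ-≤ M (m≤m+n (# k Q) (ι (Q k)))) (cover-⋃ k Q λ u l → h u (m<n⇒m<1+n l))
  where
  shrink : ∀ p → ∃[ u ] u < suc k × Q u ≡ true × P u p → ∃[ u ] u < k × Q u ≡ true × P u p
  shrink p (u , l , q , x) with u ≟ k
  ... | yes refl = true≢false q e
  ... | no ne = u , ≤∧≢⇒< (s≤s⁻¹ l) ne , q , x

cover-list : ∀ {N} (Ls : List Pr) {P : Pr → Pr → Set} {M} → (∀ F → F ∈ Ls → Cover N (P F) M) →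
  Cover N (λ p → ∃ λ F → F ∈ Ls × P F p) (length Ls * M)
cover-list [] h = cover-none λ { p (F , () , _) }
cover-list {N} (F ∷ Ls) {P} {M} h = cover-⊆ split ≤-refl (cover-⊎ (h F (here refl)) (cover-list Ls λ F i → h F (there i)))
  where
  split : ∀ p → ∃ (λ G → G ∈ F ∷ Ls × P G p) → P F p ⊎ ∃ (λ G → G ∈ Ls × P G p)
  split p (G , here refl , x) = inj₁ x
  split p (G , there i , x) = inj₂ (G , i , x)

argmin : ∀ N (p : Pr) (d : ℕ → ℕ) → (∃[ v ] v < N × p v ≡ true × (∀ u → u < N → p u ≡ true → d v ≤ d u)) ⊎ (∀ u → u < N → p u ≡ false)
argmin zero p d = inj₂ λ { u () }
argmin (suc N) p d with argmin N p d | bool? (p N)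
... | inj₂ none | inj₂ e = inj₂ λ u l → g u l (u ≟ N)
  where
  g : ∀ u → u < suc N → Dec (u ≡ N) → p u ≡ false
  g u l (yes refl) = e
  g u l (no ne) = none u (≤∧≢⇒< (s≤s⁻¹ l) ne)
... | inj₂ none | inj₁ e = inj₁ (N , ≤-refl , e , λ u l q → g u l q (u ≟ N))
  where
  g : ∀ u → u < suc N → p u ≡ true → Dec (u ≡ N) → d N ≤ d u
  g u l q (yes refl) = ≤-refl
  g u l q (no ne) = true≢false q (none u (≤∧≢⇒< (s≤s⁻¹ l) ne))
... | inj₁ (v , lv , pv , min) | inj₂ e = inj₁ (v , m<n⇒m<1+n lv , pv , λ u l q → g u l q (u ≟ N))
  where
  g : ∀ u → u < suc N → p u ≡ true → Dec (u ≡ N) → d v ≤ d u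
  g u l q (yes refl) = true≢false q e
  g u l q (no ne) = min u (≤∧≢⇒< (s≤s⁻¹ l) ne) q
... | inj₁ (v , lv , pv , min) | inj₁ e with ≤-total (d v) (d N)
...   | inj₁ le = inj₁ (v , m<n⇒m<1+n lv , pv , λ u l q → g u l q (u ≟ N))
  where
  g : ∀ u → u < suc N → p u ≡ true → Dec (u ≡ N) → d v ≤ d u
  g u l q (yes refl) = le
  g u l q (no ne) = min u (≤∧≢⇒< (s≤s⁻¹ l) ne) q
...   | inj₂ ge = inj₁ (N , ≤-refl , e , λ u l q → g u l q (u ≟ N))
  where
  g : ∀ u → u < suc N → p u ≡ true → Dec (u ≡ N) → d N ≤ d u
  g u l q (yes refl) = ≤-refl
  g u l q (no ne) = ≤-trans ge (min u (≤∧≢⇒< (s≤s⁻¹ l) ne) q)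

_-ᵛ_ : Pr → ℕ → Pr
(p -ᵛ v) x = p x ∧ not (v ≡ᵇ x)

-ᵛ-⊆ : ∀ {p v x} → (p -ᵛ v) x ≡ true → p x ≡ true
-ᵛ-⊆ h = proj₁ (∧-split h)

-ᵛ-≢ : ∀ {p v x} → (p -ᵛ v) x ≡ true → v ≢ x
-ᵛ-≢ {p} {v} h refl = true≢false (≡ᵇ-refl v) (not-true (proj₂ (∧-split {p v} h)))

-ᵛ-keep : ∀ {p v x} → v ≢ x → p x ≡ true → (p -ᵛ v) x ≡ true
-ᵛ-keep ne h = ∧-join h (not-false (≢ᵇ-false ne))

-ᵛ-same : ∀ p {v x} → v ≢ x → (p -ᵛ v) x ≡ p x
-ᵛ-same p {v} {x} ne rewrite ≢ᵇ-false ne with p x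
... | true = refl
... | false = refl

#-remove : ∀ N p {v} → v < N → p v ≡ true → # N p ≡ suc (# N (p -ᵛ v))
#-remove N p {v} l h = trans (#-split N p (v ≡ᵇ_)) (cong (_+ # N (p -ᵛ v)) (trans (#-cong N λ x _ → e x) (#-single N v l)))
  where
  e : ∀ x → p x ∧ (v ≡ᵇ x) ≡ (v ≡ᵇ x)
  e x with v ≟ x
  ... | yes refl rewrite h = refl
  ... | no ne rewrite ≢ᵇ-false ne with p x
  ...   | true = refl
  ...   | false = refl

set-insert : ∀ N p v → # N (set v true p) ≤ suc (# N p)
set-insert N p v = ≤-trans (∑-mono N λ x _ → e x) (≤-trans (≤-reflexive (∑-+ N _ _)) (+-monoˡ-≤ (# N p) (#-single≤ N v)))
  where
  e : ∀ x → ι (set v true p x) ≤ ι (v ≡ᵇ x) + ι (p x)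
  e x with v ≡ᵇ x
  ... | true = s≤s z≤n
  ... | false = ≤-refl

set-⊆ : ∀ p v x → set v true p x ≡ true → (v ≡ x) ⊎ (p x ≡ true)
set-⊆ p v x h with v ≟ x
... | yes e = inj₁ e
... | no ne = inj₂ (trans (sym (set-≢ v true p ne)) h)

set-⊇ : ∀ p v x → p x ≡ true → set v true p x ≡ true
set-⊇ p v x h with v ≡ᵇ x
... | true = refl
... | false = h

set-cong : ∀ N v b p q → p ≈[ N ] q → set v b p ≈[ N ] set v b q
set-cong N v b p q h x l with v ≡ᵇ x
... | true = refl
... | false = h x l

set-remove : ∀ p v → p v ≡ true → ∀ x → p x ≡ set v true (p -ᵛ v) x
set-remove p v h x with v ≟ x
... | yes refl = trans h (sym (set-= v true (p -ᵛ v)))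
... | no ne = trans (sym (-ᵛ-same p ne)) (sym (set-≢ v true (p -ᵛ v) ne))

-- An integral stand-in for 7 · 3^(n/3): 10 and 14 are the integer parts of 7 · 3^(1/3) and 7 ·
-- 3^(2/3). The factor 7 leaves enough room for the branching inequality to survive rounding.
moon : ℕ → ℕ
moon 0 = 7
moon 1 = 10
moon 2 = 14
moon (suc (suc (suc n))) = 3 * moon n

4moon≤ : ∀ e → 4 * moon e ≤ 3 * moon (suc e)
4moon≤ 0 = ≤ᵇ⇒≤ 28 30 _
4moon≤ 1 = ≤ᵇ⇒≤ 40 42 _
4moon≤ 2 = ≤ᵇ⇒≤ 56 63 _
4moon≤ (suc (suc (suc e))) = lem (moon e) (moon (suc e)) (4moon≤ e)
  where
  lem : ∀ a b → 4 * a ≤ 3 * b → 4 * (3 * a) ≤ 3 * (3 * b)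
  lem a b h = lin-sound (con 4 ⊠ (con 3 ⊠ var 0)) (con 3 ⊠ (con 3 ⊠ var 1)) (con 3 ⊠ (con 4 ⊠ var 0)) (con 3 ⊠ (con 3 ⊠ var 1)) (a ∷ b ∷ []) refl (3 · h)

2moon≤ : ∀ e → 2 * moon e ≤ moon (2 + e)
2moon≤ 0 = ≤ᵇ⇒≤ 14 14 _
2moon≤ 1 = ≤ᵇ⇒≤ 20 21 _
2moon≤ 2 = ≤ᵇ⇒≤ 28 30 _
2moon≤ (suc (suc (suc e))) = lem (moon e) (moon (2 + e)) (2moon≤ e)
  where
  lem : ∀ a b → 2 * a ≤ b → 2 * (3 * a) ≤ 3 * b
  lem a b h = lin-sound (con 2 ⊠ (con 3 ⊠ var 0)) (con 3 ⊠ var 1) (con 3 ⊠ (con 2 ⊠ var 0)) (con 3 ⊠ var 1) (a ∷ b ∷ []) refl (3 · h)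

moon-suc : ∀ e → moon e ≤ moon (suc e)
moon-suc e = lem (moon e) (moon (suc e)) (4moon≤ e)
  where
  lem : ∀ a b → 4 * a ≤ 3 * b → a ≤ b
  lem a b h = *-cancelˡ-≤ 3 (lin-sound (con 3 ⊠ var 0) (con 3 ⊠ var 1) (con 4 ⊠ var 0) (con 3 ⊠ var 1) (a ∷ b ∷ []) refl h)

-- Equality holds at three branches. Beyond that, one more branch multiplies the left side by at
-- most 4/3, and by `4moon≤` one more vertex multiplies the right side by at least 4/3.
moon-branch : ∀ d e → suc d * moon e ≤ moon (suc d + e)
moon-branch 0 e = ≤-trans (≤-reflexive (+-identityʳ _)) (moon-suc e)
moon-branch 1 e = 2moon≤ e
moon-branch 2 e = ≤-refl
moon-branch (suc (suc (suc d))) e = ≤-trans (lem (moon e) (moon (suc e)) (4moon≤ e))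
  (≤-trans (moon-branch (suc (suc d)) (suc e)) (≤-reflexive (cong moon (+-suc (3 + d) e))))
  where
  lem : ∀ a b → 4 * a ≤ 3 * b → (4 + d) * a ≤ (3 + d) * b
  lem a b h = *-cancelˡ-≤ 3 (lin-sound (con 3 ⊠ ((con 4 ⊞ var 0) ⊠ var 1)) (con 3 ⊠ ((con 3 ⊞ var 0) ⊠ var 2)) ((con 3 ⊞ var 0) ⊠ (con 4 ⊠ var 1)) ((con 3 ⊞ var 0) ⊠ (con 3 ⊠ var 2)) (d ∷ a ∷ b ∷ []) refl ((3 + d) · h))

moon>0 : ∀ n → 1 ≤ moon n
moon>0 0 = s≤s z≤n
moon>0 1 = s≤s z≤n
moon>0 2 = s≤s z≤n
moon>0 (suc (suc (suc n))) = ≤-trans (moon>0 n) (m≤n*m (moon n) 3)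

-- Values 5·2^j and 7·2^j approximate a multiple of 2^(n/2) closely enough for every branching used.
hujter : ℕ → ℕ
hujter 0 = 5
hujter 1 = 7
hujter (suc (suc n)) = 2 * hujter n

hujter-suc : ∀ e → hujter e ≤ hujter (suc e)
hujter-suc 0 = ≤ᵇ⇒≤ 5 7 _
hujter-suc 1 = ≤ᵇ⇒≤ 7 10 _
hujter-suc (suc (suc e)) = *-monoʳ-≤ 2 (hujter-suc e)

-- The branching vector (1, 4): omit a vertex of degree at least 3, or take it and lose its closed
-- neighbourhood.
hujter-14 : ∀ e → hujter (3 + e) + hujter e ≤ hujter (4 + e)
hujter-14 0 = ≤ᵇ⇒≤ 19 20 _
hujter-14 1 = ≤ᵇ⇒≤ 27 28 _
hujter-14 (suc (suc e)) = lem (hujter (3 + e)) (hujter e) (hujter (4 + e)) (hujter-14 e)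
  where
  lem : ∀ a b c → a + b ≤ c → 2 * a + 2 * b ≤ 2 * c
  lem a b c h = lin-sound (con 2 ⊠ var 0 ⊞ con 2 ⊠ var 1) (con 2 ⊠ var 2) (con 2 ⊠ (var 0 ⊞ var 1)) (con 2 ⊠ var 2) (a ∷ b ∷ c ∷ []) refl (2 · h)

-- The branching vector (3, 3, 4), which occurs when every vertex has degree 2.
hujter-334 : ∀ e → hujter (1 + e) + hujter (1 + e) + hujter e ≤ hujter (4 + e)
hujter-334 0 = ≤ᵇ⇒≤ 19 20 _
hujter-334 1 = ≤ᵇ⇒≤ 27 28 _
hujter-334 (suc (suc e)) = lem (hujter (1 + e)) (hujter e) (hujter (4 + e)) (hujter-334 e)
  where
  lem : ∀ a b c → a + a + b ≤ c → 2 * a + 2 * a + 2 * b ≤ 2 * c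
  lem a b c h = lin-sound (con 2 ⊠ var 0 ⊞ con 2 ⊠ var 0 ⊞ con 2 ⊠ var 1) (con 2 ⊠ var 2) (con 2 ⊠ (var 0 ⊞ var 0 ⊞ var 1)) (con 2 ⊠ var 2) (a ∷ b ∷ c ∷ []) refl (2 · h)

hujter>0 : ∀ n → 1 ≤ hujter n
hujter>0 0 = s≤s z≤n
hujter>0 1 = s≤s z≤n
hujter>0 (suc (suc n)) = ≤-trans (hujter>0 n) (m≤n*m (hujter n) 2)

hujter-mono : ∀ {a b} → a ≤ b → hujter a ≤ hujter b
hujter-mono {a} {b} h with m≤n⇒∃[o]m+o≡n h
... | o , refl = go o
  where
  go : ∀ o → hujter a ≤ hujter (a + o)
  go zero rewrite +-identityʳ a = ≤-refl
  go (suc o) rewrite +-suc a o = ≤-trans (go o) (hujter-suc (a + o))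

_⊆ᵖ_ : Pr → Pr → Set
p ⊆ᵖ q = ∀ x → p x ≡ true → q x ≡ true

module Graph (N : ℕ) (adj : ℕ → ℕ → Bool) (adj-sym : ∀ x y → adj x y ≡ true → adj y x ≡ true) where

  InRange : Pr → Set
  InRange B = ∀ x → B x ≡ true → x < N

  Loopless : Pr → Set
  Loopless B = ∀ x → B x ≡ true → adj x x ≡ false

  Indep : Pr → Set
  Indep I = ∀ x y → I x ≡ true → I y ≡ true → adj x y ≡ false

  TriangleFree : Pr → Set
  TriangleFree B = ∀ x y z → B x ≡ true → B y ≡ true → B z ≡ true →
    adj x y ≡ true → adj y z ≡ true → adj x z ≡ true → ⊥

  deg : Pr → ℕ → ℕ
  deg B v = # N λ x → B x ∧ adj v x

  record MIS (B I : Pr) : Set where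
    constructor mis
    field
      sub : I ⊆ᵖ B
      indep : Indep I
      dominated : ∀ x → B x ≡ true → I x ≡ false → ∃[ y ] I y ≡ true × adj x y ≡ true
  open MIS public

  nb : Pr → ℕ → Pr
  nb B v x = B x ∧ ((v ≡ᵇ x) ∨ adj v x)

  _-ᴺ_ : Pr → ℕ → Pr
  (B -ᴺ v) x = B x ∧ not ((v ≡ᵇ x) ∨ adj v x)

  -ᴺ-⊆ : ∀ {B v x} → (B -ᴺ v) x ≡ true → B x ≡ true
  -ᴺ-⊆ h = proj₁ (∧-split h)

  -ᴺ-out : ∀ {B v x} → (B -ᴺ v) x ≡ true → v ≢ x × adj v x ≡ false
  -ᴺ-out {B} {v} {x} h = (λ { refl → true≢false (≡ᵇ-refl v) (proj₁ d) }) , proj₂ d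
    where d = ∨-false {v ≡ᵇ x} (not-true (proj₂ (∧-split {B x} h)))

  -ᴺ-keep : ∀ {B v x} → B x ≡ true → v ≢ x → adj v x ≡ false → (B -ᴺ v) x ≡ true
  -ᴺ-keep {B} {v} {x} h ne a rewrite h | ≢ᵇ-false ne | a = refl

  nb-size : ∀ B v → v < N → B v ≡ true → adj v v ≡ false → # N (nb B v) ≡ suc (deg B v)
  nb-size B v l h a = trans (∑-cong N λ x _ → e x) (trans (∑-+ N _ _) (cong (_+ deg B v) (#-single N v l)))
    where
    e : ∀ x → ι (nb B v x) ≡ ι (v ≡ᵇ x) + ι (B x ∧ adj v x)
    e x with v ≟ x
    ... | yes refl rewrite h | ≡ᵇ-refl v | a = refl
    ... | no ne rewrite ≢ᵇ-false ne = refl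

  -ᴺ-size : ∀ B v → v < N → B v ≡ true → adj v v ≡ false → # N B ≡ suc (deg B v) + # N (B -ᴺ v)
  -ᴺ-size B v l h a = trans (#-split N B (λ x → (v ≡ᵇ x) ∨ adj v x)) (cong (_+ # N (B -ᴺ v)) (nb-size B v l h a))

  mis-in : ∀ {B I v} → MIS B I → I v ≡ true → MIS (B -ᴺ v) (I -ᵛ v)
  mis-in {B} {I} {v} (mis s i d) iv = mis
    (λ x h → -ᴺ-keep {B} (s x (-ᵛ-⊆ {I} {v} h)) (-ᵛ-≢ {I} h) (i v x iv (-ᵛ-⊆ {I} {v} h)))
    (λ x y hx hy → i x y (-ᵛ-⊆ {I} {v} hx) (-ᵛ-⊆ {I} {v} hy)) dom
    where
    dom : ∀ x → (B -ᴺ v) x ≡ true → (I -ᵛ v) x ≡ false → ∃[ y ] (I -ᵛ v) y ≡ true × adj x y ≡ true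
    dom x hx nx with d x (-ᴺ-⊆ {B} hx) (trans (sym (-ᵛ-same I (proj₁ (-ᴺ-out {B} hx)))) nx)
    ... | y , iy , a = y , -ᵛ-keep {I} {v} (λ { refl → true≢false (adj-sym x v a) (proj₂ (-ᴺ-out {B} hx)) }) iy , a

  mis-out : ∀ {B I v} → MIS B I → I v ≡ false → MIS (B -ᵛ v) I
  mis-out {B} {I} {v} (mis s i d) iv = mis
    (λ x h → -ᵛ-keep {B} {v} (λ { refl → true≢false h iv }) (s x h)) i (λ x hx nx → d x (-ᵛ-⊆ {B} {v} hx) nx)

  mis-restrict : ∀ {B F I} → MIS B I → I ⊆ᵖ F → F ⊆ᵖ B → MIS F I
  mis-restrict (mis s i d) IF FB = mis IF i (λ x hx → d x (FB x hx))

  cover-in : ∀ {B v M} → Cover N (MIS (B -ᴺ v)) M → Cover N (λ I → MIS B I × I v ≡ true) M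
  cover-in {B} {v} = cover-map (set v true) (set-cong N v true)
    (λ { I (m , iv) → (I -ᵛ v) , mis-in m iv , λ x _ → set-remove I v iv x })

  cover-out : ∀ {B v M} → Cover N (MIS (B -ᵛ v)) M → Cover N (λ I → MIS B I × I v ≡ false) M
  cover-out = cover-⊆ (λ { I (m , iv) → mis-out m iv }) ≤-refl

  cover-split : ∀ {B v M M'} → Cover N (MIS (B -ᴺ v)) M → Cover N (MIS (B -ᵛ v)) M' → Cover N (MIS B) (M + M')
  cover-split {B} {v} c c' = cover-⊆ (λ I m → g I m (bool? (I v))) ≤-refl (cover-⊎ (cover-in c) (cover-out c'))
    where
    g : ∀ I → MIS B I → (I v ≡ true) ⊎ (I v ≡ false) → (MIS B I × I v ≡ true) ⊎ (MIS B I × I v ≡ false)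
    g I m (inj₁ e) = inj₁ (m , e)
    g I m (inj₂ e) = inj₂ (m , e)

  -- A maximal independent set meets the closed neighbourhood of every vertex.
  cover-nb : ∀ {B} v {M} → InRange B → B v ≡ true → adj v v ≡ false →
    (∀ u → u < N → nb B v u ≡ true → Cover N (MIS (B -ᴺ u)) M) → Cover N (MIS B) (suc (deg B v) * M)
  cover-nb {B} v {M} ir bv a c = cover-⊆ (λ I m → g I m (bool? (I v))) (*-monoˡ-≤ M (≤-reflexive (nb-size B v (ir v bv) bv a)))
    (cover-⋃ N (nb B v) λ u l h → cover-in (c u l h))
    where
    g : ∀ I → MIS B I → (I v ≡ true) ⊎ (I v ≡ false) → ∃[ u ] u < N × nb B v u ≡ true × MIS B I × I u ≡ true
    g I m (inj₁ e) = v , ir v bv , ∧-join bv (∨-left (≡ᵇ-refl v)) , m , e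
    g I m (inj₂ e) with dominated m v bv e
    ... | y , iy , ay = y , ir y (sub m y iy) , ∧-join (sub m y iy) (∨-right {v ≡ᵇ y} ay) , m , iy

  cover-empty : ∀ {B} → (∀ x → x < N → B x ≡ false) → Cover N (MIS B) 1
  cover-empty h = cover-one (λ _ → false) λ I m x l → ¬true λ e → true≢false (sub m x e) (h x l)

  inRange-⊆ : ∀ {B B'} → B' ⊆ᵖ B → InRange B → InRange B'
  inRange-⊆ s ir x h = ir x (s x h)

  loopless-⊆ : ∀ {B B'} → B' ⊆ᵖ B → Loopless B → Loopless B'
  loopless-⊆ s ll x h = ll x (s x h)

  triangleFree-⊆ : ∀ {B B'} → B' ⊆ᵖ B → TriangleFree B → TriangleFree B'
  triangleFree-⊆ s tf x y z hx hy hz = tf x y z (s x hx) (s y hy) (s z hz)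

  -- Branch over the closed neighbourhood of a vertex v of minimum degree δ. Every vertex u there
  -- has degree at least δ, so each of the δ + 1 branches loses at least δ + 1 vertices.
  moon-moser′ : ∀ fuel b B → b ≤ fuel → InRange B → Loopless B → # N B ≤ b → Cover N (MIS B) (moon b)
  moon-moser′ fuel b B bf ir ll h with argmin N B (deg B)
  ... | inj₂ none = cover-⊆ (λ _ x → x) (moon>0 b) (cover-empty none)
  moon-moser′ zero zero B bf ir ll h | inj₁ (v , l , bv , min) = ⊥-elim (<⇒≱ (#-has N B l bv) h)
  moon-moser′ (suc fuel) b B bf ir ll h | inj₁ (v , l , bv , min) with m≤n⇒∃[o]m+o≡n {suc (deg B v)} {b} (≤-trans (≤-trans (m≤m+n _ (# N (B -ᴺ v))) (≤-reflexive (sym (-ᴺ-size B v l bv (ll v bv))))) h)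
  ... | e , refl = cover-⊆ (λ _ x → x) (moon-branch (deg B v) e) (cover-nb v ir bv (ll v bv) rec)
    where
    rec : ∀ u → u < N → nb B v u ≡ true → Cover N (MIS (B -ᴺ u)) (moon e)
    rec u lu hu = moon-moser′ fuel e (B -ᴺ u) (≤-trans (m≤n+m e (deg B v)) (s≤s⁻¹ bf)) (inRange-⊆ (λ x → -ᴺ-⊆ {B}) ir) (loopless-⊆ (λ x → -ᴺ-⊆ {B}) ll)
      (+-cancelˡ-≤ (suc (deg B v)) _ _ (≤-trans (+-monoˡ-≤ _ (s≤s (min u lu bu))) (≤-trans (≤-reflexive (sym (-ᴺ-size B u lu bu (ll u bu)))) h)))
      where bu = proj₁ (∧-split hu)

  moon-moser : ∀ b B → InRange B → Loopless B → # N B ≤ b → Cover N (MIS B) (moon b)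
  moon-moser b B = moon-moser′ b b B ≤-refl

  branch-sized : ∀ {B} v {M} d e → InRange B → Loopless B → B v ≡ true → deg B v ≤ d → # N B ≤ suc d + e →
    (∀ u → u < N → nb B v u ≡ true → d ≤ deg B u) →
    (∀ B' → B' ⊆ᵖ B → # N B' ≤ e → Cover N (MIS B') M) → Cover N (MIS B) (suc d * M)
  branch-sized {B} v {M} d e ir ll bv dv h large c = cover-⊆ (λ _ x → x) (*-monoˡ-≤ M (s≤s dv))
    (cover-nb v ir bv (ll v bv) λ u lu hu → c (B -ᴺ u) (λ x → -ᴺ-⊆ {B}) (+-cancelˡ-≤ (suc d) _ _
      (≤-trans (+-monoˡ-≤ _ (s≤s (large u lu hu))) (≤-trans (≤-reflexive (sym (-ᴺ-size B u lu (proj₁ (∧-split hu)) (ll u (proj₁ (∧-split hu)))))) h))))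

  -- A vertex of degree at least 3 branches by (1, 4); one of degree 0 or 1 branches over its closed
  -- neighbourhood. Otherwise all degrees are 2, and for v₀ with neighbours u and w a maximal
  -- independent set contains v₀, or u, or else w but not u.
  hujter-tuza′ : ∀ fuel b B → b ≤ fuel → InRange B → Loopless B → TriangleFree B → # N B ≤ b → Cover N (MIS B) (hujter b)
  hujter-tuza′ fuel b B bf ir ll tf h with any<? N B
  ... | inj₂ none = cover-⊆ (λ _ x → x) (hujter>0 b) (cover-empty none)
  hujter-tuza′ zero zero B bf ir ll tf h | inj₁ (v , l , bv) = ⊥-elim (<⇒≱ (#-has N B l bv) h)
  hujter-tuza′ (suc fuel) b B bf ir ll tf h | inj₁ (v₀ , l₀ , b₀) = step (any<? N λ v → B v ∧ (3 ≤ᵇ deg B v)) (any<? N λ v → B v ∧ (deg B v ≤ᵇ 1))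
    where
    rec : ∀ b' → suc b' ≤ b → ∀ B' → B' ⊆ᵖ B → # N B' ≤ b' → Cover N (MIS B') (hujter b')
    rec b' lt B' s h' = hujter-tuza′ fuel b' B' (s≤s⁻¹ (≤-trans lt bf)) (inRange-⊆ s ir) (loopless-⊆ s ll) (triangleFree-⊆ s tf) h'
    size : ∀ {v} → B v ≡ true → suc (deg B v) + # N (B -ᴺ v) ≤ b
    size {v} bv = ≤-trans (≤-reflexive (sym (-ᴺ-size B v (ir v bv) bv (ll v bv)))) h
    isolated : ∀ b → # N B ≤ b → ∀ v → v < N → B v ≡ true → deg B v ≡ 0 →
      (∀ b' → suc b' ≤ b → ∀ B' → B' ⊆ᵖ B → # N B' ≤ b' → Cover N (MIS B') (hujter b')) → Cover N (MIS B) (hujter b)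
    isolated zero h v l bv d rec = ⊥-elim (<⇒≱ (#-has N B l bv) h)
    isolated (suc b) h v l bv d rec = cover-⊆ (λ _ x → x) (≤-trans (≤-reflexive (+-identityʳ _)) (hujter-suc b))
      (branch-sized v 0 b ir ll bv (≤-reflexive d) h (λ _ _ _ → z≤n) (rec b ≤-refl))
    step : (∃[ v ] v < N × (B v ∧ (3 ≤ᵇ deg B v)) ≡ true) ⊎ (∀ v → v < N → (B v ∧ (3 ≤ᵇ deg B v)) ≡ false) →
      (∃[ v ] v < N × (B v ∧ (deg B v ≤ᵇ 1)) ≡ true) ⊎ (∀ v → v < N → (B v ∧ (deg B v ≤ᵇ 1)) ≡ false) → Cover N (MIS B) (hujter b)
    step (inj₁ (v , l , e)) _ = big (m≤n⇒∃[o]m+o≡n (≤-trans (s≤s (≤-trans (≤ᵇ-true {3} {deg B v} (proj₂ (∧-split {B v} e))) (m≤m+n _ (# N (B -ᴺ v))))) (size bv)))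
      where
      bv = proj₁ (∧-split e)
      big : (∃[ e ] 4 + e ≡ b) → Cover N (MIS B) (hujter b)
      big (o , refl) = cover-⊆ (λ _ x → x) (≤-trans (≤-reflexive (+-comm (hujter o) _)) (hujter-14 o))
        (cover-split {B} {v} (rec o (m≤n+m (suc o) 3) _ (λ x → -ᴺ-⊆ {B}) (+-cancelˡ-≤ 4 _ _ (≤-trans (+-monoˡ-≤ _ (s≤s (≤ᵇ-true {3} (proj₂ (∧-split {B v} e))))) (size bv))))
          (rec (3 + o) ≤-refl _ (λ x → -ᵛ-⊆ {B} {v}) (s≤s⁻¹ (≤-trans (≤-reflexive (sym (#-remove N B l bv))) h))))
    step (inj₂ _) (inj₁ (v , l , e)) with deg B v in dv
    ... | zero = isolated b h v l (proj₁ (∧-split e)) dv rec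
    ... | suc (suc k) = true≢false e (¬true λ e' → <⇒≱ (s≤s (s≤s (z≤n {k}))) (≤ᵇ-true {suc (suc k)} {1} (proj₂ (∧-split {B v} e'))))
    ... | suc zero = leaf (m≤n⇒∃[o]m+o≡n (≤-trans (s≤s (≤-trans (≤-reflexive (sym dv)) (m≤m+n _ _))) (size bv)))
      where
      bv : B v ≡ true
      bv = proj₁ (∧-split e)
      leaf : (∃[ o ] 2 + o ≡ b) → Cover N (MIS B) (hujter b)
      leaf (o , refl) = branch-sized v 1 o ir ll bv (≤-reflexive dv) h large (rec o (m≤n+m (suc o) 1))
        where
        large : ∀ u → u < N → nb B v u ≡ true → 1 ≤ deg B u
        large u lu hu with ∨-split {v ≡ᵇ u} (proj₂ (∧-split {B u} hu))
        ... | inj₁ e with ≡ᵇ-true {v} e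
        ...   | refl = ≤-reflexive (sym dv)
        large u lu hu | inj₂ a = #-has N _ (ir v bv) (∧-join bv (adj-sym v u a))
    step (inj₂ small) (inj₂ large) = two (#-pos N (nbr v₀) (subst (0 <_) (sym (deg2 v₀ b₀)) (s≤s z≤n)))
      where
      nbr : ℕ → Pr
      nbr v x = B x ∧ adj v x
      deg2 : ∀ v → B v ≡ true → deg B v ≡ 2
      deg2 v bv = ≤-antisym
        (≮⇒≥ λ l → true≢false (∧-join bv (true-≤ᵇ l)) (small v (ir v bv)))
        (≰⇒> λ l → true≢false (∧-join bv (true-≤ᵇ l)) (large v (ir v bv)))
      two : (∃[ u ] u < N × nbr v₀ u ≡ true) → Cover N (MIS B) (hujter b)
      two (u , lu , hu) = three (#-pos N (nbr v₀ -ᵛ u) (≤-reflexive (suc-injective (trans (sym (deg2 v₀ b₀)) (#-remove N (nbr v₀) lu hu)))))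
        where
        one : # N (nbr v₀ -ᵛ u) ≡ 1
        one = sym (suc-injective (trans (sym (deg2 v₀ b₀)) (#-remove N (nbr v₀) lu hu)))
        bu = proj₁ (∧-split hu)
        three : (∃[ w ] w < N × (nbr v₀ -ᵛ u) w ≡ true) → Cover N (MIS B) (hujter b)
        three (w , lw , hw) = four (m≤n⇒∃[o]m+o≡n {4} {b} (≤-trans (≤-trans (m≤m+n 4 _) sizeW) h))
          where
          u≢w : u ≢ w
          u≢w = -ᵛ-≢ {nbr v₀} hw
          hw' : nbr v₀ w ≡ true
          hw' = -ᵛ-⊆ {nbr v₀} {u} hw
          bw = proj₁ (∧-split hw')
          none : ∀ y → y < N → ((nbr v₀ -ᵛ u) -ᵛ w) y ≡ false
          none = #-zero N _ (suc-injective (trans (sym (#-remove N (nbr v₀ -ᵛ u) lw hw)) one))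
          wu : adj w u ≡ false
          wu = ¬true λ a → tf v₀ w u b₀ bw bu (proj₂ (∧-split {B w} hw')) a (proj₂ (∧-split {B u} hu))
          -- Triangle-freeness makes u and w non-adjacent, so deleting u leaves w its two
          -- neighbours; the third branch loses u, w and both of them, four vertices in all.
          degw : 2 ≤ deg (B -ᵛ u) w
          degw = ≤-trans (≤-reflexive (sym (deg2 w bw))) (#-mono N λ x _ e → ∧-join
            (-ᵛ-keep {B} {u} (λ { refl → true≢false (proj₂ (∧-split {B u} e)) wu }) (proj₁ (∧-split e))) (proj₂ (∧-split {B x} e)))
          sizeW : 4 + # N ((B -ᵛ u) -ᴺ w) ≤ # N B
          sizeW = ≤-trans (s≤s (≤-trans (+-monoˡ-≤ _ (s≤s degw)) (≤-reflexive (sym (-ᴺ-size (B -ᵛ u) w lw (-ᵛ-keep {B} {u} u≢w bw) (ll w bw))))))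
            (≤-reflexive (sym (#-remove N B lu bu)))
          four : (∃[ o ] 4 + o ≡ b) → Cover N (MIS B) (hujter b)
          four (o , refl) = cover-⊆ (λ I m → which I m (bool? (I v₀)) (bool? (I u))) (hujter-334 o)
            (cover-⊎ (cover-⊎ (cover-in (cov b₀)) (cover-in (cov bu))) (cover-in {B -ᵛ u} {w} covW))
            where
            cov : ∀ {v} → B v ≡ true → Cover N (MIS (B -ᴺ v)) (hujter (1 + o))
            cov {v} bv = rec (1 + o) (m≤n+m (2 + o) 2) _ (λ x → -ᴺ-⊆ {B}) (+-cancelˡ-≤ 3 _ _ (≤-trans (≤-reflexive (cong (λ d → suc d + # N (B -ᴺ v)) (sym (deg2 v bv)))) (size bv)))
            covW : Cover N (MIS ((B -ᵛ u) -ᴺ w)) (hujter o)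
            covW = rec o (m≤n+m (suc o) 3) _ (λ x e → -ᵛ-⊆ {B} {u} (-ᴺ-⊆ {B -ᵛ u} e)) (+-cancelˡ-≤ 4 _ _ (≤-trans sizeW h))
            which : ∀ I → MIS B I → (I v₀ ≡ true) ⊎ (I v₀ ≡ false) → (I u ≡ true) ⊎ (I u ≡ false) →
              ((MIS B I × I v₀ ≡ true) ⊎ (MIS B I × I u ≡ true)) ⊎ (MIS (B -ᵛ u) I × I w ≡ true)
            which I m (inj₁ e) _ = inj₁ (inj₁ (m , e))
            which I m (inj₂ _) (inj₁ e) = inj₁ (inj₂ (m , e))
            which I m (inj₂ e) (inj₂ e') with dominated m v₀ b₀ e
            ... | y , iy , a with w ≟ y
            ...   | yes refl = inj₂ (mis-out m e' , iy)
            ...   | no ne = true≢false (-ᵛ-keep {nbr v₀ -ᵛ u} {w} ne (-ᵛ-keep {nbr v₀} {u} (λ { refl → true≢false iy e' }) (∧-join (sub m y iy) a))) (none y (ir y (sub m y iy)))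

  hujter-tuza : ∀ b B → InRange B → Loopless B → TriangleFree B → # N B ≤ b → Cover N (MIS B) (hujter b)
  hujter-tuza b B = hujter-tuza′ b b B ≤-refl

  -- Deciding membership for each of the at most k vertices of `D` costs a factor 2 per vertex and
  -- leaves a triangle-free graph.
  hujter-tuza-modulo : ∀ k b B D → InRange B → Loopless B → TriangleFree (B ∖ D) → # N (λ x → B x ∧ D x) ≤ k → # N B ≤ b →
    Cover N (MIS B) (2 ^ k * hujter b)
  hujter-tuza-modulo k b B D ir ll tf hk hb with any<? N (λ x → B x ∧ D x)
  ... | inj₂ none = cover-⊆ (λ _ x → x) (m≤n*m (hujter b) (2 ^ k) {{m^n≢0 2 k}}) (hujter-tuza b B ir ll
      (triangleFree-⊆ (λ x h → ∧-join h (not-false (¬true λ d → true≢false (∧-join h d) (none x (ir x h))))) tf) hb)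
  hujter-tuza-modulo zero b B D ir ll tf hk hb | inj₁ (v , l , h) = ⊥-elim (<⇒≱ (#-has N _ l h) hk)
  hujter-tuza-modulo (suc k) b B D ir ll tf hk hb | inj₁ (v , l , h) =
    cover-⊆ (λ _ x → x) (≤-reflexive (sum (2 ^ k) (hujter b))) (cover-split {B} {v} (go (B -ᴺ v) (λ x → -ᴺ-⊆ {B}) (λ x e → proj₁ (-ᴺ-out {B} e))) (go (B -ᵛ v) (λ x → -ᵛ-⊆ {B} {v}) (λ x e → -ᵛ-≢ {B} e)))
    where
    sum : ∀ a b → a * b + a * b ≡ 2 * a * b
    sum = solve-∀
    go : ∀ B' → B' ⊆ᵖ B → (∀ x → B' x ≡ true → v ≢ x) → Cover N (MIS B') (2 ^ k * hujter b)
    go B' s nv = hujter-tuza-modulo k b B' D (inRange-⊆ s ir) (loopless-⊆ s ll)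
      (triangleFree-⊆ (λ x e → ∧-join (s x (proj₁ (∧-split e))) (proj₂ (∧-split {B' x} e))) tf)
      (s≤s⁻¹ (≤-trans (s≤s (#-mono N λ x _ e → -ᵛ-keep {λ x → B x ∧ D x} {v} (nv x (proj₁ (∧-split e))) (∧-join (s x (proj₁ (∧-split e))) (proj₂ (∧-split {B' x} e)))))
        (≤-trans (≤-reflexive (sym (#-remove N (λ x → B x ∧ D x) l h))) hk)))
      (≤-trans (#-mono N λ x _ → s x) hb)

-- Containers

module GraphContainers (N : ℕ) (adj : ℕ → ℕ → Bool) (adj-sym : ∀ x y → adj x y ≡ true → adj y x ≡ true)
  (Δ q : ℕ) (growth : q ^ suc Δ ≤ suc q ^ Δ) where

  open Graph N adj adj-sym

  -- `F` consists of a core of small maximum degree and of vertices selected on the way. Each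
  -- selection removes a closed neighbourhood of at least Δ + 1 vertices, so (Δ + 1) times the
  -- number of selected vertices is at most |A| - |core|; `small` restates this.
  record Container (A F : Pr) : Set where
    constructor container
    field
      inside : F ⊆ᵖ A
      core : Pr
      core⊆ : core ⊆ᵖ F
      sparse : ∀ x → core x ≡ true → deg core x < Δ
      small : suc Δ * # N F ≤ # N A + Δ * # N core

  -- The number of containers is at most (1 + 1/q)^a. Omitting a vertex of degree at least Δ leaves
  -- a - 1 vertices, taking it at most a - 1 - Δ, and `growth` is exactly the inequality under which
  -- this recursion preserves the bound.
  Family : ℕ → Pr → Set
  Family a A = ∃ λ (L : List Pr) → length L * q ^ a ≤ suc q ^ a ×
    (∀ I → I ⊆ᵖ A → Indep I → ∃ λ F → F ∈ L × I ⊆ᵖ F) × (∀ F → F ∈ L → Container A F)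

  containers′ : ∀ fuel a A → a ≤ fuel → InRange A → Loopless A → # N A ≤ a → Family a A
  containers′ fuel a A af ir ll h with any<? N (λ v → A v ∧ (Δ ≤ᵇ deg A v))
  ... | inj₂ none = A ∷ [] , ≤-trans (≤-reflexive (+-identityʳ _)) (^-monoˡ-≤ a (n≤1+n q)) , (λ I s _ → A , here refl , s) ,
    λ { F (here refl) → container (λ _ e → e) A (λ _ e → e)
      (λ x e → ≰⇒> λ l → true≢false (∧-join e (true-≤ᵇ l)) (none x (ir x e))) ≤-refl }
  containers′ zero zero A af ir ll h | inj₁ (v , l , e) = ⊥-elim (<⇒≱ (#-has N A l (proj₁ (∧-split e))) h)
  containers′ (suc fuel) a A af ir ll h | inj₁ (v , l , e) = go (m≤n⇒∃[o]m+o≡n {suc Δ} {a} (≤-trans (m≤m+n (suc Δ) _) size))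
    where
    av : A v ≡ true
    av = proj₁ (∧-split e)
    size : suc Δ + # N (A -ᴺ v) ≤ a
    size = ≤-trans (+-monoˡ-≤ _ (s≤s (≤ᵇ-true {Δ} {deg A v} (proj₂ (∧-split {A v} e))))) (≤-trans (≤-reflexive (sym (-ᴺ-size A v l av (ll v av)))) h)
    sizeA : suc Δ + # N (A -ᴺ v) ≤ # N A
    sizeA = ≤-trans (+-monoˡ-≤ _ (s≤s (≤ᵇ-true {Δ} {deg A v} (proj₂ (∧-split {A v} e))))) (≤-reflexive (sym (-ᴺ-size A v l av (ll v av))))
    go : (∃[ o ] suc Δ + o ≡ a) → Family a A
    go (o , refl) = join (containers′ fuel (Δ + o) (A -ᵛ v) (s≤s⁻¹ af) (inRange-⊆ (λ x → -ᵛ-⊆ {A} {v}) ir) (loopless-⊆ (λ x → -ᵛ-⊆ {A} {v}) ll)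
        (s≤s⁻¹ (≤-trans (≤-reflexive (sym (#-remove N A l av))) h)))
      (containers′ fuel o (A -ᴺ v) (≤-trans (m≤n+m o Δ) (s≤s⁻¹ af)) (inRange-⊆ (λ x → -ᴺ-⊆ {A} {v}) ir) (loopless-⊆ (λ x → -ᴺ-⊆ {A} {v}) ll)
        (+-cancelˡ-≤ (suc Δ) _ _ size))
      where
      join : Family (Δ + o) (A -ᵛ v) → Family o (A -ᴺ v) → Family (suc Δ + o) A
      join (L₁ , len₁ , cov₁ , ok₁) (L₂ , len₂ , cov₂ , ok₂) = L₁ ++ map (set v true) L₂ , len , cov , ok
        where
        len : length (L₁ ++ map (set v true) L₂) * q ^ (suc Δ + o) ≤ suc q ^ (suc Δ + o)
        len = ≤-trans (≤-reflexive (trans (cong (_* q ^ (suc Δ + o)) (trans (length-++ L₁) (cong (length L₁ +_) (length-map _ L₂))))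
            (trans (*-distribʳ-+ (q ^ (suc Δ + o)) (length L₁) (length L₂))
              (cong (λ s → length L₁ * (q * q ^ (Δ + o)) + length L₂ * s) (^-distribˡ-+-* q (suc Δ) o)))))
          (arith (length L₁) (length L₂) (q ^ (Δ + o)) (q ^ suc Δ) (q ^ o) (suc q ^ (Δ + o)) (suc q ^ Δ) (suc q ^ o)
            len₁ len₂ growth (^-distribˡ-+-* (suc q) Δ o))
          where
          arith : ∀ l₁ l₂ a b c A B C → l₁ * a ≤ A → l₂ * c ≤ C → b ≤ B → A ≡ B * C → l₁ * (q * a) + l₂ * (b * c) ≤ A + q * A
          arith l₁ l₂ a b c _ B C h₁ h₂ h₃ refl = lin-sound (var 0 ⊠ (var 1 ⊠ var 2) ⊞ var 3 ⊠ (var 4 ⊠ var 5)) (var 6 ⊠ var 7 ⊞ var 1 ⊠ (var 6 ⊠ var 7)) (var 1 ⊠ (var 0 ⊠ var 2) ⊞ (var 4 ⊠ (var 3 ⊠ var 5) ⊞ var 7 ⊠ var 4)) (var 1 ⊠ (var 6 ⊠ var 7) ⊞ (var 4 ⊠ var 7 ⊞ var 7 ⊠ var 6)) (l₁ ∷ q ∷ a ∷ l₂ ∷ b ∷ c ∷ B ∷ C ∷ []) refl (q · h₁ & b · h₂ & C · h₃)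
        cov : ∀ I → I ⊆ᵖ A → Indep I → ∃ λ F → F ∈ L₁ ++ map (set v true) L₂ × I ⊆ᵖ F
        cov I s ind with bool? (I v)
        ... | inj₂ nv with cov₁ I (λ x ix → -ᵛ-keep {A} {v} (λ { refl → true≢false ix nv }) (s x ix)) ind
        ...   | F , i , sub = F , ∈-++⁺ˡ i , sub
        cov I s ind | inj₁ iv with cov₂ (I -ᵛ v) (λ x ix → -ᴺ-keep {A} (s x (-ᵛ-⊆ {I} {v} ix)) (-ᵛ-≢ {I} ix) (ind v x iv (-ᵛ-⊆ {I} {v} ix)))
            (λ x y ix iy → ind x y (-ᵛ-⊆ {I} {v} ix) (-ᵛ-⊆ {I} {v} iy))
        ... | F , i , sub = set v true F , ∈-++⁺ʳ L₁ (∈-map⁺ _ i) , λ x ix → g x ix (v ≟ x)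
          where
          g : ∀ x → I x ≡ true → Dec (v ≡ x) → set v true F x ≡ true
          g x ix (yes refl) = set-= v true F
          g x ix (no ne) = set-⊇ F v x (sub x (-ᵛ-keep {I} {v} ne ix))
        ok : ∀ F → F ∈ L₁ ++ map (set v true) L₂ → Container A F
        ok F i with ∈-++⁻ L₁ i
        ... | inj₁ i₁ with ok₁ F i₁
        ...   | container ins c cs sp sm = container (λ x h → -ᵛ-⊆ {A} {v} (ins x h)) c cs sp
          (≤-trans sm (+-monoˡ-≤ _ (#-mono N λ x _ → -ᵛ-⊆ {A} {v})))
        ok F i | inj₂ i₂ with ∈-map⁻ (set v true) i₂
        ... | F' , i' , refl with ok₂ F' i'
        ...   | container ins c cs sp sm = container inn c (λ x h → set-⊇ F' v x (cs x h)) sp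
            (arith (# N (set v true F')) (# N F') (# N (A -ᴺ v)) (# N A) (Δ * # N c) (set-insert N F' v) sm sizeA)
          where
          inn : set v true F' ⊆ᵖ A
          inn x h with set-⊆ F' v x h
          ... | inj₁ refl = av
          ... | inj₂ h' = -ᴺ-⊆ {A} {v} (ins x h')
          arith : ∀ f f' a' a c → f ≤ suc f' → suc Δ * f' ≤ a' + c → suc Δ + a' ≤ a → suc Δ * f ≤ a + c
          arith f f' a' a c h₁ h₂ h₃ = lin-sound ((con 1 ⊞ var 0) ⊠ var 1) (var 2 ⊞ var 3) ((con 1 ⊞ var 0) ⊠ var 1 ⊞ ((con 1 ⊞ var 0) ⊠ var 4 ⊞ (con 1 ⊞ var 0 ⊞ var 5))) ((con 1 ⊞ var 0) ⊠ (con 1 ⊞ var 4) ⊞ (var 5 ⊞ var 3 ⊞ var 2)) (Δ ∷ f ∷ a ∷ c ∷ f' ∷ a' ∷ []) refl (suc Δ · h₁ & h₂ & h₃)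

  containers : ∀ A → InRange A → Loopless A → Family (# N A) A
  containers A ir ll = containers′ (# N A) (# N A) A ≤-refl ir ll ≤-refl

ratio-mono : ∀ q {a b l} → a ≤ b → l * q ^ a ≤ suc q ^ a → l * q ^ b ≤ suc q ^ b
ratio-mono q {a} {b} {l} h e with m≤n⇒∃[o]m+o≡n h
... | o , refl rewrite ^-distribˡ-+-* q a o | ^-distribˡ-+-* (suc q) a o =
  ≤-trans (≤-reflexive (sym (*-assoc l (q ^ a) (q ^ o)))) (*-mono-≤ e (^-monoˡ-≤ o (n≤1+n q)))

smallSets : ℕ → ℕ → List Pr
smallSets zero k = (λ _ → false) ∷ []
smallSets (suc N) zero = map (set N false) (smallSets N zero)
smallSets (suc N) (suc k) = map (set N false) (smallSets N (suc k)) ++ map (set N true) (smallSets N k)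

-- Weight a set T by q^(-|T|). The weights of all subsets add up to (1 + 1/q)^N, and each set listed
-- has weight at least q^(-k).
smallSets-length : ∀ q → 0 < q → ∀ N k → length (smallSets N k) * q ^ N ≤ suc q ^ N * q ^ k
smallSets-length q q>0 zero k = *-mono-≤ (≤-refl {1}) (m^n>0 q {{>-nonZero q>0}} k)
smallSets-length q q>0 (suc N) zero = ≤-trans (≤-reflexive (cong (_* q ^ suc N) (length-map _ (smallSets N 0))))
  (arith (length (smallSets N 0)) (q ^ N) (suc q ^ N) (smallSets-length q q>0 N 0))
  where
  arith : ∀ l a A → l * a ≤ A * 1 → l * (q * a) ≤ (A + q * A) * 1
  arith l a A h = lin-sound (var 0 ⊠ (var 1 ⊠ var 2)) ((var 3 ⊞ var 1 ⊠ var 3) ⊠ con 1) (var 1 ⊠ (var 0 ⊠ var 2)) (var 1 ⊠ (var 3 ⊠ con 1)) (l ∷ q ∷ a ∷ A ∷ []) refl (q · h)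
smallSets-length q q>0 (suc N) (suc k) = ≤-trans (≤-reflexive (cong (_* q ^ suc N) (trans (length-++ (map (set N false) (smallSets N (suc k))))
    (cong₂ _+_ (length-map _ (smallSets N (suc k))) (length-map _ (smallSets N k))))))
  (arith (length (smallSets N (suc k))) (length (smallSets N k)) (q ^ N) (suc q ^ N) (q ^ k) (smallSets-length q q>0 N (suc k)) (smallSets-length q q>0 N k))
  where
  arith : ∀ l₁ l₂ a A b → l₁ * a ≤ A * (q * b) → l₂ * a ≤ A * b → (l₁ + l₂) * (q * a) ≤ (A + q * A) * (q * b)
  arith l₁ l₂ a A b h₁ h₂ = lin-sound ((var 0 ⊞ var 1) ⊠ (var 2 ⊠ var 3)) ((var 4 ⊞ var 2 ⊠ var 4) ⊠ (var 2 ⊠ var 5)) (var 2 ⊠ (var 0 ⊠ var 3) ⊞ var 2 ⊠ (var 1 ⊠ var 3)) (var 2 ⊠ (var 4 ⊠ (var 2 ⊠ var 5)) ⊞ var 2 ⊠ (var 4 ⊠ var 5)) (l₁ ∷ l₂ ∷ q ∷ a ∷ A ∷ b ∷ []) refl (q · h₁ & q · h₂)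

set-≈ : ∀ {N b T T'} → T N ≡ b → T ≈[ N ] T' → T ≈[ suc N ] set N b T'
set-≈ {N} {b} {T} {T'} t e x l with N ≟ x
... | yes refl = trans t (sym (set-= N b T'))
... | no ne = trans (e x (≤∧≢⇒< (s≤s⁻¹ l) λ { refl → ne refl })) (sym (set-≢ N b T' ne))

smallSets-cover : ∀ N k T → # N T ≤ k → ∃ λ T' → T' ∈ smallSets N k × T ≈[ N ] T'
smallSets-cover zero k T h = _ , here refl , λ x ()
smallSets-cover (suc N) zero T h with smallSets-cover N zero T (≤-trans (m≤m+n _ _) h)
... | T' , i , e = set N false T' , ∈-map⁺ _ i , set-≈ (#-zero (suc N) T (n≤0⇒n≡0 h) N ≤-refl) e
smallSets-cover (suc N) (suc k) T h with bool? (T N)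
... | inj₂ t with smallSets-cover N (suc k) T (≤-trans (m≤m+n _ _) h)
...   | T' , i , e = set N false T' , ∈-++⁺ˡ (∈-map⁺ _ i) , set-≈ t e
smallSets-cover (suc N) (suc k) T h | inj₁ t
  with smallSets-cover N k T (s≤s⁻¹ (≤-trans (≤-reflexive (trans (+-comm 1 _) (cong (# N T +_) (sym (ι-true t))))) h))
... | T' , i , e = set N true T' , ∈-++⁺ʳ _ (∈-map⁺ _ i) , set-≈ t e

firstK : ∀ N k X → k ≤ # N X → ∃ λ T → T ⊆ᵖ X × # N T ≡ k
firstK zero zero X h = (λ _ → false) , (λ x ()) , refl
firstK (suc N) k X h with k ≤? # N X
... | yes h' with firstK N k X h'
...   | T , s , e = (T ∖ (N ≡ᵇ_)) , (λ x p → s x (proj₁ (∧-split p))) ,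
  trans (cong₂ _+_ (#-cong N λ x l → -ᵛ-same T {N} λ { refl → <-irrefl refl l }) (ι-false (¬true λ p → -ᵛ-≢ {T} {N} p refl))) (trans (+-identityʳ _) e)
firstK (suc N) k X h | no nh = X , (λ _ p → p) , ≤-antisym (≤-trans (+-monoʳ-≤ _ (ι≤1 (X N))) (≤-trans (≤-reflexive (+-comm _ 1)) (≰⇒> nh))) h

within-⊆ : ∀ {n A F} → F ⊆ᵖ A → Within n A → Within n F
within-⊆ s (z , b) = ¬true (λ e → true≢false (s _ e) z) , λ x l → ¬true λ e → true≢false (s x e) (b x l)

-- Containers for Schur triples

SumFreeCover : ℕ → Pr → ℕ → (Pr → Set) → Set
SumFreeCover n A M P = ∃ λ (L : List Pr) → length L ≤ M ×
  (∀ S → SF S → S ⊆ᵖ A → ∃ λ F → F ∈ L × S ⊆ᵖ F) × (∀ F → F ∈ L → F ⊆ᵖ A × P F)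

-- With at least n²/d Schur triples, at least n/(2d) elements v of `A` are popular, meaning that
-- n/(2d) pairs of `A` differ by v. If a sum-free S has k popular elements T, then S is independent
-- in the graph of differences in T and graph containers apply. If it has fewer, dropping all other
-- popular elements from `A` still contains S. Either way the set shrinks by n/(16d).
module SchurStep (d Δ q B n : ℕ) (d>0 : 0 < d) (Δ>0 : 0 < Δ) (q>0 : 0 < q) (growth : q ^ suc Δ ≤ suc q ^ Δ)
  (hB : suc q ^ suc n ≤ B * q ^ suc n) (large : 16 * d * (4 * d * Δ) ≤ n) (n>0 : 0 < n)
  (A : Pr) (wA : Within n A) (many : n * n ≤ d * τ n A) where

  N k : ℕ
  N = suc n
  k = 4 * d * Δ

  qN>0 : NonZero (q ^ N)
  qN>0 = m^n≢0 q N {{>-nonZero q>0}}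

  pairs : Pr → ℕ → ℕ
  pairs X v = ∑ N λ b → ι (X b) * ι (X (v + b))

  pop : Pr
  pop v = A v ∧ (n ≤ᵇ 2 * d * pairs A v)

  #A≤n : # N A ≤ n
  #A≤n = ≤-trans (≤-reflexive (∑-head n _)) (≤-trans (≤-reflexive (cong (λ b → ι b + # n (λ x → A (suc x))) (proj₁ wA))) (#≤ n _))

  pairs≤ : ∀ v → pairs A v ≤ n
  pairs≤ v = ≤-trans (∑-mono N λ b _ → ≤-trans (*-monoʳ-≤ (ι (A b)) (ι≤1 (A (v + b)))) (≤-reflexive (*-identityʳ _))) #A≤n

  τ-pairs : τ n A ≡ ∑ N λ v → ι (A v) * pairs A v
  τ-pairs = ∑-cong N λ a _ → trans (∑-cong N λ b _ → *-assoc (ι (A a)) _ _) (∑-*ˡ N (ι (A a)) _)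

  pop-many : n ≤ 2 * d * # N pop
  pop-many = *-cancelˡ-≤ n {{>-nonZero n>0}} (arith (# N pop) (τ n A) (# N A) many le #A≤n)
    where
    arith : ∀ p t a → n * n ≤ d * t → 2 * d * t ≤ n * a + p * (2 * d * n) → a ≤ n → n * n ≤ n * (2 * d * p)
    arith p t a h₁ h₂ h₃ = lin-sound (var 0 ⊠ var 0) (var 0 ⊠ (con 2 ⊠ var 1 ⊠ var 2)) (con 2 ⊠ (var 0 ⊠ var 0) ⊞ (con 2 ⊠ var 1 ⊠ var 3 ⊞ var 0 ⊠ var 4)) (con 2 ⊠ (var 1 ⊠ var 3) ⊞ (var 0 ⊠ var 4 ⊞ var 2 ⊠ (con 2 ⊠ var 1 ⊠ var 0) ⊞ var 0 ⊠ var 0)) (n ∷ d ∷ p ∷ t ∷ a ∷ []) refl (2 · h₁ & h₂ & n · h₃)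
    pt : ∀ v → 2 * d * (ι (A v) * pairs A v) ≤ n * ι (A v) + ι (pop v) * (2 * d * n)
    pt v = ≤-trans (aux (A v) (n ≤ᵇ 2 * d * pairs A v) (pairs A v) (λ e → <⇒≤ (≤ᵇ-false e)) (pairs≤ v))
        (≤-reflexive (cong (λ s → n * ι (A v) + s * (2 * d * n)) (sym (ι-∧ (A v) (n ≤ᵇ 2 * d * pairs A v)))))
      where
      aux : ∀ b b' p → (b' ≡ false → 2 * d * p ≤ n) → p ≤ n → 2 * d * (ι b * p) ≤ n * ι b + ι b * ι b' * (2 * d * n)
      aux true true p h h' = lin-sound (con 2 ⊠ var 0 ⊠ (con 1 ⊠ var 1)) (var 2 ⊠ con 1 ⊞ con 1 ⊠ con 1 ⊠ (con 2 ⊠ var 0 ⊠ var 2)) (con 2 ⊠ var 0 ⊠ var 1) (con 2 ⊠ var 0 ⊠ var 2) (d ∷ p ∷ n ∷ []) refl (2 * d · h')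
      aux true false p h h' = lin-sound (con 2 ⊠ var 0 ⊠ (con 1 ⊠ var 1)) (var 2 ⊠ con 1 ⊞ con 1 ⊠ con 0 ⊠ (con 2 ⊠ var 0 ⊠ var 2)) (con 2 ⊠ var 0 ⊠ var 1) (var 2) (d ∷ p ∷ n ∷ []) refl (h refl)
      aux false b' p h h' = expr-≤ (con 2 ⊠ var 0 ⊠ (con 0 ⊠ var 1)) (var 2 ⊠ con 0 ⊞ con 0 ⊠ var 3 ⊠ (con 2 ⊠ var 0 ⊠ var 2)) (d ∷ p ∷ n ∷ ι b' ∷ []) refl
    le : 2 * d * τ n A ≤ n * # N A + # N pop * (2 * d * n)
    le = begin
      2 * d * τ n A ≡⟨ cong (2 * d *_) τ-pairs ⟩
      2 * d * (∑ N λ v → ι (A v) * pairs A v) ≡⟨ ∑-*ˡ N (2 * d) _ ⟨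
      (∑ N λ v → 2 * d * (ι (A v) * pairs A v)) ≤⟨ ∑-mono N (λ v _ → pt v) ⟩
      (∑ N λ v → n * ι (A v) + ι (pop v) * (2 * d * n)) ≡⟨ ∑-+ N _ _ ⟩
      (∑ N λ v → n * ι (A v)) + (∑ N λ v → ι (pop v) * (2 * d * n)) ≡⟨ cong₂ _+_ (∑-*ˡ N n _) (∑-*ʳ N (2 * d * n) _) ⟩
      n * # N A + # N pop * (2 * d * n) ∎
      where open ≤-Reasoning

  Shrunk : Pr → Set
  Shrunk F = 16 * d * # N F + n ≤ 16 * d * # N A

  pop⊆A : pop ⊆ᵖ A
  pop⊆A x h = proj₁ (∧-split h)

  module WithT (T : Pr) (T⊆pop : T ⊆ᵖ pop) (#T≤k : # N T ≤ k) where

    F₁ : Pr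
    F₁ x = (A x ∧ not (pop x)) ∨ T x

    F₁⊆A : F₁ ⊆ᵖ A
    F₁⊆A x h with ∨-split {A x ∧ not (pop x)} h
    ... | inj₁ e = proj₁ (∧-split e)
    ... | inj₂ e = pop⊆A x (T⊆pop x e)

    F₁-shrunk : Shrunk F₁
    F₁-shrunk = arith (# N F₁) (# N pop) (# N A) k le pop-many large
      where
      arith : ∀ f p a k → f + p ≤ a + k → n ≤ 2 * d * p → 16 * d * k ≤ n → 16 * d * f + n ≤ 16 * d * a
      arith f p a k h₁ h₂ h₃ = lin-sound (con 16 ⊠ var 0 ⊠ var 1 ⊞ var 2) (con 16 ⊠ var 0 ⊠ var 3) (con 16 ⊠ var 0 ⊠ (var 1 ⊞ var 4) ⊞ (con 8 ⊠ var 2 ⊞ con 16 ⊠ var 0 ⊠ var 5)) (con 16 ⊠ var 0 ⊠ (var 3 ⊞ var 5) ⊞ (con 8 ⊠ (con 2 ⊠ var 0 ⊠ var 4) ⊞ var 2)) (d ∷ f ∷ n ∷ a ∷ p ∷ k ∷ []) refl (16 * d · h₁ & 8 · h₂ & h₃)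
      pt : ∀ a p t → ι ((a ∧ not (a ∧ p)) ∨ t) + ι (a ∧ p) ≤ ι a + ι t
      pt true true t = ≤-reflexive (+-comm (ι t) 1)
      pt true false t = s≤s z≤n
      pt false p t = ≤-reflexive (+-identityʳ _)
      le : # N F₁ + # N pop ≤ # N A + k
      le = ≤-trans (≤-reflexive (sym (∑-+ N _ _))) (≤-trans (∑-mono N λ x _ → pt (A x) (n ≤ᵇ 2 * d * pairs A x) (T x))
        (≤-trans (≤-reflexive (∑-+ N _ _)) (+-monoʳ-≤ (# N A) #T≤k)))

    adj : ℕ → ℕ → Bool
    adj x y = T (x ∸ y) ∨ T (y ∸ x)

    adj-sym : ∀ x y → adj x y ≡ true → adj y x ≡ true
    adj-sym x y h = trans (∨-comm (T (y ∸ x)) (T (x ∸ y))) h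

    open Graph N adj adj-sym
    open GraphContainers N adj adj-sym Δ q growth

    T0 : T 0 ≡ false
    T0 = ¬true λ e → true≢false (pop⊆A 0 (T⊆pop 0 e)) (proj₁ wA)

    ir : InRange A
    ir x h = s≤s (within-≤ wA h)

    ll : Loopless A
    ll x _ rewrite n∸n≡0 x | T0 = refl

    family : Family (# N A) A
    family = containers A ir ll

    -- Popularity gives at least k n/(2d) = 2Δn pairs b, t + b in `A` with t in `T`, and the sparse
    -- core holds at most Δn of them. A vertex outside the core lies in at most two pairs for each
    -- t, so at least n/(8d) vertices lie outside; `small` turns at least half of that loss into a
    -- loss for `F`.
    container-shrunk : k ≤ # N T → ∀ F → Container A F → Shrunk F
    container-shrunk k≤ F (container ins A' A'⊆F sparse small) =
      arith (# N F) (# N A) (# N A') (# N (A ∖ A')) P P' split small Pbig P'small Pdiff (≤-trans #A'≤ #A≤n)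
      where
      A'⊆A : A' ⊆ᵖ A
      A'⊆A x h = ins x (A'⊆F x h)
      #A'≤ : # N A' ≤ # N A
      #A'≤ = #-mono N λ x _ → A'⊆A x
      split : # N A ≡ # N A' + # N (A ∖ A')
      split = trans (#-split N A A') (cong (_+ # N (A ∖ A')) (#-cong N λ x _ → e x (bool? (A' x))))
        where
        e : ∀ x → (A' x ≡ true) ⊎ (A' x ≡ false) → A x ∧ A' x ≡ A' x
        e x (inj₁ h) rewrite A'⊆A x h = refl
        e x (inj₂ h) rewrite h with A x
        ... | true = refl
        ... | false = refl
      P P' : ℕ
      P = ∑ N λ t → ι (T t) * pairs A t
      P' = ∑ N λ t → ι (T t) * pairs A' t
      Pbig : k * n ≤ 2 * d * P
      Pbig = begin
        k * n ≤⟨ *-monoˡ-≤ n k≤ ⟩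
        # N T * n ≡⟨ ∑-*ʳ N n _ ⟨
        (∑ N λ t → ι (T t) * n) ≤⟨ ∑-mono N (λ t _ → pt t (bool? (T t))) ⟩
        (∑ N λ t → 2 * d * (ι (T t) * pairs A t)) ≡⟨ ∑-*ˡ N (2 * d) _ ⟩
        2 * d * P ∎
        where
        open ≤-Reasoning
        pt : ∀ t → (T t ≡ true) ⊎ (T t ≡ false) → ι (T t) * n ≤ 2 * d * (ι (T t) * pairs A t)
        pt t (inj₂ e) rewrite e = z≤n
        pt t (inj₁ e) = arith' (ι (T t)) (pairs A t) (≤ᵇ-true (proj₂ (∧-split {A t} (T⊆pop t e))))
          where
          arith' : ∀ i p → n ≤ 2 * d * p → i * n ≤ 2 * d * (i * p)
          arith' i p h = lin-sound (var 0 ⊠ var 1) (con 2 ⊠ var 2 ⊠ (var 0 ⊠ var 3)) (var 0 ⊠ var 1) (var 0 ⊠ (con 2 ⊠ var 2 ⊠ var 3)) (i ∷ n ∷ d ∷ p ∷ []) refl (i · h)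
      P'small : P' ≤ Δ * # N A'
      P'small = begin
        P' ≡⟨ ∑-cong N (λ t _ → sym (∑-*ˡ N (ι (T t)) _)) ⟩
        (∑ N λ t → ∑ N λ b → ι (T t) * (ι (A' b) * ι (A' (t + b)))) ≡⟨ ∑-swap N N _ ⟩
        (∑ N λ b → ∑ N λ t → ι (T t) * (ι (A' b) * ι (A' (t + b)))) ≤⟨ ∑-mono N (λ b _ → row b (bool? (A' b))) ⟩
        (∑ N λ b → Δ * ι (A' b)) ≡⟨ ∑-*ˡ N Δ _ ⟩
        Δ * # N A' ∎
        where
        open ≤-Reasoning
        row : ∀ b → (A' b ≡ true) ⊎ (A' b ≡ false) → (∑ N λ t → ι (T t) * (ι (A' b) * ι (A' (t + b)))) ≤ Δ * ι (A' b)
        row b (inj₂ e) = ≤-trans (≤-reflexive (trans (∑-cong N λ t _ → trans (cong (λ s → ι (T t) * (ι s * ι (A' (t + b)))) e) (*-zeroʳ (ι (T t)))) (∑-zero N))) z≤n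
        row b (inj₁ e) = begin
          (∑ N λ t → ι (T t) * (ι (A' b) * ι (A' (t + b)))) ≤⟨ ∑-mono N (λ t _ → pt t) ⟩
          (∑ N λ t → ι (A' (b + t) ∧ adj b (b + t))) ≤⟨ ∑-shift b N (λ y → ι (A' y ∧ adj b y)) ⟩
          (∑ (b + N) λ y → ι (A' y ∧ adj b y)) ≡⟨ ∑-tail0 _ (m≤n+m N b) (λ y l → ι-false (¬true λ h → <⇒≱ (ir y (A'⊆A y (proj₁ (∧-split h)))) l)) ⟩
          deg A' b ≤⟨ <⇒≤ (sparse b e) ⟩
          Δ ≡⟨ trans (cong (λ s → Δ * ι s) e) (*-identityʳ Δ) ⟨
          Δ * ι (A' b) ∎
          where
          pt : ∀ t → ι (T t) * (ι (A' b) * ι (A' (t + b))) ≤ ι (A' (b + t) ∧ adj b (b + t))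
          pt t rewrite +-comm t b | m+n∸m≡n b t = aux (T t) (A' b) (A' (b + t)) (T (b ∸ (b + t)))
            where
            aux : ∀ t a a' z → ι t * (ι a * ι a') ≤ ι (a' ∧ (z ∨ t))
            aux true true true true = ≤-refl
            aux true true true false = ≤-refl
            aux true true false z = z≤n
            aux true false a' z = z≤n
            aux false a a' z = z≤n
      Pdiff : P ≤ P' + k * (2 * # N (A ∖ A'))
      Pdiff = begin
        P ≤⟨ ∑-mono N (λ t _ → *-monoʳ-≤ (ι (T t)) (one t)) ⟩
        (∑ N λ t → ι (T t) * (pairs A' t + 2 * # N (A ∖ A'))) ≡⟨ trans (∑-cong N λ t _ → *-distribˡ-+ (ι (T t)) _ _) (∑-+ N _ _) ⟩
        P' + (∑ N λ t → ι (T t) * (2 * # N (A ∖ A'))) ≡⟨ cong (P' +_) (∑-*ʳ N _ _) ⟩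
        P' + # N T * (2 * # N (A ∖ A')) ≤⟨ +-monoʳ-≤ P' (*-monoˡ-≤ _ #T≤k) ⟩
        P' + k * (2 * # N (A ∖ A')) ∎
        where
        open ≤-Reasoning
        D : Pr
        D = A ∖ A'
        one : ∀ t → pairs A t ≤ pairs A' t + 2 * # N D
        one t = begin
          pairs A t ≤⟨ ∑-mono N (λ b _ → pt (A b) (A' b) (A (t + b)) (A' (t + b))) ⟩
          (∑ N λ b → ι (A' b) * ι (A' (t + b)) + (ι (D b) + ι (D (t + b)))) ≡⟨ trans (∑-+ N _ _) (cong (pairs A' t +_) (∑-+ N _ _)) ⟩
          pairs A' t + (# N D + ∑ N λ b → ι (D (t + b))) ≤⟨ +-monoʳ-≤ (pairs A' t) (+-monoʳ-≤ (# N D) (≤-trans (∑-shift t N (λ y → ι (D y)))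
              (≤-reflexive (∑-tail0 _ (m≤n+m N t) λ y l → ι-false (¬true λ h → <⇒≱ (ir y (proj₁ (∧-split h))) l))))) ⟩
          pairs A' t + (# N D + # N D) ≡⟨ cong (λ s → pairs A' t + (# N D + s)) (sym (+-identityʳ _)) ⟩
          pairs A' t + 2 * # N D ∎
          where
          pt : ∀ a a' b b' → ι a * ι b ≤ ι a' * ι b' + (ι (a ∧ not a') + ι (b ∧ not b'))
          pt false a' b b' = z≤n
          pt true a' false b' = z≤n
          pt true false true b' = s≤s z≤n
          pt true true true false = s≤s z≤n
          pt true true true true = ≤-refl
      arith : ∀ f a a' r P P' → a ≡ a' + r → suc Δ * f ≤ a + Δ * a' → 4 * d * Δ * n ≤ 2 * d * P → P' ≤ Δ * a' →
        P ≤ P' + 4 * d * Δ * (2 * r) → a' ≤ n → 16 * d * f + n ≤ 16 * d * a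
      arith f _ a' r P P' refl h₁ h₂ h₃ h₄ h₅ = *-cancelˡ-≤ (suc Δ) (lin-sound ((con 1 ⊞ var 0) ⊠ (con 16 ⊠ var 1 ⊠ var 2 ⊞ var 3)) ((con 1 ⊞ var 0) ⊠ (con 16 ⊠ var 1 ⊠ (var 4 ⊞ var 5))) (con 16 ⊠ var 1 ⊠ ((con 1 ⊞ var 0) ⊠ var 2) ⊞ (con 2 ⊠ var 0 ⊠ var 3 ⊞ var 3 ⊠ (con 1 ⊞ con 0))) (con 16 ⊠ var 1 ⊠ (var 4 ⊞ var 5 ⊞ var 0 ⊠ var 4) ⊞ (con 2 ⊠ var 0 ⊠ (con 8 ⊠ var 1 ⊠ var 5) ⊞ var 3 ⊠ var 0)) (Δ ∷ d ∷ f ∷ n ∷ a' ∷ r ∷ []) refl (16 * d · h₁ & 2 * Δ · drop & n · Δ>0))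
        where
        drop : n ≤ 8 * d * r
        drop = *-cancelˡ-≤ (2 * d * Δ) {{>-nonZero (*-mono-≤ (*-mono-≤ (s≤s (z≤n {1})) d>0) Δ>0)}} (lin-sound (con 2 ⊠ var 0 ⊠ var 1 ⊠ var 2) (con 2 ⊠ var 0 ⊠ var 1 ⊠ (con 8 ⊠ var 0 ⊠ var 3)) (con 4 ⊠ var 0 ⊠ var 1 ⊠ var 2 ⊞ (con 2 ⊠ var 0 ⊠ var 4 ⊞ (con 2 ⊠ var 0 ⊠ var 5 ⊞ con 2 ⊠ var 0 ⊠ var 1 ⊠ var 6))) (con 2 ⊠ var 0 ⊠ var 5 ⊞ (con 2 ⊠ var 0 ⊠ (var 1 ⊠ var 6) ⊞ (con 2 ⊠ var 0 ⊠ (var 4 ⊞ con 4 ⊠ var 0 ⊠ var 1 ⊠ (con 2 ⊠ var 3)) ⊞ con 2 ⊠ var 0 ⊠ var 1 ⊠ var 2))) (d ∷ Δ ∷ n ∷ r ∷ P' ∷ P ∷ a' ∷ []) refl (h₂ & 2 * d · h₃ & 2 * d · h₄ & 2 * d * Δ · h₅))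

  cap : Pr → Pr
  cap T x = pop x ∧ T x

  one : ∀ T → ∃ λ (L : List Pr) → length L ≤ suc B ×
    (∀ F → F ∈ L → F ⊆ᵖ A × Shrunk F) ×
    (∀ S → SF S → S ⊆ᵖ A → cap T ⊆ᵖ S → # N (cap T) ≤ k → k ≤ # N (cap T) ⊎ (λ x → S x ∧ pop x) ⊆ᵖ cap T →
      ∃ λ F → F ∈ L × S ⊆ᵖ F)
  one T with # N (cap T) ≤? k
  ... | no nk = [] , z≤n , (λ F ()) , λ S _ _ _ h → ⊥-elim (nk h)
  ... | yes hk with k ≤? # N (cap T) | W.family
    where module W = WithT (cap T) (λ x h → proj₁ (∧-split h)) hk
  ...   | no k≰ | _ = W.F₁ ∷ [] , s≤s z≤n , (λ { F (here refl) → W.F₁⊆A , W.F₁-shrunk }) ,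
      λ { S sf sA cs _ (inj₁ h) → ⊥-elim (k≰ h)
        ; S sf sA cs _ (inj₂ h) → W.F₁ , here refl , λ x sx → cover S x (sA x sx) sx h }
    where
    module W = WithT (cap T) (λ x h → proj₁ (∧-split h)) hk
    cover : ∀ S x → A x ≡ true → S x ≡ true → (λ x → S x ∧ pop x) ⊆ᵖ cap T → W.F₁ x ≡ true
    cover S x ax sx h with bool? (pop x)
    ... | inj₁ p = ∨-right {A x ∧ not (pop x)} (h x (∧-join sx p))
    ... | inj₂ p = ∨-left (∧-join ax (not-false p))
  ...   | yes k≤ | (L , len , cov , ok) = W.F₁ ∷ L , s≤s lenB ,
      (λ { F (here refl) → W.F₁⊆A , W.F₁-shrunk ; F (there i) → C.Container.inside (ok F i) , W.container-shrunk k≤ F (ok F i) }) ,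
      λ { S sf sA cs _ _ → let (F , i , s) = cov S sA (indep S sf cs) in F , there i , s }
    where
    module W = WithT (cap T) (λ x h → proj₁ (∧-split h)) hk
    module C = GraphContainers N W.adj W.adj-sym Δ q growth
    lenB : length L ≤ B
    lenB = *-cancelʳ-≤ (length L) B (q ^ N) {{qN>0}} (≤-trans (ratio-mono q {# N A} {N} {length L} (#≤ N A) len) hB)
    indep : ∀ S → SF S → cap T ⊆ᵖ S → Graph.Indep N W.adj W.adj-sym S
    indep S sf cs x y sx sy = ¬true λ a → g (∨-split {cap T (x ∸ y)} a)
      where
      away : ∀ x y → cap T (x ∸ y) ≡ true → S x ≡ true → S y ≡ true → ⊥
      away x y h sx sy = true≢false sx (subst (λ v → S v ≡ false) (m∸n+n≡m y≤x) (sf (x ∸ y) y (cs (x ∸ y) h) sy))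
        where
        y≤x : y ≤ x
        y≤x = <⇒≤ (m∸n≢0⇒n<m λ e → true≢false (subst (λ v → cap T v ≡ true) e h) W.T0)
      g : (cap T (x ∸ y) ≡ true) ⊎ (cap T (y ∸ x) ≡ true) → ⊥
      g (inj₁ h) = away x y h sx sy
      g (inj₂ h) = away y x h sy sx

  concat : (Ts : List Pr) → ∃ λ (L : List Pr) → length L ≤ length Ts * suc B ×
    (∀ F → F ∈ L → F ⊆ᵖ A × Shrunk F) ×
    (∀ T S → T ∈ Ts → SF S → S ⊆ᵖ A → cap T ⊆ᵖ S → # N (cap T) ≤ k → k ≤ # N (cap T) ⊎ (λ x → S x ∧ pop x) ⊆ᵖ cap T →
      ∃ λ F → F ∈ L × S ⊆ᵖ F)
  concat [] = [] , z≤n , (λ F ()) , λ T S ()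
  concat (T ∷ Ts) with one T | concat Ts
  ... | L₁ , len₁ , ok₁ , cov₁ | L₂ , len₂ , ok₂ , cov₂ = L₁ ++ L₂ , ≤-trans (≤-reflexive (length-++ L₁)) (+-mono-≤ len₁ len₂) , ok , cov
    where
    ok : ∀ F → F ∈ L₁ ++ L₂ → F ⊆ᵖ A × Shrunk F
    ok F i with ∈-++⁻ L₁ i
    ... | inj₁ j = ok₁ F j
    ... | inj₂ j = ok₂ F j
    cov : ∀ T' S → T' ∈ T ∷ Ts → SF S → S ⊆ᵖ A → cap T' ⊆ᵖ S → # N (cap T') ≤ k → k ≤ # N (cap T') ⊎ (λ x → S x ∧ pop x) ⊆ᵖ cap T' →
      ∃ λ F → F ∈ L₁ ++ L₂ × S ⊆ᵖ F
    cov _ S (here refl) sf sA c h h' with cov₁ S sf sA c h h'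
    ... | F , i , s = F , ∈-++⁺ˡ i , s
    cov T' S (there i) sf sA c h h' with cov₂ T' S i sf sA c h h'
    ... | F , j , s = F , ∈-++⁺ʳ L₁ j , s

  schur-step : SumFreeCover n A (B * q ^ k * suc B) Shrunk
  schur-step with concat (smallSets N k)
  ... | L , len , ok , cov = L , ≤-trans len (*-monoˡ-≤ (suc B) lenT) , cover , ok
    where
    lenT : length (smallSets N k) ≤ B * q ^ k
    lenT = *-cancelʳ-≤ _ (B * q ^ k) (q ^ N) {{qN>0}} (≤-trans (smallSets-length q q>0 N k)
      (≤-trans (*-monoˡ-≤ (q ^ k) hB) (≤-reflexive (e B (q ^ N) (q ^ k)))))
      where
      e : ∀ a b c → a * b * c ≡ a * c * b
      e = solve-∀
    popN : ∀ x → pop x ≡ true → x < N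
    popN x h = s≤s (within-≤ wA (pop⊆A x h))
    use : ∀ S → SF S → S ⊆ᵖ A → ∀ T → T ⊆ᵖ (λ x → S x ∧ pop x) → # N T ≤ k → k ≤ # N T ⊎ (λ x → S x ∧ pop x) ⊆ᵖ T → ∃ λ F → F ∈ L × S ⊆ᵖ F
    use S sf sA T sT hk alt with smallSets-cover N k T hk
    ... | T' , i , e = cov T' S i sf sA (λ x h → proj₁ (∧-split (sT x (back x h)))) (subst (_≤ k) eq hk) (alt' alt)
      where
      back : ∀ x → cap T' x ≡ true → T x ≡ true
      back x h = trans (e x (popN x (proj₁ (∧-split h)))) (proj₂ (∧-split {pop x} h))
      forth : ∀ x → T x ≡ true → cap T' x ≡ true
      forth x h = ∧-join px (trans (sym (e x (popN x px))) h)
        where px = proj₂ (∧-split {S x} (sT x h))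
      eq : # N T ≡ # N (cap T')
      eq = ≤-antisym (#-mono N λ x _ → forth x) (#-mono N λ x _ → back x)
      alt' : k ≤ # N T ⊎ (λ x → S x ∧ pop x) ⊆ᵖ T → k ≤ # N (cap T') ⊎ (λ x → S x ∧ pop x) ⊆ᵖ cap T'
      alt' (inj₁ h) = inj₁ (subst (k ≤_) eq h)
      alt' (inj₂ h) = inj₂ λ x p → forth x (h x p)
    cover : ∀ S → SF S → S ⊆ᵖ A → ∃ λ F → F ∈ L × S ⊆ᵖ F
    cover S sf sA with k ≤? # N (λ x → S x ∧ pop x)
    ... | no k≰ = use S sf sA _ (λ _ h → h) (<⇒≤ (≰⇒> k≰)) (inj₂ λ _ h → h)
    ... | yes k≤ with firstK N k (λ x → S x ∧ pop x) k≤
    ...   | T , sT , eT = use S sf sA T sT (≤-reflexive eT) (inj₁ (≤-reflexive (sym eT)))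

module SchurContainers (d Δ q B n : ℕ) (d>0 : 0 < d) (Δ>0 : 0 < Δ) (q>0 : 0 < q) (growth : q ^ suc Δ ≤ suc q ^ Δ)
  (hB : suc q ^ suc n ≤ B * q ^ suc n) (large : 16 * d * (4 * d * Δ) ≤ n) (n>0 : 0 < n) where

  step-bound : ℕ
  step-bound = B * q ^ (4 * d * Δ) * suc B

  Few : Pr → Set
  Few F = d * τ n F ≤ n * n

  B>0 : 0 < B
  B>0 = n≢0⇒n>0 λ { refl → <⇒≱ (m^n>0 (suc q) (suc n)) hB }

  step-bound>0 : 0 < step-bound
  step-bound>0 = *-mono-≤ (*-mono-≤ B>0 (m^n>0 q {{>-nonZero q>0}} (4 * d * Δ))) (s≤s z≤n)

  τ-empty : ∀ A → # (suc n) A ≡ 0 → τ n A ≡ 0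
  τ-empty A h = trans (∑-cong (suc n) λ a l → trans (∑-cong (suc n) λ b _ → cong (λ s → ι s * ι (A b) * ι (A (a + b))) (#-zero (suc n) A h a l)) (∑-zero (suc n))) (∑-zero (suc n))

  -- The size hypothesis allows `j` rounds: each step lowers |A| by n/(16d), and an empty set has no
  -- Schur triples.
  iterate : ∀ j A → Within n A → 16 * d * # (suc n) A ≤ j * n → SumFreeCover n A (step-bound ^ j) Few
  iterate j A w h with d * τ n A ≤? n * n
  ... | yes few = A ∷ [] , m^n>0 step-bound {{>-nonZero step-bound>0}} j , (λ S _ s → A , here refl , s) , λ { F (here refl) → (λ _ e → e) , few }
  iterate zero A w h | no nf = ⊥-elim (nf (≤-trans (≤-reflexive (trans (cong (d *_) (τ-empty A z)) (*-zeroʳ d))) z≤n))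
    where
    z : # (suc n) A ≡ 0
    z = n≤0⇒n≡0 (*-cancelˡ-≤ (16 * d) {{>-nonZero (*-mono-≤ (s≤s (z≤n {15})) d>0)}} (≤-trans h z≤n))
  iterate (suc j) A w h | no nf with SchurStep.schur-step d Δ q B n d>0 Δ>0 q>0 growth hB large n>0 A w (<⇒≤ (≰⇒> nf))
  ... | L , len , cov , ok = go
    where
    next-h : ∀ F → F ∈ L → 16 * d * # (suc n) F ≤ j * n
    next-h F i = arith (16 * d * # (suc n) F) (16 * d * # (suc n) A) (proj₂ (ok F i)) h
      where
      arith : ∀ f a → f + n ≤ a → a ≤ suc j * n → f ≤ j * n
      arith f a h₁ h₂ = lin-sound (var 0) (var 1 ⊠ var 2) (var 0 ⊞ var 2 ⊞ var 3) (var 3 ⊞ (con 1 ⊞ var 1) ⊠ var 2) (f ∷ j ∷ n ∷ a ∷ []) refl (h₁ & h₂)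
    build : ∀ L' → (∀ F → F ∈ L' → F ∈ L) → ∃ λ (R : List Pr) → length R ≤ length L' * step-bound ^ j ×
      (∀ F S → F ∈ L' → SF S → S ⊆ᵖ F → ∃ λ G → G ∈ R × S ⊆ᵖ G) × (∀ G → G ∈ R → G ⊆ᵖ A × Few G)
    build [] _ = [] , z≤n , (λ F S ()) , λ G ()
    build (F ∷ L') s with iterate j F (within-⊆ (proj₁ (ok F (s F (here refl)))) w) (next-h F (s F (here refl))) | build L' (λ F i → s F (there i))
    ... | R₁ , l₁ , c₁ , o₁ | R₂ , l₂ , c₂ , o₂ = R₁ ++ R₂ , ≤-trans (≤-reflexive (length-++ R₁)) (+-mono-≤ l₁ l₂) , c , o
      where
      c : ∀ F' S → F' ∈ F ∷ L' → SF S → S ⊆ᵖ F' → ∃ λ G → G ∈ R₁ ++ R₂ × S ⊆ᵖ G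
      c _ S (here refl) sf sF with c₁ S sf sF
      ... | G , i , e = G , ∈-++⁺ˡ i , e
      c F' S (there i) sf sF with c₂ F' S i sf sF
      ... | G , i , e = G , ∈-++⁺ʳ R₁ i , e
      o : ∀ G → G ∈ R₁ ++ R₂ → G ⊆ᵖ A × Few G
      o G i with ∈-++⁻ R₁ i
      ... | inj₁ k = (λ x e → proj₁ (ok F (s F (here refl))) x (proj₁ (o₁ G k) x e)) , proj₂ (o₁ G k)
      ... | inj₂ k = o₂ G k
    go : SumFreeCover n A (step-bound ^ suc j) Few
    go with build L (λ _ i → i)
    ... | R , l , c , o = R , ≤-trans l (*-monoˡ-≤ (step-bound ^ j) len) , (λ S sf sA → let (F , i , s) = cov S sf sA in c F S i sf s) , o

  interval : Pr
  interval x = (1 ≤ᵇ x) ∧ (x ≤ᵇ n)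

  interval-within : Within n interval
  interval-within = refl , λ x l → ¬true λ e → <⇒≱ l (≤ᵇ-true (proj₂ (∧-split {1 ≤ᵇ x} e)))

  schur-containers : SumFreeCover n interval (step-bound ^ (16 * d)) Few
  schur-containers = iterate (16 * d) interval interval-within (*-monoʳ-≤ (16 * d)
    (≤-trans (≤-reflexive (∑-head n _)) (#≤ n _)))

-- Large sum-free sets

odd : ℕ → Bool
odd zero = false
odd (suc n) = not (odd n)

odd-2+ : ∀ n → odd (2 + n) ≡ odd n
odd-2+ n with odd n
... | true = refl
... | false = refl

odd-+ : ∀ x y → odd (x + y) ≡ (if odd x then not (odd y) else odd y)
odd-+ zero y = refl
odd-+ (suc x) y rewrite odd-+ x y with odd x | odd y
... | true | true = refl
... | true | false = refl
... | false | b = refl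

even-half : ∀ n → odd n ≡ false → ∃[ j ] n ≡ j * 2
even-half zero h = 0 , refl
even-half (suc (suc n)) h with even-half n (trans (sym (odd-2+ n)) h)
... | j , refl = suc j , refl

evens : ∀ n → 2 * # n (λ x → not (odd x)) ≤ n + ι (odd n)
evens zero = z≤n
evens (suc n) = aux (odd n) (# n (λ x → not (odd x))) (evens n)
  where
  aux : ∀ b s → 2 * s ≤ n + ι b → 2 * (s + ι (not b)) ≤ suc n + ι (not b)
  aux true s h = ≤-trans (≤-reflexive e₁) (≤-trans h (≤-reflexive e₂))
    where
    e₁ : 2 * (s + 0) ≡ 2 * s
    e₁ = expr-≡ (con 2 ⊠ (var 0 ⊞ con 0)) (con 2 ⊠ var 0) (s ∷ []) refl
    e₂ : n + 1 ≡ suc n + 0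
    e₂ = expr-≡ (var 0 ⊞ con 1) (con 1 ⊞ var 0 ⊞ con 0) (n ∷ []) refl
  aux false s h = ≤-trans (≤-reflexive e₁) (≤-trans (+-monoˡ-≤ 2 h) (≤-reflexive e₂))
    where
    e₁ : 2 * (s + 1) ≡ 2 * s + 2
    e₁ = expr-≡ (con 2 ⊠ (var 0 ⊞ con 1)) (con 2 ⊠ var 0 ⊞ con 2) (s ∷ []) refl
    e₂ : n + 0 + 2 ≡ suc n + 1
    e₂ = expr-≡ (var 0 ⊞ con 0 ⊞ con 2) (con 1 ⊞ var 0 ⊞ con 1) (n ∷ []) refl

∑-periodic : ∀ ℓ u → (∀ x → u (ℓ + x) ≡ u x) → ∀ d → ∑ ℓ (λ x → u (d + x)) ≡ ∑ ℓ u
∑-periodic ℓ u per zero = refl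
∑-periodic ℓ u per (suc d) = trans (+-cancelˡ-≡ (u d) _ _ eq) (∑-periodic ℓ u per d)
  where
  eq : u d + ∑ ℓ (λ x → u (suc d + x)) ≡ u d + ∑ ℓ (λ x → u (d + x))
  eq = trans (cong₂ _+_ (cong u (sym (+-identityʳ d))) (∑-cong ℓ λ x _ → cong u (sym (+-suc d x))))
    (trans (sym (∑-head ℓ (λ x → u (d + x)))) (trans (cong (∑ ℓ (λ x → u (d + x)) +_) (trans (cong u (+-comm d ℓ)) (per d))) (+-comm _ (u d))))

-- B is reduced modulo ℓ = max B − min B; X is the resulting ℓ-periodic set.
module Structure (n : ℕ) (B : Pr) (wB : Within n B) (sf : SF B)
  (dense : 15 * n < 32 * # (suc n) B) (n≥200 : 200 ≤ n)
  (m ℓ' : ℕ) (Bm : B m ≡ true) (m-min : ∀ x → B x ≡ true → m ≤ x)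
  (BM : B (m + suc ℓ') ≡ true) (M-max : ∀ x → B x ≡ true → x ≤ m + suc ℓ') where

  N b ℓ M : ℕ
  N = suc n
  b = # N B
  ℓ = suc ℓ'
  M = m + ℓ

  M≤n : M ≤ n
  M≤n = within-≤ wB BM

  below : ∀ x → x < m → B x ≡ false
  below x l = ¬true λ e → <⇒≱ l (m-min x e)

  above : ∀ x → M < x → B x ≡ false
  above x l = ¬true λ e → <⇒≱ l (M-max x e)

  β : ℕ → ℕ
  β x = ι (B x)

  ∑-below : ∀ k → ∑ (m + k) β ≡ ∑ k (λ x → β (m + x))
  ∑-below k = trans (∑-split m k β) (cong (_+ ∑ k (λ x → β (m + x))) (#-empty m B below))

  b-eq : b ≡ ∑ (suc ℓ) (λ x → β (m + x))
  b-eq = trans (∑-tail0 β (s≤s M≤n) (λ x l → ι-false (above x l))) (trans (cong (λ k → ∑ k β) (sym (+-suc m ℓ))) (∑-below (suc ℓ)))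

  X : Pr
  X x = B (m + x % ℓ)

  X-per : ∀ x → X (ℓ + x) ≡ X x
  X-per x = cong (λ y → B (m + y)) (trans (cong (_% ℓ) (+-comm ℓ x)) ([m+n]%n≡m%n x ℓ))

  X-small : ∀ x → x < ℓ → X x ≡ B (m + x)
  X-small x l = cong (λ y → B (m + y)) (m<n⇒m%n≡m l)

  ξ : ℕ → ℕ
  ξ x = ι (X x)

  ξ-per : ∀ x → ξ (ℓ + x) ≡ ξ x
  ξ-per x = cong ι (X-per x)

  xs : ℕ
  xs = ∑ ℓ ξ

  xs-eq : xs ≡ ∑ ℓ (λ x → β (m + x))
  xs-eq = ∑-cong ℓ λ x l → cong ι (X-small x l)

  -- The minimum m and the maximum m + ℓ coincide modulo ℓ; this is the only collision.
  b≡ : b ≡ suc xs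
  b≡ = trans b-eq (trans (cong₂ _+_ (sym xs-eq) (ι-true BM)) (+-comm xs 1))

  K : ℕ → Set
  K d = ∃[ x ] X x ≡ true × X (d + x) ≡ true

  -- An upper bound for the difference set of `X` modulo ℓ: if two members of `B` differ by y, then
  -- y is outside `B`; if the difference wraps around, then ℓ - y is outside `B`.
  kset : Pr
  kset y = (y ≡ᵇ 0) ∨ (not (B y) ∨ not (B (ℓ ∸ y)))

  κ : ℕ
  κ = # ℓ kset

  K-kset : ∀ x y → y < ℓ → X x ≡ true → X (y + x) ≡ true → kset y ≡ true
  K-kset x y ly hx hy = go (x′ + y <? ℓ)
    where
    x′ = x % ℓ
    lx : x′ < ℓ
    lx = m%n<n x ℓ
    hy′ : B (m + (x′ + y) % ℓ) ≡ true
    hy′ = trans (cong (λ z → B (m + z)) (trans (cong (λ z → (x′ + z) % ℓ) (sym (m<n⇒m%n≡m ly))) (trans (sym (%-distribˡ-+ x y ℓ)) (cong (_% ℓ) (+-comm x y))))) hy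
    go : Dec (x′ + y < ℓ) → kset y ≡ true
    go (yes l) = ∨-right {y ≡ᵇ 0} (∨-left (not-false (¬true λ by → true≢false
      (trans (cong B (trans (e m x′ y) (cong (m +_) (sym (m<n⇒m%n≡m l))))) hy′) (sf (m + x′) y hx by))))
      where
      e : ∀ m x y → m + x + y ≡ m + (x + y)
      e = solve-∀
    go (no nl) with m≤n⇒∃[o]m+o≡n (≮⇒≥ nl)
    ... | z , ez = ∨-right {y ≡ᵇ 0} (∨-right {not (B y)} (not-false (¬true λ bl → true≢false
        (trans (cong B eq₂) hx) (sf (m + z) (ℓ ∸ y) bz bl))))
      where
      z<ℓ : z < ℓ
      z<ℓ = +-cancelˡ-< ℓ z ℓ (subst (_< ℓ + ℓ) (sym ez) (+-mono-< lx ly))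
      bz : B (m + z) ≡ true
      bz = trans (cong (λ w → B (m + w)) (sym (trans (cong (_% ℓ) (sym ez)) (trans (cong (_% ℓ) (+-comm ℓ z)) (trans ([m+n]%n≡m%n z ℓ) (m<n⇒m%n≡m z<ℓ)))))) hy′
      eq₂ : m + z + (ℓ ∸ y) ≡ m + x′
      eq₂ = trans (+-assoc m z (ℓ ∸ y)) (cong (m +_) (+-cancelʳ-≡ y _ _ (trans (+-assoc z (ℓ ∸ y) y) (trans (cong (z +_) (m∸n+n≡m (<⇒≤ ly))) (trans (+-comm z ℓ) ez)))))

  -- If m + y is in `B`, neither y nor ℓ - y is, because m and m + ℓ are in `B`. Hence at least |X|
  -- - 1 values y satisfy both conditions of `kset`, and inclusion-exclusion subtracts them from
  -- twice the complement of `B` in [1, ℓ - 1]. That complement is bounded because at most m + 1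
  -- elements of `B` are ℓ or larger.
  κ-bound : κ + 3 * b ≤ 2 * M + 3
  κ-bound = arith κ xs qs sb b κ≤ both-many qs-eq b≤ b≡
    where
    Q : Pr
    Q y = not (B y)
    qs both sb : ℕ
    qs = ∑ ℓ' (λ x → ι (Q (suc x)))
    both = ∑ ℓ' (λ x → ι (Q (suc x) ∧ Q (ℓ ∸ suc x)))
    sb = ∑ ℓ' (λ x → β (suc x))
    qr : ∑ ℓ' (λ x → ι (Q (ℓ ∸ suc x))) ≡ qs
    qr = trans (∑-cong ℓ' λ x l → cong (λ z → ι (Q z)) (sym (suc-∸ x l))) (∑-rev ℓ' (λ x → ι (Q (suc x))))
      where
      suc-∸ : ∀ x → x < ℓ' → suc (ℓ' ∸ suc x) ≡ ℓ' ∸ x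
      suc-∸ x l = sym (+-∸-assoc 1 l)
    κ≤ : κ + both ≤ 1 + (qs + qs)
    κ≤ = begin
      κ + both ≡⟨ cong (_+ both) (∑-head ℓ' (λ y → ι (kset y))) ⟩
      1 + ∑ ℓ' (λ x → ι (Q (suc x) ∨ Q (ℓ ∸ suc x))) + both ≡⟨ +-assoc 1 _ both ⟩
      1 + (∑ ℓ' (λ x → ι (Q (suc x) ∨ Q (ℓ ∸ suc x))) + both) ≡⟨ cong (1 +_) (∑-+ ℓ' _ _) ⟨
      1 + ∑ ℓ' (λ x → ι (Q (suc x) ∨ Q (ℓ ∸ suc x)) + ι (Q (suc x) ∧ Q (ℓ ∸ suc x))) ≡⟨ cong (1 +_) (∑-cong ℓ' λ x _ → pt (Q (suc x)) (Q (ℓ ∸ suc x))) ⟩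
      1 + ∑ ℓ' (λ x → ι (Q (suc x)) + ι (Q (ℓ ∸ suc x))) ≡⟨ cong (1 +_) (trans (∑-+ ℓ' _ _) (cong (qs +_) qr)) ⟩
      1 + (qs + qs) ∎
      where
      open ≤-Reasoning
      pt : ∀ p q → ι (p ∨ q) + ι (p ∧ q) ≡ ι p + ι q
      pt true q = refl
      pt false q = +-identityʳ _
    both-many : xs ≤ 1 + both
    both-many = ≤-trans (≤-reflexive (trans xs-eq (∑-head ℓ' _))) (+-mono-≤ (ι≤1 (B (m + 0))) (∑-mono ℓ' λ x l → ι-mono (g x l)))
      where
      g : ∀ x → x < ℓ' → B (m + suc x) ≡ true → (Q (suc x) ∧ Q (ℓ ∸ suc x)) ≡ true
      g x l h = ∧-join (not-false (¬true λ e → true≢false h (sf m (suc x) Bm e)))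
        (not-false (¬true λ e → true≢false (trans (cong B eq) BM) (sf (m + suc x) (ℓ ∸ suc x) h e)))
        where
        eq : m + suc x + (ℓ ∸ suc x) ≡ m + ℓ
        eq = trans (+-assoc m (suc x) _) (cong (m +_) (m+[n∸m]≡n (s≤s (<⇒≤ l))))
    qs-eq : sb + qs ≡ ℓ'
    qs-eq = trans (sym (∑-+ ℓ' _ _)) (trans (∑-cong ℓ' λ x _ → ι-not (B (suc x))) (trans (∑-const ℓ' 1) (*-identityʳ ℓ')))
    b≤ : b ≤ sb + suc m
    b≤ = begin
      b ≡⟨ ∑-tail0 β (s≤s M≤n) (λ x l → ι-false (above x l)) ⟩
      ∑ (suc (m + ℓ)) β ≡⟨ cong (λ k → ∑ k β) eM ⟩
      ∑ (ℓ + suc m) β ≡⟨ ∑-split ℓ (suc m) β ⟩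
      ∑ ℓ β + ∑ (suc m) (λ x → β (ℓ + x)) ≤⟨ +-mono-≤ (≤-reflexive (trans (∑-head ℓ' β) (cong (λ c → ι c + sb) (proj₁ wB)))) (#≤ (suc m) (λ x → B (ℓ + x))) ⟩
      sb + suc m ∎
      where
      open ≤-Reasoning
      eM : suc (m + ℓ) ≡ ℓ + suc m
      eM = trans (cong suc (+-comm m ℓ)) (sym (+-suc ℓ m))
    arith : ∀ κ xs qs sb b → κ + both ≤ 1 + (qs + qs) → xs ≤ 1 + both → sb + qs ≡ ℓ' → b ≤ sb + suc m → b ≡ suc xs →
      κ + 3 * b ≤ 2 * (m + suc ℓ') + 3
    arith κ xs qs sb _ h₁ h₂ h₃ h₄ refl = lin-sound (var 0 ⊞ con 3 ⊠ (con 1 ⊞ var 1)) (con 2 ⊠ (var 2 ⊞ (con 1 ⊞ var 3)) ⊞ con 3) (var 0 ⊞ var 4 ⊞ (var 1 ⊞ (con 2 ⊠ (var 5 ⊞ var 6) ⊞ con 2 ⊠ (con 1 ⊞ var 1)))) (con 1 ⊞ (var 6 ⊞ var 6) ⊞ (con 1 ⊞ var 4 ⊞ (con 2 ⊠ var 3 ⊞ con 2 ⊠ (var 5 ⊞ (con 1 ⊞ var 2))))) (κ ∷ xs ∷ m ∷ ℓ' ∷ both ∷ sb ∷ qs ∷ []) refl (h₁ & h₂ & 2 · ≤-reflexive h₃ & 2 · h₄)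

  reps : ℕ → ℕ
  reps d = ∑ ℓ λ x → ξ x * ξ (d + x)

  reps-shift : ∀ d a → ∑ ℓ (λ x → ξ (a + x) * ξ (d + (a + x))) ≡ reps d
  reps-shift d = ∑-periodic ℓ (λ x → ξ x * ξ (d + x)) λ x → cong₂ _*_ (ξ-per x)
    (trans (cong ξ (e d ℓ x)) (ξ-per (d + x)))
    where
    e : ∀ d l x → d + (l + x) ≡ l + (d + x)
    e = solve-∀

  -- Since 2κ < 3|X|, every difference has more than |X|/2 representations, so two of them share
  -- a midpoint and the differences of X form a subgroup of ℤ/ℓ.
  many-reps : ∀ d → K d → 2 * xs ≤ reps d + κ
  many-reps d (x₀ , h₀ , h₁) = begin
    2 * xs ≡⟨ cong (xs +_) (+-identityʳ xs) ⟩
    xs + xs ≡⟨ cong₂ _+_ (∑-periodic ℓ ξ ξ-per x₀) (trans (∑-cong ℓ λ y _ → cong ξ (sym (+-assoc d x₀ y))) (∑-periodic ℓ ξ ξ-per (d + x₀))) ⟨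
    ∑ ℓ (λ y → ξ (x₀ + y)) + ∑ ℓ (λ y → ξ (d + (x₀ + y))) ≡⟨ ∑-+ ℓ _ _ ⟨
    ∑ ℓ (λ y → ξ (x₀ + y) + ξ (d + (x₀ + y))) ≤⟨ ∑-mono ℓ (λ y l → pt (X (x₀ + y)) (X (d + (x₀ + y))) (kset y)
        (λ e → K-kset x₀ y l h₀ (trans (cong X (+-comm y x₀)) e))
        (λ e → K-kset (d + x₀) y l h₁ (trans (cong X (e' y d x₀)) e))) ⟩
    ∑ ℓ (λ y → ξ (x₀ + y) * ξ (d + (x₀ + y)) + ι (kset y)) ≡⟨ ∑-+ ℓ _ _ ⟩
    ∑ ℓ (λ y → ξ (x₀ + y) * ξ (d + (x₀ + y))) + κ ≡⟨ cong (_+ κ) (reps-shift d x₀) ⟩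
    reps d + κ ∎
    where
    open ≤-Reasoning
    e' : ∀ y d x → y + (d + x) ≡ d + (x + y)
    e' = solve-∀
    pt : ∀ p q k → (p ≡ true → k ≡ true) → (q ≡ true → k ≡ true) → ι p + ι q ≤ ι p * ι q + ι k
    pt true true k h h' rewrite h refl = ≤-refl
    pt true false k h h' rewrite h refl = ≤-refl
    pt false true k h h' rewrite h' refl = ≤-refl
    pt false false k h h' = z≤n

  -- By `κ-bound` this amounts to 9b > 4M up to constants. Density 15/32 exceeds 4/9, and n ≥ 200
  -- absorbs the constants.
  2κ<3xs : 2 * κ < 3 * xs
  2κ<3xs = arith κ xs b M κ-bound b≡ M≤n dense
    where
    arith : ∀ κ xs b M → κ + 3 * b ≤ 2 * M + 3 → b ≡ suc xs → M ≤ n → 15 * n < 32 * b → 2 * κ < 3 * xs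
    arith κ xs _ M h₁ refl h₂ h₃ = *-cancelˡ-≤ 32 (lin-sound (con 32 ⊠ (con 1 ⊞ con 2 ⊠ var 0)) (con 32 ⊠ (con 3 ⊠ var 1)) (con 64 ⊠ (var 0 ⊞ con 3 ⊠ (con 1 ⊞ var 1)) ⊞ (con 128 ⊠ var 2 ⊞ (con 9 ⊠ (con 1 ⊞ con 15 ⊠ var 3) ⊞ con 6 ⊠ con 200))) (con 64 ⊠ (con 2 ⊠ var 2 ⊞ con 3) ⊞ (con 128 ⊠ var 3 ⊞ (con 9 ⊠ (con 32 ⊠ (con 1 ⊞ var 1)) ⊞ con 6 ⊠ var 3))) (κ ∷ xs ∷ M ∷ n ∷ []) refl (64 · h₁ & 128 · h₂ & 9 · h₃ & 6 · n≥200))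

  K-+ : ∀ d e → K d → K e → K (e + d)
  K-+ d e kd ke with ∑-pigeon ℓ {λ x → ξ (d + x)} {λ x → ξ x * ξ (d + x) + ξ (d + x) * ξ (e + (d + x))} lt
    where
    lt : ∑ ℓ (λ x → ξ (d + x)) < ∑ ℓ (λ x → ξ x * ξ (d + x) + ξ (d + x) * ξ (e + (d + x)))
    lt = subst₂ _<_ (sym (∑-periodic ℓ ξ ξ-per d)) (sym (trans (∑-+ ℓ _ _) (cong (reps d +_) (reps-shift e d))))
      (arith xs (reps d) (reps e) κ (many-reps d kd) (many-reps e ke) 2κ<3xs)
      where
      arith : ∀ x p q k → 2 * x ≤ p + k → 2 * x ≤ q + k → 2 * k < 3 * x → x < p + q
      arith x p q k h₁ h₂ h₃ = lin-sound (con 1 ⊞ var 0) (var 1 ⊞ var 2) (con 2 ⊠ var 0 ⊞ (con 2 ⊠ var 0 ⊞ (con 1 ⊞ con 2 ⊠ var 3))) (var 1 ⊞ var 3 ⊞ (var 2 ⊞ var 3 ⊞ con 3 ⊠ var 0)) (x ∷ p ∷ q ∷ k ∷ []) refl (h₁ & h₂ & h₃)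
  ... | x , _ , h = x , three (X x) (X (d + x)) (X (e + (d + x))) refl refl h
    where
    three : ∀ p q r → X x ≡ p → X (e + (d + x)) ≡ r → ι q < ι p * ι q + ι q * ι r → X x ≡ true × X (e + d + x) ≡ true
    three true true true a c _ = a , trans (cong X (+-assoc e d x)) c
    three true true false a c (s≤s ())
    three true false r a c ()
    three false true true a c (s≤s ())
    three false true false a c ()
    three false false r a c ()

  X0 : X 0 ≡ true
  X0 = trans (X-small 0 (s≤s z≤n)) (trans (cong B (+-identityʳ m)) Bm)

  K0 : K 0
  K0 = 0 , X0 , X0

  -- The translates of `X` by 0, 1 and 2 have total size 3|X| > ℓ, so two of them meet.
  K1or2 : K 1 ⊎ K 2
  K1or2 with ∑-pigeon ℓ {λ _ → 1} {λ x → ξ x + ξ (1 + x) + ξ (2 + x)} lt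
    where
    lt : ∑ ℓ (λ _ → 1) < ∑ ℓ (λ x → ξ x + ξ (1 + x) + ξ (2 + x))
    lt = subst₂ _<_ (sym (trans (∑-const ℓ 1) (*-identityʳ ℓ)))
      (sym (trans (∑-+ ℓ _ _) (cong₂ _+_ (trans (∑-+ ℓ _ _) (cong (xs +_) (∑-periodic ℓ ξ ξ-per 1))) (∑-periodic ℓ ξ ξ-per 2))))
      (arith xs b b≡ M≤n dense)
      where
      arith : ∀ xs b → b ≡ suc xs → m + suc ℓ' ≤ n → 15 * n < 32 * b → suc ℓ' < xs + xs + xs
      arith xs _ refl h₁ h₂ = *-cancelˡ-≤ 32 (lin-sound (con 32 ⊠ (con 1 ⊞ (con 1 ⊞ var 0))) (con 32 ⊠ (var 1 ⊞ var 1 ⊞ var 1)) (con 44 ⊠ (var 2 ⊞ (con 1 ⊞ var 0)) ⊞ (con 3 ⊠ (con 1 ⊞ con 15 ⊠ var 3) ⊞ con 200)) (con 44 ⊠ var 3 ⊞ (con 3 ⊠ (con 32 ⊠ (con 1 ⊞ var 1)) ⊞ var 3)) (ℓ' ∷ xs ∷ m ∷ n ∷ []) refl (44 · h₁ & 3 · h₂ & n≥200))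
  ... | x , _ , h = two (X x) (X (1 + x)) (X (2 + x)) refl refl refl h
    where
    two : ∀ p q r → X x ≡ p → X (1 + x) ≡ q → X (2 + x) ≡ r → 1 < ι p + ι q + ι r → K 1 ⊎ K 2
    two true true r a c e _ = inj₁ (x , a , c)
    two true false true a c e _ = inj₂ (x , a , e)
    two false true true a c e _ = inj₁ (1 + x , c , e)
    two true false false a c e (s≤s ())
    two false true false a c e (s≤s ())
    two false false true a c e (s≤s ())
    two false false false a c e ()

  -- Now every residue is a difference, so `κ` is at least ℓ and `κ-bound` forces M < 3m. For x < m
  -- at most one of m + x and 2m + x lies in `B`, since m does.
  interval-case : K 1 → b ≤ m
  interval-case k1 = begin
    b ≡⟨ ∑-tail0 β (s≤s M≤n) (λ x l → ι-false (above x l)) ⟩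
    ∑ (suc M) β ≤⟨ ∑-len β M<3m ⟩
    ∑ (m + (m + m)) β ≡⟨ ∑-below (m + m) ⟩
    ∑ (m + m) (λ x → β (m + x)) ≡⟨ ∑-split m m _ ⟩
    ∑ m (λ x → β (m + x)) + ∑ m (λ x → β (m + (m + x))) ≡⟨ ∑-+ m _ _ ⟨
    ∑ m (λ x → β (m + x) + β (m + (m + x))) ≤⟨ ∑-mono m (λ x _ → pt (B (m + x)) (B (m + (m + x))) (sf m (m + x) Bm)) ⟩
    ∑ m (λ _ → 1) ≡⟨ trans (∑-const m 1) (*-identityʳ m) ⟩
    m ∎
    where
    open ≤-Reasoning
    pt : ∀ p q → (p ≡ true → q ≡ false) → ι p + ι q ≤ 1
    pt true q h rewrite h refl = ≤-refl
    pt false q h = ι≤1 q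
    all : ∀ d → K d
    all zero = K0
    all (suc d) = K-+ d 1 (all d) k1
    ℓ≤κ : ℓ ≤ κ
    ℓ≤κ = ≤-trans (≤-reflexive (sym (trans (∑-const ℓ 1) (*-identityʳ ℓ)))) (∑-mono ℓ λ y l → ≤-reflexive (sym (ι-true (in-k y l (all y)))))
      where
      in-k : ∀ y → y < ℓ → K y → kset y ≡ true
      in-k y l (x , h , h') = K-kset x y l h h'
    M<3m : suc M ≤ m + (m + m)
    M<3m = arith κ b κ-bound ℓ≤κ M≤n dense
      where
      arith : ∀ κ b → κ + 3 * b ≤ 2 * (m + suc ℓ') + 3 → suc ℓ' ≤ κ → m + suc ℓ' ≤ n → 15 * n < 32 * b → suc (m + suc ℓ') ≤ m + (m + m)
      arith κ b h₁ h₂ h₃ h₄ = *-cancelˡ-≤ 32 (lin-sound (con 32 ⊠ (con 1 ⊞ (var 0 ⊞ (con 1 ⊞ var 1)))) (con 32 ⊠ (var 0 ⊞ (var 0 ⊞ var 0))) (con 96 ⊠ (var 2 ⊞ con 3 ⊠ var 3) ⊞ (con 96 ⊠ (con 1 ⊞ var 1) ⊞ (con 128 ⊠ (var 0 ⊞ (con 1 ⊞ var 1)) ⊞ (con 9 ⊠ (con 1 ⊞ con 15 ⊠ var 4) ⊞ con 6 ⊠ con 200)))) (con 96 ⊠ (con 2 ⊠ (var 0 ⊞ (con 1 ⊞ var 1)) ⊞ con 3) ⊞ (con 96 ⊠ var 2 ⊞ (con 128 ⊠ var 4 ⊞ (con 9 ⊠ (con 32 ⊠ var 3) ⊞ con 6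 ⊠ var 4)))) (m ∷ ℓ' ∷ κ ∷ b ∷ n ∷ []) refl (96 · h₁ & 96 · h₂ & 128 · h₃ & 9 · h₄ & 6 · n≥200))

  K-step : ∀ d → K 2 → K d → ∀ j → K (j * 2 + d)
  K-step d k2 kd zero = kd
  K-step d k2 kd (suc j) = K-+ (j * 2 + d) 2 (K-step d k2 kd j) k2

  K-wrap : K (suc ℓ) → K 1
  K-wrap (x , h , h') = x , h , trans (sym (X-per (1 + x))) (trans (cong X (+-suc ℓ x)) h')

  K-parity : K 2 → ∀ d → d ≤ suc ℓ → odd (suc ℓ ∸ d) ≡ false → K d → K 1
  K-parity k2 d l e kd with even-half (suc ℓ ∸ d) e
  ... | j , ej = K-wrap (subst K (trans (cong (_+ d) (sym ej)) (m∸n+n≡m l)) (K-step d k2 kd j))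

  odd-∸ : ∀ a d → d ≤ a → odd (a ∸ d) ≡ (if odd d then not (odd a) else odd a)
  odd-∸ a d l = g (odd (a ∸ d)) (odd d) (odd a) (trans (cong odd (sym (m∸n+n≡m l))) (odd-+ (a ∸ d) d))
    where
    g : ∀ x y z → z ≡ (if x then not y else y) → x ≡ (if y then not z else z)
    g true true _ refl = refl
    g true false _ refl = refl
    g false true _ refl = refl
    g false false _ refl = refl

  -- Steps of 2 reach ℓ + 1, which is 1 modulo ℓ: for odd ℓ they start from 0, for even ℓ from the
  -- odd difference x - m.
  mixed : K 2 → ∀ x → B x ≡ true → odd (x ∸ m) ≡ true → K 1
  mixed k2 x bx o with bool? (odd ℓ)
  ... | inj₁ oℓ = K-parity k2 0 z≤n (trans (cong not oℓ) refl) K0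
  ... | inj₂ eℓ = K-parity k2 (x ∸ m) (≤-trans xm≤ (n≤1+n ℓ))
      (trans (odd-∸ (suc ℓ) (x ∸ m) (≤-trans xm≤ (n≤1+n ℓ))) (cong₂ (λ a c → if a then not (not c) else not c) o eℓ))
      (0 , X0 , trans (cong X (+-identityʳ (x ∸ m))) (trans (X-small (x ∸ m) (≤∧≢⇒< xm≤ λ e → true≢false (trans (cong odd (sym e)) o) eℓ)) (trans (cong B (m+[n∸m]≡n (m-min x bx))) bx)))
    where
    xm≤ : x ∸ m ≤ ℓ
    xm≤ = ≤-trans (∸-monoˡ-≤ m (M-max x bx)) (≤-reflexive (m+n∸m≡n m ℓ))

  -- `B` and its translate by -m are disjoint, because m is in the sum-free set `B`, and both
  -- consist of even numbers; so |B| is at most about n/4.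
  all-even-absurd : (∀ x → B x ≡ true → odd x ≡ false) → ⊥
  all-even-absurd ev = 1≰0 (arith (# N (λ x → not (odd x))) b (ι (odd N)) le (evens N) (ι≤1 (odd N)) dense)
    where
    arith : ∀ e b i → b + b ≤ e → 2 * e ≤ suc n + i → i ≤ 1 → 15 * n < 32 * b → 1 ≤ 0
    arith e b i h₁ h₂ h₃ h₄ = lin-sound (con 1) (con 0) (con 16 ⊠ (var 0 ⊞ var 0) ⊞ (con 8 ⊠ (con 2 ⊠ var 1) ⊞ (con 8 ⊠ var 2 ⊞ (con 1 ⊞ con 15 ⊠ var 3 ⊞ con 200)))) (con 16 ⊠ var 1 ⊞ (con 8 ⊠ (con 1 ⊞ var 3 ⊞ var 2) ⊞ (con 8 ⊠ con 1 ⊞ (con 32 ⊠ var 0 ⊞ var 3)))) (b ∷ e ∷ i ∷ n ∷ []) refl (16 · h₁ & 8 · h₂ & 8 · h₃ & h₄ & n≥200)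
    even-m : ∀ x → B (m + x) ≡ true → odd x ≡ false
    even-m x h = trans (g (odd m) (odd x) (ev m Bm)) (trans (sym (odd-+ m x)) (ev (m + x) h))
      where
      g : ∀ a c → a ≡ false → c ≡ (if a then not c else c)
      g _ c refl = refl
    shifted : b ≤ ∑ N (λ x → β (m + x))
    shifted = ≤-trans (∑-len β (m≤n+m N m)) (≤-reflexive (∑-below N))
    le : b + b ≤ # N (λ x → not (odd x))
    le = ≤-trans (+-monoʳ-≤ b shifted) (≤-trans (≤-reflexive (sym (∑-+ N _ _))) (∑-mono N λ x _ → pt x (B x) (B (m + x)) refl refl))
      where
      pt : ∀ x p q → B x ≡ p → B (m + x) ≡ q → ι p + ι q ≤ ι (not (odd x))
      pt x true true e e' = true≢false e' (sf m x Bm e)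
      pt x true false e e' rewrite ev x e = ≤-refl
      pt x false true e e' rewrite even-m x e' = ≤-refl
      pt x false false e e' = z≤n

  same-parity : (∀ x → x < N → (B x ∧ odd (x ∸ m)) ≡ false) → ∀ x → B x ≡ true → odd x ≡ odd m
  same-parity none x bx = trans (cong odd (sym (m+[n∸m]≡n (m-min x bx)))) (trans (odd-+ m (x ∸ m))
    (trans (cong (λ c → if odd m then not c else c) ez) (g (odd m))))
    where
    ez : odd (x ∸ m) ≡ false
    ez = ¬true λ e → true≢false (∧-join bx e) (none x (s≤s (within-≤ wB bx)))
    g : ∀ a → (if a then true else false) ≡ a
    g true = refl
    g false = refl

  conclusion : (∀ x → B x ≡ true → odd x ≡ true) ⊎ (b ≤ m)
  conclusion with K1or2
  ... | inj₁ k1 = inj₂ (interval-case k1)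
  ... | inj₂ k2 with any<? N (λ x → B x ∧ odd (x ∸ m))
  ...   | inj₁ (x , _ , h) = inj₂ (interval-case (mixed k2 x (proj₁ (∧-split h)) (proj₂ (∧-split {B x} h))))
  ...   | inj₂ none with bool? (odd m)
  ...     | inj₁ om = inj₁ λ x bx → trans (same-parity none x bx) om
  ...     | inj₂ em = ⊥-elim (all-even-absurd λ x bx → trans (same-parity none x bx) em)

large-sum-free : ∀ n B → Within n B → SF B → 15 * n < 32 * # (suc n) B → 200 ≤ n →
  (∀ x → B x ≡ true → odd x ≡ true) ⊎ (∃[ m ] (∀ x → B x ≡ true → m ≤ x) × # (suc n) B ≤ m)
large-sum-free n B w sf dense n≥200 with argmin (suc n) B (λ x → x) | argmin (suc n) B (λ x → n ∸ x)
... | inj₂ none | _ = ⊥-elim (<⇒≱ dense (≤-trans (≤-reflexive (trans (cong (32 *_) (#-empty (suc n) B none)) refl)) z≤n))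
... | inj₁ _ | inj₂ none = ⊥-elim (<⇒≱ dense (≤-trans (≤-reflexive (trans (cong (32 *_) (#-empty (suc n) B none)) refl)) z≤n))
... | inj₁ (m , lm , bm , min) | inj₁ (M , lM , bM , max) = go (M ∸ m) (m+[n∸m]≡n (min M lM bM))
  where
  min' : ∀ x → B x ≡ true → m ≤ x
  min' x bx = min x (s≤s (within-≤ w bx)) bx
  max' : ∀ x → B x ≡ true → x ≤ M
  max' x bx = ∸-cancelʳ-≤ (within-≤ w bx) (max x (s≤s (within-≤ w bx)) bx)
  go : ∀ l → m + l ≡ M → (∀ x → B x ≡ true → odd x ≡ true) ⊎ (∃[ m ] (∀ x → B x ≡ true → m ≤ x) × # (suc n) B ≤ m)
  go zero e = ⊥-elim (1≰0 (arith (# (suc n) B) dense one))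
    where
    arith : ∀ b → 15 * n < 32 * b → b ≤ 1 → 1 ≤ 0
    arith b h₁ h₂ = lin-sound (con 1) (con 0) (con 1 ⊞ con 15 ⊠ var 0 ⊞ (con 32 ⊠ var 1 ⊞ con 200)) (con 32 ⊠ var 1 ⊞ (con 32 ⊠ con 1 ⊞ var 0)) (n ∷ b ∷ []) refl (h₁ & 32 · h₂ & n≥200)
    one : # (suc n) B ≤ 1
    one = ≤-trans (#-mono (suc n) λ x _ bx → trans (cong (_≡ᵇ x) (≤-antisym (min' x bx) (≤-trans (max' x bx) (≤-reflexive (trans (sym e) (+-identityʳ m)))))) (≡ᵇ-refl x)) (#-single≤ (suc n) m)
  go (suc ℓ') refl with Structure.conclusion n B w sf dense n≥200 m ℓ' bm min' bM max'
  ... | inj₁ o = inj₁ o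
  ... | inj₂ h = inj₂ (m , min' , h)

-- Link graphs

-- A positive form of maximality: the Schur triple that v would complete together with S, where v
-- may be a summand, the sum, or both summands.
Killed : Pr → ℕ → Set
Killed S v = (∃[ a ] ∃[ b ] S a ≡ true × S b ≡ true × v + a ≡ b) ⊎
  ((∃[ a ] ∃[ b ] S a ≡ true × S b ≡ true × a + b ≡ v) ⊎ S (v + v) ≡ true)

record MaxSF (n : ℕ) (S : Pr) : Set where
  constructor maxSF
  field
    within : Within n S
    sumFree : SF S
    killed : ∀ v → 0 < v → v ≤ n → S v ≡ false → Killed S v

SF? : ∀ n T → Within n T → SF T ⊎ ¬ SF T
SF? n T w with any<? (suc n) (λ x → T x ∧ (1 ≤ᵇ # (suc n) (λ y → T y ∧ T (x + y))))
... | inj₁ (x , _ , h) = inj₂ λ sf → bad sf (#-pos (suc n) _ (≤ᵇ-true {1} (proj₂ (∧-split {T x} h))))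
  where
  bad : SF T → (∃[ y ] y < suc n × (T y ∧ T (x + y)) ≡ true) → ⊥
  bad sf (y , _ , e) = true≢false (proj₂ (∧-split {T y} e)) (sf x y (proj₁ (∧-split h)) (proj₁ (∧-split e)))
... | inj₂ none = inj₁ λ x y tx ty → ¬true λ txy → true≢false
  (∧-join tx (true-≤ᵇ (#-has (suc n) (λ y → T y ∧ T (x + y)) (s≤s (within-≤ w ty)) (∧-join ty txy)))) (none x (s≤s (within-≤ w tx)))

module Link (n : ℕ) (T : Pr) where

  adj : ℕ → ℕ → Bool
  adj x y = T (x + y) ∨ (T (x ∸ y) ∨ T (y ∸ x))

  adj-sym : ∀ x y → adj x y ≡ true → adj y x ≡ true
  adj-sym x y h = trans (cong₂ _∨_ (cong T (+-comm y x)) (∨-comm (T (y ∸ x)) (T (x ∸ y)))) h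

  -- Vertices that `T` rules out by itself, through a Schur triple whose other members all lie in
  -- `T`. They are discarded, as no maximal set with trace `T` contains them.
  loop : Pr
  loop x = T (x + x) ∨ (1 ≤ᵇ # (suc n) (λ a → T a ∧ (T (x + a) ∨ T (x ∸ a))))

  clean : Pr → Pr
  clean B x = B x ∧ not (loop x)

  open Graph (suc n) adj adj-sym public

  clean-loopless : ∀ B → T 0 ≡ false → Loopless (clean B)
  clean-loopless B t0 x h rewrite n∸n≡0 x | t0 = ¬true λ e → true≢false (∨-left (twice e)) (not-true (proj₂ (∧-split {B x} h)))
    where
    twice : T (x + x) ∨ false ≡ true → T (x + x) ≡ true
    twice e with ∨-split {T (x + x)} e
    ... | inj₁ e' = e'

  -- A vertex v missing from S is killed by a Schur triple. Since `B` is sum-free, the triple meets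
  -- `C`, hence `T`; since v is not a loop, its other members are not all in `T`. The remaining one
  -- is a neighbour of v in S ∩ B.
  link : ∀ {S B C} → MaxSF n S → Within n B → Within n C → SF B → (∀ x → B x ≡ true → C x ≡ false) →
    (∀ x → S x ≡ true → B x ≡ true ⊎ C x ≡ true) → (∀ x → T x ≡ (S x ∧ C x)) →
    MIS (clean B) (λ x → S x ∧ B x)
  link {S} {B} {C} (maxSF w sf kill) wB wC sfB disj cov eq = mis sub' ind dom
    where
    T→S : ∀ {x} → T x ≡ true → S x ≡ true
    T→S {x} h = proj₁ (∧-split (trans (sym (eq x)) h))
    mkT : ∀ {x} → S x ≡ true → C x ≡ true → T x ≡ true
    mkT {x} s c = trans (eq x) (∧-join s c)
    T0 : T 0 ≡ false
    T0 = ¬true λ h → true≢false (T→S h) (proj₁ w)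
    pos : ∀ x y → T (x ∸ y) ≡ true → y ≤ x
    pos x y h = <⇒≤ (m∸n≢0⇒n<m λ e → true≢false (subst (λ v → T v ≡ true) e h) T0)
    noDiff : ∀ x y → S x ≡ true → S y ≡ true → S (x ∸ y) ≡ true → y ≤ x → ⊥
    noDiff x y sx sy sd l = true≢false (trans (cong S (m∸n+n≡m l)) sx) (sf (x ∸ y) y sd sy)
    noLoop : ∀ x → S x ≡ true → loop x ≡ false
    noLoop x sx = ¬true λ h → g (∨-split {T (x + x)} h)
      where
      g : (T (x + x) ≡ true) ⊎ ((1 ≤ᵇ # (suc n) (λ a → T a ∧ (T (x + a) ∨ T (x ∸ a)))) ≡ true) → ⊥
      g (inj₁ h) = true≢false (T→S h) (sf x x sx sx)
      g (inj₂ h) with #-pos (suc n) _ (≤ᵇ-true {1} h)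
      ... | a , _ , e with ∨-split {T (x + a)} (proj₂ (∧-split {T a} e))
      ...   | inj₁ e' = true≢false (T→S e') (sf x a sx (T→S (proj₁ (∧-split e))))
      ...   | inj₂ e' = noDiff x a sx (T→S (proj₁ (∧-split e))) (T→S e') (pos x a e')
    sub' : (λ x → S x ∧ B x) ⊆ᵖ clean B
    sub' x h = ∧-join (proj₂ (∧-split {S x} h)) (not-false (noLoop x (proj₁ (∧-split h))))
    ind : Indep (λ x → S x ∧ B x)
    ind x y hx hy = ¬true λ a → g (∨-split {T (x + y)} a)
      where
      sx = proj₁ (∧-split hx)
      sy = proj₁ (∧-split hy)
      g : (T (x + y) ≡ true) ⊎ ((T (x ∸ y) ∨ T (y ∸ x)) ≡ true) → ⊥
      g (inj₁ h) = true≢false (T→S h) (sf x y sx sy)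
      g (inj₂ h) with ∨-split {T (x ∸ y)} h
      ... | inj₁ e = noDiff x y sx sy (T→S e) (pos x y e)
      ... | inj₂ e = noDiff y x sy sx (T→S e) (pos y x e)
    dom : ∀ v → clean B v ≡ true → (S v ∧ B v) ≡ false → ∃[ y ] (S y ∧ B y) ≡ true × adj v y ≡ true
    dom v h nv = cases (kill v (within-pos wB bv) (within-≤ wB bv) (¬true λ s → true≢false (∧-join s bv) nv))
      where
      bv : B v ≡ true
      bv = proj₁ (∧-split h)
      nl : loop v ≡ false
      nl = not-true (proj₂ (∧-split {B v} h))
      loopy : ∀ a → T a ≡ true → (T (v + a) ∨ T (v ∸ a)) ≡ true → ⊥
      loopy a ta e = true≢false (∨-right {T (v + v)} (true-≤ᵇ (#-has (suc n) (λ a → T a ∧ (T (v + a) ∨ T (v ∸ a)))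
        (s≤s (within-≤ w (T→S ta))) (∧-join ta e)))) nl
      Goal = ∃[ y ] (S y ∧ B y) ≡ true × adj v y ≡ true
      sum-case : ∀ a → S a ≡ true → S (v + a) ≡ true → B a ≡ true ⊎ C a ≡ true → B (v + a) ≡ true ⊎ C (v + a) ≡ true → Goal
      sum-case a sa sb (inj₁ ba) (inj₁ bb) = true≢false bb (sfB v a bv ba)
      sum-case a sa sb (inj₁ ba) (inj₂ cb) = a , ∧-join sa ba , ∨-left (mkT sb cb)
      sum-case a sa sb (inj₂ ca) (inj₁ bb) = v + a , ∧-join sb bb ,
        ∨-right {T (v + (v + a))} (∨-right {T (v ∸ (v + a))} (trans (cong T (m+n∸m≡n v a)) (mkT sa ca)))
      sum-case a sa sb (inj₂ ca) (inj₂ cb) = ⊥-elim (loopy a (mkT sa ca) (∨-left (mkT sb cb)))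
      diff-case : ∀ a b → a + b ≡ v → S a ≡ true → S b ≡ true → B a ≡ true ⊎ C a ≡ true → B b ≡ true ⊎ C b ≡ true → Goal
      diff-case a b refl sa sb (inj₁ ba) (inj₁ bb) = true≢false bv (sfB a b ba bb)
      diff-case a b refl sa sb (inj₁ ba) (inj₂ cb) = a , ∧-join sa ba ,
        ∨-right {T (a + b + a)} (∨-left (trans (cong T (m+n∸m≡n a b)) (mkT sb cb)))
      diff-case a b refl sa sb (inj₂ ca) (inj₁ bb) = b , ∧-join sb bb ,
        ∨-right {T (a + b + b)} (∨-left (trans (cong T (m+n∸n≡m a b)) (mkT sa ca)))
      diff-case a b refl sa sb (inj₂ ca) (inj₂ cb) = ⊥-elim (loopy a (mkT sa ca) (∨-right {T (a + b + a)} (trans (cong T (m+n∸m≡n a b)) (mkT sb cb))))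
      cases : Killed S v → Goal
      cases (inj₁ (a , _ , sa , sb , refl)) = sum-case a sa sb (cov a sa) (cov (v + a) sb)
      cases (inj₂ (inj₁ (a , b , sa , sb , e))) = diff-case a b e sa sb (cov a sa) (cov b sb)
      cases (inj₂ (inj₂ s)) with cov (v + v) s
      ... | inj₁ b = true≢false b (sfB v v bv bv)
      ... | inj₂ c = true≢false (∨-left (mkT s c)) nl

subsets-cover : ∀ N C → Cover N (λ T → T ⊆ᵖ C) (2 ^ # N C)
subsets-cover zero C = cover-one (λ _ → false) λ p _ x ()
subsets-cover (suc N) C with subsets-cover N C | bool? (C N)
... | L , len , cov | inj₂ e = map (set N false) L ,
    ≤-trans (≤-reflexive (length-map _ L)) (≤-trans len (≤-reflexive (cong (2 ^_) (sym (trans (cong (λ b → # N C + ι b) e) (+-identityʳ _)))))) ,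
    λ T s → let (q , i , eq) = cov T s in set N false q , ∈-map⁺ _ i , set-≈ (¬true λ t → true≢false (s N t) e) eq
... | L , len , cov | inj₁ e = map (set N false) L ++ map (set N true) L ,
    ≤-trans (≤-reflexive (trans (length-++ (map (set N false) L)) (cong₂ _+_ (length-map _ L) (length-map _ L))))
      (≤-trans (+-mono-≤ len len) (≤-reflexive (trans (cong (2 ^ # N C +_) (sym (+-identityʳ _))) (cong (2 ^_) (trans (+-comm 1 _) (cong (λ b → # N C + ι b) (sym e))))))) ,
    g
  where
  g : ∀ T → T ⊆ᵖ C → ∃ λ q → q ∈ map (set N false) L ++ map (set N true) L × T ≈[ suc N ] q
  g T s with cov T s | bool? (T N)
  ... | q , i , eq | inj₂ t = set N false q , ∈-++⁺ˡ (∈-map⁺ _ i) , set-≈ t eq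
  ... | q , i , eq | inj₁ t = set N true q , ∈-++⁺ʳ _ (∈-map⁺ _ i) , set-≈ t eq

cover-link : ∀ {n B C M} → Within n B → Within n C → SF B → (∀ x → B x ≡ true → C x ≡ false) →
  (∀ T → T ⊆ᵖ C → SF T → Cover (suc n) (Link.MIS n T (Link.clean n T B)) M) →
  Cover (suc n) (λ S → MaxSF n S × (∀ x → S x ≡ true → B x ≡ true ⊎ C x ≡ true)) (2 ^ # (suc n) C * M)
cover-link {n} {B} {C} {M} wB wC sfB disj h with subsets-cover (suc n) C
... | L , len , cov = cover-⊆ find (*-monoˡ-≤ M len) (cover-list L (λ q _ → each q))
  where
  cap : Pr → Pr
  cap q x = C x ∧ q x
  Of : Pr → Pr → Set
  Of q S = MaxSF n S × (∀ x → S x ≡ true → B x ≡ true ⊎ C x ≡ true) × (∀ x → cap q x ≡ (S x ∧ C x))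
  find : ∀ S → MaxSF n S × (∀ x → S x ≡ true → B x ≡ true ⊎ C x ≡ true) → ∃ λ q → q ∈ L × Of q S
  find S (ms , sc) with cov (λ x → S x ∧ C x) (λ x e → proj₂ (∧-split {S x} e))
  ... | q , i , e = q , i , ms , sc , λ x → g x (bool? (C x))
    where
    g : ∀ x → (C x ≡ true) ⊎ (C x ≡ false) → cap q x ≡ (S x ∧ C x)
    g x (inj₁ c) = trans (cong (_∧ q x) c) (sym (e x (s≤s (within-≤ wC c))))
    g x (inj₂ c) = trans (cong (_∧ q x) c) (sym (trans (cong (S x ∧_) c) (∧-comm (S x) false)))
  each : ∀ q → Cover (suc n) (Of q) M
  each q with SF? n (cap q) (within-⊆ (λ x e → proj₁ (∧-split e)) wC)
  ... | inj₂ nsf = cover-⊆ (λ _ x → x) z≤n (cover-none λ { S (maxSF w sf k , _ , eq) → nsf λ x y hx hy → ¬true λ hxy →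
      true≢false (in-S x y S eq hxy) (sf x y (proj₁ (∧-split (trans (sym (eq x)) hx))) (proj₁ (∧-split (trans (sym (eq y)) hy)))) })
    where
    in-S : ∀ x y S → (∀ x → cap q x ≡ (S x ∧ C x)) → cap q (x + y) ≡ true → S (x + y) ≡ true
    in-S x y S eq h = proj₁ (∧-split (trans (sym (eq (x + y))) h))
  ... | inj₁ sfT = cover-map (λ I x → I x ∨ cap q x) (λ I I' e x l → cong (_∨ cap q x) (e x l))
      (λ { S (ms , sc , eq) → (λ x → S x ∧ B x) , Link.link n (cap q) ms wB wC sfB disj sc eq , λ x _ → back S sc eq x (bool? (S x)) })
      (h (cap q) (λ x e → proj₁ (∧-split e)) sfT)
    where
    back : ∀ S → (∀ x → S x ≡ true → B x ≡ true ⊎ C x ≡ true) → (∀ x → cap q x ≡ (S x ∧ C x)) → ∀ x → (S x ≡ true) ⊎ (S x ≡ false) →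
      S x ≡ (S x ∧ B x) ∨ cap q x
    back S sc eq x (inj₁ s) with sc x s
    ... | inj₁ b = trans s (sym (∨-left (∧-join s b)))
    ... | inj₂ c = trans s (sym (∨-right {S x ∧ B x} (trans (eq x) (∧-join s c))))
    back S sc eq x (inj₂ s) = trans s (sym (trans (cong ((S x ∧ B x) ∨_) (eq x)) (cong (λ b → (b ∧ B x) ∨ (b ∧ C x)) s)))

Diff : Pr → ℕ → ℕ → Set
Diff T x y = (∃[ a ] T a ≡ true × x ≡ y + a) ⊎ (∃[ a ] T a ≡ true × y ≡ x + a)

diff-sym : ∀ {T x y} → Diff T x y → Diff T y x
diff-sym (inj₁ d) = inj₂ d
diff-sym (inj₂ d) = inj₁ d

mkDiff : ∀ {T} → T 0 ≡ false → ∀ x y → (T (x ∸ y) ∨ T (y ∸ x)) ≡ true → Diff T x y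
mkDiff {T} t0 x y h with ∨-split {T (x ∸ y)} h
... | inj₁ e = inj₁ (x ∸ y , e , sym (m+[n∸m]≡n {y} {x} (<⇒≤ (m∸n≢0⇒n<m λ z → true≢false (subst (λ v → T v ≡ true) z e) t0))))
... | inj₂ e = inj₂ (y ∸ x , e , sym (m+[n∸m]≡n {x} {y} (<⇒≤ (m∸n≢0⇒n<m λ z → true≢false (subst (λ v → T v ≡ true) z e) t0))))

sf-⊥ : ∀ {T} → SF T → ∀ {a b c} → T a ≡ true → T b ≡ true → T c ≡ true → c ≡ a + b → ⊥
sf-⊥ sf ta tb tc refl = true≢false tc (sf _ _ ta tb)

-- Eight orientations of three differences. The two cyclic ones make a sum of elements of `T`
-- vanish, although 0 is not in `T`; each of the other six is a Schur triple in `T`.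
no-diff-triangle : ∀ {T} → SF T → T 0 ≡ false → ∀ {x y z} → Diff T x y → Diff T y z → Diff T x z → ⊥
no-diff-triangle {T} sf t0 {x} {y} {z} (inj₁ (a , ta , refl)) (inj₁ (b , tb , refl)) (inj₁ (c , tc , e)) =
  sf-⊥ sf tb ta tc (+-cancelˡ-≡ z c (b + a) (trans (sym e) (+-assoc z b a)))
no-diff-triangle {T} sf t0 {x} {y} {z} (inj₁ (a , ta , refl)) (inj₁ (b , tb , refl)) (inj₂ (c , tc , e)) =
  true≢false ta (subst (λ v → T v ≡ false) (sym (m+n≡0⇒n≡0 b (m+n≡0⇒m≡0 (b + a) (+-cancelˡ-≡ z _ 0 (trans (g z a b c) (trans (sym e) (sym (+-identityʳ z)))))))) t0)
  where
  g : ∀ z a b c → z + (b + a + c) ≡ z + b + a + c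
  g = solve-∀
no-diff-triangle {T} sf t0 {x} {y} {z} (inj₁ (a , ta , refl)) (inj₂ (b , tb , refl)) (inj₁ (c , tc , e)) =
  sf-⊥ sf tb tc ta (+-cancelˡ-≡ y a (b + c) (trans e (+-assoc y b c)))
no-diff-triangle {T} sf t0 {x} {y} {z} (inj₁ (a , ta , refl)) (inj₂ (b , tb , refl)) (inj₂ (c , tc , e)) =
  sf-⊥ sf ta tc tb (+-cancelˡ-≡ y b (a + c) (trans e (+-assoc y a c)))
no-diff-triangle {T} sf t0 {x} {y} {z} (inj₂ (a , ta , refl)) (inj₁ (b , tb , e)) (inj₁ (c , tc , refl)) =
  sf-⊥ sf tc ta tb (+-cancelˡ-≡ z b (c + a) (trans (sym e) (+-assoc z c a)))
no-diff-triangle {T} sf t0 {x} {y} {z} (inj₂ (a , ta , refl)) (inj₁ (b , tb , e)) (inj₂ (c , tc , refl)) =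
  sf-⊥ sf tc tb ta (+-cancelˡ-≡ x a (c + b) (trans e (+-assoc x c b)))
no-diff-triangle {T} sf t0 {x} {y} {z} (inj₂ (a , ta , refl)) (inj₂ (b , tb , refl)) (inj₁ (c , tc , e)) =
  true≢false ta (subst (λ v → T v ≡ false) (sym (m+n≡0⇒m≡0 a (m+n≡0⇒m≡0 (a + b) (+-cancelˡ-≡ x _ 0 (trans (g x a b c) (trans (sym e) (sym (+-identityʳ x)))))))) t0)
  where
  g : ∀ x a b c → x + (a + b + c) ≡ x + a + b + c
  g = solve-∀
no-diff-triangle {T} sf t0 {x} {y} {z} (inj₂ (a , ta , refl)) (inj₂ (b , tb , refl)) (inj₂ (c , tc , e)) =
  sf-⊥ sf ta tb tc (+-cancelˡ-≡ x c (a + b) (trans (sym e) (+-assoc x a b)))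

clean-range : ∀ {n B} T → Within n B → Link.InRange n T (Link.clean n T B)
clean-range T w x h = s≤s (within-≤ w (proj₁ (∧-split h)))

clean-size : ∀ n B T → # (suc n) (Link.clean n T B) ≤ # (suc n) B
clean-size n B T = #-mono (suc n) λ x _ h → proj₁ (∧-split h)

MaximalIn : ℕ → Pr → Pr → Pr → Set
MaximalIn n B C S = MaxSF n S × (∀ x → S x ≡ true → B x ≡ true ⊎ C x ≡ true)

generic-case : ∀ {n B C} w → Within n B → Within n C → SF B → (∀ x → B x ≡ true → C x ≡ false) → # (suc n) B ≤ w →
  Cover (suc n) (MaximalIn n B C) (2 ^ # (suc n) C * moon w)
generic-case {n} {B} {C} w wB wC sfB disj h = cover-link wB wC sfB disj λ T s sfT →
  Link.moon-moser n T w (Link.clean n T B) (clean-range T wB) (Link.clean-loopless n T B (proj₁ (within-⊆ s wC))) (≤-trans (clean-size n B T) h)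

-- Two vertices above `h` have a sum beyond n, so among them every link edge is a difference and
-- `no-diff-triangle` applies. The lower part `B₁` is therefore moved into the set whose trace is
-- fixed.
interval-case : ∀ {n B C} h m → Within n B → Within n C → SF B → (∀ x → B x ≡ true → C x ≡ false) →
  n ≤ suc (h + h) → (∀ x → B x ≡ true → m ≤ x) → # (suc n) B ≤ m →
  Cover (suc n) (MaximalIn n B C) (2 ^ # (suc n) C * hujter (2 + h))
interval-case {n} {B} {C} h m wB wC sfB disj nh min bm =
  cover-⊆ reassign bound (cover-link {n} {B₂} {C₂} (within-⊆ (λ x e → proj₁ (∧-split e)) wB) wC₂ (λ x y hx hy → ¬true λ hxy →
      true≢false (proj₁ (∧-split hxy)) (sfB x y (proj₁ (∧-split hx)) (proj₁ (∧-split hy)))) disj₂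
    λ T s sfT → Link.hujter-tuza n T (# (suc n) B₂) (Link.clean n T B₂) (clean-range T (within-⊆ (λ x e → proj₁ (∧-split e)) wB))
      (Link.clean-loopless n T B₂ (proj₁ (within-⊆ s wC₂))) (tf T s sfT) (clean-size n B₂ T))
  where
  N = suc n
  B₁ B₂ C₂ : Pr
  B₁ x = B x ∧ not (suc h ≤ᵇ x)
  B₂ x = B x ∧ (suc h ≤ᵇ x)
  C₂ x = C x ∨ B₁ x
  wC₂ : Within n C₂
  wC₂ = ¬true (λ e → z (∨-split {C 0} e)) , λ x l → ¬true λ e → o x l (∨-split {C x} e)
    where
    z : (C 0 ≡ true) ⊎ (B₁ 0 ≡ true) → ⊥
    z (inj₁ e) = true≢false e (proj₁ wC)
    z (inj₂ e) = true≢false (proj₁ (∧-split e)) (proj₁ wB)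
    o : ∀ x → n < x → (C x ≡ true) ⊎ (B₁ x ≡ true) → ⊥
    o x l (inj₁ e) = true≢false e (proj₂ wC x l)
    o x l (inj₂ e) = true≢false (proj₁ (∧-split e)) (proj₂ wB x l)
  disj₂ : ∀ x → B₂ x ≡ true → C₂ x ≡ false
  disj₂ x e = ¬true λ c → g (∨-split {C x} c)
    where
    g : (C x ≡ true) ⊎ (B₁ x ≡ true) → ⊥
    g (inj₁ c) = true≢false c (disj x (proj₁ (∧-split e)))
    g (inj₂ c) = true≢false (proj₂ (∧-split {B x} e)) (not-true (proj₂ (∧-split {B x} c)))
  reassign : ∀ S → MaximalIn n B C S → MaximalIn n B₂ C₂ S
  reassign S (ms , sc) = ms , λ x s → g x (sc x s) (bool? (suc h ≤ᵇ x))
    where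
    g : ∀ x → B x ≡ true ⊎ C x ≡ true → ((suc h ≤ᵇ x) ≡ true) ⊎ ((suc h ≤ᵇ x) ≡ false) → B₂ x ≡ true ⊎ C₂ x ≡ true
    g x (inj₂ c) _ = inj₂ (∨-left c)
    g x (inj₁ b) (inj₁ l) = inj₁ (∧-join b l)
    g x (inj₁ b) (inj₂ l) = inj₂ (∨-right {C x} (∧-join b (not-false l)))
  tf : ∀ T → T ⊆ᵖ C₂ → SF T → Link.TriangleFree n T (Link.clean n T B₂)
  tf T s sfT x y z hx hy hz exy eyz exz = no-diff-triangle sfT t0 (df x y (big x hx) (big y hy) exy) (df y z (big y hy) (big z hz) eyz) (df x z (big x hx) (big z hz) exz)
    where
    wT = within-⊆ s wC₂
    t0 = proj₁ wT
    big : ∀ x → Link.clean n T B₂ x ≡ true → suc h ≤ x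
    big x e = ≤ᵇ-true {suc h} (proj₂ (∧-split {B x} (proj₁ (∧-split {B₂ x} e))))
    df : ∀ x y → suc h ≤ x → suc h ≤ y → Link.adj n T x y ≡ true → Diff T x y
    df x y lx ly e with ∨-split {T (x + y)} e
    ... | inj₁ p = ⊥-elim (1≰0 (arith (within-≤ wT p)))
      where
      arith : x + y ≤ n → 1 ≤ 0
      arith p = lin-sound (con 1) (con 0) (var 0 ⊞ var 1 ⊞ (con 1 ⊞ var 2 ⊞ (con 1 ⊞ var 2 ⊞ var 3))) (var 3 ⊞ (var 0 ⊞ (var 1 ⊞ (con 1 ⊞ (var 2 ⊞ var 2))))) (x ∷ y ∷ h ∷ n ∷ []) refl (p & lx & ly & nh)
    ... | inj₂ p = mkDiff {T} t0 x y p
  low : # N B₁ + m ≤ suc h ⊎ # N B₁ ≡ 0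
  low with m ≤? suc h
  ... | no nm = inj₂ (#-empty N B₁ λ x _ → ¬true λ e → nm (≤-trans (min x (proj₁ (∧-split e))) (<⇒≤ (≤ᵇ-false (not-true (proj₂ (∧-split {B x} e)))))))
  ... | yes lm with m≤n⇒∃[o]m+o≡n lm
  ...   | o , eo = inj₁ (≤-trans (≤-reflexive (+-comm _ m)) (≤-trans (+-monoʳ-≤ m le) (≤-reflexive eo)))
    where
    vanish : ∀ x → suc h ≤ x → ι (B₁ x) ≡ 0
    vanish x l = ι-false (¬true λ e → <⇒≱ (≤ᵇ-false (not-true (proj₂ (∧-split {B x} e)))) l)
    le : # N B₁ ≤ o
    le = ≤-trans (∑-len _ (m≤m+n N (suc h))) (≤-trans (≤-reflexive (trans (∑-tail0 {suc h} (λ x → ι (B₁ x)) (m≤n+m (suc h) N) vanish)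
      (trans (cong (λ k → # k B₁) (sym eo)) (trans (∑-split m o _) (cong (_+ ∑ o (λ x → ι (B₁ (m + x)))) (#-empty m B₁ λ x l → ¬true λ e → <⇒≱ l (min x (proj₁ (∧-split e)))))))))
      (#≤ o (λ x → B₁ (m + x))))
  split : # N B ≡ # N B₂ + # N B₁
  split = #-split N B (suc h ≤ᵇ_)
  B₂≤ : # N B₂ ≤ 2 + h
  B₂≤ with ≤-total (suc h) N
  ... | inj₂ l = ≤-trans (#≤ N B₂) (≤-trans l (n≤1+n _))
  ... | inj₁ l with m≤n⇒∃[o]m+o≡n l
  ...   | o , eo = ≤-trans (≤-reflexive (trans (cong (λ k → # k B₂) (sym eo)) (trans (∑-split (suc h) o _)
      (cong (_+ ∑ o (λ x → ι (B₂ (suc h + x)))) (#-empty (suc h) B₂ λ x l → ¬true λ e → <⇒≱ l (≤ᵇ-true {suc h} (proj₂ (∧-split {B x} e))))))))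
      (≤-trans (#≤ o (λ x → B₂ (suc h + x))) (arith eo))
    where
    arith : suc h + o ≡ suc n → o ≤ 2 + h
    arith e = lin-sound (var 0) (con 2 ⊞ var 1) (con 1 ⊞ var 1 ⊞ var 0 ⊞ var 2) (con 1 ⊞ var 2 ⊞ (con 1 ⊞ (var 1 ⊞ var 1))) (o ∷ h ∷ n ∷ []) refl (≤-reflexive e & nh)
  -- An element of `B₁` costs a factor 2, as much as two vertices under `hujter`. As `B₁` lies in
  -- [m, h], |B₁| + m ≤ h + 1; adding |B₁| + |B₂| ≤ m gives the estimate.
  weight : # N B₁ * 2 + # N B₂ ≤ 2 + h
  weight with low
  ... | inj₂ z = ≤-trans (≤-reflexive (cong (λ s → s * 2 + # N B₂) z)) B₂≤
  ... | inj₁ l = arith (# N B₁) (# N B₂) (# N B) l split bm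
    where
    arith : ∀ p q b → p + m ≤ suc h → b ≡ q + p → b ≤ m → p * 2 + q ≤ 2 + h
    arith p q _ h₁ refl h₂ = lin-sound (var 0 ⊠ con 2 ⊞ var 1) (con 2 ⊞ var 2) (var 0 ⊞ var 3 ⊞ (var 1 ⊞ var 0)) (con 1 ⊞ var 2 ⊞ var 3) (p ∷ q ∷ h ∷ m ∷ []) refl (h₁ & h₂)
  hujter-2* : ∀ p q → 2 ^ p * hujter q ≡ hujter (p * 2 + q)
  hujter-2* zero q = +-identityʳ _
  hujter-2* (suc p) q = trans (*-assoc 2 (2 ^ p) (hujter q)) (cong (2 *_) (hujter-2* p q))
  C₂≤ : # N C₂ ≤ # N C + # N B₁
  C₂≤ = ≤-trans (∑-mono N λ x _ → g (C x) (B₁ x)) (≤-reflexive (∑-+ N _ _))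
    where
    g : ∀ a b → ι (a ∨ b) ≤ ι a + ι b
    g true b = s≤s z≤n
    g false b = ≤-refl
  bound : 2 ^ # N C₂ * hujter (# N B₂) ≤ 2 ^ # N C * hujter (2 + h)
  bound = begin
    2 ^ # N C₂ * hujter (# N B₂) ≤⟨ *-monoˡ-≤ _ (^-monoʳ-≤ 2 C₂≤) ⟩
    2 ^ (# N C + # N B₁) * hujter (# N B₂) ≡⟨ cong (_* hujter (# N B₂)) (^-distribˡ-+-* 2 (# N C) (# N B₁)) ⟩
    2 ^ # N C * 2 ^ # N B₁ * hujter (# N B₂) ≡⟨ *-assoc (2 ^ # N C) _ _ ⟩
    2 ^ # N C * (2 ^ # N B₁ * hujter (# N B₂)) ≡⟨ cong (2 ^ # N C *_) (hujter-2* (# N B₁) (# N B₂)) ⟩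
    2 ^ # N C * hujter (# N B₁ * 2 + # N B₂) ≤⟨ *-monoʳ-≤ (2 ^ # N C) (hujter-mono weight) ⟩
    2 ^ # N C * hujter (2 + h) ∎
    where open ≤-Reasoning

-- Link graphs on odd numbers

odd-window : ∀ a L → 2 * ∑ L (λ x → ι (odd (a + x))) ≤ L + 1
odd-window a L = ≤-trans (go L) (+-monoʳ-≤ L (ι≤1 (not (odd (a + L)))))
  where
  go : ∀ L → 2 * ∑ L (λ x → ι (odd (a + x))) ≤ L + ι (not (odd (a + L)))
  go zero = z≤n
  go (suc L) = ≤-trans (aux (odd (a + L)) (∑ L (λ x → ι (odd (a + x)))) (go L)) (≤-reflexive (cong (λ v → suc L + ι (not (odd v))) (sym (+-suc a L))))
    where
    aux : ∀ b s → 2 * s ≤ L + ι (not b) → 2 * (s + ι b) ≤ suc L + ι (not (not b))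
    aux true s h = ≤-trans (≤-reflexive (*-distribˡ-+ 2 s 1)) (≤-trans (+-monoˡ-≤ 2 h) (≤-reflexive e))
      where
      e : L + 0 + 2 ≡ suc L + 1
      e = expr-≡ (var 0 ⊞ con 0 ⊞ con 2) (con 1 ⊞ var 0 ⊞ con 1) (L ∷ []) refl
    aux false s h = ≤-trans (≤-reflexive (cong (2 *_) (+-identityʳ s))) (≤-trans h (≤-reflexive e))
      where
      e : L + 1 ≡ suc L + 0
      e = expr-≡ (var 0 ⊞ con 1) (con 1 ⊞ var 0 ⊞ con 0) (L ∷ []) refl

#-unique : ∀ N p → (∀ x y → p x ≡ true → p y ≡ true → x ≡ y) → # N p ≤ 1
#-unique N p u with any<? N p
... | inj₂ none = ≤-trans (≤-reflexive (#-empty N p none)) z≤n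
... | inj₁ (x , _ , h) = ≤-trans (#-mono N λ y _ hy → trans (cong (_≡ᵇ y) (u x y h hy)) (≡ᵇ-refl y)) (#-single≤ N x)

double-inj : ∀ x y → x + x ≡ y + y → x ≡ y
double-inj x y e with <-cmp x y
... | tri< l _ _ = ⊥-elim (<-irrefl e (+-mono-< l l))
... | tri≈ _ e' _ = e'
... | tri> _ _ l = ⊥-elim (<-irrefl (sym e) (+-mono-< l l))

∑-weighted : ∀ N E (G : ℕ → ℕ → ℕ) c → (∀ t → ∑ N (λ x → G x t) ≤ c) → ∑ N (λ x → ∑ N (λ t → ι (E t) * G x t)) ≤ # N E * c
∑-weighted N E G c h = begin
  ∑ N (λ x → ∑ N (λ t → ι (E t) * G x t)) ≡⟨ ∑-swap N N _ ⟩
  ∑ N (λ t → ∑ N (λ x → ι (E t) * G x t)) ≡⟨ ∑-cong N (λ t _ → ∑-*ˡ N (ι (E t)) _) ⟩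
  ∑ N (λ t → ι (E t) * ∑ N (λ x → G x t)) ≤⟨ ∑-mono N (λ t _ → *-monoʳ-≤ (ι (E t)) (h t)) ⟩
  ∑ N (λ t → ι (E t) * c) ≡⟨ ∑-*ʳ N c _ ⟩
  # N E * c ∎
  where open ≤-Reasoning

∑-witness : ∀ N (E : Pr) (G : ℕ → ℕ) {t} → t < N → E t ≡ true → G t ≤ ∑ N (λ t → ι (E t) * G t)
∑-witness N E G {t} l e = ≤-trans (≤-reflexive (sym (trans (cong (λ b → ι b * G t) e) (*-identityˡ _)))) (∑-term N (λ t → ι (E t) * G t) l)

-- The vertices through which a sum edge can lie on a triangle of the link graph of E.
module Exceptional (N : ℕ) (E : Pr) where

  hits : ℕ → ℕ → ℕ → ℕ → ℕ
  hits x t₁ t₂ t₃ = δ (x + x + t₁) (t₂ + t₃) + δ (x + x) (t₁ + t₂ + t₃)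

  cnt : ℕ → ℕ
  cnt x = ∑ N λ t₁ → ι (E t₁) * ∑ N λ t₂ → ι (E t₂) * ∑ N λ t₃ → ι (E t₃) * hits x t₁ t₂ t₃

  D : Pr
  D x = 1 ≤ᵇ cnt x

  -- For each of the |E|³ triples t₁, t₂, t₃ either equation determines x, so a triple contributes
  -- at most two exceptional vertices.
  D-size : # N D ≤ # N E * (# N E * (# N E * 2))
  D-size = ≤-trans (∑-mono N λ x _ → g (cnt x)) (∑-weighted N E _ _ λ t₁ → ∑-weighted N E _ _ λ t₂ → ∑-weighted N E _ 2 λ t₃ →
      ≤-trans (≤-reflexive (∑-+ N _ _)) (+-mono-≤ (#-unique N _ λ x y h h' → double-inj x y (+-cancelʳ-≡ t₁ _ _ (trans (≡ᵇ-true {x + x + t₁} h) (sym (≡ᵇ-true {y + y + t₁} h')))))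
        (#-unique N _ λ x y h h' → double-inj x y (trans (≡ᵇ-true {x + x} h) (sym (≡ᵇ-true {y + y} h'))))))
    where
    g : ∀ c → ι (1 ≤ᵇ c) ≤ c
    g zero = z≤n
    g (suc c) = s≤s z≤n

  module _ (E< : ∀ t → E t ≡ true → t < N) where

    D-in : ∀ x t₁ t₂ t₃ → E t₁ ≡ true → E t₂ ≡ true → E t₃ ≡ true → 1 ≤ hits x t₁ t₂ t₃ → D x ≡ true
    D-in x t₁ t₂ t₃ e₁ e₂ e₃ h = true-≤ᵇ (≤-trans h (≤-trans (∑-witness N E (λ t₃ → hits x t₁ t₂ t₃) (E< t₃ e₃) e₃)
      (≤-trans (∑-witness N E (λ t₂ → ∑ N λ t₃ → ι (E t₃) * hits x t₁ t₂ t₃) (E< t₂ e₂) e₂)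
        (∑-witness N E (λ t₁ → ∑ N λ t₂ → ι (E t₂) * ∑ N λ t₃ → ι (E t₃) * hits x t₁ t₂ t₃) (E< t₁ e₁) e₁))))

    D-minus : ∀ x t₁ t₂ t₃ → E t₁ ≡ true → E t₂ ≡ true → E t₃ ≡ true → x + x + t₁ ≡ t₂ + t₃ → D x ≡ true
    D-minus x t₁ t₂ t₃ e₁ e₂ e₃ e = D-in x t₁ t₂ t₃ e₁ e₂ e₃ (≤-trans (≤-reflexive (sym (trans (cong (λ v → δ v (t₂ + t₃)) e) (δ-refl (t₂ + t₃))))) (m≤m+n _ _))

    D-plus : ∀ x t₁ t₂ t₃ → E t₁ ≡ true → E t₂ ≡ true → E t₃ ≡ true → x + x ≡ t₁ + t₂ + t₃ → D x ≡ true
    D-plus x t₁ t₂ t₃ e₁ e₂ e₃ e = D-in x t₁ t₂ t₃ e₁ e₂ e₃ (≤-trans (≤-reflexive (sym (trans (cong (λ v → δ v (t₁ + t₂ + t₃)) e) (δ-refl (t₁ + t₂ + t₃))))) (m≤n+m _ _))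

    one-sum : ∀ {x y z} → E (x + y) ≡ true → Diff E y z → Diff E x z → D x ≡ true ⊎ D y ≡ true
    one-sum {z = z} e (inj₁ (a , ta , refl)) (inj₁ (c , tc , refl)) = inj₁ (D-minus (z + c) a _ c ta e tc (g z a c))
      where
      g : ∀ z a c → z + c + (z + c) + a ≡ z + c + (z + a) + c
      g = solve-∀
    one-sum {x} e (inj₁ (a , ta , refl)) (inj₂ (c , tc , refl)) = inj₂ (D-plus (x + c + a) _ a c e ta tc (g x a c))
      where
      g : ∀ x a c → x + c + a + (x + c + a) ≡ x + (x + c + a) + a + c
      g = solve-∀
    one-sum {y = y} e (inj₂ (a , ta , refl)) (inj₁ (c , tc , refl)) = inj₁ (D-plus (y + a + c) _ a c e ta tc (g y a c))
      where
      g : ∀ y a c → y + a + c + (y + a + c) ≡ y + a + c + y + a + c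
      g = solve-∀
    one-sum {x} {y} e (inj₂ (a , ta , refl)) (inj₂ (c , tc , e')) = inj₁ (D-minus x c _ a tc e ta (trans (+-assoc x x c) (trans (cong (x +_) (sym e')) (sym (+-assoc x y a)))))

    module _ (sf : SF E) (e0 : E 0 ≡ false) where

      two-sums : ∀ {x y z} → E (x + y) ≡ true → E (y + z) ≡ true → Diff E x z → ⊥
      two-sums {x} {y} {z} e e' (inj₁ (a , ta , refl)) = sf-⊥ sf e' ta e (g y z a)
        where
        g : ∀ y z a → z + a + y ≡ y + z + a
        g = solve-∀
      two-sums {x} {y} {z} e e' (inj₂ (a , ta , refl)) = sf-⊥ sf e ta e' (g x y a)
        where
        g : ∀ x y a → y + (x + a) ≡ x + y + a
        g = solve-∀

      Edge : ℕ → ℕ → Set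
      Edge x y = E (x + y) ≡ true ⊎ Diff E x y

      comm : ∀ {x y} → E (x + y) ≡ true → E (y + x) ≡ true
      comm {x} {y} e = trans (cong E (+-comm y x)) e

      -- The number of sum edges decides. With none or two of them, the three labels form a Schur
      -- triple or vanish, which `E` excludes; with one or three, twice some vertex is a signed sum
      -- of three labels, so that vertex is in `D`.
      triangle : ∀ {x y z} → Edge x y → Edge y z → Edge x z → D x ≡ true ⊎ (D y ≡ true ⊎ D z ≡ true)
      triangle {x} {y} {z} (inj₁ a) (inj₁ b) (inj₁ c) = inj₁ (D-minus x (y + z) (x + y) (x + z) b a c (g x y z))
        where
        g : ∀ x y z → x + x + (y + z) ≡ x + y + (x + z)
        g = solve-∀
      triangle (inj₁ a) (inj₁ b) (inj₂ c) = ⊥-elim (two-sums a b c)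
      triangle {x} (inj₁ a) (inj₂ b) (inj₁ c) = ⊥-elim (two-sums (comm {x} a) c b)
      triangle {x} {y} {z} (inj₂ a) (inj₁ b) (inj₁ c) = ⊥-elim (two-sums c (comm {y} b) a)
      triangle (inj₁ a) (inj₂ b) (inj₂ c) with one-sum a b c
      ... | inj₁ d = inj₁ d
      ... | inj₂ d = inj₂ (inj₁ d)
      triangle (inj₂ a) (inj₁ b) (inj₂ c) with one-sum b (diff-sym c) (diff-sym a)
      ... | inj₁ d = inj₂ (inj₁ d)
      ... | inj₂ d = inj₂ (inj₂ d)
      triangle (inj₂ a) (inj₂ b) (inj₁ c) with one-sum c (diff-sym b) a
      ... | inj₁ d = inj₁ d
      ... | inj₂ d = inj₂ (inj₂ d)
      triangle (inj₂ a) (inj₂ b) (inj₂ c) = ⊥-elim (no-diff-triangle sf e0 a b c)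

-- For an even t, a set of odd numbers with few pairs x + y = t or x − y = t misses a quarter of the odd numbers.
module OddSparse (n : ℕ) (A : Pr) (wA : Within n A) (oddA : ∀ x → A x ≡ true → odd x ≡ true)
  (t : ℕ) (even-t : odd t ≡ false) (t≤n : t ≤ n) where

  N : ℕ
  N = suc n

  α : ℕ → ℕ
  α x = ι (A x)

  c : ℕ
  c = ∑ N λ x → α x * (α (x + t) + α (t ∸ x))

  α≤ : ∀ x → α x ≤ ι (odd x)
  α≤ x = ι-mono (oddA x)

  odd-+t : ∀ x → odd (x + t) ≡ odd x
  odd-+t x rewrite odd-+ x t | even-t with odd x
  ... | true = refl
  ... | false = refl

  odd-t∸ : ∀ x → x ≤ t → odd (t ∸ x) ≡ odd x
  odd-t∸ x l = g (odd (t ∸ x)) (odd x) (trans (sym (odd-+ (t ∸ x) x)) (trans (cong odd (m∸n+n≡m l)) even-t))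
    where
    g : ∀ a b → (if a then not b else b) ≡ false → a ≡ b
    g true true _ = refl
    g false false _ = refl

  pt : ∀ p q o → (p ≡ true → o ≡ true) → (q ≡ true → o ≡ true) → ι p + ι q ≤ ι o + ι p * ι q
  pt true true o h h' rewrite h refl = ≤-refl
  pt true false o h h' rewrite h refl = ≤-refl
  pt false true o h h' rewrite h' refl = ≤-refl
  pt false false o h h' = z≤n

  -- Compare `A` with its translate by t: they overlap in at most `c` odd numbers. Bounding `A` once
  -- without its first and once without its last t places gives 2|A| ≤ (n + t)/2 + c up to
  -- constants, and t ≤ n/2.
  short : 2 * t ≤ n → 8 * # N A ≤ 3 * n + 8 + 4 * c
  short 2t≤n with m≤n⇒∃[o]m+o≡n (≤-trans t≤n (n≤1+n n))
  ... | r , er = arith (# N A) S₁ S₂ O₁ O₂ O₃ c split₁ split₂ main (odd-window 0 r) (odd-window r t) (odd-window 0 t)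
    where
    S₁ S₂ O₁ O₂ O₃ : ℕ
    S₁ = ∑ r α
    S₂ = ∑ r (λ x → α (t + x))
    O₁ = ∑ r (λ x → ι (odd (0 + x)))
    O₂ = ∑ t (λ x → ι (odd (r + x)))
    O₃ = ∑ t (λ x → ι (odd (0 + x)))
    split₁ : # N A ≤ S₁ + O₂
    split₁ = ≤-trans (≤-reflexive (trans (cong (λ k → ∑ k α) (trans (sym er) (+-comm t r))) (∑-split r t α))) (+-monoʳ-≤ S₁ (∑-mono t λ x _ → α≤ (r + x)))
    split₂ : # N A ≤ O₃ + S₂
    split₂ = ≤-trans (≤-reflexive (trans (cong (λ k → ∑ k α) (sym er)) (∑-split t r α))) (+-monoˡ-≤ S₂ (∑-mono t λ x _ → α≤ x))
    main : S₁ + S₂ ≤ O₁ + c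
    main = ≤-trans (≤-reflexive (sym (∑-+ r _ _))) (≤-trans (∑-mono r λ x _ → pt (A x) (A (t + x)) (odd x) (oddA x)
        (λ e → trans (sym (trans (cong odd (+-comm t x)) (odd-+t x))) (oddA (t + x) e)))
      (≤-trans (≤-reflexive (∑-+ r _ _)) (+-monoʳ-≤ O₁ (≤-trans (∑-mono r λ x _ →
        *-monoʳ-≤ (α x) (≤-trans (≤-reflexive (cong α (+-comm t x))) (m≤m+n _ _))) (∑-len _ (≤-trans (m≤n+m r t) (≤-reflexive er)))))))
    arith : ∀ a S₁ S₂ O₁ O₂ O₃ c → a ≤ S₁ + O₂ → a ≤ O₃ + S₂ → S₁ + S₂ ≤ O₁ + c → 2 * O₁ ≤ r + 1 → 2 * O₂ ≤ t + 1 → 2 * O₃ ≤ t + 1 →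
      8 * a ≤ 3 * n + 8 + 4 * c
    arith a S₁ S₂ O₁ O₂ O₃ c h₁ h₂ h₃ h₄ h₅ h₆ = *-cancelˡ-≤ 2 (≤-trans (x₁ a S₁ S₂ O₁ O₂ O₃ c h₁ h₂ h₃ h₄ h₅ h₆) (x₂ c))
      where
      x₁ : ∀ a S₁ S₂ O₁ O₂ O₃ c → a ≤ S₁ + O₂ → a ≤ O₃ + S₂ → S₁ + S₂ ≤ O₁ + c → 2 * O₁ ≤ r + 1 → 2 * O₂ ≤ t + 1 → 2 * O₃ ≤ t + 1 →
        2 * (8 * a) ≤ 4 * (r + 1) + 4 * (t + 1) + 4 * (t + 1) + 8 * c
      x₁ a S₁ S₂ O₁ O₂ O₃ c h₁ h₂ h₃ h₄ h₅ h₆ = lin-sound (con 2 ⊠ (con 8 ⊠ var 0)) (con 4 ⊠ (var 1 ⊞ con 1) ⊞ con 4 ⊠ (var 2 ⊞ con 1) ⊞ con 4 ⊠ (var 2 ⊞ con 1) ⊞ con 8 ⊠ var 3) (con 8 ⊠ var 0 ⊞ (con 8 ⊠ var 0 ⊞ (con 8 ⊠ (var 4 ⊞ var 5) ⊞ (con 4 ⊠ (con 2 ⊠ var 6) ⊞ (con 4 ⊠ (con 2 ⊠ var 7) ⊞ con 4 ⊠ (con 2 ⊠ var 8)))))) (con 8 ⊠ (var 4 ⊞ var 7) ⊞ (con 8 ⊠ (var 8 ⊞ var 5) ⊞ (con 8 ⊠ (var 6 ⊞ var 3) ⊞ (con 4 ⊠ (var 1 ⊞ con 1) ⊞ (con 4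 ⊠ (var 2 ⊞ con 1) ⊞ con 4 ⊠ (var 2 ⊞ con 1)))))) (a ∷ r ∷ t ∷ c ∷ S₁ ∷ S₂ ∷ O₁ ∷ O₂ ∷ O₃ ∷ []) refl (8 · h₁ & 8 · h₂ & 8 · h₃ & 4 · h₄ & 4 · h₅ & 4 · h₆)
      x₂ : ∀ c → 4 * (r + 1) + 4 * (t + 1) + 4 * (t + 1) + 8 * c ≤ 2 * (3 * n + 8 + 4 * c)
      x₂ c = lin-sound (con 4 ⊠ (var 0 ⊞ con 1) ⊞ con 4 ⊠ (var 1 ⊞ con 1) ⊞ con 4 ⊠ (var 1 ⊞ con 1) ⊞ con 8 ⊠ var 2) (con 2 ⊠ (con 3 ⊠ var 3 ⊞ con 8 ⊞ con 4 ⊠ var 2)) (con 4 ⊠ (var 1 ⊞ var 0) ⊞ con 2 ⊠ (var 1 ⊞ (var 1 ⊞ con 0))) (con 4 ⊠ (con 1 ⊞ var 3) ⊞ con 2 ⊠ var 3) (r ∷ t ∷ c ∷ n ∷ []) refl (4 · ≤-reflexive er & 2 · 2t≤n)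

  -- The reflection x ↦ t - x preserves the odd numbers of [0, t], so `A` contains about half of
  -- them or fewer, up to `c`; beyond t there are at most (n - t)/2 odd numbers, and t ≥ n/2.
  long : n ≤ 2 * t → 8 * # N A ≤ 3 * n + 8 + 4 * c
  long n≤2t with m≤n⇒∃[o]m+o≡n (s≤s t≤n)
  ... | r , er = arith (# N A) S₁ O₁ O₂ c split main (odd-window 0 (suc t)) (odd-window (suc t) r)
    where
    S₁ O₁ O₂ : ℕ
    S₁ = ∑ (suc t) α
    O₁ = ∑ (suc t) (λ x → ι (odd (0 + x)))
    O₂ = ∑ r (λ x → ι (odd (suc t + x)))
    split : # N A ≤ S₁ + O₂
    split = ≤-trans (≤-reflexive (trans (cong (λ k → ∑ k α) (sym er)) (∑-split (suc t) r α))) (+-monoʳ-≤ S₁ (∑-mono r λ x _ → α≤ (suc t + x)))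
    main : S₁ + S₁ ≤ O₁ + c
    main = ≤-trans (≤-reflexive (trans (cong (S₁ +_) (sym (∑-rev (suc t) α))) (sym (∑-+ (suc t) _ _))))
      (≤-trans (∑-mono (suc t) λ x l → pt (A x) (A (t ∸ x)) (odd x) (oddA x) (λ e → trans (sym (odd-t∸ x (s≤s⁻¹ l))) (oddA (t ∸ x) e)))
      (≤-trans (≤-reflexive (∑-+ (suc t) _ _)) (+-monoʳ-≤ O₁ (≤-trans (∑-mono (suc t) λ x _ → *-monoʳ-≤ (α x) (m≤n+m (α (t ∸ x)) (α (x + t)))) (∑-len _ (s≤s t≤n))))))
    arith : ∀ a S₁ O₁ O₂ c → a ≤ S₁ + O₂ → S₁ + S₁ ≤ O₁ + c → 2 * O₁ ≤ suc t + 1 → 2 * O₂ ≤ r + 1 → 8 * a ≤ 3 * n + 8 + 4 * c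
    arith a S₁ O₁ O₂ c h₁ h₂ h₃ h₄ = lin-sound (con 8 ⊠ var 0) (con 3 ⊠ var 1 ⊞ con 8 ⊞ con 4 ⊠ var 2) (con 8 ⊠ var 0 ⊞ (con 4 ⊠ (var 3 ⊞ var 3) ⊞ (con 2 ⊠ (con 2 ⊠ var 4) ⊞ (con 4 ⊠ (con 2 ⊠ var 5) ⊞ (con 4 ⊠ (con 1 ⊞ (var 6 ⊞ var 7)) ⊞ var 1))))) (con 8 ⊠ (var 3 ⊞ var 5) ⊞ (con 4 ⊠ (var 4 ⊞ var 2) ⊞ (con 2 ⊠ (con 1 ⊞ var 6 ⊞ con 1) ⊞ (con 4 ⊠ (var 7 ⊞ con 1) ⊞ (con 4 ⊠ (con 1 ⊞ var 1) ⊞ (var 6 ⊞ (var 6 ⊞ con 0))))))) (a ∷ n ∷ c ∷ S₁ ∷ O₁ ∷ O₂ ∷ t ∷ r ∷ []) refl (8 · h₁ & 4 · h₂ & 2 · h₃ & 4 · h₄ & 4 · ≤-reflexive er & n≤2t)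

  sparse-bound : 8 * # N A ≤ 3 * n + 8 + 4 * c
  sparse-bound with ≤-total (2 * t) n
  ... | inj₁ l = short l
  ... | inj₂ l = long l

module OddCase (n h w Δ q Q : ℕ) (growth : q ^ suc Δ ≤ suc q ^ Δ) (hQ : suc q ^ suc n ≤ Q * q ^ suc n) (q>0 : 0 < q)
  (Δ≥12 : 12 ≤ Δ) (n≥200 : 200 ≤ n) (nh : n ≤ suc (h + h)) (w-max : ∀ f → 32 * f ≤ 15 * n → f ≤ w)
  (B C : Pr) (wB : Within n B) (wC : Within n C) (oddB : ∀ x → B x ≡ true → odd x ≡ true) where

  N K bound : ℕ
  N = suc n
  K = 256 * Δ
  bound = 2 ^ (K * (K * (K * 2))) * hujter (2 + h) + Q * moon w

  sfB : SF B
  sfB x y bx by = ¬true λ bxy → true≢false (oddB (x + y) bxy) (trans (odd-+ x y) (cong₂ (λ a b → if a then not b else b) (oddB x bx) (oddB y by)))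

  #B≤ : # N B ≤ 2 + h
  #B≤ = ≤-trans (#-mono N λ x _ → oddB x) (arith (# N odd) (odd-window 0 N) nh)
    where
    arith : ∀ o → 2 * o ≤ suc n + 1 → n ≤ suc (h + h) → o ≤ 2 + h
    arith o h₁ h₂ = *-cancelˡ-≤ 2 (lin-sound (con 2 ⊠ var 0) (con 2 ⊠ (con 2 ⊞ var 1)) (con 2 ⊠ var 0 ⊞ var 2) (con 1 ⊞ var 2 ⊞ con 1 ⊞ (con 1 ⊞ (var 1 ⊞ var 1))) (o ∷ h ∷ n ∷ []) refl (h₁ & h₂))

  module WithT (T : Pr) (wT : Within n T) (sfT : SF T) where

    open Link n T

    B° E : Pr
    B° = clean B
    E x = T x ∧ not (odd x)

    t0 : T 0 ≡ false
    t0 = proj₁ wT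

    E⊆T : E ⊆ᵖ T
    E⊆T x e = proj₁ (∧-split e)

    E-even : ∀ x → E x ≡ true → odd x ≡ false
    E-even x e = not-true (proj₂ (∧-split {T x} e))

    E< : ∀ x → E x ≡ true → x < N
    E< x e = s≤s (within-≤ wT (E⊆T x e))

    sfE : SF E
    sfE x y ex ey = ¬true λ exy → true≢false (E⊆T _ exy) (sfT x y (E⊆T x ex) (E⊆T y ey))

    e0 : E 0 ≡ false
    e0 = ¬true λ e → true≢false (E⊆T 0 e) t0

    ir : InRange B°
    ir = clean-range T wB

    ll : Loopless B°
    ll = clean-loopless B t0

    odd° : ∀ x → B° x ≡ true → odd x ≡ true
    odd° x e = oddB x (proj₁ (∧-split e))

    -- Sums and differences of odd vertices are even, so every edge has its label in `E`. Away from
    -- the at most 2K³ exceptional vertices the graph is triangle-free.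
    few-evens : # N E ≤ K → Cover N (MIS B°) (2 ^ (K * (K * (K * 2))) * hujter (2 + h))
    few-evens le = hujter-tuza-modulo (K * (K * (K * 2))) (2 + h) B° D ir ll tf
        (≤-trans (#-mono N λ x _ e → proj₂ (∧-split {B° x} e)) (≤-trans D-size (*-mono-≤ le (*-mono-≤ le (*-monoˡ-≤ 2 le)))))
        (≤-trans (clean-size n B T) #B≤)
      where
      open Exceptional N E
      edge : ∀ x y → odd x ≡ true → odd y ≡ true → adj x y ≡ true → Edge E< sfE e0 x y
      edge x y ox oy a with ∨-split {T (x + y)} a
      ... | inj₁ s = inj₁ (∧-join s (not-false (trans (odd-+ x y) (cong₂ (λ a b → if a then not b else b) ox oy))))
      ... | inj₂ s = inj₂ (toE (mkDiff {T} t0 x y s))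
        where
        even-diff : ∀ x y a → odd x ≡ true → odd y ≡ true → x ≡ y + a → odd a ≡ false
        even-diff _ y a ox oy refl = g (odd y) (odd a) oy (trans (sym (odd-+ y a)) ox)
          where
          g : ∀ p q → p ≡ true → (if p then not q else q) ≡ true → q ≡ false
          g _ q refl e = not-true e
        toE : Diff T x y → Diff E x y
        toE (inj₁ (a , ta , e)) = inj₁ (a , ∧-join ta (not-false (even-diff x y a ox oy e)) , e)
        toE (inj₂ (a , ta , e)) = inj₂ (a , ∧-join ta (not-false (even-diff y x a oy ox e)) , e)
      tf : TriangleFree (B° ∖ D)
      tf x y z hx hy hz a b c = g (triangle E< sfE e0 (edge x y (od x hx) (od y hy) a) (edge y z (od y hy) (od z hz) b) (edge x z (od x hx) (od z hz) c))
        where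
        od : ∀ x → (B° ∖ D) x ≡ true → odd x ≡ true
        od x h = odd° x (proj₁ (∧-split h))
        nd : ∀ x → (B° ∖ D) x ≡ true → D x ≡ false
        nd x h = not-true (proj₂ (∧-split {B° x} h))
        g : D x ≡ true ⊎ (D y ≡ true ⊎ D z ≡ true) → ⊥
        g (inj₁ d) = true≢false d (nd x hx)
        g (inj₂ (inj₁ d)) = true≢false d (nd y hy)
        g (inj₂ (inj₂ d)) = true≢false d (nd z hz)

    open GraphContainers N adj adj-sym Δ q growth

    -- A core vertex x has fewer than Δ neighbours, each counted at most once as x + t and once as t
    -- - x; so the counts `c t` over `E` add up to at most 2Δn. As |E| ≥ 256Δ, the least of them is
    -- at most n/128. `OddSparse` then limits the core to little more than 3n/8, and `small` keeps
    -- `F` below 15n/32.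
    container-small : K ≤ # N E → ∀ F → Container B° F → # N F ≤ w
    container-small K≤ F (container ins A A⊆F sp sm) = go (argmin N E c)
      where
      A⊆B° : A ⊆ᵖ B°
      A⊆B° x e = ins x (A⊆F x e)
      wA : Within n A
      wA = within-⊆ (λ x e → proj₁ (∧-split (A⊆B° x e))) wB
      c : ℕ → ℕ
      c t = ∑ N λ x → ι (A x) * (ι (A (x + t)) + ι (A (t ∸ x)))
      row : ∀ x → ι (A x) * ∑ N (λ t → ι (E t) * (ι (A (x + t)) + ι (A (t ∸ x)))) ≤ 2 * Δ * ι (A x)
      row x = aux (A x) refl
        where
        g : ℕ → ℕ
        g y = ι (A y ∧ adj x y)
        plus : ∀ a b t z → ι t * ι a ≤ ι (a ∧ (b ∨ (z ∨ t)))
        plus true true true z = ≤-refl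
        plus true false true true = ≤-refl
        plus true false true false = ≤-refl
        plus true b false z = z≤n
        plus false b true z = z≤n
        plus false b false z = z≤n
        minus : ∀ a b z → ι b * ι a ≤ ι (a ∧ (b ∨ z))
        minus true true z = ≤-refl
        minus a false z = z≤n
        minus false true z = z≤n
        p₁ : ∀ t → ι (E t) * ι (A (x + t)) ≤ g (x + t)
        p₁ t = ≤-trans (*-monoˡ-≤ _ (ι-mono (E⊆T t))) (≤-trans (plus (A (x + t)) (T (x + (x + t))) (T t) (T (x ∸ (x + t))))
          (≤-reflexive (cong (λ v → ι (A (x + t) ∧ (T (x + (x + t)) ∨ (T (x ∸ (x + t)) ∨ T v)))) (sym (m+n∸m≡n x t)))))
        s₁ : ∑ N (λ t → ι (E t) * ι (A (x + t))) ≤ deg A x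
        s₁ = ≤-trans (∑-mono N λ t _ → p₁ t) (≤-trans (∑-shift x N g) (≤-reflexive (∑-tail0 g (m≤n+m N x)
          λ y l → ι-false (¬true λ e → <⇒≱ l (within-≤ wA (proj₁ (∧-split e)))))))
        p₂ : ∀ t → ι (E t) * ι (A (t ∸ x)) ≤ g (t ∸ x)
        p₂ t with bool? (A (t ∸ x))
        ... | inj₂ e = ≤-trans (≤-reflexive (trans (cong (λ b → ι (E t) * ι b) e) (*-zeroʳ (ι (E t))))) z≤n
        ... | inj₁ e = ≤-trans (*-monoˡ-≤ _ (ι-mono (E⊆T t))) (≤-trans (≤-reflexive (cong (λ v → ι (T v) * ι (A (t ∸ x))) (sym eq)))
            (minus (A (t ∸ x)) (T (x + (t ∸ x))) _))
          where
          eq : x + (t ∸ x) ≡ t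
          eq = m+[n∸m]≡n {x} {t} (<⇒≤ (m∸n≢0⇒n<m λ z → true≢false (subst (λ v → A v ≡ true) z e) (proj₁ wA)))
        s₂ : ∑ N (λ t → ι (E t) * ι (A (t ∸ x))) ≤ deg A x
        s₂ = ≤-trans (∑-mono N λ t _ → p₂ t) (∑-monus N x g (cong (λ b → ι (b ∧ adj x 0)) (proj₁ wA)))
        both : ∑ N (λ t → ι (E t) * (ι (A (x + t)) + ι (A (t ∸ x)))) ≤ deg A x + deg A x
        both = ≤-trans (≤-reflexive (trans (∑-cong N λ t _ → *-distribˡ-+ (ι (E t)) _ _) (∑-+ N _ _))) (+-mono-≤ s₁ s₂)
        aux : ∀ b → A x ≡ b → ι b * ∑ N (λ t → ι (E t) * (ι (A (x + t)) + ι (A (t ∸ x)))) ≤ 2 * Δ * ι b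
        aux false e = z≤n
        aux true e = arith _ (deg A x) both (<⇒≤ (sp x e))
          where
          arith : ∀ s d → s ≤ d + d → d ≤ Δ → 1 * s ≤ 2 * Δ * 1
          arith s d h₁ h₂ = lin-sound (con 1 ⊠ var 0) (con 2 ⊠ var 1 ⊠ con 1) (var 0 ⊞ con 2 ⊠ var 2) (var 2 ⊞ var 2 ⊞ con 2 ⊠ var 1) (s ∷ Δ ∷ d ∷ []) refl (h₁ & 2 · h₂)
      total : ∑ N (λ t → ι (E t) * c t) ≤ 2 * Δ * # N A
      total = begin
        ∑ N (λ t → ι (E t) * c t) ≡⟨ ∑-cong N (λ t _ → sym (∑-*ˡ N (ι (E t)) _)) ⟩
        ∑ N (λ t → ∑ N λ x → ι (E t) * (ι (A x) * (ι (A (x + t)) + ι (A (t ∸ x))))) ≡⟨ ∑-swap N N _ ⟩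
        ∑ N (λ x → ∑ N λ t → ι (E t) * (ι (A x) * (ι (A (x + t)) + ι (A (t ∸ x))))) ≡⟨ ∑-cong N (λ x _ → trans (∑-cong N λ t _ → sw (ι (E t)) (ι (A x)) _) (∑-*ˡ N (ι (A x)) _)) ⟩
        ∑ N (λ x → ι (A x) * ∑ N λ t → ι (E t) * (ι (A (x + t)) + ι (A (t ∸ x)))) ≤⟨ ∑-mono N (λ x _ → row x) ⟩
        ∑ N (λ x → 2 * Δ * ι (A x)) ≡⟨ ∑-*ˡ N (2 * Δ) _ ⟩
        2 * Δ * # N A ∎
        where
        open ≤-Reasoning
        sw : ∀ a b c → a * (b * c) ≡ b * (a * c)
        sw = solve-∀
      #≤n : ∀ X → X 0 ≡ false → # N X ≤ n
      #≤n X x0 = ≤-trans (≤-reflexive (trans (∑-head n _) (cong (λ b → ι b + # n (λ x → X (suc x))) x0))) (#≤ n _)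
      go : (∃[ t ] t < N × E t ≡ true × (∀ u → u < N → E u ≡ true → c t ≤ c u)) ⊎ (∀ u → u < N → E u ≡ false) → # N F ≤ w
      go (inj₂ none) = ⊥-elim (<⇒≱ (≤-trans (*-mono-≤ (s≤s (z≤n {255})) (≤-trans (s≤s z≤n) Δ≥12)) K≤) (≤-reflexive (#-empty N E none)))
      go (inj₁ (t , lt , et , min)) = w-max (# N F) (arith (# N F) (# N A) (# N B°) (c t) sm (#≤n B° b°0) (OddSparse.sparse-bound n A wA (λ x e → odd° x (A⊆B° x e)) t (E-even t et) (s≤s⁻¹ lt)) ct)
        where
        b°0 : B° 0 ≡ false
        b°0 = ¬true λ e → true≢false (proj₁ (∧-split e)) (proj₁ wB)
        e*c : # N E * c t ≤ 2 * Δ * n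
        e*c = ≤-trans (≤-reflexive (sym (∑-*ʳ N (c t) _))) (≤-trans (∑-mono N λ u l → g u l (bool? (E u)))
          (≤-trans total (*-monoʳ-≤ (2 * Δ) (#≤n A (proj₁ wA)))))
          where
          g : ∀ u → u < N → (E u ≡ true) ⊎ (E u ≡ false) → ι (E u) * c t ≤ ι (E u) * c u
          g u l (inj₁ e) = *-monoʳ-≤ (ι (E u)) (min u l e)
          g u l (inj₂ e) = ≤-trans (≤-reflexive (cong (λ b → ι b * c t) e)) z≤n
        ct : 128 * c t ≤ n
        ct = *-cancelˡ-≤ (2 * Δ) {{>-nonZero (*-mono-≤ (s≤s (z≤n {1})) (≤-trans (s≤s (z≤n {11})) Δ≥12))}}
          (ar (# N E) (c t) K≤ e*c)
          where
          ar : ∀ e c → 256 * Δ ≤ e → e * c ≤ 2 * Δ * n → 2 * Δ * (128 * c) ≤ 2 * Δ * n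
          ar e c h₁ h₂ = lin-sound (con 2 ⊠ var 0 ⊠ (con 128 ⊠ var 1)) (con 2 ⊠ var 0 ⊠ var 2) (var 1 ⊠ (con 256 ⊠ var 0) ⊞ var 3 ⊠ var 1) (var 1 ⊠ var 3 ⊞ con 2 ⊠ var 0 ⊠ var 2) (Δ ∷ c ∷ n ∷ e ∷ []) refl (c · h₁ & h₂)
        arith : ∀ f a b c → suc Δ * f ≤ b + Δ * a → b ≤ n → 8 * a ≤ 3 * n + 8 + 4 * c → 128 * c ≤ n → 32 * f ≤ 15 * n
        arith f a b c h₁ h₂ h₃ h₄ = *-cancelˡ-≤ (8 * suc Δ) (lin-sound (con 8 ⊠ (con 1 ⊞ var 0) ⊠ (con 32 ⊠ var 1)) (con 8 ⊠ (con 1 ⊞ var 0) ⊠ (con 15 ⊠ var 2)) (con 256 ⊠ ((con 1 ⊞ var 0) ⊠ var 1) ⊞ (con 256 ⊠ var 3 ⊞ (con 32 ⊠ var 0 ⊠ (con 8 ⊠ var 4) ⊞ (var 0 ⊠ (con 128 ⊠ var 5) ⊞ (con 12 ⊠ var 2 ⊠ con 12 ⊞ con 11 ⊠ var 0 ⊠ con 200))))) (con 256 ⊠ (var 3 ⊞ var 0 ⊠ var 4) ⊞ (con 256 ⊠ var 2 ⊞ (con 32 ⊠ var 0 ⊠ (con 3 ⊠ var 2 ⊞ con 8 ⊞ con 4 ⊠ var 5) ⊞ (var 0 ⊠ var 2 ⊞ (con 12 ⊠ var 2 ⊠ var 0 ⊞ con 11 ⊠ var 0 ⊠ var 2)))))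 (Δ ∷ f ∷ n ∷ b ∷ a ∷ c ∷ []) refl (256 · h₁ & 256 · h₂ & 32 * Δ · h₃ & Δ · h₄ & 12 * n · Δ≥12 & 11 * Δ · n≥200))

    many-evens : K ≤ # N E → Cover N (MIS B°) (Q * moon w)
    many-evens K≤ with containers B° ir ll
    ... | L , len , cov , ok = cover-⊆ (λ I m → let (F , i , s) = cov I (sub m) (indep m) in F , i , mis-restrict m s (Container.inside (ok F i)) , i)
        (*-monoˡ-≤ (moon w) lenQ)
        (cover-list L {λ F I → MIS F I × F ∈ L} λ F i → cover-⊆ (λ I m → proj₁ m) ≤-refl
          (moon-moser w F (inRange-⊆ (Container.inside (ok F i)) ir) (loopless-⊆ (Container.inside (ok F i)) ll) (container-small K≤ F (ok F i))))
      where
      lenQ : length L ≤ Q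
      lenQ = *-cancelʳ-≤ (length L) Q (q ^ N) {{m^n≢0 q N {{>-nonZero q>0}}}} (≤-trans (ratio-mono q {# N B°} {N} {length L} (#≤ N B°) len) hQ)

    cover-T : Cover N (MIS B°) bound
    cover-T with ≤-total (# N E) K
    ... | inj₁ l = cover-⊆ (λ _ x → x) (m≤m+n _ _) (few-evens l)
    ... | inj₂ l = cover-⊆ (λ _ x → x) (m≤n+m _ _) (many-evens l)

  odd-case : (∀ x → B x ≡ true → C x ≡ false) → Cover N (MaximalIn n B C) (2 ^ # N C * bound)
  odd-case disj = cover-link wB wC sfB disj λ T s sfT → WithT.cover-T T (within-⊆ s wC) sfT

-- The upper bound

^-distribʳ-* : ∀ k a b → (a * b) ^ k ≡ a ^ k * b ^ k
^-distribʳ-* zero a b = refl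
^-distribʳ-* (suc k) a b = trans (cong (a * b *_) (^-distribʳ-* k a b)) ([m*n]*[o*p]≡[m*o]*[n*p] a b (a ^ k) (b ^ k))

bernoulli : ∀ x k → x ^ suc k + suc k * x ^ k ≤ suc x ^ suc k
bernoulli x zero = ≤-reflexive (e x)
  where
  e : ∀ x → x * 1 + 1 ≡ (1 + x) * 1
  e = solve-∀
bernoulli x (suc k) = ≤-trans (step (x ^ k)) (*-monoʳ-≤ (suc x) (bernoulli x k))
  where
  step : ∀ p → x * (x * p) + suc (suc k) * (x * p) ≤ suc x * (x * p + suc k * p)
  step p = expr-≤ (var 0 ⊠ (var 0 ⊠ var 1) ⊞ (con 1 ⊞ (con 1 ⊞ var 2)) ⊠ (var 0 ⊠ var 1)) ((con 1 ⊞ var 0) ⊠ (var 0 ⊠ var 1 ⊞ (con 1 ⊞ var 2) ⊠ var 1)) (x ∷ p ∷ k ∷ []) refl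

-- Bernoulli's inequality for (1 - 1/(q+1))^k with denominators cleared; `r` stands for q + 1 - k.
reverse-bernoulli : ∀ q k r → k + r ≡ suc q → suc q ^ k * r ≤ q ^ k * suc q
reverse-bernoulli q zero r e = ≤-reflexive (cong (1 *_) e)
reverse-bernoulli q (suc k) r e = arith (suc q ^ k) (q ^ k) (reverse-bernoulli q k (suc r) (trans (+-suc k r) e))
    (≤-trans (m≤n+m r k) (≤-reflexive (suc-injective e)))
  where
  arith : ∀ a b → a * suc r ≤ b * suc q → r ≤ q → suc q * a * r ≤ q * b * suc q
  arith a b h₁ h₂ = lin-sound ((con 1 ⊞ var 0) ⊠ var 1 ⊠ var 2) (var 0 ⊠ var 3 ⊠ (con 1 ⊞ var 0)) (var 0 ⊠ (var 1 ⊠ (con 1 ⊞ var 2)) ⊞ var 1 ⊠ var 2) (var 0 ⊠ (var 3 ⊠ (con 1 ⊞ var 0)) ⊞ var 1 ⊠ var 0) (q ∷ a ∷ r ∷ b ∷ []) refl (q · h₁ & a · h₂)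

root-two : ∀ σ k → k ≤ σ → suc (2 * σ) ^ k ≤ 2 * (2 * σ) ^ k
root-two σ k le with m≤n⇒∃[o]m+o≡n le
... | o , refl = *-cancelʳ-≤ _ _ (suc σ) (arith (suc (2 * σ) ^ k) ((2 * σ) ^ k) (reverse-bernoulli (2 * σ) k (suc (σ + o)) (eq k o)))
  where
  eq : ∀ k o → k + suc (k + o + o) ≡ suc (2 * (k + o))
  eq = solve-∀
  arith : ∀ a b → a * suc (σ + o) ≤ b * suc (2 * σ) → a * suc σ ≤ 2 * b * suc σ
  arith a b h = lin-sound (var 0 ⊠ (con 1 ⊞ (var 1 ⊞ var 2))) (con 2 ⊠ var 3 ⊠ (con 1 ⊞ (var 1 ⊞ var 2))) (var 0 ⊠ (con 1 ⊞ (var 1 ⊞ var 2 ⊞ var 2))) (var 3 ⊠ (con 1 ⊞ con 2 ⊠ (var 1 ⊞ var 2))) (a ∷ k ∷ o ∷ b ∷ []) refl h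

-- Each block of σ factors 1 + 1/(2σ) contributes at most 2 by `root-two`; the incomplete block
-- accounts for the additional factor 2.
exp-growth : ∀ σ .{{_ : NonZero σ}} N → suc (2 * σ) ^ N ≤ 2 ^ suc (N div σ) * (2 * σ) ^ N
exp-growth σ N = begin
  suc q ^ N ≡⟨ cong (suc q ^_) (m≡m%n+[m/n]*n N σ) ⟩
  suc q ^ (N % σ + N div σ * σ) ≡⟨ ^-distribˡ-+-* (suc q) (N % σ) (N div σ * σ) ⟩
  suc q ^ (N % σ) * suc q ^ (N div σ * σ) ≤⟨ *-mono-≤ (root-two σ (N % σ) (<⇒≤ (m%n<n N σ))) (blocks (N div σ)) ⟩
  2 * q ^ (N % σ) * (2 ^ (N div σ) * q ^ (N div σ * σ)) ≡⟨ e (q ^ (N % σ)) (2 ^ (N div σ)) (q ^ (N div σ * σ)) ⟩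
  2 ^ suc (N div σ) * (q ^ (N % σ) * q ^ (N div σ * σ)) ≡⟨ cong (2 ^ suc (N div σ) *_) (trans (sym (^-distribˡ-+-* q (N % σ) (N div σ * σ))) (cong (q ^_) (sym (m≡m%n+[m/n]*n N σ)))) ⟩
  2 ^ suc (N div σ) * q ^ N ∎
  where
  open ≤-Reasoning
  q = 2 * σ
  e : ∀ a b c → 2 * a * (b * c) ≡ 2 * b * (a * c)
  e = solve-∀
  blocks : ∀ j → suc q ^ (j * σ) ≤ 2 ^ j * q ^ (j * σ)
  blocks zero = ≤-refl
  blocks (suc j) = begin
    suc q ^ (σ + j * σ) ≡⟨ ^-distribˡ-+-* (suc q) σ (j * σ) ⟩
    suc q ^ σ * suc q ^ (j * σ) ≤⟨ *-mono-≤ (root-two σ σ ≤-refl) (blocks j) ⟩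
    2 * q ^ σ * (2 ^ j * q ^ (j * σ)) ≡⟨ e (q ^ σ) (2 ^ j) (q ^ (j * σ)) ⟩
    2 * 2 ^ j * (q ^ σ * q ^ (j * σ)) ≡⟨ cong (2 ^ suc j *_) (sym (^-distribˡ-+-* q σ (j * σ))) ⟩
    2 ^ suc j * q ^ (suc j * σ) ∎

n<2^n : ∀ n → n < 2 ^ n
n<2^n zero = s≤s z≤n
n<2^n (suc n) = arith (2 ^ n) (n<2^n n)
  where
  arith : ∀ a → suc n ≤ a → suc (suc n) ≤ 2 * a
  arith a h = lin-sound (con 1 ⊞ (con 1 ⊞ var 0)) (con 2 ⊠ var 1) (con 2 ⊠ (con 1 ⊞ var 0)) (con 2 ⊠ var 1) (n ∷ a ∷ []) refl (2 · h)

double-growth : ∀ q → 0 < q → 2 * q ^ q ≤ suc q ^ q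
double-growth (suc k) _ = ≤-trans (≤-reflexive (e (suc k ^ k))) (bernoulli (suc k) k)
  where
  e : ∀ a → 2 * (suc k * a) ≡ suc k * a + suc k * a
  e a = expr-≡ (con 2 ⊠ ((con 1 ⊞ var 0) ⊠ var 1)) ((con 1 ⊞ var 0) ⊠ var 1 ⊞ (con 1 ⊞ var 0) ⊠ var 1) (k ∷ a ∷ []) refl

-- As (1 + 1/q)^q ≥ 2, the q²-th power of 1 + 1/q is at least 2^q, which exceeds q. Thus Δ = q²
-- satisfies the growth condition of the containers.
container-growth : ∀ q → 0 < q → q ^ suc (q * q) ≤ suc q ^ (q * q)
container-growth q q>0 = begin
  q * q ^ (q * q) ≤⟨ *-monoˡ-≤ _ (<⇒≤ (n<2^n q)) ⟩
  2 ^ q * q ^ (q * q) ≡⟨ cong (2 ^ q *_) (sym (^-*-assoc q q q)) ⟩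
  2 ^ q * (q ^ q) ^ q ≡⟨ ^-distribʳ-* q 2 (q ^ q) ⟨
  (2 * q ^ q) ^ q ≤⟨ ^-monoˡ-≤ q (double-growth q q>0) ⟩
  (suc q ^ q) ^ q ≡⟨ ^-*-assoc (suc q) q q ⟩
  suc q ^ (q * q) ∎
  where open ≤-Reasoning

^-cancel-≤ : ∀ k {a b} → 0 < k → a ^ k ≤ b ^ k → a ≤ b
^-cancel-≤ (suc k) {a} {b} _ h = ≮⇒≥ λ l → <⇒≱ (^-monoˡ-< (suc k) l) h

moon³ : ∀ j → moon j ^ 3 ≤ 343 * 3 ^ j
moon³ 0 = ≤ᵇ⇒≤ 343 343 _
moon³ 1 = ≤ᵇ⇒≤ 1000 1029 _
moon³ 2 = ≤ᵇ⇒≤ 2744 3087 _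
moon³ (suc (suc (suc j))) = arith (moon j) (3 ^ j) (moon³ j)
  where
  arith : ∀ x a → x * (x * (x * 1)) ≤ 343 * a → 3 * x * (3 * x * (3 * x * 1)) ≤ 343 * (3 * (3 * (3 * a)))
  arith x a h = lin-sound (con 3 ⊠ var 0 ⊠ (con 3 ⊠ var 0 ⊠ (con 3 ⊠ var 0 ⊠ con 1))) (con 343 ⊠ (con 3 ⊠ (con 3 ⊠ (con 3 ⊠ var 1)))) (con 27 ⊠ (var 0 ⊠ (var 0 ⊠ (var 0 ⊠ con 1)))) (con 27 ⊠ (con 343 ⊠ var 1)) (x ∷ a ∷ []) refl (27 · h)

hujter² : ∀ j → hujter j * hujter j ≤ 49 * 2 ^ j
hujter² 0 = ≤ᵇ⇒≤ 25 49 _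
hujter² 1 = ≤ᵇ⇒≤ 49 98 _
hujter² (suc (suc j)) = arith (hujter j) (2 ^ j) (hujter² j)
  where
  arith : ∀ x a → x * x ≤ 49 * a → 2 * x * (2 * x) ≤ 49 * (2 * (2 * a))
  arith x a h = lin-sound (con 2 ⊠ var 0 ⊠ (con 2 ⊠ var 0)) (con 49 ⊠ (con 2 ⊠ (con 2 ⊠ var 1))) (con 4 ⊠ (var 0 ⊠ var 0)) (con 4 ⊠ (con 49 ⊠ var 1)) (x ∷ a ∷ []) refl (4 · h)

-- Changes the base of an exponential bound from `a` to `b` when `a ^ v ≤ b ^ g`. The exponents
-- involved are rational, so both sides are compared after raising them to the power `r`.
power-transfer : ∀ {x c C a b w n p r p′ r′ u v g} → 0 < r → p * r ≡ p′ * r′ → x ^ p′ ≤ c * a ^ w → c ^ r′ ≤ C ^ r →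
  w * r′ ≤ v * u → a ^ v ≤ b ^ g → g * u ≡ n * r → 0 < a → x ^ p ≤ C * b ^ n
power-transfer {x} {c} {C} {a} {b} {w} {n} {p} {r} {p′} {r′} {u} {v} {g} r>0 pr hx hc hw hab gu a>0 = ^-cancel-≤ r r>0 (begin
  (x ^ p) ^ r ≡⟨ trans (^-*-assoc x p r) (trans (cong (x ^_) pr) (sym (^-*-assoc x p′ r′))) ⟩
  (x ^ p′) ^ r′ ≤⟨ ^-monoˡ-≤ r′ hx ⟩
  (c * a ^ w) ^ r′ ≡⟨ ^-distribʳ-* r′ c (a ^ w) ⟩
  c ^ r′ * (a ^ w) ^ r′ ≡⟨ cong (c ^ r′ *_) (^-*-assoc a w r′) ⟩
  c ^ r′ * a ^ (w * r′) ≤⟨ *-mono-≤ hc (^-monoʳ-≤ a {{>-nonZero a>0}} hw) ⟩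
  C ^ r * a ^ (v * u) ≡⟨ cong (C ^ r *_) (sym (^-*-assoc a v u)) ⟩
  C ^ r * (a ^ v) ^ u ≤⟨ *-monoʳ-≤ (C ^ r) (^-monoˡ-≤ u hab) ⟩
  C ^ r * (b ^ g) ^ u ≡⟨ cong (C ^ r *_) (trans (^-*-assoc b g u) (trans (cong (b ^_) gu) (sym (^-*-assoc b n r)))) ⟩
  C ^ r * (b ^ n) ^ r ≡⟨ ^-distribʳ-* r C (b ^ n) ⟨
  (C * b ^ n) ^ r ∎)
  where open ≤-Reasoning

-- 3⁵ < 2⁸ is what makes the density 15/32 harmless.
moon⁴ : ∀ n w → 32 * w ≤ 15 * n → moon w ^ 4 ≤ 2 ^ (17 + n)
moon⁴ n w h = ≤-trans (power-transfer {moon w} {343} {2 ^ 17} {3} {2} {w} {n} {4} {24} {3} {32} {3 * n} {5} {8} (s≤s z≤n) refl (moon³ w)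
    (≤ᵇ⇒≤ (343 ^ 32) ((2 ^ 17) ^ 24) _) (≤-trans (≤-reflexive (*-comm w 32)) (≤-trans h (≤-reflexive (*-assoc 5 3 n))))
    (≤ᵇ⇒≤ (3 ^ 5) (2 ^ 8) _) (trans (sym (*-assoc 8 3 n)) (*-comm 24 n)) (s≤s z≤n))
  (≤-reflexive (sym (^-distribˡ-+-* 2 17 n)))

hujter⁴ : ∀ n h → h + h ≤ n → hujter (2 + h) ^ 4 ≤ 2 ^ (17 + n)
hujter⁴ n h hn = ≤-trans (square (hujter (2 + h)) 49 (2 ^ (2 + h)) (2 ^ 12) (hujter² (2 + h)) (≤ᵇ⇒≤ (49 * 49) (2 ^ 12) _))
  (≤-trans (≤-reflexive (trans (cong (2 ^ 12 *_) (sym (^-distribˡ-+-* 2 (2 + h) (2 + h)))) (sym (^-distribˡ-+-* 2 12 (2 + h + (2 + h))))))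
    (^-monoʳ-≤ 2 (expo hn)))
  where
  expo : h + h ≤ n → 12 + (2 + h + (2 + h)) ≤ 17 + n
  expo hn = lin-sound (con 12 ⊞ (con 2 ⊞ var 0 ⊞ (con 2 ⊞ var 0))) (con 17 ⊞ var 1) (var 0 ⊞ var 0) (var 1) (h ∷ n ∷ []) refl hn
  square : ∀ y c p C → y * y ≤ c * p → c * c ≤ C → y ^ 4 ≤ C * (p * p)
  square y c p C h₁ h₂ = ≤-trans (≤-reflexive (e y)) (≤-trans (*-mono-≤ h₁ h₁) (≤-trans (≤-reflexive (e′ c p)) (*-monoˡ-≤ (p * p) h₂)))
    where
    e : ∀ x → x * (x * (x * (x * 1))) ≡ x * x * (x * x)
    e = solve-∀
    e′ : ∀ c p → c * p * (c * p) ≡ c * c * (p * p)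
    e′ = solve-∀

sum⁴ : ∀ x y z → x ^ 4 ≤ z → y ^ 4 ≤ z → (x + y) ^ 4 ≤ 2 ^ 4 * z
sum⁴ x y z hx hy with ≤-total x y
... | inj₁ l = ≤-trans (^-monoˡ-≤ 4 (+-monoˡ-≤ y l)) (≤-trans (≤-reflexive (e y)) (*-monoʳ-≤ (2 ^ 4) hy))
  where
  e : ∀ y → (y + y) * ((y + y) * ((y + y) * ((y + y) * 1))) ≡ 16 * (y * (y * (y * (y * 1))))
  e = solve-∀
... | inj₂ l = ≤-trans (^-monoˡ-≤ 4 (+-monoʳ-≤ x l)) (≤-trans (≤-reflexive (e x)) (*-monoʳ-≤ (2 ^ 4) hx))
  where
  e : ∀ y → (y + y) * ((y + y) * ((y + y) * ((y + y) * 1))) ≡ 16 * (y * (y * (y * (y * 1))))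
  e = solve-∀

fourth-power : ∀ a b c m x y → x ^ 4 ≤ 2 ^ m → y ^ 4 ≤ 2 ^ m →
  (2 ^ a * (2 ^ b * (2 ^ c * (x + y)))) ^ 4 ≤ 2 ^ (4 * a + 4 * b + 4 * c + (4 + m))
fourth-power a b c m x y hx hy = begin
  (2 ^ a * (2 ^ b * (2 ^ c * (x + y)))) ^ 4 ≡⟨ spread (2 ^ a) (2 ^ b) (2 ^ c) (x + y) ⟩
  (2 ^ a) ^ 4 * (2 ^ b) ^ 4 * (2 ^ c) ^ 4 * (x + y) ^ 4 ≤⟨ *-monoʳ-≤ ((2 ^ a) ^ 4 * (2 ^ b) ^ 4 * (2 ^ c) ^ 4) (≤-trans (sum⁴ x y (2 ^ m) hx hy) (≤-reflexive (sym (^-distribˡ-+-* 2 4 m)))) ⟩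
  (2 ^ a) ^ 4 * (2 ^ b) ^ 4 * (2 ^ c) ^ 4 * 2 ^ (4 + m) ≡⟨ cong (_* 2 ^ (4 + m)) (cong₂ _*_ (cong₂ _*_ (four a) (four b)) (four c)) ⟩
  2 ^ (4 * a) * 2 ^ (4 * b) * 2 ^ (4 * c) * 2 ^ (4 + m) ≡⟨ sym (trans (^-distribˡ-+-* 2 (4 * a + 4 * b + 4 * c) (4 + m)) (cong (_* 2 ^ (4 + m))
      (trans (^-distribˡ-+-* 2 (4 * a + 4 * b) (4 * c)) (cong (_* 2 ^ (4 * c)) (^-distribˡ-+-* 2 (4 * a) (4 * b)))))) ⟩
  2 ^ (4 * a + 4 * b + 4 * c + (4 + m)) ∎
  where
  open ≤-Reasoning
  four : ∀ e → (2 ^ e) ^ 4 ≡ 2 ^ (4 * e)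
  four e = trans (^-*-assoc 2 e 4) (cong (2 ^_) (*-comm e 4))
  spread : ∀ a b c x → (a * (b * (c * x))) ^ 4 ≡ a ^ 4 * b ^ 4 * c ^ 4 * x ^ 4
  spread a b c x = trans (^-distribʳ-* 4 a _) (trans (cong (a ^ 4 *_) (trans (^-distribʳ-* 4 b _) (cong (b ^ 4 *_) (^-distribʳ-* 4 c x)))) (e (a ^ 4) (b ^ 4) (c ^ 4) (x ^ 4)))
    where
    e : ∀ a b c x → a * (b * (c * x)) ≡ a * b * c * x
    e = solve-∀

half : ∀ n → ∃[ h ] h + h ≤ n × n ≤ suc (h + h)
half zero = 0 , z≤n , z≤n
half (suc zero) = 0 , z≤n , s≤s z≤n
half (suc (suc n)) with half n
... | h , l , u = suc h , ≤-trans (≤-reflexive (cong suc (+-suc h h))) (s≤s (s≤s l)) , ≤-trans (s≤s (s≤s u)) (≤-reflexive (cong (λ v → suc (suc v)) (sym (+-suc h h))))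

removalConst>0 : ∀ t → 0 < t → 0 < removalConst t
removalConst>0 t t>0 = *-mono-≤ (*-mono-≤ (*-mono-≤ (*-mono-≤ t>0 t>0) (*-mono-≤ t>0 t>0)) (*-mono-≤ (*-mono-≤ t>0 t>0) t>0))
    (*-mono-≤ (*-mono-≤ (k≤tower j 1) (k≤tower j 1)) (k≤tower j 1))
  where j = suc (t * (t * t * (t * t)))

-- `s` is the accuracy and `d` the reciprocal Schur density that removal tolerates. There are 16d
-- rounds of containers, each costing about 2N/σ bits, so σ = 32ds makes their total about n/s bits;
-- `rest` collects the costs that do not grow with n.
module UpperBound (s d σ q Δ : ℕ) .{{_ : NonZero s}} .{{_ : NonZero σ}} (d>0 : 0 < d) (σ-eq : σ ≡ 32 * d * s) (q>0 : 0 < q) (Δ≥12 : 12 ≤ Δ)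
  (growth : q ^ suc Δ ≤ suc q ^ Δ) (exp-bound : ∀ N → suc q ^ N ≤ 2 ^ suc (N div σ) * q ^ N)
  (remove : ∀ n A → 0 < n → Within n A → d * τ n A ≤ n * n →
    ∃ λ (C : Pr) → (∀ x → C x ≡ true → A x ≡ true) × s * # (suc n) C ≤ n × SF (A ∖ C)) where

  k κ : ℕ
  k = 4 * d * Δ
  κ = (256 * Δ) * ((256 * Δ) * ((256 * Δ) * 2))

  rest : ℕ
  rest = 4 * (1 + σ + 16 * d * s * suc (q * k)) + 4 * (1 + σ) + s * (4 * suc κ + 21)

  module At (n : ℕ) (n≥200 : 200 ≤ n) (n≥step : 16 * d * k ≤ n) (n≥rest : rest ≤ n) where

    N β e₂ w h e₁ Q P₁ P₂ P M : ℕ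
    N = suc n
    β = suc (N div σ)
    e₂ = n div s
    w = 15 * n div 32
    h = proj₁ (half n)
    e₁ = 16 * d * (2 * β + suc (q * k))
    Q = 2 ^ β
    P₁ = moon w + hujter (2 + h)
    P₂ = 2 ^ κ * hujter (2 + h) + Q * moon w
    P = P₁ + P₂
    M = 2 ^ e₁ * (2 ^ e₂ * P)

    n>0 : 0 < n
    n>0 = ≤-trans (s≤s z≤n) n≥200

    hQ : suc q ^ N ≤ Q * q ^ N
    hQ = exp-bound N

    w-max : ∀ f → 32 * f ≤ 15 * n → f ≤ w
    w-max f le = ≤-trans (≤-reflexive (sym (m*n/n≡m f 32))) (/-monoˡ-≤ 32 (≤-trans (≤-reflexive (*-comm f 32)) le))

    w-ok : 32 * w ≤ 15 * n
    w-ok = ≤-trans (≤-reflexive (*-comm 32 w)) (m/n*n≤m (15 * n) 32)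

    open SchurContainers d Δ q Q n d>0 (≤-trans (s≤s z≤n) Δ≥12) q>0 growth hQ n≥step n>0

    container-case : ∀ F → F ⊆ᵖ interval → Few F → Cover N (λ S → MaxSF n S × S ⊆ᵖ F) (2 ^ e₂ * P)
    container-case F sub few = go (remove n F n>0 wF few)
      where
      wF : Within n F
      wF = within-⊆ sub interval-within
      go : (∃ λ (C : Pr) → (∀ x → C x ≡ true → F x ≡ true) × s * # N C ≤ n × SF (F ∖ C)) → Cover N (λ S → MaxSF n S × S ⊆ᵖ F) (2 ^ e₂ * P)
      go (C , C⊆F , small , sf) = cover-⊆ place ≤-refl (cases (32 * # N B ≤? 15 * n))
        where
        B : Pr
        B = F ∖ C
        wB : Within n B
        wB = within-⊆ (λ x e → proj₁ (∧-split e)) wF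
        wC : Within n C
        wC = within-⊆ C⊆F wF
        disj : ∀ x → B x ≡ true → C x ≡ false
        disj x e = not-true (proj₂ (∧-split {F x} e))
        place : ∀ S → MaxSF n S × S ⊆ᵖ F → MaximalIn n B C S
        place S (ms , sF) = ms , λ x sx → g x (sF x sx) (bool? (C x))
          where
          g : ∀ x → F x ≡ true → (C x ≡ true) ⊎ (C x ≡ false) → B x ≡ true ⊎ C x ≡ true
          g x f (inj₁ c) = inj₂ c
          g x f (inj₂ c) = inj₁ (∧-join f (not-false c))
        #C : # N C ≤ e₂
        #C = ≤-trans (≤-reflexive (sym (m*n/n≡m (# N C) s))) (/-monoˡ-≤ s (≤-trans (≤-reflexive (*-comm (# N C) s)) small))
        enlarge : ∀ {P'} → P' ≤ P → Cover N (MaximalIn n B C) (2 ^ # N C * P') → Cover N (MaximalIn n B C) (2 ^ e₂ * P)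
        enlarge le = cover-⊆ (λ _ x → x) (*-mono-≤ (^-monoʳ-≤ 2 #C) le)
        cases : Dec (32 * # N B ≤ 15 * n) → Cover N (MaximalIn n B C) (2 ^ e₂ * P)
        cases (yes le) = enlarge (≤-trans (m≤m+n (moon w) (hujter (2 + h))) (m≤m+n P₁ P₂)) (generic-case w wB wC sf disj (w-max (# N B) le))
        cases (no gt) with large-sum-free n B wB sf (≰⇒> gt) n≥200
        ... | inj₁ ob = enlarge (m≤n+m P₂ P₁) (OddCase.odd-case n h w Δ q Q growth hQ q>0 Δ≥12 n≥200 (proj₂ (proj₂ (half n))) w-max B C wB wC ob disj)
        ... | inj₂ (m , min , bm) = enlarge (≤-trans (m≤n+m (hujter (2 + h)) (moon w)) (m≤m+n P₁ P₂)) (interval-case h m wB wC sf disj (proj₂ (proj₂ (half n))) min bm)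

    count : step-bound ^ (16 * d) ≤ 2 ^ e₁
    count = ≤-trans (^-monoˡ-≤ (16 * d) sb) (≤-reflexive (trans (^-*-assoc 2 (2 * β + suc (q * k)) (16 * d)) (cong (2 ^_) (*-comm (2 * β + suc (q * k)) (16 * d)))))
      where
      sb : step-bound ≤ 2 ^ (2 * β + suc (q * k))
      sb = begin
        Q * q ^ k * suc Q ≤⟨ *-mono-≤ (*-monoʳ-≤ Q (≤-trans (^-monoˡ-≤ k (<⇒≤ (n<2^n q))) (≤-reflexive (^-*-assoc 2 q k)))) (+-monoˡ-≤ Q (m^n>0 2 β)) ⟩
        Q * 2 ^ (q * k) * (Q + Q) ≡⟨ e Q (2 ^ (q * k)) ⟩
        Q * Q * (2 * 2 ^ (q * k)) ≡⟨ cong (_* 2 ^ suc (q * k)) (sym (trans (cong (2 ^_) (cong (β +_) (+-identityʳ β))) (^-distribˡ-+-* 2 β β))) ⟩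
        2 ^ (2 * β) * 2 ^ suc (q * k) ≡⟨ ^-distribˡ-+-* 2 (2 * β) (suc (q * k)) ⟨
        2 ^ (2 * β + suc (q * k)) ∎
        where
        open ≤-Reasoning
        e : ∀ a b → a * b * (a + a) ≡ a * a * (2 * b)
        e = solve-∀

    cover-maximal : Cover N (MaxSF n) M
    cover-maximal with schur-containers
    ... | L , len , cov , ok = cover-⊆ find (*-monoˡ-≤ (2 ^ e₂ * P) (≤-trans len count))
        (cover-list L λ F i → container-case F (proj₁ (ok F i)) (proj₂ (ok F i)))
      where
      find : ∀ S → MaxSF n S → ∃ λ F → F ∈ L × (MaxSF n S × S ⊆ᵖ F)
      find S ms with cov S (MaxSF.sumFree ms) (λ x e → ∧-join (true-≤ᵇ (within-pos (MaxSF.within ms) e)) (true-≤ᵇ (within-≤ (MaxSF.within ms) e)))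
      ... | F , i , sub = F , i , ms , sub

    P≤ : P ≤ 2 ^ (β + suc κ) * (moon w + hujter (2 + h))
    P≤ = ≤-trans (arith (moon w) (hujter (2 + h)) (2 ^ β) (2 ^ κ) (m^n>0 2 β) (m^n>0 2 κ)) (≤-reflexive (cong (_* (moon w + hujter (2 + h))) (sym (^-distribˡ-+-* 2 β (suc κ)))))
      where
      arith : ∀ x y a b → 1 ≤ a → 1 ≤ b → x + y + (b * y + a * x) ≤ a * (2 * b) * (x + y)
      arith x y a b ha hb = ≤-trans (+-mono-≤ {x + y} {a * b * (x + y)} (≤-trans (≤-reflexive (sym (*-identityˡ _))) (*-monoˡ-≤ (x + y) (*-mono-≤ ha hb)))
          (+-mono-≤ (≤-trans (≤-reflexive (sym (*-identityˡ _))) (*-monoˡ-≤ (b * y) ha)) (≤-trans (≤-reflexive (sym (*-identityˡ _))) (*-monoˡ-≤ (a * x) hb))))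
        (≤-reflexive (e x y a b))
        where
        e : ∀ x y a b → a * b * (x + y) + (a * (b * y) + b * (a * x)) ≡ a * (2 * b) * (x + y)
        e = solve-∀

    total : ℕ
    total = 4 * e₁ + 4 * e₂ + 4 * (β + suc κ) + (4 + (17 + n))

    M⁴ : M ^ 4 ≤ 2 ^ total
    M⁴ = ≤-trans (^-monoˡ-≤ 4 (*-monoʳ-≤ (2 ^ e₁) (*-monoʳ-≤ (2 ^ e₂) P≤)))
      (fourth-power e₁ e₂ (β + suc κ) (17 + n) (moon w) (hujter (2 + h)) (moon⁴ n w w-ok) (hujter⁴ n h (proj₁ (proj₂ (half n)))))

    -- The 13 is 8 + 4 + 1: `β` enters through the containers of both rounds, each contributing at
    -- most 4n after multiplication by s; the subsets of `C` contribute 4n, and the constants n by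
    -- the choice of `rest`.
    exponent : s * total ≤ (s + 13) * n
    exponent = arith d s σ β e₂ (suc (q * k)) (suc κ) σ-eq σβ se₂ n≥rest (m≤n*m β (32 * d) {{>-nonZero (*-mono-≤ (s≤s (z≤n {31})) d>0)}})
      where
      σβ : σ * β ≤ suc n + σ
      σβ = ≤-trans (≤-reflexive (trans (*-suc σ (N div σ)) (+-comm σ _))) (+-monoˡ-≤ σ (≤-trans (≤-reflexive (*-comm σ (N div σ))) (m/n*n≤m N σ)))
      se₂ : s * e₂ ≤ n
      se₂ = ≤-trans (≤-reflexive (*-comm s e₂)) (m/n*n≤m n s)
      arith : ∀ d s σ β e₂ z κ → σ ≡ 32 * d * s → σ * β ≤ suc n + σ → s * e₂ ≤ n →
        4 * (1 + σ + 16 * d * s * z) + 4 * (1 + σ) + s * (4 * κ + 21) ≤ n → β ≤ 32 * d * β →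
        s * (4 * (16 * d * (2 * β + z)) + 4 * e₂ + 4 * (β + κ) + (4 + (17 + n))) ≤ (s + 13) * n
      arith d s _ β e₂ z κ refl h₁ h₂ h₃ h₄ = lin-sound (var 0 ⊠ (con 4 ⊠ (con 16 ⊠ var 1 ⊠ (con 2 ⊠ var 2 ⊞ var 3)) ⊞ con 4 ⊠ var 4 ⊞ con 4 ⊠ (var 2 ⊞ var 5) ⊞ (con 4 ⊞ (con 17 ⊞ var 6)))) ((var 0 ⊞ con 13) ⊠ var 6) (con 8 ⊠ (con 32 ⊠ var 1 ⊠ var 0 ⊠ var 2) ⊞ (con 4 ⊠ (var 0 ⊠ var 4) ⊞ (con 4 ⊠ (con 1 ⊞ con 32 ⊠ var 1 ⊠ var 0 ⊞ con 16 ⊠ var 1 ⊠ var 0 ⊠ var 3) ⊞ con 4 ⊠ (con 1 ⊞ con 32 ⊠ var 1 ⊠ var 0) ⊞ var 0 ⊠ (con 4 ⊠ var 5 ⊞ con 21) ⊞ con 4 ⊠ var 0 ⊠ var 2))) (con 8 ⊠ (con 1 ⊞ var 6 ⊞ con 32 ⊠ var 1 ⊠ var 0) ⊞ (con 4 ⊠ var 6 ⊞ (var 6 ⊞ con 4 ⊠ var 0 ⊠ (con 32 ⊠ var 1 ⊠ var 2)))) (s ∷ d ∷ β ∷ z ∷ e₂ ∷ κ ∷ n ∷ []) refl (8 · h₁ & 4 · h₂ & h₃ & 4 * s · h₄)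

    M-bound : M ^ (4 * s) ≤ 2 ^ ((s + 13) * n)
    M-bound = ≤-trans (≤-reflexive (sym (^-*-assoc M 4 s))) (≤-trans (^-monoˡ-≤ s M⁴) (≤-trans (≤-reflexive (trans (^-*-assoc 2 total s) (cong (2 ^_) (*-comm total s)))) (^-monoʳ-≤ 2 exponent)))

-- Removal is invoked with 60s, which cancels the 60 in its conclusion and leaves |C| ≤ n/s.
upper-bound : ∀ s → 0 < s → ∃[ n₀ ] ∀ n → n₀ ≤ n → ∃[ M ] Cover (suc n) (MaxSF n) M × M ^ (4 * s) ≤ 2 ^ ((s + 13) * n)
upper-bound s s>0 = build (removalConst (60 * s)) (removalConst>0 (60 * s) (*-mono-≤ (s≤s (z≤n {59})) s>0))
    (arithmetic-removal (60 * s) (≤-trans (≤ᵇ⇒≤ 3 60 _) (*-mono-≤ (≤-refl {60}) s>0)))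
  where
  build : ∀ d → 0 < d → (∀ n A → 0 < n → Within n A → d * τ n A ≤ n * n →
      ∃ λ (C : Pr) → (∀ x → C x ≡ true → A x ≡ true) × 60 * s * # (suc n) C ≤ 60 * n × SF (A ∖ C)) →
    ∃[ n₀ ] ∀ n → n₀ ≤ n → ∃[ M ] Cover (suc n) (MaxSF n) M × M ^ (4 * s) ≤ 2 ^ ((s + 13) * n)
  build d d>0 rem = 200 + (step + rest) , λ n le →
      let l₁ = ≤-trans (m≤m+n 200 (step + rest)) le
          l₂ = ≤-trans (≤-trans (m≤m+n step rest) (m≤n+m (step + rest) 200)) le
          l₃ = ≤-trans (≤-trans (m≤n+m rest step) (m≤n+m (step + rest) 200)) le
      in At.M n l₁ l₂ l₃ , At.cover-maximal n l₁ l₂ l₃ , At.M-bound n l₁ l₂ l₃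
    where
    σ q : ℕ
    σ = 32 * d * s
    q = 2 * σ
    σ>0 : 0 < σ
    σ>0 = *-mono-≤ (*-mono-≤ (s≤s (z≤n {31})) d>0) s>0
    σ≥2 : 2 ≤ σ
    σ≥2 = ≤-trans (≤ᵇ⇒≤ 2 32 _) (*-mono-≤ (*-mono-≤ (≤-refl {32}) d>0) s>0)
    q≥4 : 4 ≤ q
    q≥4 = *-monoʳ-≤ 2 σ≥2
    q>0 : 0 < q
    q>0 = ≤-trans (s≤s z≤n) q≥4
    remove : ∀ n A → 0 < n → Within n A → d * τ n A ≤ n * n →
      ∃ λ (C : Pr) → (∀ x → C x ≡ true → A x ≡ true) × s * # (suc n) C ≤ n × SF (A ∖ C)
    remove n A n>0 w few with rem n A n>0 w few
    ... | C , sub , small , sf = C , sub , *-cancelˡ-≤ 60 (≤-trans (≤-reflexive (sym (*-assoc 60 s (# (suc n) C)))) small) , sf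
    open UpperBound s d σ q (q * q) {{>-nonZero s>0}} {{>-nonZero σ>0}} d>0 refl q>0 (≤-trans (≤ᵇ⇒≤ 12 16 _) (*-mono-≤ q≥4 q≥4))
      (container-growth q q>0) (exp-growth σ {{>-nonZero σ>0}}) remove
    step : ℕ
    step = 16 * d * k

-- Maximal sum-free sets as subsets of [n]

-- These imports come late because the constructor +_ makes sections of _+_ ambiguous.
open import Data.Fin using (toℕ; fromℕ<) renaming (zero to fzero; suc to fsuc)
import Data.Fin.Properties as Finₚ
open import Data.Fin.Subset using (Subset; inside; outside; _⊃_)
import Data.Fin.Subset as Subset
open import Data.Fin.Subset.Induction using (⊃-wellFounded)
open import Data.Integer using (+_)
import Data.Integer as ℤ
import Data.Integer.Properties as ℤₚ
open import Data.List.Membership.Propositional.Properties using (∈-∃++)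
open import Data.List.Relation.Unary.Unique.Propositional using (Unique; []; _∷_)
import Data.List.Relation.Unary.Unique.Propositional.Properties as Uniqueₚ
open import Data.List.Relation.Unary.All using ([]; _∷_) renaming (lookup to All-lookup)
open import Data.Vec using ([]; _∷_)
open import Induction.WellFounded using (Acc; acc)
open import Data.Integer using (-[1+_])
open import Data.Rational.Unnormalised using (ℚᵘ; mkℚᵘ; *<*; _≃_)
import Data.Rational.Unnormalised as ℚ
import Data.Rational.Unnormalised.Properties as ℚₚ
open import Data.Rational.Unnormalised using (_/_)

look : ∀ {n} → Subset n → Pr
look [] _ = false
look (b ∷ S) zero = b
look (b ∷ S) (suc i) = look S i

-- Index i stands for the integer i + 1, so the characteristic function is shifted by one and never
-- contains 0.
χ : ∀ {n} → Subset n → Pr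
χ S zero = false
χ S (suc i) = look S i

look-∈ : ∀ {n} {S : Subset n} {i} → i Subset.∈ S → look S (toℕ i) ≡ true
look-∈ Data.Vec.here = refl
look-∈ (Data.Vec.there h) = look-∈ h

∈-look : ∀ {n} (S : Subset n) v → look S v ≡ true → ∃[ i ] i Subset.∈ S × toℕ i ≡ v
∈-look (true ∷ S) zero h = fzero , Data.Vec.here , refl
∈-look (b ∷ S) (suc v) h with ∈-look S v h
... | i , m , e = fsuc i , Data.Vec.there m , cong suc e

look-range : ∀ {n} (S : Subset n) v → n ≤ v → look S v ≡ false
look-range [] v h = refl
look-range (b ∷ S) (suc v) (s≤s h) = look-range S v h

look-inj : ∀ {n} (S T : Subset n) → (∀ v → v < n → look S v ≡ look T v) → S ≡ T
look-inj [] [] h = refl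
look-inj (a ∷ S) (b ∷ T) h = cong₂ _∷_ (h 0 (s≤s z≤n)) (look-inj S T λ v l → h (suc v) (s≤s l))

χ-within : ∀ {n} (S : Subset n) → Within n (χ S)
χ-within {n} S = refl , λ { (suc x) (s≤s l) → look-range S x l }

fromPr : ∀ n → Pr → Subset n
fromPr zero p = []
fromPr (suc n) p = p 0 ∷ fromPr n (λ x → p (suc x))

look-fromPr : ∀ n p v → v < n → look (fromPr n p) v ≡ p v
look-fromPr (suc n) p zero l = refl
look-fromPr (suc n) p (suc v) (s≤s l) = look-fromPr n (λ x → p (suc x)) v l

χ⁻¹ : ∀ n → Pr → Subset n
χ⁻¹ n p = fromPr n (λ x → p (suc x))

χ-χ⁻¹ : ∀ n p → Within n p → ∀ v → χ (χ⁻¹ n p) v ≡ p v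
χ-χ⁻¹ n p w zero = sym (proj₁ w)
χ-χ⁻¹ n p w (suc v) with v <? n
... | yes l = look-fromPr n (λ x → p (suc x)) v l
... | no nl = trans (look-range (χ⁻¹ n p) v (≮⇒≥ nl)) (sym (proj₂ w (suc v) (s≤s (≮⇒≥ nl))))

SF-SumFree : ∀ {n} (S : Subset n) → SF (χ S) → SumFree ⟦ S ⟧
SF-SumFree S sf _ _ (i , i∈ , refl) (j , j∈ , refl) (k , k∈ , e) =
  true≢false (trans (cong (χ S) (ℤₚ.+-injective e)) (look-∈ k∈)) (sf (suc (toℕ i)) (suc (toℕ j)) (look-∈ i∈) (look-∈ j∈))

SumFree-SF : ∀ {n} (S : Subset n) → SumFree ⟦ S ⟧ → SF (χ S)
SumFree-SF S sf (suc x) (suc y) hx hy = ¬true λ h → bad (∈-look S x hx) (∈-look S y hy) (∈-look S (x + suc y) h)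
  where
  bad : (∃[ i ] i Subset.∈ S × toℕ i ≡ x) → (∃[ i ] i Subset.∈ S × toℕ i ≡ y) → (∃[ i ] i Subset.∈ S × toℕ i ≡ x + suc y) → ⊥
  bad (i , i∈ , refl) (j , j∈ , refl) (k , k∈ , e) = sf (val i) (val j) (i , i∈ , refl) (j , j∈ , refl) (k , k∈ , cong (λ v → + suc v) (sym e))

Killed? : ∀ n S → Within n S → ∀ v → Killed S v ⊎ ¬ Killed S v
Killed? n S w v with any<? (suc n) (λ a → S a ∧ S (v + a)) | any<? (suc n) (λ a → S a ∧ S (v ∸ a)) | bool? (S (v + v))
... | inj₁ (a , _ , h) | _ | _ = inj₁ (inj₁ (a , v + a , proj₁ (∧-split h) , proj₂ (∧-split {S a} h) , refl))
... | inj₂ _ | inj₁ (a , _ , h) | _ = inj₁ (inj₂ (inj₁ (a , v ∸ a , proj₁ (∧-split h) , proj₂ (∧-split {S a} h) ,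
    m+[n∸m]≡n {a} {v} (<⇒≤ (m∸n≢0⇒n<m λ z → true≢false (subst (λ u → S u ≡ true) z (proj₂ (∧-split {S a} h))) (proj₁ w))))))
... | inj₂ _ | inj₂ _ | inj₁ h = inj₁ (inj₂ (inj₂ h))
... | inj₂ n₁ | inj₂ n₂ | inj₂ n₃ = inj₂ no′
  where
  no′ : ¬ Killed S v
  no′ (inj₁ (a , _ , sa , sb , refl)) = true≢false (∧-join sa sb) (n₁ a (s≤s (within-≤ w sa)))
  no′ (inj₂ (inj₁ (a , b , sa , sb , refl))) = true≢false (∧-join sa (trans (cong S (m+n∸m≡n a b)) sb)) (n₂ a (s≤s (within-≤ w sa)))
  no′ (inj₂ (inj₂ h)) = true≢false h n₃

insert-SF : ∀ n S → Within n S → SF S → ∀ v → 0 < v → ¬ Killed S v → SF (set v true S)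
insert-SF n S w sf v v>0 nk x y hx hy = ¬true λ hxy → cases (set-⊆ S v x hx) (set-⊆ S v y hy) (set-⊆ S v (x + y) hxy)
  where
  fix : ∀ {a b} → a + b ≡ a → 0 < b → ⊥
  fix {a} {b} e l = <-irrefl (sym (+-cancelˡ-≡ a b 0 (trans e (sym (+-identityʳ a))))) l
  cases : (v ≡ x) ⊎ (S x ≡ true) → (v ≡ y) ⊎ (S y ≡ true) → (v ≡ x + y) ⊎ (S (x + y) ≡ true) → ⊥
  cases (inj₁ refl) (inj₁ refl) (inj₁ e) = fix (sym e) v>0
  cases (inj₁ refl) (inj₁ refl) (inj₂ h) = nk (inj₂ (inj₂ h))
  cases (inj₁ refl) (inj₂ sy) (inj₁ e) = fix (sym e) (within-pos w sy)
  cases (inj₁ refl) (inj₂ sy) (inj₂ h) = nk (inj₁ (y , v + y , sy , h , refl))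
  cases (inj₂ sx) (inj₁ refl) (inj₁ e) = fix (trans (+-comm v x) (sym e)) (within-pos w sx)
  cases (inj₂ sx) (inj₁ refl) (inj₂ h) = nk (inj₁ (x , v + x , sx , trans (cong S (+-comm v x)) h , refl))
  cases (inj₂ sx) (inj₂ sy) (inj₁ e) = nk (inj₂ (inj₁ (x , y , sx , sy , sym e)))
  cases (inj₂ sx) (inj₂ sy) (inj₂ h) = true≢false h (sf x y sx sy)

maximal-MaxSF : ∀ {n} (S : Subset n) → MaximalSumFree S → MaxSF n (χ S)
maximal-MaxSF {n} S (sf , mx) = maxSF (χ-within S) (SumFree-SF S sf) killed
  where
  killed : ∀ v → 0 < v → v ≤ n → χ S v ≡ false → Killed (χ S) v
  killed v@(suc u) v>0 v≤n nv with Killed? n (χ S) (χ-within S) v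
  ... | inj₁ k = k
  ... | inj₂ nk = ⊥-elim (mx S⁺ (SF-SumFree S⁺ λ x y hx hy → trans (eqT (x + y)) (sfp x y (trans (sym (eqT x)) hx) (trans (sym (eqT y)) hy))) (sub , new))
    where
    p : Pr
    p = set v true (χ S)
    wp : Within n p
    wp = refl , λ x l → trans (set-≢ v true (χ S) {x} λ { refl → <⇒≱ l v≤n }) (proj₂ (χ-within S) x l)
    S⁺ : Subset n
    S⁺ = χ⁻¹ n p
    eqT : ∀ x → χ S⁺ x ≡ p x
    eqT = χ-χ⁻¹ n p wp
    sfp : SF p
    sfp = insert-SF n (χ S) (χ-within S) (SumFree-SF S sf) v v>0 nk
    inT : ∀ i → p (suc (toℕ i)) ≡ true → i Subset.∈ S⁺
    inT i h with ∈-look S⁺ (toℕ i) (trans (eqT (suc (toℕ i))) h)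
    ... | j , j∈ , e = subst (Subset._∈ S⁺) (Finₚ.toℕ-injective e) j∈
    sub : S Subset.⊆ S⁺
    sub {i} i∈ = inT i (set-⊇ (χ S) v (suc (toℕ i)) (look-∈ i∈))
    new : ∃[ i ] i Subset.∈ S⁺ × ¬ (i Subset.∈ S)
    new = fromℕ< v≤n , inT (fromℕ< v≤n) (trans (cong (λ k → p (suc k)) (Finₚ.toℕ-fromℕ< v≤n)) (set-= v true (χ S))) ,
      λ i∈ → true≢false (trans (cong (look S) (sym (Finₚ.toℕ-fromℕ< v≤n))) (look-∈ i∈)) nv

unique-length : ∀ {A : Set} {xs ys : List A} → Unique xs → (∀ x → x ∈ xs → x ∈ ys) → length xs ≤ length ys
unique-length [] sub = z≤n
unique-length {A} {x ∷ xs} {ys} (nx ∷ u) sub with ∈-∃++ (sub x (here refl))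
... | as , bs , refl = ≤-trans (s≤s (unique-length u sub')) (≤-reflexive (trans (cong suc (length-++ as)) (trans (sym (+-suc (length as) (length bs))) (sym (length-++ as)))))
  where
  sub' : ∀ y → y ∈ xs → y ∈ as ++ bs
  sub' y i with ∈-++⁻ as (sub y (there i))
  ... | inj₁ j = ∈-++⁺ˡ j
  ... | inj₂ (there j) = ∈-++⁺ʳ as j
  ... | inj₂ (here refl) = ⊥-elim (All-lookup nx i refl)

∷-inj : ∀ {n} {b : Bool} {S T : Subset n} → (b ∷ S) ≡ (b ∷ T) → S ≡ T
∷-inj refl = refl

allSubsets-unique : ∀ n → Unique (allSubsets n)
allSubsets-unique zero = [] ∷ []
allSubsets-unique (suc n) = Uniqueₚ.++⁺ (Uniqueₚ.map⁺ ∷-inj (allSubsets-unique n)) (Uniqueₚ.map⁺ ∷-inj (allSubsets-unique n)) disjoint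
  where
  disjoint : ∀ {S} → (S ∈ map (outside ∷_) (allSubsets n)) × (S ∈ map (inside ∷_) (allSubsets n)) → ⊥
  disjoint (a , b) with ∈-map⁻ (outside ∷_) a | ∈-map⁻ (inside ∷_) b
  ... | _ , _ , refl | _ , _ , ()

allSubsets-length : ∀ n → length (allSubsets n) ≡ 2 ^ n
allSubsets-length zero = refl
allSubsets-length (suc n) = trans (length-++ (map (outside ∷_) (allSubsets n)))
  (trans (cong₂ _+_ (trans (length-map _ (allSubsets n)) (allSubsets-length n)) (trans (length-map _ (allSubsets n)) (allSubsets-length n))) (cong (_+_ (2 ^ n)) (sym (+-identityʳ _))))

fmax-≤ : ∀ n M → Cover (suc n) (MaxSF n) M → fmax n ≤ M
fmax-≤ n M (L , len , cov) = ≤-trans (unique-length (Uniqueₚ.filter⁺ maximalSumFree? (allSubsets-unique n)) sub) (≤-trans (≤-reflexive (length-map (χ⁻¹ n) L)) len)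
  where
  sub : ∀ S → S ∈ filter maximalSumFree? (allSubsets n) → S ∈ map (χ⁻¹ n) L
  sub S i with cov (χ S) (maximal-MaxSF S (proj₂ (∈-filter⁻ maximalSumFree? {xs = allSubsets n} i)))
  ... | q , j , e = subst (_∈ map (χ⁻¹ n) L) (sym (look-inj S (χ⁻¹ n q) λ v l → trans (e (suc v) (s≤s l)) (sym (look-fromPr n _ v l)))) (∈-map⁺ (χ⁻¹ n) j)

extend : ∀ {n} (S : Subset n) → SumFree ⟦ S ⟧ → ∃[ T ] MaximalSumFree T × S Subset.⊆ T
extend {n} S sf = grow S sf (⊃-wellFounded S)
  where
  grow : (S : Subset n) → SumFree ⟦ S ⟧ → Acc _⊃_ S → ∃[ T ] MaximalSumFree T × S Subset.⊆ T
  grow S sf (acc rec) with extendable? S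
  ... | no ne = S , (sf , λ T sfT l → ne (T , sfT , l)) , λ h → h
  ... | yes (T , sfT , l) with grow T sfT (rec l)
  ...   | U , mU , sub = U , mU , λ h → sub (proj₁ l h)

-- One element of each pair {2i+1, 4j−(2i+1)} together with 4j; any maximal extension remembers the choices.
module Pairs (n j : ℕ) (4j≤n : 4 * j ≤ n) (j>0 : 0 < j) where

  -- Halving recovers i from 2i + 1, so bit i of `c` selects 2i + 1, and its absence selects the
  -- partner 4j - (2i + 1).
  lowᶜ : Subset j → ℕ → Bool
  lowᶜ c v = if suc v ≤ᵇ 2 * j then look c ⌊ v /2⌋ else not (look c ⌊ 4 * j ∸ v /2⌋)

  p : Subset j → Pr
  p c v = (4 * j ≡ᵇ v) ∨ ((odd v ∧ (v ≤ᵇ 4 * j)) ∧ lowᶜ c v)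

  p-cases : ∀ c v → p c v ≡ true → (4 * j ≡ v) ⊎ (odd v ≡ true × v ≤ 4 * j × lowᶜ c v ≡ true)
  p-cases c v h with ∨-split {4 * j ≡ᵇ v} h
  ... | inj₁ e = inj₁ (≡ᵇ-true e)
  ... | inj₂ e = inj₂ (proj₁ (∧-split (proj₁ (∧-split {odd v ∧ (v ≤ᵇ 4 * j)} e))) , ≤ᵇ-true (proj₂ (∧-split {odd v} (proj₁ (∧-split {odd v ∧ (v ≤ᵇ 4 * j)} e)))) ,
      proj₂ (∧-split {odd v ∧ (v ≤ᵇ 4 * j)} e))

  even-2* : ∀ k → odd (2 * k) ≡ false
  even-2* k = trans (odd-+ k (k + 0)) (trans (cong (λ v → if odd k then not (odd v) else odd v) (+-identityʳ k)) (g (odd k)))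
    where
    g : ∀ b → (if b then not b else b) ≡ false
    g true = refl
    g false = refl

  even-4j : odd (4 * j) ≡ false
  even-4j = trans (cong odd (*-assoc 2 2 j)) (even-2* (2 * j))

  p-within : ∀ c → Within n (p c)
  p-within c = ¬true (λ h → z (p-cases c 0 h)) , λ x l → ¬true λ h → o x l (p-cases c x h)
    where
    z : (4 * j ≡ 0) ⊎ (odd 0 ≡ true × 0 ≤ 4 * j × lowᶜ c 0 ≡ true) → ⊥
    z (inj₁ e) = <-irrefl (sym e) (*-mono-≤ (s≤s (z≤n {3})) j>0)
    z (inj₂ (() , _))
    o : ∀ x → n < x → (4 * j ≡ x) ⊎ (odd x ≡ true × x ≤ 4 * j × lowᶜ c x ≡ true) → ⊥
    o x l (inj₁ refl) = <⇒≱ l 4j≤n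
    o x l (inj₂ (_ , le , _)) = <⇒≱ l (≤-trans le 4j≤n)

  -- Nothing can be added to 4j, the largest element. Two odd elements have an even sum, which could
  -- only be 4j; but of two numbers with that sum only one was selected.
  p-SF : ∀ c → SF (p c)
  p-SF c x y hx hy = ¬true λ h → go (p-cases c x hx) (p-cases c y hy) (p-cases c (x + y) h)
    where
    Case : ℕ → Set
    Case v = (4 * j ≡ v) ⊎ (odd v ≡ true × v ≤ 4 * j × lowᶜ c v ≡ true)
    big : ∀ {a b} → 4 * j ≡ a → 0 < b → Case (a + b) → ⊥
    big refl l (inj₁ e) = <-irrefl e (m<m+n (4 * j) l)
    big refl l (inj₂ (_ , le , _)) = <⇒≱ (m<m+n (4 * j) l) le
    pair : ∀ x y → x + y ≡ 4 * j → x < 2 * j → odd y ≡ true → lowᶜ c x ≡ true → lowᶜ c y ≡ true → ⊥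
    pair x y e l oy lx ly = true≢false (trans (sym (cong (λ b → if b then look c ⌊ x /2⌋ else not (look c ⌊ 4 * j ∸ x /2⌋)) (true-≤ᵇ l))) lx)
      (not-true (trans (cong (λ v → not (look c ⌊ v /2⌋)) (sym (trans (cong (_∸ y) (sym e)) (m+n∸n≡m x y))))
        (trans (sym (cong (λ b → if b then look c ⌊ y /2⌋ else not (look c ⌊ 4 * j ∸ y /2⌋)) (false-≤ᵇ {suc y} {2 * j} y≥))) ly)))
      where
      y≥ : 2 * j < suc y
      y≥ = s≤s (+-cancelˡ-≤ (2 * j) _ _ (arith (≤-reflexive e) (<⇒≤ l)))
        where
        arith : x + y ≤ 4 * j → x ≤ 2 * j → 2 * j + 2 * j ≤ 2 * j + y
        arith h₁ h₂ = lin-sound (con 2 ⊠ var 0 ⊞ con 2 ⊠ var 0) (con 2 ⊠ var 0 ⊞ var 1) (con 4 ⊠ var 0 ⊞ var 2) (var 2 ⊞ var 1 ⊞ con 2 ⊠ var 0) (j ∷ y ∷ x ∷ []) refl (≤-reflexive (sym e) & h₂)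
    go : Case x → Case y → Case (x + y) → ⊥
    go (inj₁ e) _ h = big e (within-pos (p-within c) hy) h
    go (inj₂ _) (inj₁ e) h = big e (within-pos (p-within c) hx) (subst Case (+-comm x y) h)
    go (inj₂ (ox , _ , lx)) (inj₂ (oy , _ , ly)) (inj₂ (oxy , _ , _)) = true≢false oxy (trans (odd-+ x y) (cong₂ (λ a b → if a then not b else b) ox oy))
    go (inj₂ (ox , _ , lx)) (inj₂ (oy , _ , ly)) (inj₁ e) with x <? 2 * j
    ... | yes l = pair x y (sym e) l oy lx ly
    ... | no nl = pair y x (trans (+-comm y x) (sym e)) y< ox ly lx
      where
      x≢ : 2 * j ≢ x
      x≢ refl = true≢false ox (even-2* j)
      y< : y < 2 * j
      y< = +-cancelˡ-≤ (2 * j) _ _ (arith (≤∧≢⇒< (≮⇒≥ nl) x≢) (≤-reflexive (sym e)))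
        where
        arith : suc (2 * j) ≤ x → x + y ≤ 4 * j → 2 * j + suc y ≤ 2 * j + 2 * j
        arith h₁ h₂ = lin-sound (con 2 ⊠ var 0 ⊞ (con 1 ⊞ var 1)) (con 2 ⊠ var 0 ⊞ con 2 ⊠ var 0) (con 1 ⊞ con 2 ⊠ var 0 ⊞ (var 2 ⊞ var 1)) (var 2 ⊞ con 4 ⊠ var 0) (j ∷ y ∷ x ∷ []) refl (h₁ & h₂)

  ext : Subset j → Subset n
  ext c = proj₁ (extend (χ⁻¹ n (p c)) (SF-SumFree _ λ x y hx hy → trans (eq (x + y)) (p-SF c x y (trans (sym (eq x)) hx) (trans (sym (eq y)) hy))))
    where
    eq = χ-χ⁻¹ n (p c) (p-within c)

  ext-max : ∀ c → MaximalSumFree (ext c)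
  ext-max c = proj₁ (proj₂ (extend (χ⁻¹ n (p c)) _))

  ext-⊇ : ∀ c v → p c v ≡ true → χ (ext c) v ≡ true
  ext-⊇ c zero h = true≢false h (proj₁ (p-within c))
  ext-⊇ c (suc v) h with ∈-look (χ⁻¹ n (p c)) v (trans (χ-χ⁻¹ n (p c) (p-within c) (suc v)) h)
  ... | i , i∈ , refl = look-∈ (proj₂ (proj₂ (extend (χ⁻¹ n (p c)) _)) i∈)

  -- If bit i is set, 2i + 1 already belongs to the starting set. If not, its partner and 4j belong
  -- to every extension, and sum-freeness keeps 2i + 1 out.
  decode : ∀ c i → i < j → look c i ≡ χ (ext c) (suc (2 * i))
  decode c i l with bool? (look c i)
  ... | inj₁ t = trans t (sym (ext-⊇ c (suc (2 * i)) (∨-right {4 * j ≡ᵇ suc (2 * i)} (∧-join (∧-join od (true-≤ᵇ le)) lowT))))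
    where
    od : odd (suc (2 * i)) ≡ true
    od = cong not (even-2* i)
    lt : suc (2 * i) < 2 * j
    lt = lin-sound (con 1 ⊞ (con 1 ⊞ con 2 ⊠ var 0)) (con 2 ⊠ var 1) (con 2 ⊠ (con 1 ⊞ var 0)) (con 2 ⊠ var 1) (i ∷ j ∷ []) refl (2 · l)
    le : suc (2 * i) ≤ 4 * j
    le = lin-sound (con 1 ⊞ con 2 ⊠ var 0) (con 4 ⊠ var 1) (con 2 ⊠ (con 1 ⊞ var 0)) (con 2 ⊠ var 1) (i ∷ j ∷ []) refl (2 · l)
    lowT : lowᶜ c (suc (2 * i)) ≡ true
    lowT = trans (cong (λ b → if b then look c ⌊ suc (2 * i) /2⌋ else not (look c ⌊ 4 * j ∸ suc (2 * i) /2⌋)) (true-≤ᵇ lt)) (trans (cong (look c) (half-odd i)) t)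
      where
      half-odd : ∀ i → ⌊ suc (2 * i) /2⌋ ≡ i
      half-odd zero = refl
      half-odd (suc i) = trans (cong (λ v → ⌊ suc (suc v) /2⌋) (+-suc i (i + 0))) (cong suc (half-odd i))
  ... | inj₂ f = trans f (sym (¬true λ h → true≢false (ext-⊇ c (4 * j) (∨-left (≡ᵇ-refl (4 * j))))
      (trans (cong (χ (ext c)) (sym eqs)) (SumFree-SF (ext c) (proj₁ (ext-max c)) (suc (2 * i)) w h (ext-⊇ c w pw)))))
    where
    le : suc (2 * i) ≤ 4 * j
    le = lin-sound (con 1 ⊞ con 2 ⊠ var 0) (con 4 ⊠ var 1) (con 2 ⊠ (con 1 ⊞ var 0)) (con 2 ⊠ var 1) (i ∷ j ∷ []) refl (2 · l)
    w : ℕ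
    w = 4 * j ∸ suc (2 * i)
    eqs : suc (2 * i) + w ≡ 4 * j
    eqs = m+[n∸m]≡n le
    half-odd : ∀ i → ⌊ suc (2 * i) /2⌋ ≡ i
    half-odd zero = refl
    half-odd (suc i) = trans (cong (λ v → ⌊ suc (suc v) /2⌋) (+-suc i (i + 0))) (cong suc (half-odd i))
    odw : odd w ≡ true
    odw = g (odd w) (trans (sym (trans (odd-+ (suc (2 * i)) w) (cong (λ b → if b then not (odd w) else odd w) (cong not (even-2* i))))) (trans (cong odd eqs) even-4j))
      where
      g : ∀ b → not b ≡ false → b ≡ true
      g true _ = refl
    w≥ : 2 * j < suc w
    w≥ = arith (≤-reflexive (sym eqs)) l
      where
      arith : 4 * j ≤ suc (2 * i) + w → suc i ≤ j → 2 * j < suc w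
      arith h₁ h₂ = lin-sound (con 1 ⊞ con 2 ⊠ var 0) (con 1 ⊞ var 1) (con 4 ⊠ var 0 ⊞ con 2 ⊠ (con 1 ⊞ var 2)) (con 1 ⊞ con 2 ⊠ var 2 ⊞ var 1 ⊞ con 2 ⊠ var 0) (j ∷ w ∷ i ∷ []) refl (h₁ & 2 · h₂)
    lowF : lowᶜ c w ≡ true
    lowF = trans (cong (λ b → if b then look c ⌊ w /2⌋ else not (look c ⌊ 4 * j ∸ w /2⌋)) (false-≤ᵇ {suc w} {2 * j} w≥))
      (not-false (trans (cong (λ v → look c ⌊ v /2⌋) (m∸[m∸n]≡n le)) (trans (cong (look c) (half-odd i)) f)))
    pw : p c w ≡ true
    pw = ∨-right {4 * j ≡ᵇ w} (∧-join (∧-join odw (true-≤ᵇ (m∸n≤m (4 * j) (suc (2 * i))))) lowF)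

  ext-inj : ∀ {c c'} → ext c ≡ ext c' → c ≡ c'
  ext-inj {c} {c'} e = look-inj c c' λ i l → trans (decode c i l) (trans (cong (λ T → χ T (suc (2 * i))) e) (sym (decode c' i l)))

  fmax-≥ : 2 ^ j ≤ fmax n
  fmax-≥ = ≤-trans (≤-reflexive (trans (sym (allSubsets-length j)) (sym (length-map ext (allSubsets j)))))
    (unique-length (Uniqueₚ.map⁺ ext-inj (allSubsets-unique j)) sub)
    where
    sub : ∀ S → S ∈ map ext (allSubsets j) → S ∈ filter maximalSumFree? (allSubsets n)
    sub S i with ∈-map⁻ ext i
    ... | c , _ , refl = ∈-filter⁺ maximalSumFree? (∈-allSubsets (ext c)) (ext-max c)

-- From power inequalities to the limit

quarter : ∀ n → ∃[ j ] 4 * j ≤ n × n ≤ 3 + 4 * j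
quarter 0 = 0 , z≤n , z≤n
quarter 1 = 0 , z≤n , s≤s z≤n
quarter 2 = 0 , z≤n , s≤s (s≤s z≤n)
quarter 3 = 0 , z≤n , s≤s (s≤s (s≤s z≤n))
quarter (suc (suc (suc (suc n)))) with quarter n
... | j , l , u = suc j , lo l , hi u
  where
  lo : 4 * j ≤ n → 4 * suc j ≤ 4 + n
  lo h = lin-sound (con 4 ⊠ (con 1 ⊞ var 0)) (con 4 ⊞ var 1) (con 4 ⊠ var 0) (var 1) (j ∷ n ∷ []) refl h
  hi : n ≤ 3 + 4 * j → 4 + n ≤ 3 + 4 * suc j
  hi h = lin-sound (con 4 ⊞ var 0) (con 3 ⊞ con 4 ⊠ (con 1 ⊞ var 1)) (var 0) (con 3 ⊞ con 4 ⊠ var 1) (n ∷ j ∷ []) refl h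

-- From 4j ≥ n - 3 one gets 4j(s + 1) ≥ s n + n - 3(s + 1), which exceeds s n by the lower bound on
-- n; that bound also makes j positive.
power-lower : ∀ F s n j → 3 * suc s + 4 ≤ n → n ≤ 3 + 4 * j → (0 < j → 2 ^ j ≤ F) → 2 ^ (s * n) < F ^ (4 * suc s)
power-lower F s n j h u bound = <-≤-trans (^-monoʳ-< 2 (s≤s (s≤s z≤n)) (arith h u))
    (≤-trans (≤-reflexive (sym (^-*-assoc 2 j (4 * suc s)))) (^-monoˡ-≤ (4 * suc s) (bound (n≢0⇒n>0 λ e → j≢0 j e u))))
  where
  j≢0 : ∀ j → j ≡ 0 → n ≤ 3 + 4 * j → ⊥
  j≢0 _ refl u′ = 1≰0 (lin-sound (con 1) (con 0) (var 0 ⊞ (con 3 ⊠ (con 1 ⊞ var 1) ⊞ con 4)) (con 3 ⊞ con 4 ⊠ con 0 ⊞ var 0) (n ∷ s ∷ []) refl (u′ & h))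
  arith : 3 * suc s + 4 ≤ n → n ≤ 3 + 4 * j → s * n < j * (4 * suc s)
  arith h u = lin-sound (con 1 ⊞ var 0 ⊠ var 1) (var 2 ⊠ (con 4 ⊠ (con 1 ⊞ var 0))) (con 3 ⊠ (con 1 ⊞ var 0) ⊞ con 4 ⊞ (con 1 ⊞ var 0) ⊠ var 1) (var 1 ⊞ (con 1 ⊞ var 0) ⊠ (con 3 ⊞ con 4 ⊠ var 2)) (s ∷ n ∷ j ∷ []) refl (h & suc s · u)

fmax-lower : ∀ s n → 3 * suc s + 4 ≤ n → 2 ^ (s * n) < fmax n ^ (4 * suc s)
fmax-lower s n h = power-lower (fmax n) s n (proj₁ (quarter n)) h (proj₂ (proj₂ (quarter n)))
  (Pairs.fmax-≥ n (proj₁ (quarter n)) (proj₁ (proj₂ (quarter n))))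

-- Passing from 13 to 14 makes the inequality strict, since n > 0.
power-upper : ∀ F M s n → F ≤ M → M ^ (4 * s) ≤ 2 ^ ((s + 13) * n) → 0 < n → F ^ (4 * s) < 2 ^ ((s + 14) * n)
power-upper F M s n FM b n>0 = ≤-<-trans (≤-trans (^-monoˡ-≤ (4 * s) FM) b) (^-monoʳ-< 2 (s≤s (s≤s z≤n)) arith)
  where
  arith : (s + 13) * n < (s + 14) * n
  arith = lin-sound (con 1 ⊞ (var 0 ⊞ con 13) ⊠ var 1) ((var 0 ⊞ con 14) ⊠ var 1) (con 1 ⊞ con 0) (var 1) (s ∷ n ∷ []) refl n>0

fmax-upper : ∀ s → 0 < s → ∃[ n₀ ] ∀ n → n₀ ≤ n → 0 < n → fmax n ^ (4 * s) < 2 ^ ((s + 14) * n)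
fmax-upper s s>0 = proj₁ ub , λ n le n>0 → power-upper (fmax n) (proj₁ (proj₂ ub n le)) s n
    (fmax-≤ n (proj₁ (proj₂ ub n le)) (proj₁ (proj₂ (proj₂ ub n le)))) (proj₂ (proj₂ (proj₂ ub n le))) n>0
  where ub = upper-bound s s>0

fraction-< : ∀ a b d e → a * suc e < b * suc d → mkℚᵘ (+ a) d ℚ.< mkℚᵘ (+ b) e
fraction-< a b d e h = *<* (subst₂ ℤ._<_ (ℤₚ.pos-* a (suc e)) (ℤₚ.pos-* b (suc d)) (ℤ.+<+ h))

-- The rational on the right is s/(4(s + 1)) with s = D + 1, the rate supplied by `fmax-lower`. It
-- misses 1/4 by 1/(4(D + 2)), which is less than ε ≥ 1/(D + 1). The stored denominator is written
-- so that its successor unfolds to 4(D + 2).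
quarter-below : ∀ p D → + 1 / 4 ℚ.- mkℚᵘ (+ suc p) D ℚ.< mkℚᵘ (+ suc D) (suc D + 3 * suc (suc D))
quarter-below p D = ℚₚ.<-respʳ-≃ cancel (ℚₚ.+-monoˡ-< (ℚ.- ε) shifted)
  where
  ε r : ℚᵘ
  ε = mkℚᵘ (+ suc p) D
  r = mkℚᵘ (+ suc D) (suc D + 3 * suc (suc D))
  cancel : r ℚ.+ ε ℚ.- ε ≃ r
  cancel = ℚₚ.≃-trans (ℚₚ.+-assoc r ε (ℚ.- ε)) (ℚₚ.≃-trans (ℚₚ.+-congʳ r (ℚₚ.+-inverseʳ ε)) (ℚₚ.+-identityʳ r))
  arith : ∀ p u → 1 * (4 * suc (suc u) * suc u) < (suc u * suc u + suc p * (4 * suc (suc u))) * 4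
  arith p u = expr-≤ (con 1 ⊞ con 1 ⊠ (con 4 ⊠ (con 1 ⊞ (con 1 ⊞ var 0)) ⊠ (con 1 ⊞ var 0))) (((con 1 ⊞ var 0) ⊠ (con 1 ⊞ var 0) ⊞ (con 1 ⊞ var 1) ⊠ (con 4 ⊠ (con 1 ⊞ (con 1 ⊞ var 0)))) ⊠ con 4) (u ∷ p ∷ []) refl
  shifted : + 1 / 4 ℚ.< r ℚ.+ ε
  shifted = fraction-< 1 (suc D * suc D + suc p * (4 * suc (suc D))) 3 (pred (4 * suc (suc D) * suc D)) (arith p D)

-- With s = 4(D + 1) the rate (s + 14)/(4s) from `fmax-upper` exceeds 1/4 by 7/(8(D + 1)), still
-- less than ε.
quarter-above : ∀ p D → mkℚᵘ (+ (4 * suc D + 14)) (pred (4 * (4 * suc D))) ℚ.< + 1 / 4 ℚ.+ mkℚᵘ (+ suc p) D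
quarter-above p D = fraction-< (4 * suc D + 14) (1 * suc D + suc p * 4) (pred (4 * (4 * suc D))) (pred (4 * suc D)) (arith p D)
  where
  arith : ∀ p u → (4 * suc u + 14) * (4 * suc u) < (1 * suc u + suc p * 4) * (4 * (4 * suc u))
  arith p u = expr-≤ (con 1 ⊞ (con 4 ⊠ (con 1 ⊞ var 0) ⊞ con 14) ⊠ (con 4 ⊠ (con 1 ⊞ var 0))) ((con 1 ⊠ (con 1 ⊞ var 0) ⊞ (con 1 ⊞ var 1) ⊠ con 4) ⊠ (con 4 ⊠ (con 4 ⊠ (con 1 ⊞ var 0)))) (u ∷ p ∷ []) refl

log-lower : ∀ m .{{_ : NonZero m}} D n → 2 ^ (suc D * suc n) < m ^ (4 * suc (suc D)) →
  lower (log₂ m ÷ℕ suc n) (mkℚᵘ (+ suc D) (suc D + 3 * suc (suc D)))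
log-lower m D n h = subst (λ e → 2 ^ (suc D * suc n) < m ^ e) (sym (*-identityʳ (4 * suc (suc D)))) h

log-upper : ∀ m .{{_ : NonZero m}} D n → m ^ (4 * (4 * suc D)) < 2 ^ ((4 * suc D + 14) * suc n) →
  upper (log₂ m ÷ℕ suc n) (mkℚᵘ (+ (4 * suc D + 14)) (pred (4 * (4 * suc D))))
log-upper m D n h = subst (λ e → m ^ e < 2 ^ ((4 * suc D + 14) * suc n)) (sym (*-identityʳ (4 * (4 * suc D)))) h

theorem1p1 : (λ n → log₂ (fmax n) {{fmax≢0 n}} ÷ℕ n) ⟶ + 1 / 4
theorem1p1 (mkℚᵘ (+ zero) D) (*<* (ℤ.+<+ ()))
theorem1p1 (mkℚᵘ -[1+ _ ] D) (*<* ())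
theorem1p1 (mkℚᵘ (+ suc p) D) _ = 3 * suc (suc D) + 4 + proj₁ ub , bounds
  where
  ub = fmax-upper (4 * suc D) (s≤s z≤n)
  bounds : ∀ n .{{_ : NonZero n}} → 3 * suc (suc D) + 4 + proj₁ ub ≤ n →
    lower (log₂ (fmax n) {{fmax≢0 n}} ÷ℕ n) (+ 1 / 4 ℚ.- mkℚᵘ (+ suc p) D) ×
    upper (log₂ (fmax n) {{fmax≢0 n}} ÷ℕ n) (+ 1 / 4 ℚ.+ mkℚᵘ (+ suc p) D)
  bounds n@(suc n′) le =
      ℝ.lower-closed (log₂ (fmax n) {{fmax≢0 n}} ÷ℕ n) (quarter-below p D)
        (log-lower (fmax n) {{fmax≢0 n}} D n′ (fmax-lower (suc D) n (≤-trans (m≤m+n _ (proj₁ ub)) le)))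
    , ℝ.upper-closed (log₂ (fmax n) {{fmax≢0 n}} ÷ℕ n) (quarter-above p D)
        (log-upper (fmax n) {{fmax≢0 n}} D n′ (proj₂ ub n (≤-trans (m≤n+m (proj₁ ub) (3 * suc (suc D) + 4)) le) (s≤s z≤n)))
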